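{- Let $p$ be a prime and let $(X_n)_{n\ge0}$ be a $\mathbb{Z}_p$-tower of strongly connected digraphs over $X=X_0$ with associated voltage assignment $\alpha:\mathbb{E}(X)\to\mathbb{Z}_p$. Assume that $\mathcal{L}_p(X,\alpha)\ne0$. Then $a(X_n)$ and $b(X_n)$ are uniformly bounded (in $n$). In particular, $\delta(X_n)$ is bounded independently of $n$.
   Context: **Digraphs and towers.** A digraph $X$ consists of finite sets $V(X)$ (vertices) and $\mathbb{E}(X)$ (directed edges) with an incidence map $e\mapsto(o(e),t(e))\in V(X)\times V(X)$. It is strongly connected if for all $(v,v')$ there is a directed path from $v$ to $v'$. A morphism of digraphs is a pair of maps on vertices and edges commuting with incidence. A covering $Y\to X$ is a surjective morphism $f$ which for each $v\in V(Y)$ induces bijections from the incoming (resp. outgoing) edges at $v$ to those at $f(v)$. It is $m$-sheeted if each vertex of $X$ has $m$ preimages, and Galois if it is $m$-sheeted with $|\mathrm{Deck}(Y/X)|=m$ for some $m$, where $\mathrm{Deck}(Y/X)$ (the Galois group) is the group of automorphisms of $Y$ over $X$. A $\mathbb{Z}_p$-tower over $X$ is a sequence of coverings $X=X_0\leftarrow X_1\leftarrow\cdots$ such that each $X_n/X$ is Galois with group isomorphic to $\mathbb{Z}/p^n\mathbb{Z}$; it is a tower of strongly connected digraphs if all $X_n$ are strongly connected. Such a tower comes from a voltage assignment $\alpha:\mathbb{E}(X)\to\mathbb{Z}_p$: $X_n$ is (compatibly with the coverings) the derived digraph with vertices $V(X)\times\mathbb{Z}/p^n\mathbb{Z}$,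 edges $\mathbb{E}(X)\times\mathbb{Z}/p^n\mathbb{Z}$, and $(e,\sigma)$ going from $(o(e),\sigma)$ to $(t(e),\sigma+\alpha(e))$. Fix such an $\alpha$. **$p$-adic Bowen–Franks function.** Let $\mathbb{Z}[T;\mathbb{Z}_p]$ be the ring of finite $\mathbb{Z}$-linear combinations of $T^a$, $a\in\mathbb{Z}_p$. With $V(X)=\{v_1,\dots,v_r\}$, let $A_\alpha$ be the $r\times r$ matrix whose $(i,j)$-entry is $\sum_eT^{\alpha(e)}$, the sum over edges $e$ from $v_j$ to $v_i$, and $\mathcal{L}_p(X,\alpha)=\det(\mathrm{Id}-A_\alpha)\in\mathbb{Z}[T;\mathbb{Z}_p]$. **Defect.** For a digraph $Y$ with vertices $v_1,\dots,v_s$, let $A_Y$ be the matrix whose $(i,j)$-entry is the number of edges from $v_j$ to $v_i$. The zeta function is $Z_Y(u)=\prod_{[C]}(1-u^{|[C]|})^{ -1}$, where $[C]$ runs over equivalence classes (under cyclic permutation) of directed cycles (closed directed paths) that are not an $m$-fold multiple of another cycle for any $m\ge2$, and $|[C]|$ is the number of edges; it equals the rational function $\det(\mathrm{Id}-uA_Y)^{ -1}$. Put $\mathcal{BF}(Y)=\mathbb{Z}^s/(\mathrm{Id}-A_Y)\mathbb{Z}^s$, $b(Y)=\mathrm{rank}_{\mathbb{Z}}\mathcal{BF}(Y)$, $a(Y)=-\mathrm{ord}_{u=1}Z_Y(u)$, and $\delta(Y)=a(Y)-b(Y)$. -}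

module Defs where

open import Algebra.Bundles using (AbelianGroup; Group; RawMonoid; RawRing)
open import Algebra.Module.Bundles using (LeftModule)
open import Algebra.Morphism.Structures using (module GroupMorphisms)
import Algebra.Properties.CommutativeMonoid.Sum as CommutativeMonoidSum
import Algebra.Properties.Semiring.Sum as Sum
open import Data.Bool.Base using (if_then_else_)
open import Data.Empty using (⊥)
open import Data.Fin.Base as Fin using (Fin; toℕ; punchIn)
import Data.Fin.Properties as Fin
open import Data.Integer.Base as ℤ using (ℤ; +_; 0ℤ; 1ℤ; -1ℤ; ∣_∣)
import Data.Integer.Properties as ℤ
open import Data.Integer.Tactic.RingSolver using (solve-∀)
open import Data.List.Base as List
  using (List; []; _∷_; _++_; length; map; filter; concat; concatMap; replicate; take; drop;
         foldr; upTo; allFin; cartesianProductWith; deduplicate)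
import Data.List.Properties as List
open import Data.List.Relation.Unary.Linked using (Linked; linked?)
open import Data.Nat.Base as ℕ using (ℕ; zero; suc; NonZero; _≤_; _^_; s≤s; z≤n)
open import Data.Nat.Divisibility using (_∣?_; n∣m*n)
open import Data.Nat.DivMod
  using (_mod_; _%_; m%n<n; m%n%n≡m%n; m<n⇒m%n≡m; %-distribˡ-+; m∣n⇒o%n%m≡o%m; n%n≡0)
import Data.Nat.Properties as ℕ
open import Data.Product using (∃; ∃!; ∃-syntax; ∃₂; _×_; _,_; proj₁; proj₂)
open import Data.Product.Function.NonDependent.Propositional using (_×-↔_)
open import Data.Vec.Functional as Vec using (Vector)
open import Function.Base using (_∘_; id)
open import Function.Bundles using (_↔_; Inverse)
open import Function.Definitions using (Surjective)
open import Function.Construct.Composition using (_↔-∘_)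
open import Function.Construct.Identity using (↔-id)
open import Function.Construct.Symmetry using (↔-sym)
open import Function.Properties.Inverse using (↔⇒↣)
open import Level using (0ℓ)
open import Relation.Binary.Construct.Closure.ReflexiveTransitive using (Star)
open import Relation.Binary.Definitions using (DecidableEquality)
open import Relation.Binary.PropositionalEquality
open import Relation.Nullary.Decidable
  using (Dec; no; does; map′; _×-dec_; ¬?; via-injection)
open import Relation.Nullary.Negation using (¬_)

------------------------------------------------------------------------
-- Digraphs and coverings

record Digraph : Set₁ where
  field
    V E    : Set
    o t    : E → V
    #V #E  : ℕ
    V↔Fin  : V ↔ Fin #V
    E↔Fin  : E ↔ Fin #E

  vertex : Fin #V → V
  vertex = Inverse.from V↔Fin

  edges : List E
  edges = map (Inverse.from E↔Fin) (allFin #E)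

  infix 4 _≟ⱽ_ _≟ᴱ_
  _≟ⱽ_ : DecidableEquality V
  _≟ⱽ_ = via-injection (↔⇒↣ V↔Fin) Fin._≟_

  _≟ᴱ_ : DecidableEquality E
  _≟ᴱ_ = via-injection (↔⇒↣ E↔Fin) Fin._≟_

  edgesFromTo : V → V → List E
  edgesFromTo v w = filter (λ e → (o e ≟ⱽ v) ×-dec (t e ≟ⱽ w)) edges

  Adjacent : V → V → Set
  Adjacent v w = ∃[ e ] (o e ≡ v × t e ≡ w)

open Digraph using (V; E)

StronglyConnected : Digraph → Set
StronglyConnected X = ∀ v w → Star (Digraph.Adjacent X) v w

record Morphism (Y X : Digraph) : Set where
  private
    module Y = Digraph Y
    module X = Digraph X
  field
    onV    : Y.V → X.V
    onE    : Y.E → X.E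
    o-comm : ∀ e → X.o (onE e) ≡ onV (Y.o e)
    t-comm : ∀ e → X.t (onE e) ≡ onV (Y.t e)

open Morphism using (onV; onE)

idᴹ : ∀ {X} → Morphism X X
idᴹ = record { onV = id ; onE = id ; o-comm = λ _ → refl ; t-comm = λ _ → refl }

infixr 9 _∘ᴹ_
_∘ᴹ_ : ∀ {Z Y X} → Morphism Y X → Morphism Z Y → Morphism Z X
g ∘ᴹ f = record
  { onV    = onV g ∘ onV f
  ; onE    = onE g ∘ onE f
  ; o-comm = λ e → trans (o-comm g (onE f e)) (cong (onV g) (o-comm f e))
  ; t-comm = λ e → trans (t-comm g (onE f e)) (cong (onV g) (t-comm f e))
  }
  where open Morphism using (o-comm; t-comm)

infix 4 _≗ᴹ_
_≗ᴹ_ : ∀ {Y X} → Morphism Y X → Morphism Y X → Set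
f ≗ᴹ g = (onV f ≗ onV g) × (onE f ≗ onE g)

record Iso (Y X : Digraph) : Set where
  field
    to         : Morphism Y X
    from       : Morphism X Y
    to∘from≗id : to ∘ᴹ from ≗ᴹ idᴹ
    from∘to≗id : from ∘ᴹ to ≗ᴹ idᴹ

record IsCovering {Y X : Digraph} (f : Morphism Y X) : Set where
  private
    module Y = Digraph Y
    module X = Digraph X
  field
    onV-surjective : Surjective _≡_ _≡_ (onV f)
    onE-surjective : Surjective _≡_ _≡_ (onE f)
    out-bijective  : ∀ v e′ → X.o e′ ≡ onV f v → ∃! _≡_ λ e → Y.o e ≡ v × onE f e ≡ e′
    in-bijective   : ∀ v e′ → X.t e′ ≡ onV f v → ∃! _≡_ λ e → Y.t e ≡ v × onE f e ≡ e′

module _ {Y X : Digraph} (f : Morphism Y X) where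

  record DeckTransformation : Set where
    field
      iso  : Iso Y Y
      over : f ∘ᴹ Iso.to iso ≗ᴹ f

    open Iso iso public

  open DeckTransformation

  private
    over⁻¹ : (φ : DeckTransformation) → f ∘ᴹ from φ ≗ᴹ f
    over⁻¹ φ =
      (λ v → trans (sym (proj₁ (over φ) _)) (cong (onV f) (proj₁ (to∘from≗id φ) v))) ,
      (λ e → trans (sym (proj₂ (over φ) _)) (cong (onE f) (proj₂ (to∘from≗id φ) e)))

  Deck : Group 0ℓ 0ℓ
  Deck = record
    { Carrier = DeckTransformation
    ; _≈_     = λ φ ψ → to φ ≗ᴹ to ψ
    ; _∙_     = λ φ ψ → record
      { iso = record
        { to         = to φ ∘ᴹ to ψ
        ; from       = from ψ ∘ᴹ from φ
        ; to∘from≗id =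
            (λ v → trans (cong (onV (to φ)) (proj₁ (to∘from≗id ψ) _)) (proj₁ (to∘from≗id φ) v)) ,
            (λ e → trans (cong (onE (to φ)) (proj₂ (to∘from≗id ψ) _)) (proj₂ (to∘from≗id φ) e))
        ; from∘to≗id =
            (λ v → trans (cong (onV (from ψ)) (proj₁ (from∘to≗id φ) _)) (proj₁ (from∘to≗id ψ) v)) ,
            (λ e → trans (cong (onE (from ψ)) (proj₂ (from∘to≗id φ) _)) (proj₂ (from∘to≗id ψ) e))
        }
      ; over =
          (λ v → trans (proj₁ (over φ) _) (proj₁ (over ψ) v)) ,
          (λ e → trans (proj₂ (over φ) _) (proj₂ (over ψ) e))
      }
    ; ε       = record
      { iso = record
        { to = idᴹ ; from = idᴹ
        ; to∘from≗id = (λ _ → refl) , (λ _ → refl)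
        ; from∘to≗id = (λ _ → refl) , (λ _ → refl)
        }
      ; over = (λ _ → refl) , (λ _ → refl)
      }
    ; _⁻¹     = λ φ → record
      { iso = record
        { to = from φ ; from = to φ
        ; to∘from≗id = from∘to≗id φ ; from∘to≗id = to∘from≗id φ
        }
      ; over = over⁻¹ φ
      }
    ; isGroup = record
      { isMonoid = record
        { isSemigroup = record
          { isMagma = record
            { isEquivalence = record
              { refl  = (λ _ → refl) , (λ _ → refl)
              ; sym   = λ (p , q) → (λ v → sym (p v)) , (λ e → sym (q e))
              ; trans = λ (p , q) (p′ , q′) →
                  (λ v → trans (p v) (p′ v)) , (λ e → trans (q e) (q′ e))
              }
            ; ∙-cong = λ {φ} (p , q) (p′ , q′) →
                (λ v → trans (cong (onV (to φ)) (p′ v)) (p _)) ,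
                (λ e → trans (cong (onE (to φ)) (q′ e)) (q _))
            }
          ; assoc = λ _ _ _ → (λ _ → refl) , (λ _ → refl)
          }
        ; identity = (λ _ → (λ _ → refl) , (λ _ → refl)) , (λ _ → (λ _ → refl) , (λ _ → refl))
        }
      ; inverse = (λ φ → from∘to≗id φ) , (λ φ → to∘from≗id φ)
      ; ⁻¹-cong = λ {φ} {ψ} (p , q) →
          (λ v → trans (cong (onV (from φ)) (trans (sym (proj₁ (to∘from≗id ψ) v)) (sym (p _))))
                       (proj₁ (from∘to≗id φ) _)) ,
          (λ e → trans (cong (onE (from φ)) (trans (sym (proj₂ (to∘from≗id ψ) e)) (sym (q _))))
                       (proj₂ (from∘to≗id φ) _))
      }
    }

  Sheeted : ℕ → Set
  Sheeted m = ∀ x → (∃[ v ] onV f v ≡ x) ↔ Fin m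

  record IsGalois : Set where
    field
      isCovering : IsCovering f
      degree     : ℕ
      sheeted    : Sheeted degree
      deckSize   : Inverse (Group.setoid Deck) (setoid (Fin degree))

------------------------------------------------------------------------
-- The group ℤ/m, on residues 0, …, m − 1

module _ (m : ℕ) .{{_ : NonZero m}} where

  private
    toℕ-mod : ∀ k → toℕ (k mod m) ≡ k % m
    toℕ-mod k = Fin.toℕ-fromℕ< (m%n<n k m)

    toℕ-% : (a : Fin m) → toℕ a % m ≡ toℕ a
    toℕ-% a = m<n⇒m%n≡m (Fin.toℕ<n a)

    %-+ˡ : ∀ j k → (j % m ℕ.+ k) % m ≡ (j ℕ.+ k) % m
    %-+ˡ j k = begin
      (j % m ℕ.+ k) % m             ≡⟨ %-distribˡ-+ (j % m) k m ⟩
      (j % m % m ℕ.+ k % m) % m     ≡⟨ cong (λ i → (i ℕ.+ k % m) % m) (m%n%n≡m%n j m) ⟩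
      (j % m ℕ.+ k % m) % m         ≡⟨ %-distribˡ-+ j k m ⟨
      (j ℕ.+ k) % m                 ∎
      where open ≡-Reasoning

    %-+ʳ : ∀ j k → (j ℕ.+ k % m) % m ≡ (j ℕ.+ k) % m
    %-+ʳ j k = trans (cong (_% m) (ℕ.+-comm j (k % m)))
                     (trans (%-+ˡ k j) (cong (_% m) (ℕ.+-comm k j)))

    add : Fin m → Fin m → Fin m
    add a b = (toℕ a ℕ.+ toℕ b) mod m

    neg : Fin m → Fin m
    neg a = (m ℕ.∸ toℕ a) mod m

    toℕ-add : ∀ a b → toℕ (add a b) ≡ (toℕ a ℕ.+ toℕ b) % m
    toℕ-add a b = toℕ-mod (toℕ a ℕ.+ toℕ b)

    add-comm : ∀ a b → add a b ≡ add b a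
    add-comm a b = cong (_mod m) (ℕ.+-comm (toℕ a) (toℕ b))

    add-assoc : ∀ a b c → add (add a b) c ≡ add a (add b c)
    add-assoc a b c = Fin.toℕ-injective (begin
      toℕ (add (add a b) c)                    ≡⟨ toℕ-add (add a b) c ⟩
      (toℕ (add a b) ℕ.+ toℕ c) % m            ≡⟨ cong (λ i → (i ℕ.+ toℕ c) % m) (toℕ-add a b) ⟩
      ((toℕ a ℕ.+ toℕ b) % m ℕ.+ toℕ c) % m    ≡⟨ %-+ˡ (toℕ a ℕ.+ toℕ b) (toℕ c) ⟩
      (toℕ a ℕ.+ toℕ b ℕ.+ toℕ c) % m          ≡⟨ cong (_% m) (ℕ.+-assoc (toℕ a) (toℕ b) (toℕ c)) ⟩
      (toℕ a ℕ.+ (toℕ b ℕ.+ toℕ c)) % m        ≡⟨ %-+ʳ (toℕ a) (toℕ b ℕ.+ toℕ c) ⟨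
      (toℕ a ℕ.+ (toℕ b ℕ.+ toℕ c) % m) % m    ≡⟨ cong (λ i → (toℕ a ℕ.+ i) % m) (toℕ-add b c) ⟨
      (toℕ a ℕ.+ toℕ (add b c)) % m            ≡⟨ toℕ-add a (add b c) ⟨
      toℕ (add a (add b c))                    ∎)
      where open ≡-Reasoning

    add-identityˡ : ∀ a → add (0 mod m) a ≡ a
    add-identityˡ a = Fin.toℕ-injective (begin
      toℕ (add (0 mod m) a)             ≡⟨ toℕ-add (0 mod m) a ⟩
      (toℕ (0 mod m) ℕ.+ toℕ a) % m     ≡⟨ cong (λ i → (i ℕ.+ toℕ a) % m) (toℕ-mod 0) ⟩
      (0 % m ℕ.+ toℕ a) % m             ≡⟨ %-+ˡ 0 (toℕ a) ⟩
      toℕ a % m                         ≡⟨ toℕ-% a ⟩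
      toℕ a                             ∎)
      where open ≡-Reasoning

    add-inverseʳ : ∀ a → add a (neg a) ≡ 0 mod m
    add-inverseʳ a = Fin.toℕ-injective (begin
      toℕ (add a (neg a))                        ≡⟨ toℕ-add a (neg a) ⟩
      (toℕ a ℕ.+ toℕ (neg a)) % m                ≡⟨ cong (λ i → (toℕ a ℕ.+ i) % m) (toℕ-mod (m ℕ.∸ toℕ a)) ⟩
      (toℕ a ℕ.+ (m ℕ.∸ toℕ a) % m) % m          ≡⟨ %-+ʳ (toℕ a) (m ℕ.∸ toℕ a) ⟩
      (toℕ a ℕ.+ (m ℕ.∸ toℕ a)) % m              ≡⟨ cong (_% m) (ℕ.m+[n∸m]≡n (ℕ.<⇒≤ (Fin.toℕ<n a))) ⟩
      m % m                                      ≡⟨ n%n≡0 m ⟩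
      0                                          ≡⟨ m<n⇒m%n≡m (ℕ.>-nonZero⁻¹ m) ⟨
      0 % m                                      ≡⟨ toℕ-mod 0 ⟨
      toℕ (0 mod m)                              ∎)
      where open ≡-Reasoning

  ℤ/ : AbelianGroup 0ℓ 0ℓ
  ℤ/ = record
    { Carrier = Fin m
    ; _≈_     = _≡_
    ; _∙_     = add
    ; ε       = 0 mod m
    ; _⁻¹     = neg
    ; isAbelianGroup = record
      { isGroup = record
        { isMonoid = record
          { isSemigroup = record { isMagma = isMagma add ; assoc = add-assoc }
          ; identity = add-identityˡ ,
                       (λ a → trans (add-comm a (0 mod m)) (add-identityˡ a))
          }
        ; inverse = (λ a → trans (add-comm (neg a) a) (add-inverseʳ a)) , add-inverseʳ
        ; ⁻¹-cong = cong neg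
        }
      ; comm = add-comm
      }
    }

  reduce-+ : ∀ j k → (j ℕ.+ k) mod m ≡ add (j mod m) (k mod m)
  reduce-+ j k = Fin.toℕ-injective (begin
    toℕ ((j ℕ.+ k) mod m)                      ≡⟨ toℕ-mod (j ℕ.+ k) ⟩
    (j ℕ.+ k) % m                              ≡⟨ %-distribˡ-+ j k m ⟩
    (j % m ℕ.+ k % m) % m                      ≡⟨ cong₂ (λ x y → (x ℕ.+ y) % m) (toℕ-mod j) (toℕ-mod k) ⟨
    (toℕ (j mod m) ℕ.+ toℕ (k mod m)) % m      ≡⟨ toℕ-add (j mod m) (k mod m) ⟨
    toℕ (add (j mod m) (k mod m))              ∎)
    where
    open ≡-Reasoning

------------------------------------------------------------------------
-- Determinants (cofactor expansion along the first row)

Matrix : Set → ℕ → Set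
Matrix A r = Fin r → Fin r → A

module _ (R : RawRing 0ℓ 0ℓ) where
  open RawRing R

  ∑ : ∀ {n} → Vector Carrier n → Carrier
  ∑ = Vec.foldr _+_ 0#

  -- (−1)ᵏ x
  signed : ℕ → Carrier → Carrier
  signed zero    x = x
  signed (suc k) x = - signed k x

  Id : ∀ {r} → Matrix Carrier r
  Id i j = if does (i Fin.≟ j) then 1# else 0#

  det : ∀ {r} → Matrix Carrier r → Carrier
  det {zero}  M = 1#
  det {suc r} M =
    ∑ λ j → signed (toℕ j) (M Fin.zero j * det (λ i k → M (Fin.suc i) (punchIn j k)))

------------------------------------------------------------------------
-- The ring ℤ[T; G] of finite ℤ-linear combinations of T^a, a ∈ G

module GroupRing (G : RawMonoid 0ℓ 0ℓ) where
  private module G = RawMonoid G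

  -- (c₁ , a₁) ∷ … ∷ (cₖ , aₖ) ∷ [] stands for c₁T^a₁ + … + cₖT^aₖ
  FormalSum : Set
  FormalSum = List (ℤ × G.Carrier)

  -- Equality in the free ℤ-module on the setoid G: the congruence generated
  -- by reordering, collecting and deleting terms.
  infix 4 _≋_
  data _≋_ : FormalSum → FormalSum → Set where
    ≋-refl   : ∀ {f} → f ≋ f
    ≋-sym    : ∀ {f g} → f ≋ g → g ≋ f
    ≋-trans  : ∀ {f g h} → f ≋ g → g ≋ h → f ≋ h
    ∷-cong   : ∀ {c a a′ f g} → a G.≈ a′ → f ≋ g → (c , a) ∷ f ≋ (c , a′) ∷ g
    ∷-swap   : ∀ {x y f} → x ∷ y ∷ f ≋ y ∷ x ∷ f
    ∷-merge  : ∀ {c d a f} → (c , a) ∷ (d , a) ∷ f ≋ (c ℤ.+ d , a) ∷ f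
    ∷-zero   : ∀ {a f} → (0ℤ , a) ∷ f ≋ f

  ℤ[T] : RawRing 0ℓ 0ℓ
  ℤ[T] = record
    { Carrier = FormalSum
    ; _≈_     = _≋_
    ; _+_     = _++_
    ; _*_     = cartesianProductWith λ (c , a) (d , b) → c ℤ.* d , a G.∙ b
    ; -_      = map λ (c , a) → ℤ.- c , a
    ; 0#      = []
    ; 1#      = (1ℤ , G.ε) ∷ []
    }

------------------------------------------------------------------------
-- p-adic integers, voltage assignments and towers

module _ (p : ℕ) .{{_ : NonZero p}} where

  ℤ/p^ : ℕ → AbelianGroup 0ℓ 0ℓ
  ℤ/p^ n = ℤ/ (p ^ n) {{ℕ.m^n≢0 p n}}

  private
    module ℤ/p^ (n : ℕ) = AbelianGroup (ℤ/p^ n)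

  reduce : ∀ n → Fin (p ^ suc n) → Fin (p ^ n)
  reduce n a = _mod_ (toℕ a) (p ^ n) {{ℕ.m^n≢0 p n}}

  private
    reduce-mod : ∀ n k → reduce n (_mod_ k (p ^ suc n) {{ℕ.m^n≢0 p (suc n)}})
                         ≡ _mod_ k (p ^ n) {{ℕ.m^n≢0 p n}}
    reduce-mod n k = Fin.toℕ-injective (begin
      toℕ (toℕ (k mod (p ^ suc n)) mod (p ^ n))  ≡⟨ Fin.toℕ-fromℕ< (m%n<n _ (p ^ n)) ⟩
      toℕ (k mod (p ^ suc n)) % p ^ n            ≡⟨ cong (_% p ^ n) (Fin.toℕ-fromℕ< (m%n<n k (p ^ suc n))) ⟩
      k % p ^ suc n % p ^ n                      ≡⟨ m∣n⇒o%n%m≡o%m (p ^ n) (p ^ suc n) k (n∣m*n p) ⟩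
      k % p ^ n                                  ≡⟨ Fin.toℕ-fromℕ< (m%n<n k (p ^ n)) ⟨
      toℕ (k mod (p ^ n))                        ∎)
      where
      open ≡-Reasoning
      instance
        pⁿ≢0   = ℕ.m^n≢0 p n
        pⁿ⁺¹≢0 = ℕ.m^n≢0 p (suc n)

    reduce-∙ : ∀ n a b → reduce n (ℤ/p^._∙_ (suc n) a b) ≡ ℤ/p^._∙_ n (reduce n a) (reduce n b)
    reduce-∙ n a b = trans (reduce-mod n (toℕ a ℕ.+ toℕ b))
                           (reduce-+ (p ^ n) {{ℕ.m^n≢0 p n}} (toℕ a) (toℕ b))

  record ℤₚ : Set where
    field
      residue  : ∀ n → Fin (p ^ n)
      coherent : ∀ n → reduce n (residue (suc n)) ≡ residue n

  open ℤₚ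

  ℤₚ,+ : RawMonoid 0ℓ 0ℓ
  ℤₚ,+ = record
    { Carrier = ℤₚ
    ; _≈_     = λ a b → ∀ n → residue a n ≡ residue b n
    ; _∙_     = λ a b → record
      { residue  = λ n → ℤ/p^._∙_ n (residue a n) (residue b n)
      ; coherent = λ n → trans (reduce-∙ n (residue a (suc n)) (residue b (suc n)))
                               (cong₂ (ℤ/p^._∙_ n) (coherent a n) (coherent b n))
      }
    ; ε       = record
      { residue  = ℤ/p^.ε
      ; coherent = λ n → reduce-mod n 0
      }
    }

  derived : (X : Digraph) (α : E X → ℤₚ) (n : ℕ) → Digraph
  derived X α n = record
    { V     = V X × Fin (p ^ n)
    ; E     = E X × Fin (p ^ n)
    ; o     = λ (e , σ) → Digraph.o X e , σ
    ; t     = λ (e , σ) → Digraph.t X e , ℤ/p^._∙_ n σ (residue (α e) n)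
    ; #V    = Digraph.#V X ℕ.* p ^ n
    ; #E    = Digraph.#E X ℕ.* p ^ n
    ; V↔Fin = ↔-sym Fin.*↔× ↔-∘ (Digraph.V↔Fin X ×-↔ ↔-id _)
    ; E↔Fin = ↔-sym Fin.*↔× ↔-∘ (Digraph.E↔Fin X ×-↔ ↔-id _)
    }

  derivedProjection : ∀ X α n → Morphism (derived X α (suc n)) (derived X α n)
  derivedProjection X α n = record
    { onV    = λ (v , σ) → v , reduce n σ
    ; onE    = λ (e , σ) → e , reduce n σ
    ; o-comm = λ _ → refl
    ; t-comm = λ (e , σ) → cong (Digraph.t X e ,_) (sym
        (trans (reduce-∙ n σ (residue (α e) (suc n)))
               (cong (ℤ/p^._∙_ n (reduce n σ)) (coherent (α e) n))))
    }

  derivedToBase : ∀ X α n → Morphism (derived X α n) X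
  derivedToBase X α n = record
    { onV = proj₁ ; onE = proj₁ ; o-comm = λ _ → refl ; t-comm = λ _ → refl }

  module _ (X : ℕ → Digraph) (π : ∀ n → Morphism (X (suc n)) (X n)) where

    toBase : ∀ n → Morphism (X n) (X 0)
    toBase zero    = idᴹ
    toBase (suc n) = toBase n ∘ᴹ π n

    record IsℤₚTower : Set where
      field
        isCovering : ∀ n → IsCovering (π n)
        isGalois   : ∀ n → IsGalois (toBase n)
        deck≅ℤ/pⁿ  : ∀ n → let open GroupMorphisms (Group.rawGroup (Deck (toBase n)))
                                                   (AbelianGroup.rawGroup (ℤ/p^ n))
                           in ∃ IsGroupIsomorphism

    -- Identifications of the X n with the derived digraphs of α, compatible
    -- with all coverings, including the canonical X₀ ≅ derived X₀ α 0.
    record IsAssociatedVoltage (α : E (X 0) → ℤₚ) : Set where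
      field
        iso        : ∀ n → Iso (X n) (derived (X 0) α n)
        compatible : ∀ n → derivedProjection (X 0) α n ∘ᴹ Iso.to (iso (suc n))
                           ≗ᴹ Iso.to (iso n) ∘ᴹ π n
        base       : derivedToBase (X 0) α 0 ∘ᴹ Iso.to (iso 0) ≗ᴹ idᴹ

  module _ (X : Digraph) (α : E X → ℤₚ) where
    open Digraph X using (#V; vertex; edgesFromTo)
    open GroupRing ℤₚ,+ using (ℤ[T])
    open RawRing ℤ[T] using (Carrier; _+_; -_; _≈_; 0#)

    voltageMatrix : Matrix Carrier #V
    voltageMatrix i j = map (λ e → 1ℤ , α e) (edgesFromTo (vertex j) (vertex i))

    bowenFranks : Carrier
    bowenFranks = det ℤ[T] λ i j → Id ℤ[T] i j + (- voltageMatrix i j)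

    BowenFranks≉0 : Set
    BowenFranks≉0 = ¬ (bowenFranks ≈ 0#)

------------------------------------------------------------------------
-- ℤ-modules: cokernels and rank

open Sum ℤ.+-*-semiring using (sum; sum-cong-≗; ∑-distrib-+; *-distribˡ-sum)

infixr 8 _·_
_·_ : ∀ {s} → Matrix ℤ s → Vector ℤ s → Vector ℤ s
(M · z) i = sum λ j → M i j ℤ.* z j

private
  ·-+ : ∀ {s} (M : Matrix ℤ s) z w i → (M · λ j → z j ℤ.+ w j) i ≡ (M · z) i ℤ.+ (M · w) i
  ·-+ M z w i = trans (sum-cong-≗ λ j → ℤ.*-distribˡ-+ (M i j) (z j) (w j))
                      (∑-distrib-+ (λ j → M i j ℤ.* z j) (λ j → M i j ℤ.* w j))

  ·-* : ∀ {s} (M : Matrix ℤ s) c z i → (M · λ j → c ℤ.* z j) i ≡ c ℤ.* (M · z) i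
  ·-* M c z i = trans (sum-cong-≗ λ j → lemma (M i j) c (z j))
                      (sym (*-distribˡ-sum c λ j → M i j ℤ.* z j))
    where
    lemma : ∀ m c z → m ℤ.* (c ℤ.* z) ≡ c ℤ.* (m ℤ.* z)
    lemma = solve-∀

module _ {s : ℕ} (M : Matrix ℤ s) where

  private
    infix 4 _~_
    _~_ : Vector ℤ s → Vector ℤ s → Set
    x ~ y = ∃[ z ] ∀ i → x i ≡ y i ℤ.+ (M · z) i

    scale-~ : ∀ c {x y} → x ~ y → (λ i → c ℤ.* x i) ~ (λ i → c ℤ.* y i)
    scale-~ c {x} {y} (z , x≡) = (λ j → c ℤ.* z j) , λ i → begin
      c ℤ.* x i                            ≡⟨ cong (c ℤ.*_) (x≡ i) ⟩
      c ℤ.* (y i ℤ.+ (M · z) i)            ≡⟨ ℤ.*-distribˡ-+ c (y i) _ ⟩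
      c ℤ.* y i ℤ.+ c ℤ.* (M · z) i        ≡⟨ cong (ℤ._+_ (c ℤ.* y i)) (·-* M c z i) ⟨
      c ℤ.* y i ℤ.+ (M · λ j → c ℤ.* z j) i ∎
      where open ≡-Reasoning

    ≗⇒~ : ∀ {x y} → x ≗ y → x ~ y
    ≗⇒~ {x} {y} x≗y = (λ j → 0ℤ ℤ.* 0ℤ) , λ i → trans (x≗y i) (sym
      (trans (cong (ℤ._+_ (y i)) (trans (·-* M 0ℤ (λ _ → 0ℤ) i) (ℤ.*-zeroˡ ((M · λ _ → 0ℤ) i))))
             (ℤ.+-identityʳ (y i))))

    +-~ : ∀ {x x′ y y′} → x ~ x′ → y ~ y′ → (λ i → x i ℤ.+ y i) ~ (λ i → x′ i ℤ.+ y′ i)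
    +-~ {x} {x′} {y} {y′} (z , x≡) (w , y≡) = (λ j → z j ℤ.+ w j) , λ i →
      trans (cong₂ ℤ._+_ (x≡ i) (y≡ i))
            (trans (lemma (x′ i) ((M · z) i) (y′ i) ((M · w) i))
                   (cong (ℤ._+_ (x′ i ℤ.+ y′ i)) (sym (·-+ M z w i))))
      where
      lemma : ∀ a b c d → (a ℤ.+ b) ℤ.+ (c ℤ.+ d) ≡ (a ℤ.+ c) ℤ.+ (b ℤ.+ d)
      lemma = solve-∀

    neg-~ : ∀ {x y} → x ~ y → (λ i → ℤ.- x i) ~ (λ i → ℤ.- y i)
    neg-~ {x} {y} x~y with scale-~ -1ℤ {x} {y} x~y
    ... | z , eq = z , λ i → trans (sym (ℤ.-1*i≡-i (x i)))
                                   (trans (eq i) (cong (ℤ._+ (M · z) i) (ℤ.-1*i≡-i (y i))))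

    sym-~ : ∀ {x y} → x ~ y → y ~ x
    sym-~ {x} {y} (z , x≡) = (λ j → -1ℤ ℤ.* z j) , λ i → begin
      y i                                                ≡⟨ lemma (y i) ((M · z) i) ⟩
      (y i ℤ.+ (M · z) i) ℤ.+ -1ℤ ℤ.* (M · z) i          ≡⟨ cong₂ ℤ._+_ (x≡ i) (·-* M -1ℤ z i) ⟨
      x i ℤ.+ (M · λ j → -1ℤ ℤ.* z j) i                  ∎
      where
      open ≡-Reasoning
      lemma : ∀ a b → a ≡ (a ℤ.+ b) ℤ.+ -1ℤ ℤ.* b
      lemma = solve-∀

    trans-~ : ∀ {x y w} → x ~ y → y ~ w → x ~ w
    trans-~ {x} {y} {w} (z , x≡) (z′ , y≡) = (λ j → z′ j ℤ.+ z j) , λ i →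
      trans (x≡ i) (trans (cong (ℤ._+ (M · z) i) (y≡ i))
        (trans (ℤ.+-assoc (w i) _ _) (cong (ℤ._+_ (w i)) (sym (·-+ M z′ z i)))))

  -- ℤˢ / M ℤˢ
  cokernel : LeftModule ℤ.+-*-ring 0ℓ 0ℓ
  cokernel = record
    { Carrierᴹ = Vector ℤ s
    ; _≈ᴹ_     = _~_
    ; _+ᴹ_     = λ x y i → x i ℤ.+ y i
    ; _*ₗ_     = λ c x i → c ℤ.* x i
    ; 0ᴹ       = λ _ → 0ℤ
    ; -ᴹ_      = λ x i → ℤ.- x i
    ; isLeftModule = record
      { isLeftSemimodule = record
        { +ᴹ-isCommutativeMonoid = record
          { isMonoid = record
            { isSemigroup = record
              { isMagma = record
                { isEquivalence = record
                  { refl  = λ {x} → ≗⇒~ {x} λ _ → refl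
                  ; sym   = λ {x} {y} → sym-~ {x} {y}
                  ; trans = λ {x} {y} {w} → trans-~ {x} {y} {w}
                  }
                ; ∙-cong = λ {x} {x′} {y} {y′} → +-~ {x} {x′} {y} {y′}
                }
              ; assoc = λ x y w → ≗⇒~ λ i → ℤ.+-assoc (x i) (y i) (w i)
              }
            ; identity = (λ x → ≗⇒~ λ i → ℤ.+-identityˡ (x i)) ,
                         (λ x → ≗⇒~ λ i → ℤ.+-identityʳ (x i))
            }
          ; comm = λ x y → ≗⇒~ λ i → ℤ.+-comm (x i) (y i)
          }
        ; isPreleftSemimodule = record
          { *ₗ-cong      = λ { {c} {_} {x} {y} refl → scale-~ c {x} {y} }
          ; *ₗ-zeroˡ     = λ x → ≗⇒~ λ i → ℤ.*-zeroˡ (x i)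
          ; *ₗ-distribʳ  = λ x c d → ≗⇒~ λ i → ℤ.*-distribʳ-+ (x i) c d
          ; *ₗ-identityˡ = λ x → ≗⇒~ λ i → ℤ.*-identityˡ (x i)
          ; *ₗ-assoc     = λ c d x → ≗⇒~ λ i → ℤ.*-assoc c d (x i)
          ; *ₗ-zeroʳ     = λ c → ≗⇒~ λ _ → ℤ.*-zeroʳ c
          ; *ₗ-distribˡ  = λ c x y → ≗⇒~ λ i → ℤ.*-distribˡ-+ c (x i) (y i)
          }
        }
      ; -ᴹ‿cong    = λ {x} {y} → neg-~ {x} {y}
      ; -ᴹ‿inverse = (λ x → ≗⇒~ λ i → ℤ.+-inverseˡ (x i)) ,
                     (λ x → ≗⇒~ λ i → ℤ.+-inverseʳ (x i))
      }
    }

module _ (N : LeftModule ℤ.+-*-ring 0ℓ 0ℓ) where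
  open LeftModule N
  open CommutativeMonoidSum +ᴹ-commutativeMonoid using () renaming (sum to sumᴹ)

  LinearlyIndependent : ∀ {k} → Vector Carrierᴹ k → Set
  LinearlyIndependent {k} x =
    (c : Vector ℤ k) → sumᴹ (λ i → c i *ₗ x i) ≈ᴹ 0ᴹ → ∀ i → c i ≡ 0ℤ

  HasRank : ℕ → Set
  HasRank k = (∃[ x ] LinearlyIndependent {k} x) ×
              (∀ x → ¬ LinearlyIndependent {suc k} x)

adjacency : (Y : Digraph) → Matrix ℤ (Digraph.#V Y)
adjacency Y i j = + length (edgesFromTo (vertex j) (vertex i))
  where open Digraph Y

BF : Digraph → LeftModule ℤ.+-*-ring 0ℓ 0ℓ
BF Y = cokernel λ i j → Id ℤ.+-*-rawRing i j ℤ.- adjacency Y i j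

------------------------------------------------------------------------
-- Power series over ℤ and rational functions

PowerSeries : Set
PowerSeries = ℕ → ℤ

oneˢ : PowerSeries
oneˢ zero    = 1ℤ
oneˢ (suc _) = 0ℤ

infixl 7 _⊛_
_⊛_ : PowerSeries → PowerSeries → PowerSeries
(f ⊛ g) n = sum {suc n} λ i → f (toℕ i) ℤ.* g (n ℕ.∸ toℕ i)

IsPolynomial : PowerSeries → Set
IsPolynomial f = ∃[ N ] ∀ n → N ≤ n → f n ≡ 0ℤ

infix 4 _∣ᴾ_
_∣ᴾ_ : PowerSeries → PowerSeries → Set
f ∣ᴾ g = ∃[ h ] IsPolynomial h × f ⊛ h ≗ g

u-1 : PowerSeries
u-1 0 = -1ℤ
u-1 1 = 1ℤ
u-1 _ = 0ℤ

[u-1]^ : ℕ → PowerSeries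
[u-1]^ zero    = oneˢ
[u-1]^ (suc k) = u-1 ⊛ [u-1]^ k

PolynomialOrderAt1 : PowerSeries → ℕ → Set
PolynomialOrderAt1 f k = ([u-1]^ k ∣ᴾ f) × ¬ ([u-1]^ (suc k) ∣ᴾ f)

-- The power series f is the expansion at 0 of a nonzero rational function
-- num / den, and ord_{u=1} (num / den) = k. Only nonzero polynomials have a
-- PolynomialOrderAt1, so num and den are nonzero.
OrderAt1 : PowerSeries → ℤ → Set
OrderAt1 f k =
  ∃₂ λ num den → IsPolynomial num × IsPolynomial den × den ⊛ f ≗ num ×
  ∃₂ λ i j → PolynomialOrderAt1 num i × PolynomialOrderAt1 den j × k ≡ + i ℤ.- + j

------------------------------------------------------------------------
-- Prime cycles and the zeta function

module _ (Y : Digraph) where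
  open Digraph Y using (o; t; edges; _≟ⱽ_; _≟ᴱ_)

  IsCycle : List (E Y) → Set
  IsCycle []       = ⊥
  IsCycle (e ∷ es) = Linked (λ e f → t e ≡ o f) (e ∷ es ++ e ∷ [])

  _-fold_ : ℕ → List (E Y) → List (E Y)
  m -fold c = concat (replicate m c)

  IsMultiple : List (E Y) → Set
  IsMultiple c = ∃₂ λ m c′ → 2 ≤ m × IsCycle c′ × c ≡ m -fold c′

  IsPrime : List (E Y) → Set
  IsPrime c = IsCycle c × ¬ IsMultiple c

  CyclicPermutation : List (E Y) → List (E Y) → Set
  CyclicPermutation c c′ = ∃ λ (k : Fin (length c)) → c′ ≡ drop (toℕ k) c ++ take (toℕ k) c

  isCycle? : ∀ c → Dec (IsCycle c)
  isCycle? []       = no λ ()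
  isCycle? (e ∷ es) = linked? (λ e f → t e ≟ⱽ o f) (e ∷ es ++ e ∷ [])

  private
    _≟ᴸ_ : DecidableEquality (List (E Y))
    _≟ᴸ_ = List.≡-dec _≟ᴱ_

    length-fold : ∀ m e es → m ≤ length (m -fold (e ∷ es))
    length-fold zero    e es = z≤n
    length-fold (suc m) e es = s≤s (begin
      m                                        ≤⟨ length-fold m e es ⟩
      length (m -fold (e ∷ es))                ≤⟨ ℕ.m≤n+m _ (length es) ⟩
      length es ℕ.+ length (m -fold (e ∷ es))  ≡⟨ List.length-++ es ⟨
      length (es ++ m -fold (e ∷ es))          ∎)
      where open ℕ.≤-Reasoning

  isMultiple? : ∀ c → Dec (IsMultiple c)
  isMultiple? c = map′ sound complete
    (Fin.any? λ (m : Fin (suc (length c))) → Fin.any? λ (k : Fin (suc (length c))) →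
      (2 ℕ.≤? toℕ m) ×-dec isCycle? (take (toℕ k) c)
        ×-dec (c ≟ᴸ (toℕ m -fold take (toℕ k) c)))
    where
    Bounded : Set
    Bounded = ∃[ m ] ∃[ k ] (2 ≤ toℕ {suc (length c)} m × IsCycle (take (toℕ {suc (length c)} k) c)
                             × c ≡ toℕ m -fold take (toℕ k) c)

    sound : Bounded → IsMultiple c
    sound (m , k , p) = toℕ m , take (toℕ k) c , p

    complete : IsMultiple c → Bounded
    complete (m@(suc m′) , c′@(e ∷ es) , 2≤m , cyc , refl) =
      Fin.fromℕ< (s≤s m≤) , Fin.fromℕ< (s≤s k≤) ,
      subst (2 ≤_) (sym toℕ-m) 2≤m ,
      subst IsCycle (sym take-k) cyc ,
      cong₂ _-fold_ (sym toℕ-m) (sym take-k)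
      where
      m≤ : m ≤ length c
      m≤ = length-fold m e es

      k≤ : length c′ ≤ length c
      k≤ = subst (length c′ ≤_) (sym (List.length-++ c′)) (ℕ.m≤m+n _ _)

      toℕ-m : toℕ (Fin.fromℕ< (s≤s m≤)) ≡ m
      toℕ-m = Fin.toℕ-fromℕ< (s≤s m≤)

      take-++ : ∀ (xs ys : List (E Y)) → take (length xs) (xs ++ ys) ≡ xs
      take-++ []       ys = refl
      take-++ (x ∷ xs) ys = cong (x ∷_) (take-++ xs ys)

      take-k : take (toℕ (Fin.fromℕ< (s≤s k≤))) c ≡ c′
      take-k = trans (cong (λ k → take k c) (Fin.toℕ-fromℕ< (s≤s k≤)))
                     (take-++ c′ (m′ -fold c′))

  isPrime? : ∀ c → Dec (IsPrime c)
  isPrime? c = isCycle? c ×-dec ¬? (isMultiple? c)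

  cyclicPermutation? : ∀ c c′ → Dec (CyclicPermutation c c′)
  cyclicPermutation? c c′ = Fin.any? λ k → c′ ≟ᴸ (drop (toℕ k) c ++ take (toℕ k) c)

  edgeSequences : ℕ → List (List (E Y))
  edgeSequences zero    = [] ∷ []
  edgeSequences (suc ℓ) = cartesianProductWith _∷_ edges (edgeSequences ℓ)

  -- One representative of each class [C] with |[C]| = ℓ.
  primeClasses : ℕ → List (List (E Y))
  primeClasses ℓ = deduplicate cyclicPermutation? (filter isPrime? (edgeSequences ℓ))

  -- (1 − u^ℓ)⁻¹ = Σₖ u^(kℓ)
  eulerFactor : ℕ → PowerSeries
  eulerFactor ℓ n = if does (ℓ ∣? n) then 1ℤ else 0ℤ

  eulerProductUpTo : ℕ → PowerSeries
  eulerProductUpTo N =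
    foldr (λ c f → eulerFactor (length c) ⊛ f) oneˢ (concatMap primeClasses (map suc (upTo N)))

  -- Classes with |[C]| > n do not affect the coefficient of uⁿ.
  zeta : PowerSeries
  zeta n = eulerProductUpTo n n

------------------------------------------------------------------------
-- The invariants a, b and δ as functional relations on values

a-Value : Digraph → ℤ → Set
a-Value Y k = OrderAt1 (zeta Y) (ℤ.- k)

b-Value : Digraph → ℤ → Set
b-Value Y k = ∃[ r ] HasRank (BF Y) r × k ≡ + r

δ-Value : Digraph → ℤ → Set
δ-Value Y k = ∃₂ λ a b → a-Value Y a × b-Value Y b × k ≡ a ℤ.- b

-- The quantity with graph Value is defined for every n, and its values are
-- bounded independently of n.
UniformlyBounded : (ℕ → ℤ → Set) → Set
UniformlyBounded Value =
  ∃[ B ] ∀ n → ∃ (Value n) × (∀ k → Value n k → ∣ k ∣ ≤ B)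

{-# OPTIONS --safe #-}

-- By its logarithmic derivative, the Euler product of the zeta function of Xₙ counts the closed
-- walks of Xₙ. Over ℤ[ζ], with ζ of order pⁿ⁺¹, the number of these is the sum over the
-- characters χ of ℤ/pⁿ of the traces of the powers of A_χ, so the zeta function is the inverse of
-- ∏_χ det(Id − u A_χ). As L_p ≠ 0, it has a term whose exponent is isolated modulo some pᵏ; then
-- det(Id − A_χ) = χ(L_p) ≠ 0 unless χ factors through ℤ/pᵏ. At most pᵏ factors, of degree at
-- most r each, thus vanish at u = 1, whence a(Xₙ) ≤ r pᵏ.
--
-- For b, the adjugate shows that L_p annihilates the Bowen–Franks module over ℤ[ℤ/pⁿ], and L_p
-- divides a non-zero integer on the kernel of ℤ[ℤ/pⁿ] → ℤ[ℤ/pᵏ]. Hence more than r pᵏ vectors are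
-- linearly dependent in the Bowen–Franks module.
--
-- The ring ℤ[ζ] is constructed as a quotient of ℤ[x] by means of linear forms; it is a domain
-- because every element has a valuation at ζ − 1.

module Submission where

open import Defs
open import Algebra.Bundles using (AbelianGroup; CommutativeRing; RawMonoid; RawRing)
open import Algebra.Module.Bundles using (LeftModule)
import Algebra.Properties.AbelianGroup as AbelianGroupProperties
import Algebra.Properties.CommutativeMonoid.Mult as CommutativeMonoidMult
import Algebra.Properties.CommutativeMonoid.Sum as CommutativeMonoidSum
import Algebra.Properties.CommutativeSemigroup as CommutativeSemigroupProperties
import Algebra.Properties.CommutativeSemiring.Binomial as Binomial
import Algebra.Properties.Group as GroupProperties
import Algebra.Properties.Ring as RingProperties
import Algebra.Properties.Semiring.Exp as SemiringExp
import Algebra.Properties.Semiring.Mult as SemiringMult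
import Algebra.Properties.Semiring.Sum as SemiringSum
import Algebra.Solver.Ring.NaturalCoefficients.Default as SemiringSolver
open import Axiom.ExcludedMiddle using (ExcludedMiddle)
open import Data.Bool.Base using (if_then_else_)
open import Data.Empty using (⊥; ⊥-elim)
open import Data.Fin.Base as Fin using (Fin; zero; suc; toℕ; punchIn; inject₁; fromℕ)
import Data.Fin.Properties as Fin
open import Data.Integer.Base as ℤ using (ℤ; +_; 0ℤ; 1ℤ; -1ℤ; ∣_∣)
open import Data.Integer.Divisibility.Signed as ℤ∣ using (divides) renaming (_∣_ to _∣ℤ_; _∣?_ to _∣ℤ?_)
import Data.Integer.Properties as ℤ
open import Data.Integer.Tactic.RingSolver using (solve-∀)
open import Data.List.Base as List
  using (List; []; _∷_; _++_; _∷ʳ_; map; filter; concat; concatMap; foldr; length; replicate; take; drop;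
         allFin; upTo; applyUpTo; deduplicate; cartesianProduct; cartesianProductWith)
import Data.List.Properties as List
open import Data.List.Membership.Propositional using (_∈_)
import Data.List.Membership.Propositional.Properties as Mem
open import Data.List.Membership.Propositional.Properties.WithK using (unique∧set⇒bag)
open import Data.List.Relation.Binary.BagAndSetEquality using (∼bag⇒↭)
open import Data.List.Relation.Binary.Permutation.Propositional as Perm using (_↭_)
import Data.List.Relation.Binary.Permutation.Propositional.Properties as Perm
open import Data.List.Relation.Unary.All as All using (All; []; _∷_)
open import Data.List.Relation.Unary.AllPairs using ([]; _∷_)
open import Data.List.Relation.Unary.Any using (here; there)
open import Data.List.Relation.Unary.Linked as Linked using (Linked; [-]; _∷_)
import Data.List.Relation.Unary.Linked.Properties as Linked
open import Data.List.Relation.Unary.Unique.Propositional using (Unique)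
import Data.List.Relation.Unary.Unique.Propositional.Properties as Unique
open import Data.Nat.Base as ℕ using (ℕ; zero; suc; z≤n; s≤s; _≤_; _<_; NonZero; _!)
open import Data.Nat.Combinatorics using (nCk≡n!/k![n-k]!; k![n∸k]!∣n!; nCn≡1) renaming (_C_ to _choose_)
open import Data.Nat.DivMod as ℕ using (_/_; _%_; _mod_)
open import Data.Nat.Divisibility as ℕ∣ using (_∣_; _∤_; _∣?_; divides)
open import Data.Nat.Induction using (<-rec)
open import Data.Nat.Primality using (Prime; euclidsLemma; prime⇒nonTrivial; prime⇒nonZero)
import Data.Nat.Properties as ℕ
open import Data.Product using (∃; ∃₂; _×_; _,_; proj₁; proj₂)
open import Data.Product.Properties using (×-≡,≡→≡)
open import Data.Sum.Base using (_⊎_; inj₁; inj₂; [_,_]′)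
open import Data.Vec.Functional using (Vector; init; insertAt; last; updateAt)
import Data.Vec.Functional.Properties as Vec
open import Function.Base using (_∘_; id)
open import Function.Bundles using (Inverse; Injection; mk⇔)
open import Function.Construct.Symmetry using (↔-sym)
open import Function.Properties.Inverse using (↔⇒↣)
open import Level using (0ℓ)
open import Relation.Binary.PropositionalEquality as ≡ using (_≡_; _≢_; _≗_; cong; cong₂; module ≡-Reasoning)
import Relation.Binary.Reasoning.Setoid as SetoidReasoning
open import Relation.Nullary.Decidable using (Dec; does; yes; no; does-⇔; map′; _×-dec_; ¬?)
open import Relation.Nullary.Negation using (¬_; contradiction)
open import Relation.Unary using (Decidable)

-- Determinants

-- Splitting Id - uA of Xₙ into blocks would require pⁿ to be invertible, so no determinant of Xₙ
-- itself occurs: the reciprocal `den` of the zeta function is a power series over ℤ, and it is a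
-- polynomial because its image over ℤ[ζ] is a product of r × r determinants. Returning from
-- θ-derivatives, θ = u d/du, to series only asks ℤ[ζ] to be torsion-free. The order of ζ is pⁿ⁺¹ so
-- that the level n = 0 is no exception; χ_j then sends the generator to ζ^{jp}. All relations
-- between powers of ζ come from Σ_{i<p} ζ^{ipⁿ} = 0, so exponents are separated modulo pⁿ only, and
-- the factor p in jp is paid for by `suc k`: in the code the bound on a and on b is r pᵏ⁺¹. For b,
-- the integer that L_p divides on the kernel may depend on n; it only has to be non-zero, as ranks
-- do not see torsion. Excluded middle decides equality of p-adic exponents and supplies least
-- periods, orders at ζ - 1 and at u = 1, and ranks.

module DetRel (R S : RawRing 0ℓ 0ℓ) where
 private
  module R = RawRing R
  module S = RawRing S

 -- A ring homomorphism weakened to a relation: it is instantiated by equality, by constant terms,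
 -- by values at u = 1, by characters and by reduction of p-adic exponents. Only raw rings are asked
 -- for, since `ℤ[T]` comes without proofs of ring laws.
 module Related (_~_ : R.Carrier → S.Carrier → Set)
  (+-~ : ∀ {a b x y} → a ~ x → b ~ y → (a R.+ b) ~ (x S.+ y))
  (*-~ : ∀ {a b x y} → a ~ x → b ~ y → (a R.* b) ~ (x S.* y))
  (neg-~ : ∀ {a x} → a ~ x → (R.- a) ~ (S.- x))
  (0-~ : R.0# ~ S.0#) (1-~ : R.1# ~ S.1#) where

  ∑-~ : ∀ {n} {f : Vector R.Carrier n} {g : Vector S.Carrier n} →
        (∀ i → f i ~ g i) → ∑ R f ~ ∑ S g
  ∑-~ {zero}  f~g = 0-~
  ∑-~ {suc n} f~g = +-~ (f~g zero) (∑-~ (f~g ∘ suc))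

  signed-~ : ∀ k {a x} → a ~ x → signed R k a ~ signed S k x
  signed-~ zero    a~x = a~x
  signed-~ (suc k) a~x = neg-~ (signed-~ k a~x)

  Id-~ : ∀ {r} (i j : Fin r) → Id R i j ~ Id S i j
  Id-~ i j with i Fin.≟ j
  ... | yes _ = 1-~
  ... | no  _ = 0-~

  det-~ : ∀ {r} {M : Matrix R.Carrier r} {N : Matrix S.Carrier r} →
          (∀ i j → M i j ~ N i j) → det R M ~ det S N
  det-~ {zero}  M~N = 1-~
  det-~ {suc r} M~N = ∑-~ λ j → signed-~ (toℕ j)
    (*-~ (M~N zero j) (det-~ λ i k → M~N (suc i) (punchIn j k)))

module Sums (R : CommutativeRing 0ℓ 0ℓ) where
  open CommutativeRing R hiding (zero)
  private module S = SemiringSum semiring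

  -- Opaque, so that unification can read off the summand.
  opaque
    sum : ∀ {n} → Vector Carrier n → Carrier
    sum = ∑ rawRing

    sum≡∑ : ∀ {n} (f : Vector Carrier n) → sum f ≡ ∑ rawRing f
    sum≡∑ f = ≡.refl

    sum-[] : (f : Vector Carrier 0) → sum f ≈ 0#
    sum-[] f = refl

    sum-∷ : ∀ {n} (f : Vector Carrier (suc n)) → sum f ≈ f zero + sum (f ∘ suc)
    sum-∷ f = refl

    sum-cong : ∀ {n} {f g : Vector Carrier n} → (∀ i → f i ≈ g i) → sum f ≈ sum g
    sum-cong = S.sum-cong-≋

    sum-+ : ∀ {n} (f g : Vector Carrier n) → sum (λ i → f i + g i) ≈ sum f + sum g
    sum-+ = S.∑-distrib-+

    sum-comm : ∀ {m n} (f : Fin m → Fin n → Carrier) →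
               sum (λ i → sum λ j → f i j) ≈ sum (λ j → sum λ i → f i j)
    sum-comm = S.∑-comm

    *-sumˡ : ∀ {n} x (f : Vector Carrier n) → x * sum f ≈ sum (λ i → x * f i)
    *-sumˡ = S.*-distribˡ-sum

    *-sumʳ : ∀ {n} x (f : Vector Carrier n) → sum f * x ≈ sum (λ i → f i * x)
    *-sumʳ = S.*-distribʳ-sum

    sum-remove : ∀ {n} i (f : Vector Carrier (suc n)) → sum f ≈ f i + sum (f ∘ punchIn i)
    sum-remove i f = S.sum-remove {i = i} f

  sum-0 : ∀ {n} {f : Vector Carrier n} → (∀ i → f i ≈ 0#) → sum f ≈ 0#
  sum-0 {zero}  f≈0 = sum-[] _
  sum-0 {suc n} f≈0 = trans (sum-∷ _)
    (trans (+-cong (f≈0 zero) (sum-0 (f≈0 ∘ suc))) (+-identityˡ 0#))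

  sum-single : ∀ {n} {f : Vector Carrier n} i → (∀ k → k ≢ i → f k ≈ 0#) → sum f ≈ f i
  sum-single zero    f≈0 =
    trans (sum-∷ _) (trans (+-congˡ (sum-0 λ k → f≈0 (suc k) λ ())) (+-identityʳ _))
  sum-single (suc i) f≈0 = trans (sum-∷ _)
    (trans (+-congʳ (f≈0 zero λ ()))
      (trans (+-identityˡ _) (sum-single i λ k k≢i → f≈0 (suc k) (k≢i ∘ Fin.suc-injective))))

  Id-≡ : ∀ {n} (i : Fin n) → Id rawRing i i ≈ 1#
  Id-≡ i with i Fin.≟ i
  ... | yes _   = refl
  ... | no  i≢i = ⊥-elim (i≢i ≡.refl)

  Id-≢ : ∀ {n} {k i : Fin n} → k ≢ i → Id rawRing k i ≈ 0#
  Id-≢ {k = k} {i} k≢i with k Fin.≟ i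
  ... | yes k≡i = ⊥-elim (k≢i k≡i)
  ... | no  _   = refl

  Id-sum : ∀ {n} (f : Vector Carrier n) i → sum (λ k → f k * Id rawRing k i) ≈ f i
  Id-sum f i = trans (sum-single i λ k k≢i → trans (*-congˡ (Id-≢ k≢i)) (zeroʳ _))
    (trans (*-congˡ (Id-≡ i)) (*-identityʳ _))

module Determinant (R : CommutativeRing 0ℓ 0ℓ) where
  open CommutativeRing R hiding (zero)
  open RingProperties ring using (-‿distribʳ-*)
  open AbelianGroupProperties +-abelianGroup
    using () renaming (⁻¹-involutive to -‿involutive; ε⁻¹≈ε to -0≈0; ⁻¹-∙-comm to -‿+-comm)
  open Sums R
  open SetoidReasoning setoid

  private
    Mat = Matrix Carrier
    sgn = signed rawRing

  open DetRel.Related rawRing rawRing _≈_ +-cong *-cong -‿cong refl refl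
    using () renaming (signed-~ to signed-cong; det-~ to det-cong′)

  opaque
    unfolding sum

    detR : ∀ {r} → Mat r → Carrier
    detR = det rawRing

    detR≡det : ∀ {r} (M : Mat r) → detR M ≡ det rawRing M
    detR≡det M = ≡.refl

    det-cong : ∀ {r} {M N : Mat r} → (∀ i j → M i j ≈ N i j) → detR M ≈ detR N
    det-cong {r} {M} {N} = det-cong′ {r} {M} {N}

    det-[] : (M : Mat 0) → detR M ≈ 1#
    det-[] M = refl

    det-expand : ∀ {r} (M : Mat (suc r)) →
      detR M ≈ sum λ j → sgn (toℕ j) (M zero j * detR λ i k → M (suc i) (punchIn j k))
    det-expand M = refl

  det-cong-≡ : ∀ {r} {M N : Mat r} → (∀ i j → M i j ≡ N i j) → detR M ≈ detR N
  det-cong-≡ M≡N = det-cong λ i j → reflexive (M≡N i j)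

  signed-+ : ∀ k x y → sgn k (x + y) ≈ sgn k x + sgn k y
  signed-+ zero    x y = refl
  signed-+ (suc k) x y = trans (-‿cong (signed-+ k x y)) (sym (-‿+-comm _ _))

  signed-* : ∀ k a x → sgn k (a * x) ≈ a * sgn k x
  signed-* zero    a x = refl
  signed-* (suc k) a x = trans (-‿cong (signed-* k a x)) (-‿distribʳ-* a _)

  signed-0 : ∀ k → sgn k 0# ≈ 0#
  signed-0 zero    = refl
  signed-0 (suc k) = trans (-‿cong (signed-0 k)) -0≈0

  signed-neg : ∀ k x → sgn k (- x) ≈ - sgn k x
  signed-neg zero    x = refl
  signed-neg (suc k) x = -‿cong (signed-neg k x)

  signed-sum : ∀ k {n} (f : Vector Carrier n) → sgn k (sum f) ≈ sum (sgn k ∘ f)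
  signed-sum k {zero}  f = trans (signed-cong k (sum-[] f)) (trans (signed-0 k) (sym (sum-[] _)))
  signed-sum k {suc n} f = trans (signed-cong k (sum-∷ f)) (trans (signed-+ k _ _)
    (trans (+-congˡ (signed-sum k (f ∘ suc))) (sym (sum-∷ _))))

  infix 8 _[_≔_]
  _[_≔_] : ∀ {A : Set} {m n} → (Fin n → Vector A m) → Fin n → Vector A m → (Fin n → Vector A m)
  M [ i ≔ w ] = updateAt M i (λ _ → w)

  ≔-∘ : ∀ {A : Set} {l m n} (M : Fin n → Vector A m) i w (h : Fin l → Fin m) a b →
        (M [ i ≔ w ]) a (h b) ≡ ((λ a b → M a (h b)) [ i ≔ w ∘ h ]) a b
  ≔-∘ {n = suc n} M zero    w h zero    b = ≡.refl
  ≔-∘ {n = suc n} M zero    w h (suc a) b = ≡.refl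
  ≔-∘ {n = suc n} M (suc i) w h zero    b = ≡.refl
  ≔-∘ {n = suc n} M (suc i) w h (suc a) b = ≔-∘ (M ∘ suc) i w h a b

  ≔-cong : ∀ {m n} (M : Fin n → Vector Carrier m) i {v w : Vector Carrier m} →
           (∀ j → v j ≈ w j) → ∀ a b → (M [ i ≔ v ]) a b ≈ (M [ i ≔ w ]) a b
  ≔-cong {n = suc n} M zero    v≈w zero    b = v≈w b
  ≔-cong {n = suc n} M zero    v≈w (suc a) b = refl
  ≔-cong {n = suc n} M (suc i) v≈w zero    b = refl
  ≔-cong {n = suc n} M (suc i) v≈w (suc a) b = ≔-cong (M ∘ suc) i v≈w a b

  minor : ∀ {r} → Fin (suc r) → Mat (suc r) → Mat r
  minor j M i k = M (suc i) (punchIn j k)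

  det-minor-≔ : ∀ {r} (M : Mat (suc r)) i w j →
                detR (minor j (M [ suc i ≔ w ])) ≈ detR (minor j M [ i ≔ w ∘ punchIn j ])
  det-minor-≔ M i w j = det-cong-≡ (≔-∘ (M ∘ suc) i w (punchIn j))

  det-+ : ∀ {r} (M : Mat r) i v w →
          detR (M [ i ≔ (λ j → v j + w j) ]) ≈ detR (M [ i ≔ v ]) + detR (M [ i ≔ w ])
  det-+ {suc r} M zero    v w = trans (det-expand _) (trans
    (sum-cong λ j → trans (signed-cong (toℕ j) (distribʳ _ (v j) (w j))) (signed-+ (toℕ j) _ _))
    (trans (sum-+ _ _) (sym (+-cong (det-expand _) (det-expand _)))))
  det-+ {suc r} M (suc i) v w = trans (det-expand _) (trans
    (sum-cong λ j → trans (signed-cong (toℕ j) (step j)) (signed-+ (toℕ j) _ _))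
    (trans (sum-+ _ _) (sym (+-cong (det-expand _) (det-expand _)))))
    where
    step : ∀ j → M zero j * detR (minor j (M [ suc i ≔ (λ j → v j + w j) ])) ≈
                 M zero j * detR (minor j (M [ suc i ≔ v ])) +
                 M zero j * detR (minor j (M [ suc i ≔ w ]))
    step j = trans (*-congˡ (begin
      detR (minor j (M [ suc i ≔ (λ j → v j + w j) ]))   ≈⟨ det-minor-≔ M i _ j ⟩
      detR (minor j M [ i ≔ _ ])                         ≈⟨ det-+ (minor j M) i _ _ ⟩
      detR (minor j M [ i ≔ v ∘ punchIn j ]) + detR (minor j M [ i ≔ w ∘ punchIn j ])
        ≈⟨ +-cong (det-minor-≔ M i v j) (det-minor-≔ M i w j) ⟨
      detR (minor j (M [ suc i ≔ v ])) + detR (minor j (M [ suc i ≔ w ])) ∎)) (distribˡ _ _ _)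

  private
    x[cy]≈c[xy] : ∀ x c y → x * (c * y) ≈ c * (x * y)
    x[cy]≈c[xy] = solve 3 (λ x c y → x :* (c :* y) := c :* (x :* y)) refl
      where open SemiringSolver commutativeSemiring using (solve; _:=_; _:*_)

  det-* : ∀ {r} (M : Mat r) i c v →
          detR (M [ i ≔ (λ j → c * v j) ]) ≈ c * detR (M [ i ≔ v ])
  det-* {suc r} M zero    c v = trans (det-expand _) (trans
    (sum-cong λ j → trans (signed-cong (toℕ j) (*-assoc c (v j) _)) (signed-* (toℕ j) c _))
    (trans (sym (*-sumˡ c _)) (*-congˡ (sym (det-expand _)))))
  det-* {suc r} M (suc i) c v = trans (det-expand _) (trans
    (sum-cong λ j → trans (signed-cong (toℕ j) (step j)) (signed-* (toℕ j) c _))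
    (trans (sym (*-sumˡ c _)) (*-congˡ (sym (det-expand _)))))
    where
    step : ∀ j → M zero j * detR (minor j (M [ suc i ≔ (λ j → c * v j) ])) ≈
                 c * (M zero j * detR (minor j (M [ suc i ≔ v ])))
    step j = trans (*-congˡ (begin
      detR (minor j (M [ suc i ≔ (λ j → c * v j) ]))  ≈⟨ det-minor-≔ M i _ j ⟩
      detR (minor j M [ i ≔ _ ])                      ≈⟨ det-* (minor j M) i c _ ⟩
      c * detR (minor j M [ i ≔ v ∘ punchIn j ])      ≈⟨ *-congˡ (det-minor-≔ M i v j) ⟨
      c * detR (minor j (M [ suc i ≔ v ]))            ∎)) (x[cy]≈c[xy] _ c _)

  det-0 : ∀ {r} (M : Mat r) i → detR (M [ i ≔ (λ _ → 0#) ]) ≈ 0#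
  det-0 M i = begin
    detR (M [ i ≔ (λ _ → 0#) ])       ≈⟨ det-cong (≔-cong M i λ _ → zeroˡ 0#) ⟨
    detR (M [ i ≔ (λ _ → 0# * 0#) ])  ≈⟨ det-* M i 0# _ ⟩
    0# * detR (M [ i ≔ (λ _ → 0#) ])  ≈⟨ zeroˡ _ ⟩
    0#                                ∎

  det-sum : ∀ {r n} (M : Mat r) i (c : Vector Carrier n) (w : Fin n → Vector Carrier r) →
            detR (M [ i ≔ (λ j → sum λ k → c k * w k j) ]) ≈ sum λ k → c k * detR (M [ i ≔ w k ])
  det-sum {n = zero}  M i c w =
    trans (det-cong (≔-cong M i λ j → sum-[] _)) (trans (det-0 M i) (sym (sum-[] _)))
  det-sum {n = suc n} M i c w = trans (det-cong (≔-cong M i λ j → sum-∷ _)) (trans (det-+ M i _ _)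
    (trans (+-cong (det-* M i (c zero) (w zero)) (det-sum M i (c ∘ suc) (w ∘ suc))) (sym (sum-∷ _))))

  -- The terms for the column pairs (0 , j + 1) and (j + 1 , 0) cancel; the others are
  -- the same sum for one column less.
  private
    lift-suc : ∀ {m n} → (Fin m → Fin n) → Fin (suc m) → Fin (suc n)
    lift-suc h zero    = zero
    lift-suc h (suc c) = suc (h c)

  pairs-cancel : ∀ {n} (x : Vector Carrier (suc (suc n))) (G : (Fin n → Fin (suc (suc n))) → Carrier) →
    (∀ {g h} → g ≗ h → G g ≈ G h) →
    (sum λ j → sum λ k → sgn (toℕ j) (sgn (toℕ k)
      (x j * (x (punchIn j k) * G (punchIn j ∘ punchIn k))))) ≈ 0#
  pairs-cancel {n} x G G-cong = begin
    _                                      ≈⟨ sum-∷ _ ⟩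
    sum a + sum (λ j → sum (term x G (suc j))) ≈⟨ +-congˡ (sum-cong λ j → sum-∷ _) ⟩
    sum a + sum (λ j → b j + c j)          ≈⟨ +-congˡ (sum-+ b c) ⟩
    sum a + (sum b + sum c)                ≈⟨ +-assoc _ _ _ ⟨
    (sum a + sum b) + sum c                ≈⟨ +-congʳ (sum-+ a b) ⟨
    sum (λ j → a j + b j) + sum c          ≈⟨ +-cong (sum-0 a+b≈0) (c≈0 n x G G-cong) ⟩
    0# + 0#                                ≈⟨ +-identityˡ 0# ⟩
    0#                                     ∎
    where
    term : ∀ {n} → Vector Carrier (suc (suc n)) → ((Fin n → Fin (suc (suc n))) → Carrier) →
           Fin (suc (suc n)) → Fin (suc n) → Carrier
    term x G j k = sgn (toℕ j) (sgn (toℕ k) (x j * (x (punchIn j k) * G (punchIn j ∘ punchIn k))))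
    a b c : Vector Carrier (suc n)
    a k = term x G zero k
    b j = term x G (suc j) zero
    c j = sum λ k → term x G (suc j) (suc k)
    a+b≈0 : ∀ j → a j + b j ≈ 0#
    a+b≈0 j = trans (+-congˡ (-‿cong (signed-cong (toℕ j) swap))) (-‿inverseʳ _)
      where
      swap : x (suc j) * (x zero * G (suc ∘ punchIn j)) ≈ x zero * (x (suc j) * G (suc ∘ punchIn j))
      swap = x[cy]≈c[xy] _ _ _
    c≈0 : ∀ n (x : Vector Carrier (suc (suc n))) (G : (Fin n → Fin (suc (suc n))) → Carrier) →
          (∀ {g h} → g ≗ h → G g ≈ G h) →
          (sum λ j → sum λ k → term x G (suc j) (suc k)) ≈ 0#
    c≈0 zero    x G G-cong = sum-0 λ j → sum-[] _
    c≈0 (suc n) x G G-cong = trans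
      (sum-cong λ j → sum-cong λ k → trans (-‿cong (signed-neg (toℕ j) _))
        (trans (-‿involutive _) (signed-cong (toℕ j) (signed-cong (toℕ k)
          (*-congˡ (*-congˡ (G-cong (lift j k))))))))
      (pairs-cancel (x ∘ suc) (G ∘ lift-suc)
        (λ g≗h → G-cong λ { zero → ≡.refl ; (suc c) → cong suc (g≗h c) }))
      where
      lift : ∀ j k → punchIn (suc j) ∘ punchIn (suc k) ≗ lift-suc (punchIn j ∘ punchIn k)
      lift j k zero    = ≡.refl
      lift j k (suc c) = ≡.refl

  -- Expansion along the first two rows turns the determinant into the double sum of `pairs-cancel`,
  -- where G h is the minor formed by the remaining rows in the columns h.
  det-alternating₀₁ : ∀ {r} (M : Mat (suc (suc r))) → (∀ j → M zero j ≈ M (suc zero) j) → detR M ≈ 0#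
  det-alternating₀₁ {r} M M₀≈M₁ = trans (det-expand M) (trans (sum-cong λ j → begin
      sgn (toℕ j) (M zero j * detR (minor j M))
        ≈⟨ signed-cong (toℕ j) (*-congˡ (det-expand (minor j M))) ⟩
      sgn (toℕ j) (M zero j * sum (inner j))
        ≈⟨ signed-cong (toℕ j) (*-cong (M₀≈M₁ j) refl) ⟩
      sgn (toℕ j) (M (suc zero) j * sum (inner j))
        ≈⟨ signed-cong (toℕ j) (*-sumˡ _ (inner j)) ⟩
      sgn (toℕ j) (sum λ k → M (suc zero) j * inner j k)
        ≈⟨ signed-sum (toℕ j) _ ⟩
      (sum λ k → sgn (toℕ j) (M (suc zero) j * inner j k))
        ≈⟨ sum-cong (λ k → signed-cong (toℕ j) (signed-* (toℕ k) _ _)) ⟨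
      (sum λ k → sgn (toℕ j) (sgn (toℕ k)
        (M (suc zero) j * (M (suc zero) (punchIn j k) * G (punchIn j ∘ punchIn k))))) ∎)
    (pairs-cancel (M (suc zero)) G λ g≗h → det-cong-≡ λ a b → cong (M (suc (suc a))) (g≗h b)))
    where
    G : (Fin r → Fin (suc (suc r))) → Carrier
    G h = detR λ a b → M (suc (suc a)) (h b)
    inner : ∀ j → Vector Carrier (suc r)
    inner j k = sgn (toℕ k) (M (suc zero) (punchIn j k) * G (punchIn j ∘ punchIn k))

  private
    rows : ∀ {r} → (v w : Vector Carrier (suc (suc r))) → (Fin r → Vector Carrier (suc (suc r))) →
           Mat (suc (suc r))
    rows v w N zero          = v
    rows v w N (suc zero)    = w
    rows v w N (suc (suc a)) = N a

  -- Polarisation: the determinant with v + w in both rows vanishes, and so do two of the four terms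
  -- into which it expands.
  det-swap₀₁ : ∀ {r} v w (N : Fin r → Vector Carrier (suc (suc r))) →
               detR (rows v w N) + detR (rows w v N) ≈ 0#
  det-swap₀₁ v w N = begin
    detR (rows v w N) + detR (rows w v N)
      ≈⟨ +-cong (+-identityˡ _) (+-identityʳ _) ⟨
    (0# + detR (rows v w N)) + (detR (rows w v N) + 0#)
      ≈⟨ +-cong (+-congʳ (det-alternating₀₁ (rows v v N) λ _ → refl))
                (+-congˡ (det-alternating₀₁ (rows w w N) λ _ → refl)) ⟨
    (detR (rows v v N) + detR (rows v w N)) + (detR (rows w v N) + detR (rows w w N))
      ≈⟨ +-cong (row₁ v) (row₁ w) ⟨
    detR (rows v v+w N) + detR (rows w v+w N)
      ≈⟨ +-cong (det-cong-≡ (at₀ v)) (det-cong-≡ (at₀ w)) ⟨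
    detR (rows v v+w N [ zero ≔ v ]) + detR (rows v v+w N [ zero ≔ w ])
      ≈⟨ det-+ (rows v v+w N) zero v w ⟨
    detR (rows v v+w N [ zero ≔ v+w ])
      ≈⟨ det-alternating₀₁ (rows v v+w N [ zero ≔ v+w ]) (λ _ → refl) ⟩
    0# ∎
    where
    v+w : Vector Carrier _
    v+w j = v j + w j
    at₀ : ∀ u a b → (rows v v+w N [ zero ≔ u ]) a b ≡ rows u v+w N a b
    at₀ u zero          b = ≡.refl
    at₀ u (suc zero)    b = ≡.refl
    at₀ u (suc (suc a)) b = ≡.refl
    at₁ : ∀ u u′ a b → (rows u v N [ suc zero ≔ u′ ]) a b ≡ rows u u′ N a b
    at₁ u u′ zero          b = ≡.refl
    at₁ u u′ (suc zero)    b = ≡.refl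
    at₁ u u′ (suc (suc a)) b = ≡.refl
    row₁ : ∀ u → detR (rows u v+w N) ≈ detR (rows u v N) + detR (rows u w N)
    row₁ u = begin
      detR (rows u v+w N)                                                ≈⟨ det-cong-≡ (at₁ u v+w) ⟨
      detR (rows u v N [ suc zero ≔ v+w ])                               ≈⟨ det-+ (rows u v N) (suc zero) v w ⟩
      detR (rows u v N [ suc zero ≔ v ]) + detR (rows u v N [ suc zero ≔ w ])
        ≈⟨ +-cong (det-cong-≡ (at₁ u v)) (det-cong-≡ (at₁ u w)) ⟩
      detR (rows u v N) + detR (rows u w N)                              ∎

  -- Rows 0 and 1 are exchanged first. Expanding along the new first row then leaves minors whose
  -- first row equals a later one, closer by one, so induction on k applies.
  det-alternating₀ : ∀ {r} (M : Mat (suc r)) k → (∀ j → M zero j ≈ M (suc k) j) → detR M ≈ 0#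
  det-alternating₀ {suc r} M zero    M₀≈Mₖ = det-alternating₀₁ M M₀≈Mₖ
  det-alternating₀ {suc r} M (suc k) M₀≈Mₖ = begin
    detR M                                     ≈⟨ det-cong-≡ as-rows ⟩
    detR (rows M₀ M₁ N)                        ≈⟨ +-identityʳ _ ⟨
    detR (rows M₀ M₁ N) + 0#                   ≈⟨ +-congˡ swapped≈0 ⟨
    detR (rows M₀ M₁ N) + detR (rows M₁ M₀ N)  ≈⟨ det-swap₀₁ M₀ M₁ N ⟩
    0#                                         ∎
    where
    M₀ = M zero
    M₁ = M (suc zero)
    N = λ a → M (suc (suc a))
    as-rows : ∀ a b → M a b ≡ rows M₀ M₁ N a b
    as-rows zero          b = ≡.refl
    as-rows (suc zero)    b = ≡.refl
    as-rows (suc (suc a)) b = ≡.refl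
    swapped≈0 : detR (rows M₁ M₀ N) ≈ 0#
    swapped≈0 = trans (det-expand _) (sum-0 λ j → trans (signed-cong (toℕ j) (trans (*-congˡ
      (det-alternating₀ (minor j (rows M₁ M₀ N)) k λ b → M₀≈Mₖ (punchIn j b)))
      (zeroʳ _))) (signed-0 (toℕ j)))

  det-alternating : ∀ {r} (M : Mat r) i k → i ≢ k → (∀ j → M i j ≈ M k j) → detR M ≈ 0#
  det-alternating {suc r} M zero    zero    i≢k Mᵢ≈Mₖ = ⊥-elim (i≢k ≡.refl)
  det-alternating {suc r} M zero    (suc k) i≢k Mᵢ≈Mₖ = det-alternating₀ M k Mᵢ≈Mₖ
  det-alternating {suc r} M (suc i) zero    i≢k Mᵢ≈Mₖ = det-alternating₀ M i (sym ∘ Mᵢ≈Mₖ)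
  det-alternating {suc r} M (suc i) (suc k) i≢k Mᵢ≈Mₖ =
    trans (det-expand M) (sum-0 λ j → trans (signed-cong (toℕ j) (trans (*-congˡ
      (det-alternating (minor j M) i k (i≢k ∘ cong suc) λ b → Mᵢ≈Mₖ (punchIn j b)))
      (zeroʳ _))) (signed-0 (toℕ j)))

  det-≔-row : ∀ {r} (M : Mat r) i k → i ≢ k → detR (M [ i ≔ M k ]) ≈ 0#
  det-≔-row M i k i≢k = det-alternating (M [ i ≔ M k ]) i k i≢k λ j → reflexive
    (≡.trans (cong (λ v → v j) (Vec.updateAt-updates i M))
             (≡.sym (cong (λ v → v j) (Vec.updateAt-minimal k i M (i≢k ∘ ≡.sym)))))

  det-≔-same : ∀ {r} (M : Mat r) i → detR (M [ i ≔ M i ]) ≈ detR M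
  det-≔-same M i = det-cong-≡ λ a b → cong (λ v → v b) (Vec.updateAt-id-local i M ≡.refl a)

  det-≔-combination : ∀ {r} (M : Mat r) i (c : Vector Carrier r) →
    detR (M [ i ≔ (λ j → sum λ k → c k * M k j) ]) ≈ c i * detR M
  det-≔-combination M i c = trans (det-sum M i c M)
    (trans (sum-single i λ k k≢i → trans (*-congˡ (det-≔-row M i k (k≢i ∘ ≡.sym))) (zeroʳ _))
           (*-congˡ (det-≔-same M i)))

  -- Cramer's rule in place of signed cofactors: with a unit vector as row i, `*-adjugate` becomes
  -- linearity in that row and no signs have to be followed.
  adjugate : ∀ {r} → Mat r → Mat r
  adjugate M j i = detR (M [ i ≔ Id rawRing j ])

  *-adjugate : ∀ {r} (M : Mat r) k i →
    sum (λ j → M k j * adjugate M j i) ≈ detR M * Id rawRing k i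
  *-adjugate M k i = begin
    sum (λ j → M k j * detR (M [ i ≔ Id rawRing j ]))              ≈⟨ det-sum M i (M k) (Id rawRing) ⟨
    detR (M [ i ≔ (λ j → sum λ l → M k l * Id rawRing l j) ])      ≈⟨ det-cong (≔-cong M i (Id-sum (M k))) ⟩
    detR (M [ i ≔ M k ])                                           ≈⟨ at-row ⟩
    detR M * Id rawRing k i                                        ∎
    where
    at-row : detR (M [ i ≔ M k ]) ≈ detR M * Id rawRing k i
    at-row with k Fin.≟ i
    ... | yes ≡.refl = trans (det-≔-same M i) (sym (*-identityʳ _))
    ... | no  k≢i    = trans (det-≔-row M i k (k≢i ∘ ≡.sym)) (sym (zeroʳ _))

  det-Id : ∀ r → detR (Id rawRing {r}) ≈ 1#
  det-Id zero    = det-[] _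
  det-Id (suc r) = begin
    detR (Id rawRing {suc r})                   ≈⟨ trans (det-expand _) (sum-∷ _) ⟩
    1# * detR (Id rawRing {r}) + sum (λ j → sgn (toℕ (suc j)) (0# * detR (minor (suc j) (Id rawRing))))
      ≈⟨ +-cong (trans (*-identityˡ _) (det-Id r))
           (sum-0 λ j → trans (signed-cong (toℕ (suc j)) (zeroˡ _)) (signed-0 (toℕ (suc j)))) ⟩
    1# + 0#                                     ≈⟨ +-identityʳ 1# ⟩
    1#                                          ∎

  -- Stated for any derivation of the ring; the one used is u d/du on power series.
  module Derivation (θ : Carrier → Carrier)
    (θ-cong : ∀ {x y} → x ≈ y → θ x ≈ θ y)
    (θ-+ : ∀ x y → θ (x + y) ≈ θ x + θ y)
    (θ-* : ∀ x y → θ (x * y) ≈ θ x * y + x * θ y)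
    (θ-neg : ∀ x → θ (- x) ≈ - θ x)
    (θ-0 : θ 0# ≈ 0#) (θ-1 : θ 1# ≈ 0#) where

    θ-sum : ∀ {n} (f : Vector Carrier n) → θ (sum f) ≈ sum (θ ∘ f)
    θ-sum {zero}  f = trans (θ-cong (sum-[] f)) (trans θ-0 (sym (sum-[] _)))
    θ-sum {suc n} f = trans (θ-cong (sum-∷ f)) (trans (θ-+ _ _)
      (trans (+-congˡ (θ-sum (f ∘ suc))) (sym (sum-∷ _))))

    θ-signed : ∀ k x → θ (sgn k x) ≈ sgn k (θ x)
    θ-signed zero    x = refl
    θ-signed (suc k) x = trans (θ-neg _) (-‿cong (θ-signed k x))

    θ-det : ∀ {r} (M : Mat r) → θ (detR M) ≈ sum λ i → detR (M [ i ≔ θ ∘ M i ])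
    θ-det {zero}  M = trans (θ-cong (det-[] M)) (trans θ-1 (sym (sum-[] _)))
    θ-det {suc r} M = begin
      θ (detR M)                                               ≈⟨ θ-cong (det-expand M) ⟩
      _                                                        ≈⟨ θ-sum (λ j → sgn (toℕ j) (M zero j * detR (minor j M))) ⟩
      sum (λ j → θ (sgn (toℕ j) (M zero j * detR (minor j M)))) ≈⟨ sum-cong step ⟩
      sum (λ j → first j + sum λ i → rest i j)                 ≈⟨ sum-+ first _ ⟩
      sum first + sum (λ j → sum λ i → rest i j)               ≈⟨ +-congˡ (sum-comm λ j i → rest i j) ⟩
      sum first + sum (λ i → sum λ j → rest i j)
        ≈⟨ +-cong (det-expand _) (sum-cong λ i → det-expand _) ⟨
      detR (M [ zero ≔ θ ∘ M zero ]) + sum (λ i → detR (M [ suc i ≔ θ ∘ M (suc i) ]))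
        ≈⟨ sum-∷ _ ⟨
      sum (λ i → detR (M [ i ≔ θ ∘ M i ]))                     ∎
      where
      first : Vector Carrier (suc r)
      first j = sgn (toℕ j) (θ (M zero j) * detR (minor j M))
      rest : Fin r → Vector Carrier (suc r)
      rest i j = sgn (toℕ j) (M zero j * detR (minor j (M [ suc i ≔ θ ∘ M (suc i) ])))
      step : ∀ j → θ (sgn (toℕ j) (M zero j * detR (minor j M))) ≈ first j + sum λ i → rest i j
      step j = begin
        θ (sgn (toℕ j) (M zero j * detR (minor j M)))
          ≈⟨ θ-signed (toℕ j) _ ⟩
        sgn (toℕ j) (θ (M zero j * detR (minor j M)))
          ≈⟨ signed-cong (toℕ j) (θ-* _ _) ⟩
        sgn (toℕ j) (θ (M zero j) * detR (minor j M) + M zero j * θ (detR (minor j M)))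
          ≈⟨ signed-+ (toℕ j) _ _ ⟩
        first j + sgn (toℕ j) (M zero j * θ (detR (minor j M)))
          ≈⟨ +-congˡ (signed-cong (toℕ j) (*-congˡ (θ-det (minor j M)))) ⟩
        first j + sgn (toℕ j) (M zero j * sum λ i → detR (minor j M [ i ≔ θ ∘ minor j M i ]))
          ≈⟨ +-congˡ (signed-cong (toℕ j) (*-congˡ (sum-cong λ i → det-minor-≔ M i _ j))) ⟨
        first j + sgn (toℕ j) (M zero j * sum λ i → detR (minor j (M [ suc i ≔ θ ∘ M (suc i) ])))
          ≈⟨ +-congˡ (signed-cong (toℕ j) (*-sumˡ _ _)) ⟩
        first j + sgn (toℕ j) (sum λ i → M zero j * detR (minor j (M [ suc i ≔ θ ∘ M (suc i) ])))
          ≈⟨ +-congˡ (signed-sum (toℕ j) _) ⟩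
        first j + sum (λ i → rest i j) ∎

    -- Since θ M = − S M, the i-th row of θ M is a combination of the rows of M whose
    -- i-th coefficient is − S i i.
    θ-det-trace : ∀ {r} (M S : Mat r) →
      (∀ i j → θ (M i j) ≈ - sum λ k → S i k * M k j) →
      θ (detR M) ≈ - (sum (λ i → S i i) * detR M)
    θ-det-trace M S θM≈-SM = begin
      θ (detR M)                             ≈⟨ θ-det M ⟩
      sum (λ i → detR (M [ i ≔ θ ∘ M i ]))   ≈⟨ sum-cong term ⟩
      sum (λ i → - 1# * (S i i * detR M))    ≈⟨ *-sumˡ (- 1#) _ ⟨
      - 1# * sum (λ i → S i i * detR M)      ≈⟨ *-congˡ (*-sumʳ _ (λ i → S i i)) ⟨
      - 1# * (sum (λ i → S i i) * detR M)    ≈⟨ RingProperties.-1*x≈-x ring _ ⟩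
      - (sum (λ i → S i i) * detR M)         ∎
      where
      term : ∀ i → detR (M [ i ≔ θ ∘ M i ]) ≈ - 1# * (S i i * detR M)
      term i = begin
        detR (M [ i ≔ θ ∘ M i ])
          ≈⟨ det-cong (≔-cong M i λ j → trans (θM≈-SM i j) (sym (RingProperties.-1*x≈-x ring _))) ⟩
        detR (M [ i ≔ (λ j → - 1# * sum λ k → S i k * M k j) ])
          ≈⟨ det-* M i (- 1#) _ ⟩
        - 1# * detR (M [ i ≔ (λ j → sum λ k → S i k * M k j) ])
          ≈⟨ *-congˡ (det-≔-combination M i (S i)) ⟩
        - 1# * (S i i * detR M) ∎

-- Formal power series

-- The identities are solved over an abstract ring, whose operations cannot unfold; they are then
-- applied to rings of series and of formal sums.
module SemiringIdentities (R : CommutativeRing 0ℓ 0ℓ) where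
  open CommutativeRing R
  open SemiringSolver commutativeSemiring using (solve; _:=_; _:+_; _:*_)

  [a+wh]+[b+wk] : ∀ a b w h k → a + w * h + (b + w * k) ≈ a + b + w * (h + k)
  [a+wh]+[b+wk] = solve 5 (λ a b w h k →
    a :+ w :* h :+ (b :+ w :* k) := a :+ b :+ w :* (h :+ k)) refl

  [a+wh]*[b+wk] : ∀ a b w h k → (a + w * h) * (b + w * k) ≈ a * b + w * (a * k + h * (b + w * k))
  [a+wh]*[b+wk] = solve 5 (λ a b w h k →
    (a :+ w :* h) :* (b :+ w :* k) := a :* b :+ w :* (a :* k :+ h :* (b :+ w :* k))) refl

  pjth≈p[t[jh]] : ∀ p j t h → p * j * t * h ≈ p * (t * (j * h))
  pjth≈p[t[jh]] = solve 4 (λ p j t h → p :* j :* t :* h := p :* (t :* (j :* h))) refl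

  u[v[fg]]≈[uf][vg] : ∀ u v f g → u * (v * (f * g)) ≈ (u * f) * (v * g)
  u[v[fg]]≈[uf][vg] = solve 4 (λ u v f g → u :* (v :* (f :* g)) := (u :* f) :* (v :* g)) refl

  elP+e[PL]≈eP[l+L] : ∀ e l P L → e * l * P + e * (P * L) ≈ e * P * (l + L)
  elP+e[PL]≈eP[l+L] = solve 4 (λ e l P L → e :* l :* P :+ e :* (P :* L) := e :* P :* (l :+ L)) refl

  p[a[bw]]≈b[a[wp]] : ∀ p a b w → p * (a * (b * w)) ≈ b * (a * (w * p))
  p[a[bw]]≈b[a[wp]] = solve 4 (λ p a b w → p :* (a :* (b :* w)) := b :* (a :* (w :* p))) refl

  TDP+D[SP]≈[T+S][DP] : ∀ T D P S → T * D * P + D * (S * P) ≈ (T + S) * (D * P)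
  TDP+D[SP]≈[T+S][DP] = solve 4 (λ T D P S → T :* D :* P :+ D :* (S :* P) := (T :+ S) :* (D :* P)) refl

  a[bc]≈b[ac] : ∀ a b c → a * (b * c) ≈ b * (a * c)
  a[bc]≈b[ac] = solve 3 (λ a b c → a :* (b :* c) := b :* (a :* c)) refl

module Series (R : CommutativeRing 0ℓ 0ℓ) where
  open CommutativeRing R hiding (zero)
  open RingProperties ring using (-‿distribˡ-*; -‿distribʳ-*; -1*x≈-x)
  open AbelianGroupProperties +-abelianGroup
    using () renaming (⁻¹-involutive to -‿involutive; ε⁻¹≈ε to -0≈0; ⁻¹-∙-comm to -‿+-comm;
                       x∙y⁻¹≈ε⇒x≈y to x-y≈0⇒x≈y; ⁻¹-injective to -‿injective; identityˡ-unique to +-identityˡ-unique)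
  open CommutativeSemigroupProperties (CommutativeRing.+-commutativeSemigroup R)
    using () renaming (interchange to +-interchange; x∙yz≈y∙xz to x+[y+z]≈y+[x+z])
  open SemiringMult semiring using () renaming (_×_ to _×ℕ_; ×-congʳ to ×ℕ-congʳ; ×-comm-* to ×ℕ-comm-*; ×-assoc-* to ×ℕ-assoc-*)
  open CommutativeMonoidMult +-commutativeMonoid using () renaming (×-distrib-+ to ×ℕ-distrib-+)
  private module ≈ = SetoidReasoning setoid

  Ser : Set
  Ser = ℕ → Carrier

  infix 4 _≈ˢ_
  -- A record instead of a pointwise equality, so that the two series can be inferred from the type
  -- of a proof.
  record _≈ˢ_ (f g : Ser) : Set where
    constructor coeffs
    field at : ∀ n → f n ≈ g n
  open _≈ˢ_ public

  tl : Ser → Ser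
  tl f n = f (suc n)

  infixl 6 _+ˢ_
  infixl 7 _*ˢ_
  infix 8 -ˢ_
  -- The Cauchy product by the recursion fg = f₀ g + u (tl f) g, which suits induction on the
  -- coefficient; `⊛≡*ˢ` compares it with `_⊛_`.
  _+ˢ_ _*ˢ_ : Ser → Ser → Ser
  (f +ˢ g) n = f n + g n
  (f *ˢ g) zero    = f 0 * g 0
  (f *ˢ g) (suc n) = f 0 * g (suc n) + (tl f *ˢ g) n

  -ˢ_ : Ser → Ser
  (-ˢ f) n = - f n

  const : Carrier → Ser
  const c zero    = c
  const c (suc n) = 0#

  0ˢ 1ˢ : Ser
  0ˢ n = 0#
  1ˢ = const 1#

  private
    *ˢ-cong : ∀ {f f′ g g′} → (∀ n → f n ≈ f′ n) → (∀ n → g n ≈ g′ n) →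
              ∀ n → (f *ˢ g) n ≈ (f′ *ˢ g′) n
    *ˢ-cong f≈ g≈ zero    = *-cong (f≈ 0) (g≈ 0)
    *ˢ-cong f≈ g≈ (suc n) = +-cong (*-cong (f≈ 0) (g≈ (suc n))) (*ˢ-cong (f≈ ∘ suc) g≈ n)

    *ˢ-suc : ∀ f g n → (f *ˢ g) (suc n) ≈ (f *ˢ tl g) n + f (suc n) * g 0
    *ˢ-suc f g zero    = refl
    *ˢ-suc f g (suc n) = trans (+-congˡ (*ˢ-suc (tl f) g n)) (sym (+-assoc _ _ _))

    *ˢ-comm : ∀ f g n → (f *ˢ g) n ≈ (g *ˢ f) n
    *ˢ-comm f g zero    = *-comm _ _
    *ˢ-comm f g (suc n) = trans (+-cong (*-comm _ _) (*ˢ-comm (tl f) g n))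
      (trans (+-comm _ _) (sym (*ˢ-suc g f n)))

    *ˢ-distribʳ : ∀ h f g n → ((f +ˢ g) *ˢ h) n ≈ (f *ˢ h) n + (g *ˢ h) n
    *ˢ-distribʳ h f g zero    = distribʳ _ _ _
    *ˢ-distribʳ h f g (suc n) = trans (+-cong (distribʳ _ _ _) (*ˢ-distribʳ h (tl f) (tl g) n))
      (+-interchange _ _ _ _)

    *ˢ-scale : ∀ c f g n → ((λ i → c * f i) *ˢ g) n ≈ c * (f *ˢ g) n
    *ˢ-scale c f g zero    = *-assoc _ _ _
    *ˢ-scale c f g (suc n) = trans (+-cong (*-assoc _ _ _) (*ˢ-scale c (tl f) g n)) (sym (distribˡ _ _ _))

    *ˢ-assoc : ∀ f g h n → ((f *ˢ g) *ˢ h) n ≈ (f *ˢ (g *ˢ h)) n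
    *ˢ-assoc f g h zero    = *-assoc _ _ _
    *ˢ-assoc f g h (suc n) = ≈.begin
      (f 0 * g 0) * h (suc n) + (tl (f *ˢ g) *ˢ h) n
        ≈.≈⟨ +-cong (*-assoc _ _ _) (*ˢ-distribʳ h (λ i → f 0 * g (suc i)) (tl f *ˢ g) n) ⟩
      f 0 * (g 0 * h (suc n)) + (((λ i → f 0 * g (suc i)) *ˢ h) n + ((tl f *ˢ g) *ˢ h) n)
        ≈.≈⟨ +-congˡ (+-cong (*ˢ-scale (f 0) (tl g) h n) (*ˢ-assoc (tl f) g h n)) ⟩
      f 0 * (g 0 * h (suc n)) + (f 0 * (tl g *ˢ h) n + (tl f *ˢ (g *ˢ h)) n)
        ≈.≈⟨ +-assoc _ _ _ ⟨
      f 0 * (g 0 * h (suc n)) + f 0 * (tl g *ˢ h) n + (tl f *ˢ (g *ˢ h)) n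
        ≈.≈⟨ +-congʳ (distribˡ _ _ _) ⟨
      f 0 * (g *ˢ h) (suc n) + (tl f *ˢ (g *ˢ h)) n ≈.∎

    *ˢ-zeroˡ : ∀ g n → (0ˢ *ˢ g) n ≈ 0#
    *ˢ-zeroˡ g zero    = zeroˡ _
    *ˢ-zeroˡ g (suc n) = trans (+-cong (zeroˡ _) (*ˢ-zeroˡ g n)) (+-identityˡ 0#)

  const-* : ∀ c g n → (const c *ˢ g) n ≈ c * g n
  const-* c g zero    = refl
  const-* c g (suc n) = trans (+-congˡ (*ˢ-zeroˡ g n)) (+-identityʳ _)

  private
    *ˢ-identityˡ : ∀ g n → (1ˢ *ˢ g) n ≈ g n
    *ˢ-identityˡ g n = trans (const-* 1# g n) (*-identityˡ _)

  series : CommutativeRing 0ℓ 0ℓ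
  series = record
    { Carrier = Ser ; _≈_ = _≈ˢ_ ; _+_ = _+ˢ_ ; _*_ = _*ˢ_ ; -_ = -ˢ_ ; 0# = 0ˢ ; 1# = 1ˢ
    ; isCommutativeRing = record
      { isRing = record
        { +-isAbelianGroup = record
          { isGroup = record
            { isMonoid = record
              { isSemigroup = record
                { isMagma = record
                  { isEquivalence = record
                    { refl  = coeffs λ n → refl
                    ; sym   = λ p → coeffs λ n → sym (at p n)
                    ; trans = λ p q → coeffs λ n → trans (at p n) (at q n) }
                  ; ∙-cong = λ p q → coeffs λ n → +-cong (at p n) (at q n) }
                ; assoc = λ f g h → coeffs λ n → +-assoc _ _ _ }
              ; identity = (λ f → coeffs λ n → +-identityˡ _) , (λ f → coeffs λ n → +-identityʳ _) }
            ; inverse = (λ f → coeffs λ n → -‿inverseˡ _) , (λ f → coeffs λ n → -‿inverseʳ _)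
            ; ⁻¹-cong = λ p → coeffs λ n → -‿cong (at p n) }
          ; comm = λ f g → coeffs λ n → +-comm _ _ }
        ; *-cong = λ p q → coeffs (*ˢ-cong (at p) (at q))
        ; *-assoc = λ f g h → coeffs (*ˢ-assoc f g h)
        ; *-identity = (λ f → coeffs (*ˢ-identityˡ f)) ,
                       (λ f → coeffs λ n → trans (*ˢ-comm f 1ˢ n) (*ˢ-identityˡ f n))
        ; distrib = (λ h f g → coeffs λ n → trans (*ˢ-comm h (f +ˢ g) n) (trans (*ˢ-distribʳ h f g n)
                      (+-cong (*ˢ-comm f h n) (*ˢ-comm g h n)))) ,
                    (λ h f g → coeffs (*ˢ-distribʳ h f g)) }
      ; *-comm = λ f g → coeffs (*ˢ-comm f g) } }

  private module S = CommutativeRing series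

  -- The derivation u d/du, which unlike d/du leaves every coefficient in its place.
  θ : Ser → Ser
  θ f n = n ×ℕ f n

  θ-cong : ∀ {f g} → f ≈ˢ g → θ f ≈ˢ θ g
  θ-cong f≈g = coeffs λ n → ×ℕ-congʳ n (at f≈g n)

  θ-+ : ∀ f g → θ (f +ˢ g) ≈ˢ θ f +ˢ θ g
  θ-+ f g = coeffs λ n → ×ℕ-distrib-+ (f n) (g n) n

  private
    x×0≈0 : ∀ n → n ×ℕ 0# ≈ 0#
    x×0≈0 zero    = refl
    x×0≈0 (suc n) = trans (+-identityˡ _) (x×0≈0 n)

  θ-const : ∀ c → θ (const c) ≈ˢ 0ˢ
  θ-const c = coeffs λ { zero → refl ; (suc n) → x×0≈0 (suc n) }

  θ-0 : θ 0ˢ ≈ˢ 0ˢ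
  θ-0 = coeffs x×0≈0

  θ-neg : ∀ f → θ (-ˢ f) ≈ˢ -ˢ θ f
  θ-neg f = coeffs λ n → go n (f n)
    where
    go : ∀ n x → n ×ℕ (- x) ≈ - (n ×ℕ x)
    go zero    x = sym -0≈0
    go (suc n) x = trans (+-congˡ (go n x)) (-‿+-comm _ _)

  θ-* : ∀ f g → θ (f *ˢ g) ≈ˢ θ f *ˢ g +ˢ f *ˢ θ g
  θ-* f g = coeffs (go f g)
    where
    go : ∀ f g n → n ×ℕ (f *ˢ g) n ≈ (θ f *ˢ g) n + (f *ˢ θ g) n
    go f g zero    = sym (trans (+-cong (zeroˡ _) (zeroʳ _)) (+-identityˡ 0#))
    go f g (suc n) = ≈.begin
      suc n ×ℕ (a + b)                                              ≈.≈⟨ ×ℕ-distrib-+ a b (suc n) ⟩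
      suc n ×ℕ a + (b + n ×ℕ b)
        ≈.≈⟨ +-cong (sym (×ℕ-comm-* (suc n) (f 0) _)) (+-congˡ (go (tl f) g n)) ⟩
      f 0 * θ g (suc n) + (b + ((θ (tl f) *ˢ g) n + (tl f *ˢ θ g) n))
        ≈.≈⟨ +-congˡ (sym (+-assoc _ _ _)) ⟩
      f 0 * θ g (suc n) + (b + (θ (tl f) *ˢ g) n + (tl f *ˢ θ g) n)
        ≈.≈⟨ x+[y+z]≈y+[x+z] _ _ _ ⟩
      (b + (θ (tl f) *ˢ g) n) + (f *ˢ θ g) (suc n)
        ≈.≈⟨ +-congʳ (trans (sym (+-identityˡ _))
               (+-cong (sym (zeroˡ _)) (sym (*ˢ-distribʳ g (tl f) (θ (tl f)) n)))) ⟩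
      (θ f *ˢ g) (suc n) + (f *ˢ θ g) (suc n)                       ≈.∎
      where
      a = f 0 * g (suc n)
      b = (tl f *ˢ g) n

  TorsionFree : Set
  TorsionFree = ∀ n x → suc n ×ℕ x ≈ 0# → x ≈ 0#

  θ≈0⇒const : TorsionFree → ∀ f → θ f ≈ˢ 0ˢ → f ≈ˢ const (f 0)
  θ≈0⇒const tf f θf≈0 = coeffs λ { zero → refl ; (suc n) → tf n _ (at θf≈0 (suc n)) }

  shift : Ser → Ser
  shift f zero    = 0#
  shift f (suc n) = f n

  shift-cong : ∀ {f g} → f ≈ˢ g → shift f ≈ˢ shift g
  shift-cong f≈g = coeffs λ { zero → refl ; (suc n) → at f≈g n }

  shift-* : ∀ f g → shift f *ˢ g ≈ˢ shift (f *ˢ g)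
  shift-* f g = coeffs λ { zero → zeroˡ _ ; (suc n) → trans (+-congʳ (zeroˡ _)) (+-identityˡ _) }

  *-shift : ∀ f g → f *ˢ shift g ≈ˢ shift (f *ˢ g)
  *-shift f g = S.trans (S.*-comm f _) (S.trans (shift-* g f) (shift-cong (S.*-comm g f)))

  -- Polynomials and their value at u = 1

  Deg≤ : Ser → ℕ → Set
  Deg≤ f N = ∀ n → N < n → f n ≈ 0#

  Deg≤-cong : ∀ {f g N} → f ≈ˢ g → Deg≤ f N → Deg≤ g N
  Deg≤-cong f≈g df n N<n = trans (sym (at f≈g n)) (df n N<n)

  Deg≤-mono : ∀ {f M N} → M ≤ N → Deg≤ f M → Deg≤ f N
  Deg≤-mono M≤N df n N<n = df n (ℕ.≤-<-trans M≤N N<n)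

  Deg≤-+ : ∀ {f g N} → Deg≤ f N → Deg≤ g N → Deg≤ (f +ˢ g) N
  Deg≤-+ df dg n N<n = trans (+-cong (df n N<n) (dg n N<n)) (+-identityˡ 0#)

  Deg≤-neg : ∀ {f N} → Deg≤ f N → Deg≤ (-ˢ f) N
  Deg≤-neg df n N<n = trans (-‿cong (df n N<n)) -0≈0

  Deg≤-0 : ∀ {N} → Deg≤ 0ˢ N
  Deg≤-0 n _ = refl

  Deg≤-const : ∀ {c N} → Deg≤ (const c) N
  Deg≤-const (suc n) _ = refl

  Deg≤-shift : ∀ {f N} → Deg≤ f N → Deg≤ (shift f) (suc N)
  Deg≤-shift df (suc n) (s≤s N<n) = df n N<n

  Deg≤-* : ∀ {f g M N} → Deg≤ f M → Deg≤ g N → Deg≤ (f *ˢ g) (M ℕ.+ N)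
  Deg≤-* {f} {g} {zero} {N} df dg n N<n = trans
    (*ˢ-cong {f} {const (f 0)} {g} (λ { zero → refl ; (suc m) → df (suc m) (s≤s z≤n) }) (λ _ → refl) n)
    (trans (const-* (f 0) g n) (trans (*-congˡ (dg n N<n)) (zeroʳ _)))
  Deg≤-* {f} {g} {suc M} {N} df dg (suc n) (s≤s M+N<n) = trans
    (+-cong (trans (*-congˡ (dg (suc n) (s≤s (ℕ.≤-trans (ℕ.m≤n+m N M) (ℕ.<⇒≤ M+N<n))))) (zeroʳ _))
            (Deg≤-* {tl f} {g} {M} {N} (λ m M<m → df (suc m) (s≤s M<m)) dg n M+N<n))
    (+-identityˡ 0#)

  IsPoly : Ser → Set
  IsPoly f = ∃ (Deg≤ f)

  IsPoly-+ : ∀ {f g} → IsPoly f → IsPoly g → IsPoly (f +ˢ g)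
  IsPoly-+ {f} {g} (M , df) (N , dg) = M ℕ.+ N ,
    Deg≤-+ {f} {g} (Deg≤-mono {f} (ℕ.m≤m+n M N) df) (Deg≤-mono {g} (ℕ.m≤n+m N M) dg)

  IsPoly-* : ∀ {f g} → IsPoly f → IsPoly g → IsPoly (f *ˢ g)
  IsPoly-* {f} {g} (M , df) (N , dg) = M ℕ.+ N , Deg≤-* {f} {g} df dg

  IsPoly-neg : ∀ {f} → IsPoly f → IsPoly (-ˢ f)
  IsPoly-neg {f} (M , df) = M , Deg≤-neg {f} df

  -- The polynomial u - 1.
  w : Ser
  w = shift 1ˢ +ˢ -ˢ 1ˢ

  IsPoly-w : IsPoly w
  IsPoly-w = 1 , Deg≤-+ {shift 1ˢ} { -ˢ 1ˢ} (Deg≤-shift {1ˢ} Deg≤-const) (Deg≤-neg {1ˢ} Deg≤-const)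

  w-* : ∀ h → w *ˢ h ≈ˢ shift h +ˢ -ˢ h
  w-* h = S.trans (S.distribʳ h (shift 1ˢ) (-ˢ 1ˢ)) (S.+-cong
    (S.trans (shift-* 1ˢ h) (shift-cong (S.*-identityˡ h)))
    (RingProperties.-1*x≈-x S.ring h))

  -- Since (u - 1) g has coefficients g (n - 1) - g n, those of g are recovered one after the other.
  w-cancel : ∀ {g h} → w *ˢ g ≈ˢ w *ˢ h → g ≈ˢ h
  w-cancel {g} {h} wg≈wh = coeffs go
    where
    eq : shift g +ˢ -ˢ g ≈ˢ shift h +ˢ -ˢ h
    eq = S.trans (S.sym (w-* g)) (S.trans wg≈wh (w-* h))
    go : ∀ n → g n ≈ h n
    cancel : ∀ n → shift g n ≈ shift h n → g n ≈ h n
    cancel n p = -‿injective (≈.begin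
      - g n                            ≈.≈⟨ +-identityˡ _ ⟨
      0# + - g n                       ≈.≈⟨ +-congʳ (-‿inverseˡ _) ⟨
      - shift g n + shift g n + - g n  ≈.≈⟨ +-assoc _ _ _ ⟩
      - shift g n + (shift g n + - g n) ≈.≈⟨ +-cong (-‿cong p) (at eq n) ⟩
      - shift h n + (shift h n + - h n) ≈.≈⟨ +-assoc _ _ _ ⟨
      - shift h n + shift h n + - h n  ≈.≈⟨ +-congʳ (-‿inverseˡ _) ⟩
      0# + - h n                       ≈.≈⟨ +-identityˡ _ ⟩
      - h n                            ≈.∎)
    go zero    = cancel 0 refl
    go (suc n) = cancel (suc n) (go n)

  -- The value at u = 1 as a relation: c is the remainder of f on division by u - 1. The quotient
  -- must be a polynomial, because u - 1 is a unit among power series and every c would qualify.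
  Ev : Ser → Carrier → Set
  Ev f c = ∃ λ h → IsPoly h × f ≈ˢ const c +ˢ w *ˢ h

  private
    const-+ : ∀ c d → const (c + d) ≈ˢ const c +ˢ const d
    const-+ c d = coeffs λ { zero → refl ; (suc n) → sym (+-identityˡ 0#) }

    const-*-const : ∀ c d → const (c * d) ≈ˢ const c *ˢ const d
    const-*-const c d = coeffs λ { zero → refl ; (suc n) → sym (trans (const-* c (const d) (suc n)) (zeroʳ c)) }

    const-neg : ∀ c → const (- c) ≈ˢ -ˢ const c
    const-neg c = coeffs λ { zero → refl ; (suc n) → sym -0≈0 }

  const-cong : ∀ {c d} → c ≈ d → const c ≈ˢ const d
  const-cong c≈d = coeffs λ { zero → c≈d ; (suc n) → refl }

  open SemiringIdentities series

  Ev-cong : ∀ {f g c} → f ≈ˢ g → Ev f c → Ev g c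
  Ev-cong f≈g (h , ph , f≈) = h , ph , S.trans (S.sym f≈g) f≈

  Ev-+ : ∀ {f g c d} → Ev f c → Ev g d → Ev (f +ˢ g) (c + d)
  Ev-+ {f} {g} {c} {d} (h , ph , f≈) (k , pk , g≈) = h +ˢ k , IsPoly-+ {h} {k} ph pk ,
    S.trans (S.+-cong f≈ g≈) (S.trans
      ([a+wh]+[b+wk] (const c) (const d) w h k)
      (S.+-congʳ (S.sym (const-+ c d))))

  Ev-* : ∀ {f g c d} → Ev f c → Ev g d → Ev (f *ˢ g) (c * d)
  Ev-* {f} {g} {c} {d} (h , ph , f≈) (k , pk , g≈) =
    const c *ˢ k +ˢ h *ˢ (const d +ˢ w *ˢ k) ,
    IsPoly-+ {const c *ˢ k} {h *ˢ (const d +ˢ w *ˢ k)} (IsPoly-* {const c} {k} (0 , Deg≤-const) pk)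
      (IsPoly-* {h} {const d +ˢ w *ˢ k} ph
        (IsPoly-+ {const d} {w *ˢ k} (0 , Deg≤-const) (IsPoly-* {w} {k} IsPoly-w pk))) ,
    S.trans (S.*-cong f≈ g≈) (S.trans
      ([a+wh]*[b+wk] (const c) (const d) w h k)
      (S.+-congʳ (S.sym (const-*-const c d))))

  Ev-neg : ∀ {f c} → Ev f c → Ev (-ˢ f) (- c)
  Ev-neg {f} {c} (h , ph , f≈) = -ˢ h , IsPoly-neg {h} ph ,
    S.trans (S.-‿cong f≈) (S.trans (S.sym (AbelianGroupProperties.⁻¹-∙-comm S.+-abelianGroup _ _))
      (S.+-cong (S.sym (const-neg c)) (RingProperties.-‿distribʳ-* S.ring w h)))

  Ev-const : ∀ c → Ev (const c) c
  Ev-const c = 0ˢ , (0 , Deg≤-0) ,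
    S.trans (S.sym (S.+-identityʳ _)) (S.+-congˡ (S.sym (S.zeroʳ w)))

  Ev-0 : Ev 0ˢ 0#
  Ev-0 = Ev-cong (coeffs λ { zero → refl ; (suc n) → refl }) (Ev-const 0#)

  Ev-w* : ∀ {h} → IsPoly h → Ev (w *ˢ h) 0#
  Ev-w* {h} ph = h , ph , S.sym (S.trans
    (S.+-congʳ (coeffs λ { zero → refl ; (suc n) → refl })) (S.+-identityˡ _))

  -- Comparing coefficients in c + (u - 1) h = d + (u - 1) k gives c + k n = d + h n for every n,
  -- and beyond both degrees this reads c = d.
  Ev-unique : ∀ {f c d} → Ev f c → Ev f d → c ≈ d
  Ev-unique {f} {c} {d} (h , (M , dh) , f≈) (k , (N , dk) , f≈′) = begin-c
    where
    open AbelianGroupProperties +-abelianGroup using (//-rightDividesʳ)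
    at0 : ∀ c h → f ≈ˢ const c +ˢ w *ˢ h → f 0 ≈ c + - h 0
    at0 c h f≈ = trans (at f≈ 0) (+-congˡ (trans (at (w-* h) 0) (+-identityˡ _)))
    atsuc : ∀ c h → f ≈ˢ const c +ˢ w *ˢ h → ∀ n → f (suc n) ≈ h n + - h (suc n)
    atsuc c h f≈ n = trans (at f≈ (suc n)) (trans (+-identityˡ _) (at (w-* h) (suc n)))
    move : ∀ a b x y → a + - b ≈ x + - y → a + y ≈ x + b
    move a b x y eq = begin
      a + y                ≈⟨ +-congʳ (trans (+-assoc a _ _) (trans (+-congˡ (-‿inverseˡ b)) (+-identityʳ a))) ⟨
      a + - b + b + y      ≈⟨ +-congʳ (+-congʳ eq) ⟩
      x + - y + b + y      ≈⟨ +-congʳ (trans (+-assoc x _ _) (trans (+-congˡ (+-comm _ _)) (sym (+-assoc x _ _)))) ⟩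
      x + b + - y + y      ≈⟨ trans (+-assoc _ _ _) (trans (+-congˡ (-‿inverseˡ y)) (+-identityʳ _)) ⟩
      x + b                ∎
      where open ≈
    inv : ∀ n → c + k n ≈ d + h n
    inv zero    = move c (h 0) d (k 0) (trans (sym (at0 c h f≈)) (at0 d k f≈′))
    inv (suc n) = ≈.begin
      c + k (suc n)                       ≈.≈⟨ +-identityʳ _ ⟨
      c + k (suc n) + 0#                  ≈.≈⟨ +-congˡ (-‿inverseʳ (k n)) ⟨
      c + k (suc n) + (k n + - k n)       ≈.≈⟨ trans (+-interchange _ _ _ _) (trans (sym (+-assoc _ _ _)) (+-congʳ (+-congʳ (inv n)))) ⟩
      d + h n + k (suc n) + - k n         ≈.≈⟨ +-congʳ (+-assoc _ _ _) ⟩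
      d + (h n + k (suc n)) + - k n
        ≈.≈⟨ +-congʳ (+-congˡ (move (h n) (h (suc n)) (k n) (k (suc n)) (trans (sym (atsuc c h f≈ n)) (atsuc d k f≈′ n)))) ⟩
      d + (k n + h (suc n)) + - k n       ≈.≈⟨ +-congʳ (+-congˡ (+-comm _ _)) ⟩
      d + (h (suc n) + k n) + - k n       ≈.≈⟨ +-congʳ (sym (+-assoc _ _ _)) ⟩
      d + h (suc n) + k n + - k n         ≈.≈⟨ trans (+-assoc _ _ _) (trans (+-congˡ (-‿inverseʳ _)) (+-identityʳ _)) ⟩
      d + h (suc n)                       ≈.∎
    begin-c : c ≈ d
    begin-c = trans (sym (+-identityʳ c)) (trans (+-congˡ (sym (dk (suc (M ℕ.+ N)) (s≤s (ℕ.m≤n+m N M)))))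
      (trans (inv (suc (M ℕ.+ N))) (trans (+-congˡ (dh (suc (M ℕ.+ N)) (s≤s (ℕ.m≤m+n M N)))) (+-identityʳ d))))

  -- Synthetic division, from f = f₀ + u (tl f) and u c = c + (u - 1) c. The last clause is for N =
  -- 0, where `pred` alone would admit a constant quotient.
  Ev-exists : ∀ N f → Deg≤ f N → ∃₂ λ c h → Deg≤ h (ℕ.pred N) × f ≈ˢ const c +ˢ w *ˢ h ×
              (N ≡ 0 → h ≈ˢ 0ˢ)
  Ev-exists zero f df = f 0 , 0ˢ , Deg≤-0 ,
    coeffs (λ { zero → trans (sym (+-identityʳ _)) (+-congˡ (sym (at (S.zeroʳ w) 0)))
              ; (suc n) → trans (df (suc n) (s≤s z≤n))
                  (sym (trans (+-identityˡ _) (at (S.zeroʳ w) (suc n)))) }) , λ _ → S.refl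
  Ev-exists (suc N) f df with Ev-exists N (tl f) (λ n N<n → df (suc n) (s≤s N<n))
  ... | c , h , dh , tf≈ , N≡0⇒ = f 0 + c , const c +ˢ shift h , deg N dh N≡0⇒ , eq , λ ()
    where
    deg : ∀ N → Deg≤ h (ℕ.pred N) → (N ≡ 0 → h ≈ˢ 0ˢ) → Deg≤ (const c +ˢ shift h) N
    deg zero    dh h≈0 = Deg≤-+ {const c} {shift h} Deg≤-const
      (λ { (suc n) _ → at (h≈0 ≡.refl) n })
    deg (suc N) dh h≈0 = Deg≤-+ {const c} {shift h} Deg≤-const (Deg≤-shift {h} dh)
    eq : f ≈ˢ const (f 0 + c) +ˢ w *ˢ (const c +ˢ shift h)
    eq = S.trans (coeffs λ { zero → sym (+-identityʳ _) ; (suc n) → trans (at tf≈ n) (sym (+-identityˡ _)) })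
      (S.trans (S.+-congˡ (S.trans (shift-+ (const c) (w *ˢ h)) (S.+-cong shift-c (S.sym (*-shift w h)))))
      (S.trans (S.+-congˡ (S.+-assoc _ _ _)) (S.trans (S.sym (S.+-assoc _ _ _))
        (S.+-cong (S.sym (const-+ (f 0) c)) (S.sym (S.distribˡ w _ _))))))
      where
      shift-+ : ∀ g h → shift (g +ˢ h) ≈ˢ shift g +ˢ shift h
      shift-+ g h = coeffs λ { zero → sym (+-identityˡ 0#) ; (suc n) → refl }
      shift-c : shift (const c) ≈ˢ const c +ˢ w *ˢ const c
      shift-c = S.trans (S.sym (S.trans (S.+-comm _ _) (S.trans (S.+-assoc _ _ _)
        (S.trans (S.+-congˡ (S.-‿inverseˡ (const c))) (S.+-identityʳ _))))) (S.+-congˡ (S.sym (w-* (const c))))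

  w^ : ℕ → Ser
  w^ zero    = 1ˢ
  w^ (suc d) = w *ˢ w^ d

  IsPoly-w^ : ∀ d → IsPoly (w^ d)
  IsPoly-w^ zero    = 0 , Deg≤-const
  IsPoly-w^ (suc d) = IsPoly-* {w} {w^ d} IsPoly-w (IsPoly-w^ d)

  Ev-*-w : ∀ F G k c g → Ev F c → Ev G g → IsPoly k → F *ˢ G ≈ˢ w *ˢ k → c * g ≈ 0#
  Ev-*-w F G k c g evF evG pk FG≈ = Ev-unique {F *ˢ G} {c * g} {0#} (Ev-* {F} {G} {c} {g} evF evG)
    (Ev-cong {w *ˢ k} {F *ˢ G} {0#} (S.sym FG≈) (Ev-w* {k} pk))

  module _ (domain : ∀ x y → x * y ≈ 0# → x ≈ 0# ⊎ y ≈ 0#) where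

    -- G does not vanish at u = 1, so the factor u − 1 divides F.
    divide-w : ∀ N F G k g → Deg≤ F N → ¬ F 0 ≈ 0# → Ev G g → ¬ g ≈ 0# → IsPoly k →
      F *ˢ G ≈ˢ w *ˢ k →
      ∃₂ λ N′ F′ → N ≡ suc N′ × Deg≤ F′ N′ × ¬ F′ 0 ≈ 0# × F′ *ˢ G ≈ˢ k
    divide-w N F G k g dF F₀≉0 evG g≉0 pk FG≈ = split (Ev-exists N F dF)
      where
      split : (∃₂ λ c h → Deg≤ h (ℕ.pred N) × F ≈ˢ const c +ˢ w *ˢ h × (N ≡ 0 → h ≈ˢ 0ˢ)) →
              ∃₂ λ N′ F′ → N ≡ suc N′ × Deg≤ F′ N′ × ¬ F′ 0 ≈ 0# × F′ *ˢ G ≈ˢ k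
      split (c , F′ , dF′ , F≈ , N≡0⇒) = degree N ≡.refl
        where
        c≈0 : c ≈ 0#
        c≈0 = [ id , (λ g≈0 → ⊥-elim (g≉0 g≈0)) ]′
          (domain c g (Ev-*-w F G k c g (F′ , (ℕ.pred N , dF′) , F≈) evG pk FG≈))
        F≈wF′ : F ≈ˢ w *ˢ F′
        F≈wF′ = S.trans F≈
          (S.trans (S.+-congʳ (coeffs λ { zero → c≈0 ; (suc n) → refl })) (S.+-identityˡ _))
        F′₀≉0 : ¬ F′ 0 ≈ 0#
        F′₀≉0 F′₀≈0 = F₀≉0 (trans (at F≈wF′ 0) (trans (at (w-* F′) 0) (trans (+-identityˡ _)
          (trans (-‿cong F′₀≈0) -0≈0))))
        F′G≈k : F′ *ˢ G ≈ˢ k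
        F′G≈k = w-cancel {F′ *ˢ G} {k}
          (S.trans (S.sym (S.*-assoc w F′ G)) (S.trans (S.*-congʳ (S.sym F≈wF′)) FG≈))
        degree : ∀ M → N ≡ M → ∃₂ λ N′ F′ → N ≡ suc N′ × Deg≤ F′ N′ × ¬ F′ 0 ≈ 0# × F′ *ˢ G ≈ˢ k
        degree zero    N≡0 = ⊥-elim (F′₀≉0 (at (N≡0⇒ N≡0) 0))
        degree (suc M) N≡M = M , F′ , N≡M , ≡.subst (λ N → Deg≤ F′ (ℕ.pred N)) N≡M dF′ , F′₀≉0 , F′G≈k

    -- A factor u - 1 of F G can only sit in F, and removing it lowers the bound on the degree of F
    -- by one. The constant term stays non-zero, so F is never zero and no factor can be removed
    -- once the bound is 0.
    order≤degree : ∀ d N F G g h → Deg≤ F N → ¬ F 0 ≈ 0# → Ev G g → ¬ g ≈ 0# → IsPoly h →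
      F *ˢ G ≈ˢ w^ d *ˢ h → d ≤ N
    order≤degree zero    N F G g h dF F₀≉0 evG g≉0 ph FG≈ = z≤n
    order≤degree (suc d) N F G g h dF F₀≉0 evG g≉0 ph FG≈ = next
      (divide-w N F G (w^ d *ˢ h) g dF F₀≉0 evG g≉0 (IsPoly-* {w^ d} {h} (IsPoly-w^ d) ph)
        (S.trans FG≈ (S.*-assoc w (w^ d) h)))
      where
      next : (∃₂ λ N′ F′ → N ≡ suc N′ × Deg≤ F′ N′ × ¬ F′ 0 ≈ 0# × F′ *ˢ G ≈ˢ w^ d *ˢ h) → suc d ≤ N
      next (N′ , F′ , ≡.refl , dF′ , F′₀≉0 , F′G≈) =
        s≤s (order≤degree d N′ F′ G g h dF′ F′₀≉0 evG g≉0 ph F′G≈)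

  -- Characteristic polynomials

  module _ {r : ℕ} (A : Matrix Carrier r) where
    open Sums R
    private
      module SS = Sums series
      open Determinant series

    id-uA : Matrix Ser r
    id-uA i j = const (Id rawRing i j) +ˢ -ˢ shift (const (A i j))

    charPoly : Ser
    charPoly = detR id-uA

    -- The separate clause for exponent 1 makes the first power A itself instead of Id · A.
    infixl 9 _^ᴬ_
    _^ᴬ_ : ℕ → Matrix Carrier r
    _^ᴬ_ zero          = Id rawRing
    _^ᴬ_ (suc zero)    = A
    _^ᴬ_ (suc (suc m)) i j = sum λ k → _^ᴬ_ (suc m) i k * A k j

    powerSums : Matrix Ser r
    powerSums i j zero    = 0#
    powerSums i j (suc m) = _^ᴬ_ (suc m) i j

    traceSeries : Ser
    traceSeries zero    = 0#
    traceSeries (suc m) = sum λ i → _^ᴬ_ (suc m) i i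

    private
      sumˢ-at : ∀ {m} (f : Fin m → Ser) n → SS.sum f n ≈ sum λ i → f i n
      sumˢ-at {zero}  f n = trans (at (SS.sum-[] f) n) (sym (sum-[] _))
      sumˢ-at {suc m} f n = trans (at (SS.sum-∷ f) n)
        (trans (+-congˡ (sumˢ-at (f ∘ suc) n)) (sym (sum-∷ _)))

      Deg≤-det : ∀ {m} (M : Matrix Ser m) → (∀ i j → Deg≤ (M i j) 1) → Deg≤ (detR M) m
      Deg≤-det {zero}  M dM = Deg≤-cong {1ˢ} (S.sym (det-[] M)) Deg≤-const
      Deg≤-det {suc m} M dM n n>m = trans (at (det-expand M) n) (trans (sumˢ-at _ n)
        (sum-0 λ j → signed-Deg≤ (toℕ j) {M zero j *ˢ detR (minor j M)}
          (Deg≤-* {M zero j} {detR (minor j M)} (dM zero j) (Deg≤-det (minor j M) λ a b → dM _ _)) n n>m))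
        where
        signed-Deg≤ : ∀ k {f N} → Deg≤ f N → Deg≤ (signed S.rawRing k f) N
        signed-Deg≤ zero    df = df
        signed-Deg≤ (suc k) {f} df = Deg≤-neg {signed S.rawRing k f} (signed-Deg≤ k df)

    charPoly-Deg≤ : Deg≤ charPoly r
    charPoly-Deg≤ = Deg≤-det id-uA λ i j → Deg≤-+ {const _} { -ˢ shift (const (A i j))} Deg≤-const
      (Deg≤-neg {shift (const (A i j))} (Deg≤-shift {const (A i j)} Deg≤-const))

    charPoly-0 : charPoly 0 ≈ 1#
    charPoly-0 = trans (reflexive (cong (λ f → f 0) (detR≡det id-uA)))
      (trans (DetRel.Related.det-~ S.rawRing rawRing (λ f c → f 0 ≈ c) +-cong *-cong -‿cong refl refl
        {M = id-uA} {N = Id rawRing} (λ i j → trans (+-congˡ -0≈0) (+-identityʳ _)))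
      (trans (sym (reflexive (Determinant.detR≡det R (Id rawRing)))) (Determinant.det-Id R r)))

    -- `Ev` respects the ring operations and hence determinants; on the entries, u c = c + (u - 1) c
    -- has the value c.
    charPoly-1 : Ev charPoly (det rawRing λ i j → Id rawRing i j + - A i j)
    charPoly-1 = ≡.subst (λ f → Ev f (det rawRing λ i j → Id rawRing i j + - A i j)) (≡.sym (detR≡det id-uA))
      (DetRel.Related.det-~ S.rawRing rawRing Ev Ev-+ Ev-* Ev-neg Ev-0 (Ev-const 1#)
        λ i j → Ev-+ (Ev-const _) (Ev-neg (Ev-cong (uc (A i j)) (Ev-+ (Ev-const (A i j)) (Ev-w* (0 , Deg≤-const)))′)))
      where
      uc : ∀ c → const c +ˢ w *ˢ const c ≈ˢ shift (const c)
      uc c = S.trans (S.+-congˡ (w-* (const c))) (S.trans (S.+-comm _ _) (S.trans (S.+-assoc _ _ _)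
        (S.trans (S.+-congˡ (S.-‿inverseˡ (const c))) (S.+-identityʳ _))))
      _′ : ∀ {f c} → Ev f (c + 0#) → Ev f c
      (h , ph , f≈) ′ = h , ph , S.trans f≈ (S.+-congʳ (const-cong (+-identityʳ _)))

    -- Jacobi's formula. `powerSums` is S = Σ_{m≥1} Aᵐuᵐ, for which S (Id - uA) = uA = -θ (Id - uA);
    -- this is the hypothesis of `θ-det-trace`.
    θ-charPoly : θ charPoly ≈ˢ -ˢ (traceSeries *ˢ charPoly)
    θ-charPoly = S.trans
      (Derivation.θ-det-trace θ θ-cong θ-+ θ-* θ-neg θ-0 (θ-const 1#) id-uA powerSums
        (λ i j → S.trans (θ-id-uA i j) (S.-‿cong (S.sym (powerSums-* i j)))))
      (S.-‿cong (S.*-congʳ (coeffs λ { zero → trans (sumˢ-at _ 0) (sum-0 λ i → refl)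
                                     ; (suc n) → sumˢ-at _ (suc n) })))
      where
      θ-id-uA : ∀ i j → θ (id-uA i j) ≈ˢ -ˢ shift (const (A i j))
      θ-id-uA i j = S.trans (θ-+ _ _) (S.trans (S.+-cong (θ-const _)
        (S.trans (θ-neg _) (S.-‿cong (coeffs λ { zero → refl ; (suc zero) → +-identityʳ _ ; (suc (suc n)) → x×0≈0 (suc (suc n)) }))))
        (S.+-identityˡ _))
      term : ∀ i j k n → (powerSums i k *ˢ id-uA k j) n ≈
             powerSums i k n * Id rawRing k j + - shift (λ m → powerSums i k m * A k j) n
      term i j k n = trans (at (S.distribˡ (powerSums i k) _ _) n) (+-cong
        (trans (*ˢ-comm (powerSums i k) _ n) (trans (const-* _ _ n) (*-comm _ _)))
        (trans (at (S.sym (RingProperties.-‿distribʳ-* S.ring (powerSums i k) _)) n) (-‿cong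
          (trans (at (*-shift (powerSums i k) _) n) (at (shift-cong (coeffs λ m →
            trans (*ˢ-comm (powerSums i k) _ m) (trans (const-* _ _ m) (*-comm _ _)))) n)))))
      sum-neg : ∀ {m} (f : Fin m → Carrier) → sum (λ k → - f k) ≈ - sum f
      sum-neg f = trans (sum-cong λ k → sym (-1*x≈-x (f k))) (trans (sym (*-sumˡ _ f)) (-1*x≈-x _))
      powerSums-* : ∀ i j → SS.sum (λ k → powerSums i k *ˢ id-uA k j) ≈ˢ shift (const (A i j))
      powerSums-* i j = coeffs λ n → trans (sumˢ-at _ n) (trans (sum-cong λ k → term i j k n)
        (trans (sum-+ _ _) (trans (+-cong (Id-sum (λ k → powerSums i k n) j) (sum-neg _)) (fin n))))
        where
        fin : ∀ n → powerSums i j n + - sum (λ k → shift (λ m → powerSums i k m * A k j) n) ≈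
                    shift (const (A i j)) n
        fin zero          = trans (+-identityˡ _) (trans (-‿cong (sum-0 λ k → refl)) -0≈0)
        fin (suc zero)    = trans (+-congˡ (trans (-‿cong (sum-0 λ k → zeroˡ _)) -0≈0)) (+-identityʳ _)
        fin (suc (suc n)) = -‿inverseʳ _

-- Sums over lists

Unique⇒↭ : ∀ {A : Set} {xs ys : List A} → Unique xs → Unique ys →
  (∀ {x} → x ∈ xs → x ∈ ys) → (∀ {x} → x ∈ ys → x ∈ xs) → xs ↭ ys
Unique⇒↭ !xs !ys xs⊆ys ys⊆xs = ∼bag⇒↭ (unique∧set⇒bag !xs !ys (mk⇔ xs⊆ys ys⊆xs))

map-∈-id : ∀ {A B : Set} {f : A → B} {g : B → A} xs → (∀ {x} → x ∈ xs → g (f x) ≡ x) → map g (map f xs) ≡ xs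
map-∈-id []       gf≡id = ≡.refl
map-∈-id (x ∷ xs) gf≡id = cong₂ _∷_ (gf≡id (here ≡.refl)) (map-∈-id xs (gf≡id ∘ there))

Unique-map : ∀ {A B : Set} {f : A → B} {g : B → A} {xs} → Unique xs →
             (∀ {x} → x ∈ xs → g (f x) ≡ x) → Unique (map f xs)
Unique-map {g = g} {xs} !xs gf≡id = Unique.map⁻ {f = g} (≡.subst Unique (≡.sym (map-∈-id xs gf≡id)) !xs)

map-↭ : ∀ {A B : Set} {f : A → B} {g : B → A} {xs ys} → Unique xs → Unique ys →
  (∀ {x} → x ∈ xs → f x ∈ ys) → (∀ {x} → x ∈ xs → g (f x) ≡ x) →
  (∀ {y} → y ∈ ys → g y ∈ xs) → (∀ {y} → y ∈ ys → f (g y) ≡ y) → map f xs ↭ ys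
map-↭ {f = f} {g} {xs} {ys} !xs !ys f∈ gf≡id g∈ fg≡id =
  Unique⇒↭ (Unique-map {g = g} !xs gf≡id) !ys from to
  where
  from : ∀ {y} → y ∈ map f xs → y ∈ ys
  from y∈ = go (Mem.∈-map⁻ f y∈)
    where
    go : ∀ {y} → (∃ λ x → x ∈ xs × y ≡ f x) → y ∈ ys
    go (x , x∈ , ≡.refl) = f∈ x∈
  to : ∀ {y} → y ∈ ys → y ∈ map f xs
  to {y} y∈ = ≡.subst (_∈ map f xs) (fg≡id y∈) (Mem.∈-map⁺ f (g∈ y∈))

length-bijection : ∀ {A B : Set} (f : A → B) (g : B → A) {xs ys} → Unique xs → Unique ys →
  (∀ {x} → x ∈ xs → f x ∈ ys) → (∀ {x} → x ∈ xs → g (f x) ≡ x) →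
  (∀ {y} → y ∈ ys → g y ∈ xs) → (∀ {y} → y ∈ ys → f (g y) ≡ y) → length xs ≡ length ys
length-bijection f g {xs} !xs !ys f∈ gf≡id g∈ fg≡id = ≡.trans (≡.sym (List.length-map f xs))
  (Perm.↭-length (map-↭ {f = f} {g} !xs !ys f∈ gf≡id g∈ fg≡id))

module ListSums (R : CommutativeRing 0ℓ 0ℓ) where
  open CommutativeRing R hiding (zero)
  open CommutativeSemigroupProperties +-commutativeSemigroup using (interchange; x∙yz≈y∙xz)

  lsum : ∀ {A : Set} → (A → Carrier) → List A → Carrier
  lsum f []       = 0#
  lsum f (x ∷ xs) = f x + lsum f xs

  𝟙ᴿ : ∀ {P : Set} → Dec P → Carrier
  𝟙ᴿ P? = if does P? then 1# else 0#

  𝟙ᴿ-yes : ∀ {P : Set} (P? : Dec P) → P → 𝟙ᴿ P? ≡ 1#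
  𝟙ᴿ-yes (yes _) p = ≡.refl
  𝟙ᴿ-yes (no ¬p) p = contradiction p ¬p

  𝟙ᴿ-no : ∀ {P : Set} (P? : Dec P) → ¬ P → 𝟙ᴿ P? ≡ 0#
  𝟙ᴿ-no (yes p) ¬p = contradiction p ¬p
  𝟙ᴿ-no (no _)  ¬p = ≡.refl

  𝟙ᴿ-⇔ : ∀ {P Q : Set} (P? : Dec P) (Q? : Dec Q) → (P → Q) → (Q → P) → 𝟙ᴿ P? ≡ 𝟙ᴿ Q?
  𝟙ᴿ-⇔ P? Q? to from = cong (λ b → if b then 1# else 0#) (does-⇔ (mk⇔ to from) P? Q?)

  private variable A B : Set

  lsum-cong : ∀ {f g : A → Carrier} xs → (∀ {x} → x ∈ xs → f x ≈ g x) → lsum f xs ≈ lsum g xs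
  lsum-cong []       f≈g = refl
  lsum-cong (x ∷ xs) f≈g = +-cong (f≈g (here ≡.refl)) (lsum-cong xs (f≈g ∘ there))

  lsum-0 : ∀ {f : A → Carrier} xs → (∀ {x} → x ∈ xs → f x ≈ 0#) → lsum f xs ≈ 0#
  lsum-0 []       f≈0 = refl
  lsum-0 (x ∷ xs) f≈0 = trans (+-cong (f≈0 (here ≡.refl)) (lsum-0 xs (f≈0 ∘ there))) (+-identityˡ 0#)

  lsum-+ : ∀ (f g : A → Carrier) xs → lsum (λ x → f x + g x) xs ≈ lsum f xs + lsum g xs
  lsum-+ f g []       = sym (+-identityˡ 0#)
  lsum-+ f g (x ∷ xs) = trans (+-congˡ (lsum-+ f g xs)) (interchange _ _ _ _)

  lsum-*ˡ : ∀ c (f : A → Carrier) xs → lsum (λ x → c * f x) xs ≈ c * lsum f xs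
  lsum-*ˡ c f []       = sym (zeroʳ c)
  lsum-*ˡ c f (x ∷ xs) = trans (+-congˡ (lsum-*ˡ c f xs)) (sym (distribˡ _ _ _))

  lsum-*ʳ : ∀ c (f : A → Carrier) xs → lsum (λ x → f x * c) xs ≈ lsum f xs * c
  lsum-*ʳ c f xs = trans (lsum-cong xs λ _ → *-comm _ c) (trans (lsum-*ˡ c f xs) (*-comm c _))

  lsum-++ : ∀ (f : A → Carrier) xs ys → lsum f (xs ++ ys) ≈ lsum f xs + lsum f ys
  lsum-++ f []       ys = sym (+-identityˡ _)
  lsum-++ f (x ∷ xs) ys = trans (+-congˡ (lsum-++ f xs ys)) (sym (+-assoc _ _ _))

  lsum-map : ∀ (f : B → Carrier) (g : A → B) xs → lsum f (map g xs) ≈ lsum (f ∘ g) xs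
  lsum-map f g []       = refl
  lsum-map f g (x ∷ xs) = +-congˡ (lsum-map f g xs)

  lsum-comm : ∀ (f : A → B → Carrier) xs ys →
              lsum (λ x → lsum (f x) ys) xs ≈ lsum (λ y → lsum (λ x → f x y) xs) ys
  lsum-comm f []       ys = sym (lsum-0 ys λ _ → refl)
  lsum-comm f (x ∷ xs) ys = trans (+-congˡ (lsum-comm f xs ys)) (sym (lsum-+ (f x) _ ys))

  lsum-filter : ∀ {P : A → Set} (P? : Decidable P) (f : A → Carrier) xs →
                lsum f (filter P? xs) ≈ lsum (λ x → 𝟙ᴿ (P? x) * f x) xs
  lsum-filter P? f []       = refl
  lsum-filter P? f (x ∷ xs) with P? x
  ... | yes _ = +-cong (sym (*-identityˡ _)) (lsum-filter P? f xs)
  ... | no  _ = trans (lsum-filter P? f xs) (trans (sym (+-identityˡ _)) (+-congʳ (sym (zeroˡ _))))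

  lsum-↭ : ∀ (f : A → Carrier) {xs ys} → xs ↭ ys → lsum f xs ≈ lsum f ys
  lsum-↭ f Perm.refl          = refl
  lsum-↭ f (Perm.prep x p)    = +-congˡ (lsum-↭ f p)
  lsum-↭ f (Perm.swap x y p)  = trans (+-congˡ (+-congˡ (lsum-↭ f p))) (x∙yz≈y∙xz _ _ _)
  lsum-↭ f (Perm.trans p q)   = trans (lsum-↭ f p) (lsum-↭ f q)

  lsum-single : ∀ {f : A → Carrier} {xs} y → Unique xs → y ∈ xs → (∀ {x} → x ∈ xs → x ≢ y → f x ≈ 0#) →
                lsum f xs ≈ f y
  lsum-single {xs = x ∷ xs} y (x∉ ∷ !xs) (here ≡.refl) f≈0 = trans
    (+-congˡ (lsum-0 xs λ z∈ → f≈0 (there z∈) λ { ≡.refl → All.lookup x∉ z∈ ≡.refl })) (+-identityʳ _)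
  lsum-single {xs = x ∷ xs} y (x∉ ∷ !xs) (there y∈) f≈0 = trans
    (+-cong (f≈0 (here ≡.refl) (All.lookup x∉ y∈)) (lsum-single y !xs y∈ (f≈0 ∘ there))) (+-identityˡ _)

module LZ = ListSums ℤ.+-*-commutativeRing

-- Finite sums and residue classes of integers

Σ< : ℕ → (ℕ → ℤ) → ℤ
Σ< zero    f = 0ℤ
Σ< (suc n) f = f 0 ℤ.+ Σ< n (f ∘ suc)

Σ<-cong : ∀ n {f g} → (∀ i → i < n → f i ≡ g i) → Σ< n f ≡ Σ< n g
Σ<-cong zero    f≡g = ≡.refl
Σ<-cong (suc n) f≡g = cong₂ ℤ._+_ (f≡g 0 (s≤s z≤n)) (Σ<-cong n λ i i<n → f≡g (suc i) (s≤s i<n))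

Σ<-0 : ∀ n {f} → (∀ i → i < n → f i ≡ 0ℤ) → Σ< n f ≡ 0ℤ
Σ<-0 zero    f≡0 = ≡.refl
Σ<-0 (suc n) f≡0 = cong₂ ℤ._+_ (f≡0 0 (s≤s z≤n)) (Σ<-0 n λ i i<n → f≡0 (suc i) (s≤s i<n))

ℤ-interchange : ∀ a b c d → (a ℤ.+ b) ℤ.+ (c ℤ.+ d) ≡ (a ℤ.+ c) ℤ.+ (b ℤ.+ d)
ℤ-interchange = solve-∀

Σ<-+ : ∀ n f g → Σ< n (λ i → f i ℤ.+ g i) ≡ Σ< n f ℤ.+ Σ< n g
Σ<-+ zero    f g = ≡.refl
Σ<-+ (suc n) f g = ≡.trans (cong (ℤ._+_ (f 0 ℤ.+ g 0)) (Σ<-+ n (f ∘ suc) (g ∘ suc)))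
  (ℤ-interchange (f 0) (g 0) _ _)

Σ<-* : ∀ n c f → Σ< n (λ i → c ℤ.* f i) ≡ c ℤ.* Σ< n f
Σ<-* zero    c f = ≡.sym (ℤ.*-zeroʳ c)
Σ<-* (suc n) c f = ≡.trans (cong (ℤ._+_ (c ℤ.* f 0)) (Σ<-* n c (f ∘ suc))) (≡.sym (ℤ.*-distribˡ-+ c _ _))

Σ<-neg : ∀ n f → Σ< n (λ i → ℤ.- f i) ≡ ℤ.- Σ< n f
Σ<-neg zero    f = ≡.refl
Σ<-neg (suc n) f = ≡.trans (cong (ℤ._+_ (ℤ.- f 0)) (Σ<-neg n (f ∘ suc))) (≡.sym (ℤ.neg-distrib-+ (f 0) _))

Σ<-const : ∀ n c → Σ< n (λ _ → c) ≡ + n ℤ.* c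
Σ<-const zero    c = ≡.sym (ℤ.*-zeroˡ c)
Σ<-const (suc n) c = ≡.trans (cong (λ s → c ℤ.+ s) (Σ<-const n c)) (≡.sym (ℤ.suc-* (+ n) c))

Σ<-last : ∀ n f → Σ< (suc n) f ≡ Σ< n f ℤ.+ f n
Σ<-last zero    f = ≡.trans (ℤ.+-identityʳ (f 0)) (≡.sym (ℤ.+-identityˡ (f 0)))
Σ<-last (suc n) f = ≡.trans (cong (ℤ._+_ (f 0)) (Σ<-last n (f ∘ suc))) (≡.sym (ℤ.+-assoc (f 0) _ _))

Σ<-telescope : ∀ n f → Σ< n (f ∘ suc) ℤ.+ f 0 ≡ Σ< n f ℤ.+ f n
Σ<-telescope n f = ≡.trans (ℤ.+-comm _ (f 0)) (Σ<-last n f)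

Σ<-single : ∀ n f i → i < n → (∀ k → k < n → k ≢ i → f k ≡ 0ℤ) → Σ< n f ≡ f i
Σ<-single (suc n) f zero    i<n f≡0 = ≡.trans
  (cong (λ s → f 0 ℤ.+ s) (Σ<-0 n λ k k<n → f≡0 (suc k) (s≤s k<n) λ ())) (ℤ.+-identityʳ _)
Σ<-single (suc n) f (suc i) (s≤s i<n) f≡0 = ≡.trans
  (cong₂ ℤ._+_ (f≡0 0 (s≤s z≤n) λ ())
    (Σ<-single n (f ∘ suc) i i<n λ k k<n k≢i → f≡0 (suc k) (s≤s k<n) (k≢i ∘ ℕ.suc-injective)))
  (ℤ.+-identityˡ _)

𝟙 : ∀ {P : Set} → Dec P → ℤ
𝟙 P? = if does P? then 1ℤ else 0ℤ

𝟙-yes : ∀ {P : Set} (P? : Dec P) → P → 𝟙 P? ≡ 1ℤ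
𝟙-yes (yes _) p = ≡.refl
𝟙-yes (no ¬p) p = contradiction p ¬p

𝟙-no : ∀ {P : Set} (P? : Dec P) → ¬ P → 𝟙 P? ≡ 0ℤ
𝟙-no (yes p) ¬p = contradiction p ¬p
𝟙-no (no _)  ¬p = ≡.refl

𝟙-⇔ : ∀ {P Q : Set} (P? : Dec P) (Q? : Dec Q) → (P → Q) → (Q → P) → 𝟙 P? ≡ 𝟙 Q?
𝟙-⇔ P? Q? to from = cong (λ b → if b then 1ℤ else 0ℤ) (does-⇔ (mk⇔ to from) P? Q?)

infix 4 _≡_[mod_] _≡_[mod_]?
-- The difference is taken in ℤ, so that it is never truncated whichever of a and b is larger.
record _≡_[mod_] (a b m : ℕ) : Set where
  constructor modulo
  field difference : + m ∣ℤ (+ a ℤ.- + b)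
open _≡_[mod_] public

_≡_[mod_]? : ∀ a b m → Dec (a ≡ b [mod m ])
a ≡ b [mod m ]? = map′ modulo difference (+ m ∣ℤ? (+ a ℤ.- + b))

∣ℤ-resp : ∀ {k x y} → x ≡ y → k ∣ℤ x → k ∣ℤ y
∣ℤ-resp ≡.refl k∣x = k∣x

∣ℤ-k : ∀ k m → + m ∣ℤ + (k ℕ.* m)
∣ℤ-k k m = divides (+ k) (ℤ.pos-* k m)

mod-refl : ∀ {m} a → a ≡ a [mod m ]
mod-refl {m} a = modulo (divides 0ℤ (≡.trans (ℤ.+-inverseʳ (+ a)) (≡.sym (ℤ.*-zeroˡ (+ m)))))

mod-sym : ∀ {m a b} → a ≡ b [mod m ] → b ≡ a [mod m ]
mod-sym {m} {a} {b} p = modulo (∣ℤ-resp (lemma (+ a) (+ b)) (ℤ∣.∣m⇒∣-m (difference p)))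
  where
  lemma : ∀ x y → ℤ.- (x ℤ.- y) ≡ y ℤ.- x
  lemma = solve-∀

mod-trans : ∀ {m a b c} → a ≡ b [mod m ] → b ≡ c [mod m ] → a ≡ c [mod m ]
mod-trans {m} {a} {b} {c} p q = modulo (∣ℤ-resp (lemma (+ a) (+ b) (+ c)) (ℤ∣.∣m∣n⇒∣m+n (difference p) (difference q)))
  where
  lemma : ∀ x y z → (x ℤ.- y) ℤ.+ (y ℤ.- z) ≡ x ℤ.- z
  lemma = solve-∀

mod-+ˡ : ∀ {m a b} c → a ≡ b [mod m ] → c ℕ.+ a ≡ c ℕ.+ b [mod m ]
mod-+ˡ {m} {a} {b} c p = modulo (∣ℤ-resp (≡.trans (lemma (+ c) (+ a) (+ b))
    (≡.sym (cong₂ ℤ._-_ (ℤ.pos-+ c a) (ℤ.pos-+ c b)))) (difference p))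
  where
  lemma : ∀ z x y → x ℤ.- y ≡ (z ℤ.+ x) ℤ.- (z ℤ.+ y)
  lemma = solve-∀

mod-+ˡ-cancel : ∀ {m a b} c → c ℕ.+ a ≡ c ℕ.+ b [mod m ] → a ≡ b [mod m ]
mod-+ˡ-cancel {m} {a} {b} c p = modulo (∣ℤ-resp (≡.trans (cong₂ ℤ._-_ (ℤ.pos-+ c a) (ℤ.pos-+ c b))
    (lemma (+ c) (+ a) (+ b))) (difference p))
  where
  lemma : ∀ z x y → (z ℤ.+ x) ℤ.- (z ℤ.+ y) ≡ x ℤ.- y
  lemma = solve-∀

mod-+ʳ : ∀ {m a b} c → a ≡ b [mod m ] → a ℕ.+ c ≡ b ℕ.+ c [mod m ]
mod-+ʳ {m} {a} {b} c p = ≡.subst₂ (λ x y → x ≡ y [mod m ]) (ℕ.+-comm c a) (ℕ.+-comm c b) (mod-+ˡ c p)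

mod-multiple : ∀ {m} a k → a ℕ.+ k ℕ.* m ≡ a [mod m ]
mod-multiple {m} a k = modulo (∣ℤ-resp
    (≡.sym (≡.trans (cong (ℤ._- + a) (ℤ.pos-+ a (k ℕ.* m))) (lemma (+ a) _))) (∣ℤ-k k m))
  where
  lemma : ∀ x y → (x ℤ.+ y) ℤ.- x ≡ y
  lemma = solve-∀

mod-period : ∀ {m} a → a ℕ.+ m ≡ a [mod m ]
mod-period {m} a = ≡.subst (λ k → a ℕ.+ k ≡ a [mod m ]) (ℕ.*-identityˡ m) (mod-multiple a 1)

mod-≤ : ∀ {m n a b} → + m ∣ℤ + n → a ≡ b [mod n ] → a ≡ b [mod m ]
mod-≤ m∣n p = modulo (ℤ∣.∣-trans m∣n (difference p))

-- As a function of a, this is the linear form on ℤ[x]/(xᵐ - 1) that reads off the coefficient of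
-- xᵇ.
δ : ℕ → ℕ → ℕ → ℤ
δ m b a = 𝟙 (a ≡ b [mod m ]?)

δ-cong : ∀ {m a a′} b → a ≡ a′ [mod m ] → δ m b a ≡ δ m b a′
δ-cong {m} {a} {a′} b p = 𝟙-⇔ (a ≡ b [mod m ]?) (a′ ≡ b [mod m ]?)
  (mod-trans (mod-sym p)) (mod-trans p)

δ-shift : ∀ m b c a → δ m (c ℕ.+ b) (c ℕ.+ a) ≡ δ m b a
δ-shift m b c a = 𝟙-⇔ (c ℕ.+ a ≡ c ℕ.+ b [mod m ]?) (a ≡ b [mod m ]?)
  (mod-+ˡ-cancel c) (mod-+ˡ c)

-- Quotients of ℤ[x]

-- (c₁ , a₁) ∷ … ∷ (cₖ , aₖ) ∷ [] stands for c₁x^a₁ + … + cₖx^aₖ, and ⟪ f , φ ⟫ is the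
-- value at f of the linear form taking xᵃ to φ a.
Formal : Set
Formal = List (ℤ × ℕ)

⟪_,_⟫ : Formal → (ℕ → ℤ) → ℤ
⟪ []          , φ ⟫ = 0ℤ
⟪ (c , a) ∷ f , φ ⟫ = c ℤ.* φ a ℤ.+ ⟪ f , φ ⟫

⟪⟫-cong : ∀ f {φ ψ} → (∀ a → φ a ≡ ψ a) → ⟪ f , φ ⟫ ≡ ⟪ f , ψ ⟫
⟪⟫-cong []            φ≡ψ = ≡.refl
⟪⟫-cong ((c , a) ∷ f) φ≡ψ = cong₂ (λ x y → c ℤ.* x ℤ.+ y) (φ≡ψ a) (⟪⟫-cong f φ≡ψ)

⟪⟫-++ : ∀ f g φ → ⟪ f ++ g , φ ⟫ ≡ ⟪ f , φ ⟫ ℤ.+ ⟪ g , φ ⟫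
⟪⟫-++ []            g φ = ≡.sym (ℤ.+-identityˡ _)
⟪⟫-++ ((c , a) ∷ f) g φ = ≡.trans (cong (ℤ._+_ (c ℤ.* φ a)) (⟪⟫-++ f g φ)) (≡.sym (ℤ.+-assoc (c ℤ.* φ a) _ _))

negF : Formal → Formal
negF = map λ (c , a) → ℤ.- c , a

⟪⟫-neg : ∀ f φ → ⟪ negF f , φ ⟫ ≡ ℤ.- ⟪ f , φ ⟫
⟪⟫-neg []            φ = ≡.refl
⟪⟫-neg ((c , a) ∷ f) φ = ≡.trans (cong₂ ℤ._+_ (≡.sym (ℤ.neg-distribˡ-* c (φ a))) (⟪⟫-neg f φ))
  (≡.sym (ℤ.neg-distrib-+ (c ℤ.* φ a) _))

mulF : Formal → Formal → Formal
mulF = cartesianProductWith λ (c , a) (d , b) → c ℤ.* d , a ℕ.+ b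

⟪⟫-map : ∀ c a g φ → ⟪ map (λ (d , b) → c ℤ.* d , a ℕ.+ b) g , φ ⟫ ≡ c ℤ.* ⟪ g , (λ b → φ (a ℕ.+ b)) ⟫
⟪⟫-map c a []            φ = ≡.sym (ℤ.*-zeroʳ c)
⟪⟫-map c a ((d , b) ∷ g) φ = ≡.trans (cong₂ ℤ._+_ (ℤ.*-assoc c d _) (⟪⟫-map c a g φ))
  (≡.sym (ℤ.*-distribˡ-+ c _ _))

⟪⟫-mul : ∀ f g φ → ⟪ mulF f g , φ ⟫ ≡ ⟪ f , (λ a → ⟪ g , (λ b → φ (a ℕ.+ b)) ⟫) ⟫
⟪⟫-mul []            g φ = ≡.refl
⟪⟫-mul ((c , a) ∷ f) g φ = ≡.trans (⟪⟫-++ (map _ g) _ φ) (cong₂ ℤ._+_ (⟪⟫-map c a g φ) (⟪⟫-mul f g φ))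

⟪⟫-+ : ∀ f φ ψ → ⟪ f , (λ a → φ a ℤ.+ ψ a) ⟫ ≡ ⟪ f , φ ⟫ ℤ.+ ⟪ f , ψ ⟫
⟪⟫-+ []            φ ψ = ≡.refl
⟪⟫-+ ((c , a) ∷ f) φ ψ = ≡.trans (cong₂ ℤ._+_ (ℤ.*-distribˡ-+ c (φ a) (ψ a)) (⟪⟫-+ f φ ψ))
  (ℤ-interchange (c ℤ.* φ a) _ _ _)

⟪⟫-* : ∀ f k φ → ⟪ f , (λ a → k ℤ.* φ a) ⟫ ≡ k ℤ.* ⟪ f , φ ⟫
⟪⟫-* []            k φ = ≡.sym (ℤ.*-zeroʳ k)
⟪⟫-* ((c , a) ∷ f) k φ = ≡.trans (cong₂ ℤ._+_ (lemma c k (φ a)) (⟪⟫-* f k φ)) (≡.sym (ℤ.*-distribˡ-+ k _ _))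
  where
  lemma : ∀ c k x → c ℤ.* (k ℤ.* x) ≡ k ℤ.* (c ℤ.* x)
  lemma = solve-∀

⟪⟫-0 : ∀ f {φ} → (∀ a → φ a ≡ 0ℤ) → ⟪ f , φ ⟫ ≡ 0ℤ
⟪⟫-0 []            φ≡0 = ≡.refl
⟪⟫-0 ((c , a) ∷ f) φ≡0 = cong₂ ℤ._+_ (≡.trans (cong (c ℤ.*_) (φ≡0 a)) (ℤ.*-zeroʳ c)) (⟪⟫-0 f φ≡0)

⟪⟫-Σ< : ∀ f n (φ : ℕ → ℕ → ℤ) → ⟪ f , (λ a → Σ< n λ i → φ i a) ⟫ ≡ Σ< n λ i → ⟪ f , φ i ⟫
⟪⟫-Σ< f zero    φ = ⟪⟫-0 f λ _ → ≡.refl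
⟪⟫-Σ< f (suc n) φ = ≡.trans (⟪⟫-+ f (φ 0) _) (cong (ℤ._+_ (⟪ f , φ 0 ⟫)) (⟪⟫-Σ< f n (φ ∘ suc)))

⟪⟫-comm : ∀ f g (φ : ℕ → ℕ → ℤ) → ⟪ f , (λ a → ⟪ g , φ a ⟫) ⟫ ≡ ⟪ g , (λ b → ⟪ f , (λ a → φ a b) ⟫) ⟫
⟪⟫-comm []            g φ = ≡.sym (⟪⟫-0 g λ _ → ≡.refl)
⟪⟫-comm ((c , a) ∷ f) g φ = ≡.trans (cong₂ ℤ._+_ (≡.sym (⟪⟫-* g c (φ a))) (⟪⟫-comm f g φ))
  (≡.sym (⟪⟫-+ g _ _))

ι : ℤ → Formal
ι c = (c , 0) ∷ []

x^ : ℕ → Formal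
x^ a = (1ℤ , a) ∷ []

-- ℤ[x] modulo the polynomials killed by a translation-invariant set of linear forms.
module FormQuotient (C : (ℕ → ℤ) → Set) (C-shift : ∀ {φ} a → C φ → C (λ b → φ (a ℕ.+ b))) where

  infix 4 _≈_
  -- Testing by integer-valued forms replaces division with remainder and normal forms, and makes
  -- the quotient torsion-free at once.
  record _≈_ (f g : Formal) : Set where
    constructor forms
    field on : ∀ φ → C φ → ⟪ f , φ ⟫ ≡ ⟪ g , φ ⟫
  open _≈_ public

  private
    mul-congʳ : ∀ f {g g′} → g ≈ g′ → mulF f g ≈ mulF f g′
    mul-congʳ f g≈ = forms λ φ Cφ → ≡.trans (⟪⟫-mul f _ φ)
      (≡.trans (⟪⟫-cong f λ a → on g≈ _ (C-shift a Cφ)) (≡.sym (⟪⟫-mul f _ φ)))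

    mul-comm : ∀ f g → mulF f g ≈ mulF g f
    mul-comm f g = forms λ φ Cφ → ≡.trans (⟪⟫-mul f g φ) (≡.trans (⟪⟫-comm f g λ a b → φ (a ℕ.+ b))
      (≡.trans (⟪⟫-cong g λ b → ⟪⟫-cong f λ a → cong φ (ℕ.+-comm a b)) (≡.sym (⟪⟫-mul g f φ))))

    mul-identityˡ : ∀ f → mulF (ι 1ℤ) f ≈ f
    mul-identityˡ f = forms λ φ Cφ → ≡.trans (⟪⟫-mul (ι 1ℤ) f φ)
      (≡.trans (ℤ.+-identityʳ _) (ℤ.*-identityˡ _))

    ≈-trans : ∀ {f g h} → f ≈ g → g ≈ h → f ≈ h
    ≈-trans p q = forms λ φ Cφ → ≡.trans (on p φ Cφ) (on q φ Cφ)

    mul-distribʳ : ∀ h f g → mulF (f ++ g) h ≈ mulF f h ++ mulF g h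
    mul-distribʳ h f g = forms λ φ Cφ → ≡.trans (⟪⟫-mul (f ++ g) h φ) (≡.trans (⟪⟫-++ f g _)
      (≡.sym (≡.trans (⟪⟫-++ (mulF f h) _ φ) (cong₂ ℤ._+_ (⟪⟫-mul f h φ) (⟪⟫-mul g h φ)))))

    ++-cong : ∀ {f f′ g g′} → f ≈ f′ → g ≈ g′ → f ++ g ≈ f′ ++ g′
    ++-cong {f} {f′} p q = forms λ φ Cφ → ≡.trans (⟪⟫-++ f _ φ)
      (≡.trans (cong₂ ℤ._+_ (on p φ Cφ) (on q φ Cφ)) (≡.sym (⟪⟫-++ f′ _ φ)))

    ++-comm : ∀ f g → f ++ g ≈ g ++ f
    ++-comm f g = forms λ φ Cφ → ≡.trans (⟪⟫-++ f g φ) (≡.trans (ℤ.+-comm ⟪ f , φ ⟫ _) (≡.sym (⟪⟫-++ g f φ)))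

    ++-inverseʳ : ∀ f → f ++ negF f ≈ []
    ++-inverseʳ f = forms λ φ Cφ → ≡.trans (⟪⟫-++ f _ φ)
      (≡.trans (cong (ℤ._+_ (⟪ f , φ ⟫)) (⟪⟫-neg f φ)) (ℤ.+-inverseʳ ⟪ f , φ ⟫))

  ring : CommutativeRing 0ℓ 0ℓ
  ring = record
    { Carrier = Formal ; _≈_ = _≈_ ; _+_ = _++_ ; _*_ = mulF ; -_ = negF ; 0# = [] ; 1# = ι 1ℤ
    ; isCommutativeRing = record
      { isRing = record
        { +-isAbelianGroup = record
          { isGroup = record
            { isMonoid = record
              { isSemigroup = record
                { isMagma = record
                  { isEquivalence = record
                    { refl  = forms λ φ Cφ → ≡.refl
                    ; sym   = λ p → forms λ φ Cφ → ≡.sym (on p φ Cφ)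
                    ; trans = ≈-trans }
                  ; ∙-cong = ++-cong }
                ; assoc = λ f g h → forms λ φ Cφ → cong (λ f → ⟪ f , φ ⟫) (++-assoc f g h) }
              ; identity = (λ f → forms λ φ Cφ → ≡.refl) ,
                           (λ f → ++-comm f []) }
            ; inverse = (λ f → ≈-trans (++-comm (negF f) f) (++-inverseʳ f)) , ++-inverseʳ
            ; ⁻¹-cong = λ {f} {g} p → forms λ φ Cφ →
                ≡.trans (⟪⟫-neg f φ) (≡.trans (cong ℤ.-_ (on p φ Cφ)) (≡.sym (⟪⟫-neg g φ))) }
          ; comm = ++-comm }
        ; *-cong = λ {f} {f′} {g} {g′} p q → ≈-trans (mul-congʳ f q)
            (≈-trans (mul-comm f g′) (≈-trans (mul-congʳ g′ p) (mul-comm g′ f′)))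
        ; *-assoc = λ f g h → forms λ φ Cφ → ≡.trans (⟪⟫-mul (mulF f g) h φ) (≡.trans (⟪⟫-mul f g _)
            (≡.sym (≡.trans (⟪⟫-mul f (mulF g h) φ) (⟪⟫-cong f λ a → ≡.trans (⟪⟫-mul g h _)
              (⟪⟫-cong g λ b → ⟪⟫-cong h λ c → cong φ (≡.sym (ℕ.+-assoc a b c)))))))
        ; *-identity = mul-identityˡ , (λ f → ≈-trans (mul-comm f (ι 1ℤ)) (mul-identityˡ f))
        ; distrib = (λ h f g → ≈-trans (mul-comm h (f ++ g)) (≈-trans (mul-distribʳ h f g)
                      (++-cong (mul-comm f h) (mul-comm g h)))) , mul-distribʳ }
      ; *-comm = mul-comm } }
    where open import Data.List.Properties using (++-assoc)

  open CommutativeRing ring using (semiring)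
  open SemiringMult semiring using () renaming (_×_ to _×ℕ_)

  ⟪⟫-× : ∀ n f φ → ⟪ n ×ℕ f , φ ⟫ ≡ + n ℤ.* ⟪ f , φ ⟫
  ⟪⟫-× zero    f φ = ≡.sym (ℤ.*-zeroˡ ⟪ f , φ ⟫)
  ⟪⟫-× (suc n) f φ = ≡.trans (⟪⟫-++ f _ φ) (≡.trans (cong (ℤ._+_ (⟪ f , φ ⟫)) (⟪⟫-× n f φ))
    (≡.sym (ℤ.suc-* (+ n) _)))

  torsionFree : ∀ n f → suc n ×ℕ f ≈ [] → f ≈ []
  torsionFree n f nf≈0 = forms λ φ Cφ → ℤ.*-cancelˡ-≡ (+ suc n) ⟪ f , φ ⟫ 0ℤ
    (≡.trans (≡.sym (⟪⟫-× (suc n) f φ)) (≡.trans (on nf≈0 φ Cφ) (≡.sym (ℤ.*-zeroʳ (+ suc n)))))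

  ι-+ : ∀ c d → ι (c ℤ.+ d) ≈ ι c ++ ι d
  ι-+ c d = forms λ φ Cφ → lemma c d (φ 0)
    where
    lemma : ∀ c d x → (c ℤ.+ d) ℤ.* x ℤ.+ 0ℤ ≡ c ℤ.* x ℤ.+ (d ℤ.* x ℤ.+ 0ℤ)
    lemma = solve-∀

  ι-* : ∀ c d → ι (c ℤ.* d) ≈ mulF (ι c) (ι d)
  ι-* c d = forms λ φ Cφ → ≡.refl

  ι-neg : ∀ c → ι (ℤ.- c) ≈ negF (ι c)
  ι-neg c = forms λ φ Cφ → ≡.refl

  ι-0 : ι 0ℤ ≈ []
  ι-0 = forms λ φ Cφ → ≡.trans (ℤ.+-identityʳ _) (ℤ.*-zeroˡ (φ 0))

  ⟪⟫-x^* : ∀ a f φ → ⟪ mulF (x^ a) f , φ ⟫ ≡ ⟪ f , (λ b → φ (a ℕ.+ b)) ⟫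
  ⟪⟫-x^* a f φ = ≡.trans (⟪⟫-mul (x^ a) f φ) (≡.trans (ℤ.+-identityʳ _) (ℤ.*-identityˡ _))

ℤ-+-cancelʳ : ∀ x y z → y ℤ.+ x ≡ z ℤ.+ x → y ≡ z
ℤ-+-cancelʳ = GroupProperties.∙-cancelʳ (AbelianGroup.group ℤ.+-0-abelianGroup)

mod-unique-≤ : ∀ {m} i k → i ≤ k → k < m → i ≡ k [mod m ] → i ≡ k
mod-unique-≤ {m} i k i≤k k<m i≡k = begin
  i                ≡⟨ ℕ.+-identityʳ i ⟨
  i ℕ.+ 0          ≡⟨ cong (i ℕ.+_) (d≡0 (k ℕ.∸ i) (ℕ.≤-<-trans (ℕ.m∸n≤m k i) k<m) m∣d) ⟨
  i ℕ.+ (k ℕ.∸ i)  ≡⟨ ℕ.m+[n∸m]≡n i≤k ⟩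
  k                ∎
  where
  open ≡-Reasoning
  lemma : ∀ x y → ℤ.- (x ℤ.- (x ℤ.+ y)) ≡ y
  lemma = solve-∀
  m∣d : m ∣ k ℕ.∸ i
  m∣d = ℤ∣.∣⇒∣ᵤ (∣ℤ-resp (begin
    ℤ.- (+ i ℤ.- + k)                       ≡⟨ cong (λ k → ℤ.- (+ i ℤ.- + k)) (ℕ.m+[n∸m]≡n i≤k) ⟨
    ℤ.- (+ i ℤ.- + (i ℕ.+ (k ℕ.∸ i)))       ≡⟨ cong (λ z → ℤ.- (+ i ℤ.- z)) (ℤ.pos-+ i (k ℕ.∸ i)) ⟩
    ℤ.- (+ i ℤ.- (+ i ℤ.+ + (k ℕ.∸ i)))     ≡⟨ lemma (+ i) (+ (k ℕ.∸ i)) ⟩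
    + (k ℕ.∸ i)                             ∎)
    (ℤ∣.∣m⇒∣-m (difference i≡k)))
  d≡0 : ∀ d → d < m → m ∣ d → d ≡ 0
  d≡0 zero    d<m m∣d = ≡.refl
  d≡0 (suc d) d<m m∣d = contradiction (ℕ∣.∣⇒≤ m∣d) (ℕ.<⇒≱ d<m)

mod-unique : ∀ {m i k} → i < m → k < m → i ≡ k [mod m ] → i ≡ k
mod-unique {m} {i} {k} i<m k<m i≡k =
  [ (λ i≤k → mod-unique-≤ i k i≤k k<m i≡k) , (λ k≤i → ≡.sym (mod-unique-≤ k i k≤i i<m (mod-sym i≡k))) ]′
  (ℕ.≤-total i k)

%-mod : ∀ a m .{{_ : NonZero m}} → a % m ≡ a [mod m ]
%-mod a m = mod-sym (≡.subst (_≡ a % m [mod m ]) (≡.sym (ℕ.m≡m%n+[m/n]*n a m)) (mod-multiple (a % m) (a / m)))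

δ-refl : ∀ m a → δ m a a ≡ 1ℤ
δ-refl m a = 𝟙-yes (a ≡ a [mod m ]?) (mod-refl a)

δ-≢ : ∀ {m b a} → ¬ a ≡ b [mod m ] → δ m b a ≡ 0ℤ
δ-≢ {m} {b} {a} = 𝟙-no (a ≡ b [mod m ]?)

Σ<-δ : ∀ m .{{_ : NonZero m}} a → Σ< m (λ i → δ m 0 (a ℕ.+ i)) ≡ 1ℤ
Σ<-δ m zero = ≡.trans (Σ<-single m _ 0 (ℕ.>-nonZero⁻¹ m)
  λ k k<m k≢0 → δ-≢ {m} λ k≡0 → k≢0 (mod-unique k<m (ℕ.>-nonZero⁻¹ m) k≡0)) (δ-refl m 0)
Σ<-δ m (suc a) = ℤ-+-cancelʳ (δ m 0 (a ℕ.+ 0)) _ _ (begin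
  Σ< m (λ i → δ m 0 (suc a ℕ.+ i)) ℤ.+ δ m 0 (a ℕ.+ 0)
    ≡⟨ cong (ℤ._+ δ m 0 (a ℕ.+ 0)) (Σ<-cong m λ i _ → cong (δ m 0) (≡.sym (ℕ.+-suc a i))) ⟩
  Σ< m (λ i → δ m 0 (a ℕ.+ suc i)) ℤ.+ δ m 0 (a ℕ.+ 0)
    ≡⟨ Σ<-telescope m (λ i → δ m 0 (a ℕ.+ i)) ⟩
  Σ< m (λ i → δ m 0 (a ℕ.+ i)) ℤ.+ δ m 0 (a ℕ.+ m)
    ≡⟨ cong₂ ℤ._+_ (Σ<-δ m a) (δ-cong 0 (≡.subst (λ b → a ℕ.+ m ≡ b [mod m ]) (≡.sym (ℕ.+-identityʳ a)) (mod-period a))) ⟩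
  1ℤ ℤ.+ δ m 0 (a ℕ.+ 0) ∎)
  where open ≡-Reasoning

-- Binomial coefficients and the Frobenius map modulo p

p∣pCk : ∀ {p} → Prime p → ∀ {k} → 0 < k → k < p → p ∣ p choose k
p∣pCk {p} pp {k} 0<k k<p = [ id , (λ p∣ → contradiction p∣ p∤k![p∸k]!) ]′
  (euclidsLemma (p choose k) (k ! ℕ.* (p ℕ.∸ k) !) pp (≡.subst (p ∣_) (≡.sym p!≡) (p∣p! p)))
  where
  k≤p = ℕ.<⇒≤ k<p
  p!≡ : (p choose k) ℕ.* (k ! ℕ.* (p ℕ.∸ k) !) ≡ p !
  p!≡ = ≡.trans (cong (ℕ._* (k ! ℕ.* (p ℕ.∸ k) !)) (nCk≡n!/k![n-k]! k≤p))
    (ℕ.m/n*n≡m {{ℕ._!*_!≢0 k (p ℕ.∸ k)}} (k![n∸k]!∣n! k≤p))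
  p∣p! : ∀ p .{{_ : NonZero p}} → p ∣ p !
  p∣p! (suc p) = ℕ∣.m∣m*n (p !)
  instance _ = prime⇒nonZero pp
  p∤m! : ∀ m → m < p → p ∤ m !
  p∤m! zero    m<p p∣1 = contradiction (ℕ∣.∣⇒≤ p∣1) (ℕ.<⇒≱ (ℕ.nonTrivial⇒n>1 p {{prime⇒nonTrivial pp}}))
  p∤m! (suc m) m<p p∣ = [ (λ p∣1+m → contradiction (ℕ∣.∣⇒≤ p∣1+m) (ℕ.<⇒≱ m<p)) , p∤m! m (ℕ.<-trans (ℕ.n<1+n m) m<p) ]′
    (euclidsLemma (suc m) (m !) pp p∣)
  p∤k![p∸k]! : p ∤ k ! ℕ.* (p ℕ.∸ k) !
  p∤k![p∸k]! p∣ = [ p∤m! k k<p , p∤m! (p ℕ.∸ k) (ℕ.∸-monoʳ-< 0<k k≤p) ]′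
    (euclidsLemma (k !) ((p ℕ.∸ k) !) pp p∣)

module Frobenius (R : CommutativeRing 0ℓ 0ℓ) {p : ℕ} (pp : Prime p) where
  open CommutativeRing R hiding (zero)
  open SemiringExp semiring using (_^_; ^-congˡ; ^-assocʳ; ^-congʳ)
  open SemiringMult semiring using () renaming (_×_ to _×ℕ_; ×-congˡ to ×ℕ-congˡ; ×-congʳ to ×ℕ-congʳ;
    ×-assocˡ to ×ℕ-assocˡ; ×-comm-* to ×ℕ-comm-*; ×-assoc-* to ×ℕ-assoc-*; ×-homo-+ to ×ℕ-homo-+)
  open SemiringSum semiring using (sum; sum-cong-≋; sum-init-last; *-distribˡ-sum)
  open SemiringIdentities R
  open SetoidReasoning setoid

  P : Carrier
  P = p ×ℕ 1#

  infix 4 _≡ₚ_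
  record _≡ₚ_ (y z : Carrier) : Set where
    constructor _∥_
    field
      remainder : Carrier
      by        : y ≈ z + P * remainder

  private
    kp×x : ∀ k x → p ∣ k → ∃ λ h → k ×ℕ x ≈ P * h
    kp×x k x (ℕ∣.divides j k≡jp) = j ×ℕ x , (begin
      k ×ℕ x             ≈⟨ ×ℕ-congˡ (≡.trans k≡jp (ℕ.*-comm j p)) ⟩
      (p ℕ.* j) ×ℕ x     ≈⟨ ×ℕ-assocˡ x p j ⟨
      p ×ℕ (j ×ℕ x)      ≈⟨ ×ℕ-congʳ p (*-identityˡ _) ⟨
      p ×ℕ (1# * j ×ℕ x) ≈⟨ ×ℕ-assoc-* p 1# _ ⟨
      P * (j ×ℕ x)       ∎)

  ≡ₚ-trans : ∀ {x y z} → x ≡ₚ y → y ≡ₚ z → x ≡ₚ z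
  ≡ₚ-trans (h ∥ x≈) (k ∥ y≈) = (k + h) ∥ trans x≈ (trans (+-congʳ y≈)
    (trans (+-assoc _ _ _) (+-congˡ (sym (distribˡ P k h)))))

  ≈⇒≡ₚ : ∀ {x y} → x ≈ y → x ≡ₚ y
  ≈⇒≡ₚ x≈y = 0# ∥ trans x≈y (sym (trans (+-congˡ (zeroʳ P)) (+-identityʳ _)))

  ≡ₚ-^ : ∀ n {y z} → y ≡ₚ z → y ^ n ≡ₚ z ^ n
  ≡ₚ-^ zero    y≡z = ≈⇒≡ₚ refl
  ≡ₚ-^ (suc n) {y} {z} y≡z@(h ∥ y≈) = go (≡ₚ-^ n y≡z)
    where
    go : y ^ n ≡ₚ z ^ n → y * y ^ n ≡ₚ z * z ^ n
    go (k ∥ yⁿ≈) = _ ∥ trans (*-cong y≈ yⁿ≈) ([a+wh]*[b+wk] z (z ^ n) P h k)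

  1^n≈1 : ∀ n → 1# ^ n ≈ 1#
  1^n≈1 zero    = refl
  1^n≈1 (suc n) = trans (*-identityˡ _) (1^n≈1 n)

  freshman : ∀ u → (1# + u) ^ p ≡ₚ 1# + u ^ p
  freshman u = go p pp ≡.refl
    where
    open Binomial commutativeSemiring using (theorem; binomialTerm)
    go : ∀ p′ → Prime p′ → p ≡ p′ → (1# + u) ^ p ≡ₚ 1# + u ^ p
    go (suc n) _ ≡.refl = proj₁ middle ∥ (begin
      (1# + u) ^ suc n                              ≈⟨ ^-congˡ (suc n) (+-comm 1# u) ⟩
      (u + 1#) ^ suc n                              ≈⟨ theorem (suc n) u 1# ⟩
      t zero + sum (λ k → t (suc k))                ≈⟨ +-congˡ (sum-init-last (λ k → t (suc k))) ⟩
      t zero + (sum (init (λ k → t (suc k))) + last (λ k → t (suc k)))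
        ≈⟨ +-cong first (+-cong (proj₂ middle) lastTerm) ⟩
      1# + (P * proj₁ middle + u ^ suc n)           ≈⟨ +-congˡ (+-comm _ _) ⟩
      1# + (u ^ suc n + P * proj₁ middle)           ≈⟨ +-assoc _ _ _ ⟨
      1# + u ^ suc n + P * proj₁ middle             ∎)
      where
      t : Fin (suc (suc n)) → Carrier
      t = binomialTerm u 1# (suc n)
      first : t zero ≈ 1#
      first = trans (+-identityʳ _) (trans (*-identityˡ _) (1^n≈1 (suc n)))
      lastTerm : t (suc (fromℕ n)) ≈ u ^ suc n
      lastTerm = begin
        t (suc (fromℕ n))
          ≈⟨ reflexive (cong (λ k → (suc n choose suc k) ×ℕ (u ^ suc k * 1# ^ (n ℕ.∸ k))) (Fin.toℕ-fromℕ n)) ⟩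
        (suc n choose suc n) ×ℕ (u ^ suc n * 1# ^ (n ℕ.∸ n))
          ≈⟨ ×ℕ-congˡ (nCn≡1 (suc n)) ⟩
        u ^ suc n * 1# ^ (n ℕ.∸ n) + 0#
          ≈⟨ trans (+-identityʳ _) (trans (*-congˡ (1^n≈1 (n ℕ.∸ n))) (*-identityʳ _)) ⟩
        u ^ suc n ∎
      divided : ∀ (k : Fin n) → ∃ λ h → t (suc (inject₁ k)) ≈ P * h
      divided k = kp×x _ _ (p∣pCk pp (s≤s z≤n)
        (s≤s (≡.subst (_< n) (≡.sym (Fin.toℕ-inject₁ k)) (Fin.toℕ<n k))))
      middle : ∃ λ h → sum (init (λ k → t (suc k))) ≈ P * h
      middle = sum (proj₁ ∘ divided) ,
        trans (sum-cong-≋ (proj₂ ∘ divided)) (sym (*-distribˡ-sum P (proj₁ ∘ divided)))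

  frobenius : ∀ e u → (1# + u) ^ (p ℕ.^ e) ≡ₚ 1# + u ^ (p ℕ.^ e)
  frobenius zero    u = ≈⇒≡ₚ (trans (*-identityʳ _) (+-congˡ (sym (*-identityʳ u))))
  frobenius (suc e) u = ≡ₚ-trans
    (≈⇒≡ₚ (trans (^-congʳ (1# + u) (ℕ.*-comm p _)) (sym (^-assocʳ (1# + u) (p ℕ.^ e) p))))
    (≡ₚ-trans (≡ₚ-^ p (frobenius e u)) (≡ₚ-trans (freshman (u ^ (p ℕ.^ e)))
      (≈⇒≡ₚ (+-congˡ (trans (^-assocʳ u (p ℕ.^ e) p) (^-congʳ u (ℕ.*-comm _ p)))))))

-- The cyclotomic ring ℤ[x] / (Φ_{pⁿ⁺¹}): as Φ_{pⁿ⁺¹} = Σ_{i<p} x^{ipⁿ}, the linear forms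
-- on ℤ[x] which vanish on its multiples are the following.
module Cyclotomic (em : ExcludedMiddle 0ℓ) {p : ℕ} (pp : Prime p) (n : ℕ) where

  q : ℕ
  q = p ℕ.^ n

  instance
    p≢0 : NonZero p
    p≢0 = prime⇒nonZero pp

    q≢0 : NonZero q
    q≢0 = ℕ.m^n≢0 p n

  p>1 : 1 < p
  p>1 = ℕ.nonTrivial⇒n>1 p {{prime⇒nonTrivial pp}}

  Vanishing : (ℕ → ℤ) → Set
  Vanishing φ = ∀ a → Σ< p (λ i → φ (a ℕ.+ i ℕ.* q)) ≡ 0ℤ

  Vanishing-shift : ∀ {φ} a → Vanishing φ → Vanishing (λ b → φ (a ℕ.+ b))
  Vanishing-shift {φ} a Vφ b = ≡.trans
    (Σ<-cong p λ i _ → cong φ (≡.sym (ℕ.+-assoc a b (i ℕ.* q)))) (Vφ (a ℕ.+ b))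

  open FormQuotient Vanishing (λ {φ} → Vanishing-shift {φ}) public
  private
    module O = CommutativeRing ring
  open Frobenius ring pp
  open SemiringExp O.semiring using (_^_; ^-congˡ; ^-assocʳ; ^-homo-*; ^-congʳ)
  open SemiringMult O.semiring using () renaming (_×_ to _×ℕ_)
  open O using (_+_; _*_; -_; 0#; 1#)

  -- The conditions at a and at a + q differ by a telescoping sum; in terms of polynomials, (x^q -
  -- 1) Φ = x^{pq} - 1.
  Vanishing-period : ∀ {φ} → Vanishing φ → ∀ a → φ (a ℕ.+ p ℕ.* q) ≡ φ a
  Vanishing-period {φ} Vφ a = ≡.sym (begin
    φ a                                              ≡⟨ ℤ.+-identityˡ _ ⟨
    0ℤ ℤ.+ φ a                                       ≡⟨ cong₂ ℤ._+_ (≡.trans (Σ<-cong p λ i _ → cong φ (≡.sym (ℕ.+-assoc a q (i ℕ.* q)))) (Vφ (a ℕ.+ q))) (cong φ (ℕ.+-identityʳ a)) ⟨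
    Σ< p (λ i → φ (a ℕ.+ suc i ℕ.* q)) ℤ.+ φ (a ℕ.+ 0 ℕ.* q)
      ≡⟨ Σ<-telescope p (λ i → φ (a ℕ.+ i ℕ.* q)) ⟩
    Σ< p (λ i → φ (a ℕ.+ i ℕ.* q)) ℤ.+ φ (a ℕ.+ p ℕ.* q) ≡⟨ cong (ℤ._+ φ (a ℕ.+ p ℕ.* q)) (Vφ a) ⟩
    0ℤ ℤ.+ φ (a ℕ.+ p ℕ.* q)                         ≡⟨ ℤ.+-identityˡ _ ⟩
    φ (a ℕ.+ p ℕ.* q)                                ∎)
    where open ≡-Reasoning

  -- The progression a, a + q, ..., a + (p - 1) q is invariant under adding q modulo pq, so it meets
  -- the classes of b and of q + b equally often. These forms witness every non-vanishing in ℤ[ζ]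
  -- below.
  Vanishing-δ : ∀ b → Vanishing (λ a → δ (p ℕ.* q) b a ℤ.- δ (p ℕ.* q) (q ℕ.+ b) a)
  Vanishing-δ b a = begin
    Σ< p (λ i → f i ℤ.- g i)                    ≡⟨ Σ<-+ p f (λ i → ℤ.- g i) ⟩
    Σ< p f ℤ.+ Σ< p (λ i → ℤ.- g i)             ≡⟨ cong (ℤ._+_ (Σ< p f)) (Σ<-neg p g) ⟩
    Σ< p f ℤ.- Σ< p g                           ≡⟨ cong (ℤ._-_ (Σ< p f)) (≡.sym f≡g) ⟩
    Σ< p f ℤ.- Σ< p f                           ≡⟨ ℤ.+-inverseʳ (Σ< p f) ⟩
    0ℤ                                          ∎
    where
    open ≡-Reasoning
    m = p ℕ.* q
    f g : ℕ → ℤ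
    f i = δ m b (a ℕ.+ i ℕ.* q)
    g i = δ m (q ℕ.+ b) (a ℕ.+ i ℕ.* q)
    q+ : ∀ i → q ℕ.+ (a ℕ.+ i ℕ.* q) ≡ a ℕ.+ suc i ℕ.* q
    q+ i = ≡.trans (≡.sym (ℕ.+-assoc q a _)) (≡.trans (cong (ℕ._+ i ℕ.* q) (ℕ.+-comm q a)) (ℕ.+-assoc a q _))
    f≡gsuc : ∀ i → f i ≡ g (suc i)
    f≡gsuc i = ≡.trans (≡.sym (δ-shift m b q (a ℕ.+ i ℕ.* q))) (cong (δ m (q ℕ.+ b)) (q+ i))
    g-period : g p ≡ g 0
    g-period = δ-cong (q ℕ.+ b) (≡.subst (λ c → a ℕ.+ m ≡ c [mod m ]) (≡.sym (ℕ.+-identityʳ a)) (mod-period a))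
    f≡g : Σ< p f ≡ Σ< p g
    f≡g = ℤ-+-cancelʳ (g 0) _ _ (≡.trans (cong (ℤ._+ g 0) (Σ<-cong p λ i _ → f≡gsuc i))
      (≡.trans (Σ<-telescope p g) (cong (ℤ._+_ (Σ< p g)) g-period)))

  q≢0[mod-pq] : ∀ b → ¬ b ≡ q ℕ.+ b [mod p ℕ.* q ]
  q≢0[mod-pq] b b≡ = ℕ.<⇒≢ (ℕ.>-nonZero⁻¹ q) (mod-unique (ℕ.<-trans (ℕ.>-nonZero⁻¹ q) q<m) q<m
    (mod-+ˡ-cancel b (≡.subst₂ (λ x y → x ≡ y [mod p ℕ.* q ]) (≡.sym (ℕ.+-identityʳ b)) (ℕ.+-comm q b) b≡)))
    where
    q<m : q < p ℕ.* q
    q<m = ≡.subst (_< p ℕ.* q) (ℕ.*-identityˡ q) (ℕ.*-monoˡ-< q p>1)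

  T : Formal
  T = x^ 1 + - 1#

  ⟪⟫-T* : ∀ f φ → ⟪ T * f , φ ⟫ ≡ ⟪ f , (λ b → φ (suc b)) ⟫ ℤ.- ⟪ f , φ ⟫
  ⟪⟫-T* f φ = ≡.trans (⟪⟫-mul T f φ) (lemma ⟪ f , (λ b → φ (suc b)) ⟫ ⟪ f , φ ⟫)
    where
    lemma : ∀ x y → 1ℤ ℤ.* x ℤ.+ (-1ℤ ℤ.* y ℤ.+ 0ℤ) ≡ x ℤ.- y
    lemma = solve-∀

  -- If T f = 0 then f = x f, so p f = Σ_{i<p} x^{iq} f = 0.
  T-regular : ∀ f → T * f ≈ 0# → f ≈ 0#
  T-regular f Tf≈0 = forms λ φ Vφ → p⟪⟫≡0 (≡.trans (≡.sym (Σ<-const p ⟪ f , φ ⟫))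
    (≡.trans (≡.sym (Σ<-cong p λ i _ → shifted (i ℕ.* q) φ Vφ))
      (≡.trans (≡.sym (⟪⟫-Σ< f p λ i b → φ (i ℕ.* q ℕ.+ b)))
        (⟪⟫-0 f λ b → ≡.trans (Σ<-cong p λ i _ → cong φ (ℕ.+-comm (i ℕ.* q) b)) (Vφ b)))))
    where
    shifted : ∀ k φ → Vanishing φ → ⟪ f , (λ b → φ (k ℕ.+ b)) ⟫ ≡ ⟪ f , φ ⟫
    shifted zero    φ Vφ = ≡.refl
    shifted (suc k) φ Vφ = ≡.trans (shifted k (φ ∘ suc) (Vanishing-shift {φ} 1 Vφ))
      (ℤ.i-j≡0⇒i≡j _ _ (≡.trans (≡.sym (⟪⟫-T* f φ)) (on Tf≈0 φ Vφ)))
    p⟪⟫≡0 : ∀ {x} → + p ℤ.* x ≡ 0ℤ → x ≡ 0ℤ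
    p⟪⟫≡0 {x} px≡0 = ℤ.*-cancelˡ-≡ (+ p) x 0ℤ (≡.trans px≡0 (≡.sym (ℤ.*-zeroʳ (+ p))))

  -- The value at x = 1. It does not respect `_≈_`; its class modulo p does, and is the residue map
  -- at T with values in ℤ/p, by `p∣aug⇒T∣` and `≈0⇒p∣aug`.
  aug : Formal → ℤ
  aug f = ⟪ f , (λ _ → 1ℤ) ⟫

  aug-* : ∀ f g → aug (f * g) ≡ aug f ℤ.* aug g
  aug-* f g = begin
    aug (f * g)                       ≡⟨ ⟪⟫-mul f g _ ⟩
    ⟪ f , (λ _ → aug g) ⟫             ≡⟨ ⟪⟫-cong f (λ _ → ℤ.*-identityʳ (aug g)) ⟨
    ⟪ f , (λ _ → aug g ℤ.* 1ℤ) ⟫      ≡⟨ ⟪⟫-* f (aug g) _ ⟩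
    aug g ℤ.* aug f                   ≡⟨ ℤ.*-comm (aug g) _ ⟩
    aug f ℤ.* aug g                   ∎
    where open ≡-Reasoning

  x^-expand : ∀ a → ∃ λ h → x^ a ≈ 1# + T * h
  x^-expand zero    = 0# , O.sym (O.trans (O.+-congˡ {1#} (O.zeroʳ T)) (O.+-identityʳ 1#))
  x^-expand (suc a) = go (x^-expand a)
    where
    go : (∃ λ h → x^ a ≈ 1# + T * h) → ∃ λ h → x^ (suc a) ≈ 1# + T * h
    go (h , x^a≈) = 1# + x^ 1 * h , (begin
      x^ 1 * x^ a                      ≈⟨ O.*-congˡ {x^ 1} x^a≈ ⟩
      x^ 1 * (1# + T * h)              ≈⟨ O.distribˡ (x^ 1) 1# (T * h) ⟩
      x^ 1 * 1# + x^ 1 * (T * h)       ≈⟨ O.+-cong {x^ 1 * 1#} {1# + T} (O.trans (O.*-identityʳ (x^ 1)) x≈1+T) xTh ⟩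
      (1# + T) + T * (x^ 1 * h)        ≈⟨ O.+-assoc 1# T _ ⟩
      1# + (T + T * (x^ 1 * h))        ≈⟨ O.+-congˡ {1#} (O.+-congʳ {T * (x^ 1 * h)} {T} (O.sym (O.*-identityʳ T))) ⟩
      1# + (T * 1# + T * (x^ 1 * h))   ≈⟨ O.+-congˡ {1#} (O.sym (O.distribˡ T 1# (x^ 1 * h))) ⟩
      1# + T * (1# + x^ 1 * h)         ∎)
      where
      open SetoidReasoning O.setoid
      x≈1+T : x^ 1 ≈ 1# + T
      x≈1+T = O.sym (O.trans (O.+-comm 1# T) (O.trans (O.+-assoc (x^ 1) (- 1#) 1#)
        (O.trans (O.+-congˡ {x^ 1} (O.-‿inverseˡ 1#)) (O.+-identityʳ (x^ 1)))))
      xTh : x^ 1 * (T * h) ≈ T * (x^ 1 * h)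
      xTh = O.trans (O.sym (O.*-assoc (x^ 1) T h)) (O.trans (O.*-congʳ {h} (O.*-comm (x^ 1) T)) (O.*-assoc T (x^ 1) h))

  aug-expand : ∀ f → ∃ λ h → f ≈ ι (aug f) + T * h
  aug-expand []            = 0# , O.sym (O.trans (O.+-cong {ι 0ℤ} ι-0 (O.zeroʳ T)) (O.+-identityʳ 0#))
  aug-expand ((c , a) ∷ f) = go (x^-expand a) (aug-expand f)
    where
    open SetoidReasoning O.setoid
    open CommutativeSemigroupProperties O.+-commutativeSemigroup using (interchange)
    head≈ : (c , a) ∷ f ≈ ι c * x^ a + f
    head≈ = forms λ φ Vφ → cong (λ d → d ℤ.* φ a ℤ.+ ⟪ f , φ ⟫) (≡.sym (ℤ.*-identityʳ c))
    go : (∃ λ h → x^ a ≈ 1# + T * h) → (∃ λ h → f ≈ ι (aug f) + T * h) →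
         ∃ λ h → (c , a) ∷ f ≈ ι (c ℤ.* 1ℤ ℤ.+ aug f) + T * h
    go (h , x^a≈) (k , f≈) = ι c * h + k , (begin
      (c , a) ∷ f                                  ≈⟨ head≈ ⟩
      ι c * x^ a + f                               ≈⟨ O.+-cong {ι c * x^ a} (O.*-congˡ {ι c} x^a≈) f≈ ⟩
      ι c * (1# + T * h) + (ι (aug f) + T * k)     ≈⟨ O.+-congʳ {ι (aug f) + T * k} (O.distribˡ (ι c) 1# (T * h)) ⟩
      ι c * 1# + ι c * (T * h) + (ι (aug f) + T * k)
        ≈⟨ interchange (ι c * 1#) _ (ι (aug f)) _ ⟩
      (ι c * 1# + ι (aug f)) + (ι c * (T * h) + T * k)
        ≈⟨ O.+-cong {ι c * 1# + ι (aug f)} (O.sym (ι-+ (c ℤ.* 1ℤ) (aug f)))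
             (O.+-congʳ {T * k} (O.trans (O.sym (O.*-assoc (ι c) T h)) (O.trans (O.*-congʳ {h} (O.*-comm (ι c) T)) (O.*-assoc T (ι c) h)))) ⟩
      ι (c ℤ.* 1ℤ ℤ.+ aug f) + (T * (ι c * h) + T * k)
        ≈⟨ O.+-congˡ {ι (c ℤ.* 1ℤ ℤ.+ aug f)} (O.sym (O.distribˡ T (ι c * h) k)) ⟩
      ι (c ℤ.* 1ℤ ℤ.+ aug f) + T * (ι c * h + k)   ∎)

  T∣_ : Formal → Set
  T∣ f = ∃ λ h → f ≈ T * h

  -- Σ_{i<p} x^{iq} vanishes and has augmentation p.
  T∣ιp : T∣ ι (+ p)
  T∣ιp = go (aug-expand Φ)
    where
    Φ< : ℕ → ℕ → Formal
    Φ< zero    a = []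
    Φ< (suc k) a = (1ℤ , a) ∷ Φ< k (q ℕ.+ a)
    Φ = Φ< p 0
    Φ<-⟪⟫ : ∀ k a φ → ⟪ Φ< k a , φ ⟫ ≡ Σ< k λ i → φ (a ℕ.+ i ℕ.* q)
    Φ<-⟪⟫ zero    a φ = ≡.refl
    Φ<-⟪⟫ (suc k) a φ = cong₂ ℤ._+_
      (≡.trans (ℤ.*-identityˡ _) (cong φ (≡.sym (ℕ.+-identityʳ a))))
      (≡.trans (Φ<-⟪⟫ k (q ℕ.+ a) φ) (Σ<-cong k λ i _ → cong φ
        (≡.trans (cong (ℕ._+ i ℕ.* q) (ℕ.+-comm q a)) (ℕ.+-assoc a q _))))
    Φ≈0 : Φ ≈ 0#
    Φ≈0 = forms λ φ Vφ → ≡.trans (Φ<-⟪⟫ p 0 φ) (Vφ 0)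
    aug-Φ : aug Φ ≡ + p
    aug-Φ = ≡.trans (Φ<-⟪⟫ p 0 _) (≡.trans (Σ<-const p 1ℤ) (ℤ.*-identityʳ (+ p)))
    go : (∃ λ h → Φ ≈ ι (aug Φ) + T * h) → T∣ ι (+ p)
    go (h , Φ≈) = - h , (begin
      ι (+ p)                            ≈⟨ O.reflexive (cong ι aug-Φ) ⟨
      ι (aug Φ)                          ≈⟨ GroupProperties.inverseˡ-unique (AbelianGroup.group O.+-abelianGroup) _ _ (O.trans (O.sym Φ≈) Φ≈0) ⟩
      - (T * h)                          ≈⟨ RingProperties.-‿distribʳ-* O.ring T h ⟩
      T * - h                            ∎)
      where open SetoidReasoning O.setoid

  p∣aug⇒T∣ : ∀ f → + p ∣ℤ aug f → T∣ f
  p∣aug⇒T∣ f (divides k aug≡) = go (aug-expand f) T∣ιp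
    where
    open SetoidReasoning O.setoid
    go : (∃ λ h → f ≈ ι (aug f) + T * h) → T∣ ι (+ p) → T∣ f
    go (h , f≈) (j , ιp≈) = ι k * j + h , (begin
      f                                  ≈⟨ f≈ ⟩
      ι (aug f) + T * h                  ≈⟨ O.+-congʳ {T * h} (O.reflexive (cong ι aug≡)) ⟩
      ι k * ι (+ p) + T * h              ≈⟨ O.+-congʳ {T * h} (O.*-congˡ {ι k} ιp≈) ⟩
      ι k * (T * j) + T * h              ≈⟨ O.+-congʳ {T * h} (O.trans (O.sym (O.*-assoc (ι k) T j)) (O.trans (O.*-congʳ {j} (O.*-comm (ι k) T)) (O.*-assoc T (ι k) j))) ⟩
      T * (ι k * j) + T * h              ≈⟨ O.distribˡ T (ι k * j) h ⟨
      T * (ι k * j + h)                  ∎)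

  -- The form 1 − p [ p ∣ ⌊a/q⌋ ] is congruent to the augmentation modulo p.
  ≈0⇒p∣aug : ∀ f → f ≈ 0# → + p ∣ℤ aug f
  ≈0⇒p∣aug f f≈0 = divides ⟪ f , ψ ⟫ (ℤ.i-j≡0⇒i≡j _ _ (begin
    aug f ℤ.- ⟪ f , ψ ⟫ ℤ.* + p                         ≡⟨ lemma (aug f) ⟪ f , ψ ⟫ (+ p) ⟩
    aug f ℤ.+ (ℤ.- + p) ℤ.* ⟪ f , ψ ⟫                   ≡⟨ cong (ℤ._+_ (aug f)) (⟪⟫-* f (ℤ.- + p) ψ) ⟨
    aug f ℤ.+ ⟪ f , (λ a → (ℤ.- + p) ℤ.* ψ a) ⟫         ≡⟨ ⟪⟫-+ f (λ _ → 1ℤ) _ ⟨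
    ⟪ f , (λ a → 1ℤ ℤ.+ (ℤ.- + p) ℤ.* ψ a) ⟫            ≡⟨ on f≈0 _ vanishing ⟩
    0ℤ                                                  ∎))
    where
    open ≡-Reasoning
    lemma : ∀ x y z → x ℤ.- y ℤ.* z ≡ x ℤ.+ (ℤ.- z) ℤ.* y
    lemma = solve-∀
    ψ : ℕ → ℤ
    ψ a = δ p 0 (a / q)
    floor : ∀ a i → (a ℕ.+ i ℕ.* q) / q ≡ a / q ℕ.+ i
    floor a i = ≡.trans (ℕ.+-distrib-/-∣ʳ a (ℕ∣.n∣m*n i)) (cong (a / q ℕ.+_) (ℕ.m*n/n≡m i q))
    vanishing : Vanishing (λ a → 1ℤ ℤ.+ (ℤ.- + p) ℤ.* ψ a)
    vanishing a = begin
      Σ< p (λ i → 1ℤ ℤ.+ (ℤ.- + p) ℤ.* ψ (a ℕ.+ i ℕ.* q))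
        ≡⟨ Σ<-+ p (λ _ → 1ℤ) _ ⟩
      Σ< p (λ _ → 1ℤ) ℤ.+ Σ< p (λ i → (ℤ.- + p) ℤ.* ψ (a ℕ.+ i ℕ.* q))
        ≡⟨ cong₂ ℤ._+_ (Σ<-const p 1ℤ) (Σ<-* p (ℤ.- + p) _) ⟩
      + p ℤ.* 1ℤ ℤ.+ (ℤ.- + p) ℤ.* Σ< p (λ i → ψ (a ℕ.+ i ℕ.* q))
        ≡⟨ cong (λ s → + p ℤ.* 1ℤ ℤ.+ (ℤ.- + p) ℤ.* s) (≡.trans (Σ<-cong p λ i _ → cong (δ p 0) (floor a i)) (Σ<-δ p (a / q))) ⟩
      + p ℤ.* 1ℤ ℤ.+ (ℤ.- + p) ℤ.* 1ℤ   ≡⟨ lemma′ (+ p) ⟩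
      0ℤ ∎
      where
      lemma′ : ∀ x → x ℤ.* 1ℤ ℤ.+ (ℤ.- x) ℤ.* 1ℤ ≡ 0ℤ
      lemma′ = solve-∀

  x^-^ : ∀ a k → x^ a ^ k ≈ x^ (k ℕ.* a)
  x^-^ a zero    = O.refl
  x^-^ a (suc k) = O.*-congˡ {x^ a} (x^-^ a k)

  -- T^{pq} ≡ x^{pq} − 1 = 0 modulo p.
  T^pq : ∃ λ h → T ^ (p ℕ.* q) ≈ P * h
  T^pq = go (frobenius (suc n) T)
    where
    open SetoidReasoning O.setoid
    x^pq≈1 : x^ (p ℕ.* q) ≈ 1#
    x^pq≈1 = forms λ φ Vφ → cong (λ x → 1ℤ ℤ.* x ℤ.+ 0ℤ) (Vanishing-period {φ} Vφ 0)
    1+T≈x : 1# + T ≈ x^ 1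
    1+T≈x = O.trans (O.+-comm 1# T) (O.trans (O.+-assoc (x^ 1) (- 1#) 1#)
      (O.trans (O.+-congˡ {x^ 1} (O.-‿inverseˡ 1#)) (O.+-identityʳ (x^ 1))))
    go : (1# + T) ^ (p ℕ.* q) ≡ₚ 1# + T ^ (p ℕ.* q) → ∃ λ h → T ^ (p ℕ.* q) ≈ P * h
    go (h ∥ eq) = - h , O.trans
      (GroupProperties.inverseˡ-unique (AbelianGroup.group O.+-abelianGroup) _ _
        (GroupProperties.identityʳ-unique (AbelianGroup.group O.+-abelianGroup) 1# _ (begin
          1# + (T ^ (p ℕ.* q) + P * h)   ≈⟨ O.+-assoc 1# (T ^ (p ℕ.* q)) (P * h) ⟨
          1# + T ^ (p ℕ.* q) + P * h     ≈⟨ eq ⟨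
          (1# + T) ^ (p ℕ.* q)           ≈⟨ ^-congˡ (p ℕ.* q) 1+T≈x ⟩
          x^ 1 ^ (p ℕ.* q)               ≈⟨ x^-^ 1 (p ℕ.* q) ⟩
          x^ (p ℕ.* q ℕ.* 1)             ≈⟨ O.reflexive (cong x^ (ℕ.*-identityʳ (p ℕ.* q))) ⟩
          x^ (p ℕ.* q)                   ≈⟨ x^pq≈1 ⟩
          1#                             ∎)))
      (RingProperties.-‿distribʳ-* O.ring P h)

  ⟪⟫-P* : ∀ f φ → ⟪ P * f , φ ⟫ ≡ + p ℤ.* ⟪ f , φ ⟫
  ⟪⟫-P* f φ = begin
    ⟪ P * f , φ ⟫                                         ≡⟨ ⟪⟫-mul P f φ ⟩
    ⟪ P , (λ a → ⟪ f , (λ b → φ (a ℕ.+ b)) ⟫) ⟫           ≡⟨ ⟪⟫-× p 1# _ ⟩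
    + p ℤ.* (1ℤ ℤ.* ⟪ f , φ ⟫ ℤ.+ 0ℤ)                     ≡⟨ cong (+ p ℤ.*_) (≡.trans (ℤ.+-identityʳ _) (ℤ.*-identityˡ _)) ⟩
    + p ℤ.* ⟪ f , φ ⟫                                     ∎
    where open ≡-Reasoning

  T^∣_ : ℕ → Formal → Set
  (T^∣ k) f = ∃ λ h → f ≈ T ^ k * h

  -- By `T^pq`, each factor T^{pq} yields a factor p. Divisibility by powers of T is thereby bounded
  -- through divisibility in ℤ.
  T^kpq⇒p^k : ∀ k f → (T^∣ (k ℕ.* (p ℕ.* q))) f → ∀ φ → Vanishing φ → + (p ℕ.^ k) ∣ℤ ⟪ f , φ ⟫
  T^kpq⇒p^k zero    f _        φ Vφ = divides ⟪ f , φ ⟫ (≡.sym (ℤ.*-identityʳ _))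
  T^kpq⇒p^k (suc k) f (h , f≈) φ Vφ = go T^pq
    where
    open SetoidReasoning O.setoid
    go : (∃ λ h → T ^ (p ℕ.* q) ≈ P * h) → + (p ℕ.^ suc k) ∣ℤ ⟪ f , φ ⟫
    go (j , T^≈) = ≡.subst₂ _∣ℤ_ (≡.sym (ℤ.pos-* p (p ℕ.^ k)))
      (≡.sym (≡.trans (on f≈P* φ Vφ) (⟪⟫-P* _ φ)))
      (ℤ∣.*-monoʳ-∣ (+ p) (T^kpq⇒p^k k (T ^ (k ℕ.* (p ℕ.* q)) * (j * h)) (j * h , O.refl) φ Vφ))
      where
      f≈P* : f ≈ P * (T ^ (k ℕ.* (p ℕ.* q)) * (j * h))
      f≈P* = begin
        f                                                       ≈⟨ f≈ ⟩
        T ^ (p ℕ.* q ℕ.+ k ℕ.* (p ℕ.* q)) * h                   ≈⟨ O.*-congʳ {h} (^-homo-* T (p ℕ.* q) (k ℕ.* (p ℕ.* q))) ⟩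
        T ^ (p ℕ.* q) * T ^ (k ℕ.* (p ℕ.* q)) * h               ≈⟨ O.*-congʳ {h} (O.*-congʳ {T ^ (k ℕ.* (p ℕ.* q))} T^≈) ⟩
        P * j * T ^ (k ℕ.* (p ℕ.* q)) * h                       ≈⟨ SemiringIdentities.pjth≈p[t[jh]] ring P j (T ^ (k ℕ.* (p ℕ.* q))) h ⟩
        P * (T ^ (k ℕ.* (p ℕ.* q)) * (j * h))                   ∎

  private
    k<p^k : ∀ k → k < p ℕ.^ k
    k<p^k zero    = s≤s z≤n
    k<p^k (suc k) = ℕ.<-≤-trans (s≤s (k<p^k k)) (ℕ.≤-trans (ℕ.+-monoˡ-≤ (p ℕ.^ k) (ℕ.m^n>0 p k))
      (≡.subst (ℕ._≤ p ℕ.^ suc k) (cong (p ℕ.^ k ℕ.+_) (ℕ.+-identityʳ _)) (ℕ.*-monoˡ-≤ (p ℕ.^ k) p>1)))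

  T^-bounded : ∀ f → ¬ f ≈ 0# → ∃ λ k → ¬ (T^∣ k) f
  T^-bounded f f≉0 = go (em {∃ λ φ → Vanishing φ × ⟪ f , φ ⟫ ≢ 0ℤ})
    where
    go : Dec (∃ λ φ → Vanishing φ × ⟪ f , φ ⟫ ≢ 0ℤ) → ∃ λ k → ¬ (T^∣ k) f
    go (no ¬φ) = contradiction (forms λ φ Vφ → decide φ Vφ (⟪ f , φ ⟫ ℤ.≟ 0ℤ)) f≉0
      where
      decide : ∀ φ → Vanishing φ → Dec (⟪ f , φ ⟫ ≡ 0ℤ) → ⟪ f , φ ⟫ ≡ 0ℤ
      decide φ Vφ (yes ≡0) = ≡0
      decide φ Vφ (no ≢0)  = contradiction (φ , Vφ , ≢0) ¬φ
    -- With N the absolute value of a non-zero value of f, N < pᴺ, so pᴺ cannot divide that value.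
    go (yes (φ , Vφ , ≢0)) = N ℕ.* (p ℕ.* q) , λ div → ℕ.<⇒≱ (k<p^k N)
      (ℕ∣.∣⇒≤ {{ℕ.≢-nonZero (≢0 ∘ ℤ.∣i∣≡0⇒i≡0)}} (ℤ∣.∣⇒∣ᵤ (T^kpq⇒p^k N f div φ Vφ)))
      where
      N = ∣ ⟪ f , φ ⟫ ∣

  T-order : ∀ k f → ¬ (T^∣ k) f → ∃₂ λ a f′ → f ≈ T ^ a * f′ × ¬ (T∣ f′)
  T-order zero    f ¬div = contradiction (f , O.sym (O.*-identityˡ f)) ¬div
  T-order (suc k) f ¬div = go (em {(T^∣ k) f})
    where
    go : Dec ((T^∣ k) f) → ∃₂ λ a f′ → f ≈ T ^ a * f′ × ¬ (T∣ f′)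
    go (no ¬div′)     = T-order k f ¬div′
    go (yes (h , f≈)) = k , h , f≈ , λ (j , h≈) → ¬div (j , O.trans f≈ (O.trans (O.*-congˡ {T ^ k} h≈)
      (O.trans (O.sym (O.*-assoc (T ^ k) T j)) (O.*-congʳ {j} (O.*-comm (T ^ k) T)))))

  T^-regular : ∀ a f → T ^ a * f ≈ 0# → f ≈ 0#
  T^-regular zero    f eq = O.trans (O.sym (O.*-identityˡ f)) eq
  T^-regular (suc a) f eq = T^-regular a f (T-regular _ (O.trans (O.sym (O.*-assoc T (T ^ a) f)) eq))

  -- Non-zero f and g are powers of T times f′ and g′ not divisible by T. As T is regular, f g = 0
  -- gives f′ g′ = 0, so p divides aug f′ · aug g′ and, by Euclid's lemma, T divides f′ or g′.
  domain : ∀ f g → f * g ≈ 0# → f ≈ 0# ⊎ g ≈ 0#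
  domain f g fg≈0 = decide (em {f ≈ 0#}) (em {g ≈ 0#})
    where
    Order : Formal → Set
    Order f = ∃₂ λ a f′ → f ≈ T ^ a * f′ × ¬ (T∣ f′)
    order : ∀ f → (∃ λ k → ¬ (T^∣ k) f) → Order f
    order f (k , ¬div) = T-order k f ¬div
    absurd : Order f → Order g → f ≈ 0# ⊎ g ≈ 0#
    absurd (a , f′ , f≈ , T∤f′) (b , g′ , g≈ , T∤g′) =
      [ (λ p∣ → contradiction (p∣aug⇒T∣ f′ (ℤ∣.∣ᵤ⇒∣ p∣)) T∤f′) , (λ p∣ → contradiction (p∣aug⇒T∣ g′ (ℤ∣.∣ᵤ⇒∣ p∣)) T∤g′) ]′
      (euclidsLemma ∣ aug f′ ∣ ∣ aug g′ ∣ pp (≡.subst (p ∣_) (ℤ.abs-* (aug f′) (aug g′))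
        (ℤ∣.∣⇒∣ᵤ (∣ℤ-resp (aug-* f′ g′) (≈0⇒p∣aug (f′ * g′) f′g′≈0)))))
      where
      f′g′≈0 : f′ * g′ ≈ 0#
      f′g′≈0 = T^-regular b (f′ * g′) (T^-regular a (T ^ b * (f′ * g′)) (O.trans
        (SemiringIdentities.u[v[fg]]≈[uf][vg] ring (T ^ a) (T ^ b) f′ g′)
        (O.trans (O.sym (O.*-cong {f} f≈ g≈)) fg≈0)))
    decide : Dec (f ≈ 0#) → Dec (g ≈ 0#) → f ≈ 0# ⊎ g ≈ 0#
    decide (yes f≈0) _         = inj₁ f≈0
    decide (no f≉0)  (yes g≈0) = inj₂ g≈0
    decide (no f≉0)  (no g≉0)  = absurd
      (order f (T^-bounded f f≉0)) (order g (T^-bounded g g≉0))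

-- Periodic words

module _ {A : Set} where

  -- Cyclic words are treated as periodic functions on ℕ: rotating a word is shifting the argument,
  -- and an m-fold word is the same function read over m periods.
  Per : (ℕ → A) → ℕ → Set
  Per W d = ∀ i → W (i ℕ.+ d) ≡ W i

  Per-multiple : ∀ {W d} k → Per W d → Per W (k ℕ.* d)
  Per-multiple {W} zero per i = cong W (ℕ.+-identityʳ i)
  Per-multiple {W} {d} (suc k) per i = ≡.trans (cong W (≡.sym (ℕ.+-assoc i d (k ℕ.* d))))
    (≡.trans (Per-multiple k per (i ℕ.+ d)) (per i))

  Per-∸ : ∀ {W a b} → Per W a → Per W (b ℕ.+ a) → Per W b
  Per-∸ {W} {a} {b} pa pb i = ≡.trans (≡.sym (pa (i ℕ.+ b)))
    (≡.trans (cong W (ℕ.+-assoc i b a)) (pb i))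

  Per-shift : ∀ {W d} k → Per W d → Per (λ i → W (k ℕ.+ i)) d
  Per-shift {W} {d} k per i = ≡.trans (cong W (≡.sym (ℕ.+-assoc k i d))) (per (k ℕ.+ i))

  -- The period n moves any argument i to i + n ≥ k, where the period of the shifted word is
  -- available.
  Per-unshift : ∀ {W d n} k → Per W n → k ≤ n → Per (λ i → W (k ℕ.+ i)) d → Per W d
  Per-unshift {W} {d} {n} k pn k≤n per i = begin
    W (i ℕ.+ d)                        ≡⟨ pn (i ℕ.+ d) ⟨
    W (i ℕ.+ d ℕ.+ n)                  ≡⟨ cong W (lemma d) ⟨
    W (k ℕ.+ (i ℕ.+ (n ℕ.∸ k) ℕ.+ d))  ≡⟨ per (i ℕ.+ (n ℕ.∸ k)) ⟩
    W (k ℕ.+ (i ℕ.+ (n ℕ.∸ k)))        ≡⟨ cong W lemma′ ⟩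
    W (i ℕ.+ n)                        ≡⟨ pn i ⟩
    W i                                ∎
    where
    open ≡-Reasoning
    lemma′ : k ℕ.+ (i ℕ.+ (n ℕ.∸ k)) ≡ i ℕ.+ n
    lemma′ = ≡.trans (ℕ.+-comm k _) (≡.trans (ℕ.+-assoc i (n ℕ.∸ k) k) (cong (i ℕ.+_) (ℕ.m∸n+n≡m k≤n)))
    lemma : ∀ d → k ℕ.+ (i ℕ.+ (n ℕ.∸ k) ℕ.+ d) ≡ i ℕ.+ d ℕ.+ n
    lemma d = ≡.trans (≡.sym (ℕ.+-assoc k _ d)) (≡.trans (cong (ℕ._+ d) lemma′)
      (≡.trans (ℕ.+-assoc i n d) (≡.trans (cong (i ℕ.+_) (ℕ.+-comm n d)) (≡.sym (ℕ.+-assoc i d n)))))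

  Per-% : ∀ {W n} .{{_ : NonZero n}} → Per W n → ∀ i → W (i % n) ≡ W i
  Per-% {W} {n} per i = ≡.trans (≡.sym (Per-multiple (i / n) per (i % n))) (cong W (≡.sym (ℕ.m≡m%n+[m/n]*n i n)))

  Per-agree : ∀ {V W n} → 1 ≤ n → Per V n → Per W n → (∀ i → i < n → V i ≡ W i) → V ≗ W
  Per-agree {n = suc n} _ pV pW V≡W i = ≡.trans (≡.sym (Per-% pV i))
    (≡.trans (V≡W _ (ℕ.m%n<n i (suc n))) (Per-% pW i))

  Per-≗ : ∀ {V W d} → V ≗ W → Per V d → Per W d
  Per-≗ V≗W per i = ≡.trans (≡.sym (V≗W _)) (≡.trans (per i) (V≗W i))

  applyUpTo-cong : ∀ {V W : ℕ → A} n → (∀ i → i < n → V i ≡ W i) → applyUpTo V n ≡ applyUpTo W n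
  applyUpTo-cong zero    V≡W = ≡.refl
  applyUpTo-cong (suc n) V≡W = cong₂ _∷_ (V≡W 0 (s≤s z≤n)) (applyUpTo-cong n λ i i<n → V≡W (suc i) (s≤s i<n))

  applyUpTo-injective : ∀ {V W : ℕ → A} n → applyUpTo V n ≡ applyUpTo W n → ∀ i → i < n → V i ≡ W i
  applyUpTo-injective (suc n) eq zero    i<n       = List.∷-injectiveˡ eq
  applyUpTo-injective (suc n) eq (suc i) (s≤s i<n) = applyUpTo-injective n (List.∷-injectiveʳ eq) i i<n

  applyUpTo-+ : ∀ (W : ℕ → A) a b → applyUpTo W (a ℕ.+ b) ≡ applyUpTo W a ++ applyUpTo (λ i → W (a ℕ.+ i)) b
  applyUpTo-+ W zero    b = ≡.refl
  applyUpTo-+ W (suc a) b = cong (W 0 ∷_) (applyUpTo-+ (W ∘ suc) a b)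

  concat-replicate : ∀ {W d} → Per W d → ∀ k → concat (replicate k (applyUpTo W d)) ≡ applyUpTo W (k ℕ.* d)
  concat-replicate             per zero    = ≡.refl
  concat-replicate {W} {d} per (suc k) = ≡.trans (cong (applyUpTo W d ++_) (concat-replicate per k))
    (≡.trans (cong (applyUpTo W d ++_) (applyUpTo-cong (k ℕ.* d) λ i _ →
      ≡.trans (≡.sym (per i)) (cong W (ℕ.+-comm i d)))) (≡.sym (applyUpTo-+ W d (k ℕ.* d))))

  take-applyUpTo : ∀ (W : ℕ → A) a b → take a (applyUpTo W (a ℕ.+ b)) ≡ applyUpTo W a
  take-applyUpTo W zero    b = ≡.refl
  take-applyUpTo W (suc a) b = cong (W 0 ∷_) (take-applyUpTo (W ∘ suc) a b)

  drop-applyUpTo : ∀ (W : ℕ → A) a b → drop a (applyUpTo W (a ℕ.+ b)) ≡ applyUpTo (λ i → W (a ℕ.+ i)) b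
  drop-applyUpTo W zero    b = ≡.refl
  drop-applyUpTo W (suc a) b = drop-applyUpTo (W ∘ suc) a b

  rotate-applyUpTo : ∀ {W n} → Per W n → ∀ k → k ≤ n →
    drop k (applyUpTo W n) ++ take k (applyUpTo W n) ≡ applyUpTo (λ i → W (k ℕ.+ i)) n
  rotate-applyUpTo {W} {n} per k k≤n = go (n ℕ.∸ k) (ℕ.m+[n∸m]≡n k≤n)
    where
    go : ∀ j → k ℕ.+ j ≡ n →
      drop k (applyUpTo W n) ++ take k (applyUpTo W n) ≡ applyUpTo (λ i → W (k ℕ.+ i)) n
    go j ≡.refl = begin
      drop k (applyUpTo W n) ++ take k (applyUpTo W n)
        ≡⟨ cong₂ _++_ (drop-applyUpTo W k j) (take-applyUpTo W k j) ⟩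
      applyUpTo (λ i → W (k ℕ.+ i)) j ++ applyUpTo W k
        ≡⟨ cong (applyUpTo (λ i → W (k ℕ.+ i)) j ++_) (applyUpTo-cong k λ i _ →
             ≡.trans (≡.sym (per i)) (cong W (≡.trans (ℕ.+-comm i n) (ℕ.+-assoc k j i)))) ⟩
      applyUpTo (λ i → W (k ℕ.+ i)) j ++ applyUpTo (λ i → W (k ℕ.+ (j ℕ.+ i))) k
        ≡⟨ applyUpTo-+ (λ i → W (k ℕ.+ i)) j k ⟨
      applyUpTo (λ i → W (k ℕ.+ i)) (j ℕ.+ k)
        ≡⟨ cong (applyUpTo (λ i → W (k ℕ.+ i))) (ℕ.+-comm j k) ⟩
      applyUpTo (λ i → W (k ℕ.+ i)) n ∎
      where open ≡-Reasoning

  private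
    nth : A → List A → ℕ → A
    nth d []       i       = d
    nth d (x ∷ xs) zero    = x
    nth d (x ∷ xs) (suc i) = nth d xs i

    applyUpTo-nth : ∀ d xs → applyUpTo (nth d xs) (length xs) ≡ xs
    applyUpTo-nth d []       = ≡.refl
    applyUpTo-nth d (x ∷ xs) = cong (x ∷_) (applyUpTo-nth d xs)

  cyc : A → List A → ℕ → A
  cyc e es i = nth e (e ∷ es) (i % suc (length es))

  Per-cyc : ∀ e es → Per (cyc e es) (suc (length es))
  Per-cyc e es i = cong (nth e (e ∷ es)) (ℕ.[m+n]%n≡m%n i (suc (length es)))

  applyUpTo-cyc : ∀ e es → applyUpTo (cyc e es) (suc (length es)) ≡ e ∷ es
  applyUpTo-cyc e es = ≡.trans (applyUpTo-cong (suc (length es)) λ i i<n → cong (nth e (e ∷ es)) (ℕ.m<n⇒m%n≡m i<n))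
    (applyUpTo-nth e (e ∷ es))

  Least : (ℕ → A) → ℕ → Set
  Least W d = 1 ≤ d × Per W d × (∀ e → 1 ≤ e → Per W e → d ≤ e)

  Least-unique : ∀ {W d e} → Least W d → Least W e → d ≡ e
  Least-unique (1≤d , pd , d≤) (1≤e , pe , e≤) = ℕ.≤-antisym (d≤ _ 1≤e pe) (e≤ _ 1≤d pd)

  Least-≗ : ∀ {V W d} → V ≗ W → Least V d → Least W d
  Least-≗ V≗W (1≤d , pd , d≤) = 1≤d , Per-≗ V≗W pd , λ e 1≤e pe → d≤ e 1≤e (Per-≗ (≡.sym ∘ V≗W) pe)

  -- The remainder of n modulo d is again a period, smaller than d.
  Least-∣ : ∀ {W d n} → Least W d → Per W n → d ∣ n
  Least-∣ {W} {suc d} {n} (_ , pd , d≤) pn = ℕ∣.m%n≡0⇒n∣m n (suc d) (r≡0 (n % suc d) (ℕ.m%n<n n (suc d)) per-r)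
    where
    per-r : Per W (n % suc d)
    per-r = Per-∸ {b = n % suc d} (Per-multiple (n / suc d) pd) (≡.subst (Per W) (ℕ.m≡m%n+[m/n]*n n (suc d)) pn)
    r≡0 : ∀ r → r < suc d → Per W r → r ≡ 0
    r≡0 zero    r<d pr = ≡.refl
    r≡0 (suc r) r<d pr = contradiction (d≤ (suc r) (s≤s z≤n) pr) (ℕ.<⇒≱ r<d)

  leastPeriod : ExcludedMiddle 0ℓ → ∀ {W n} → 1 ≤ n → Per W n → ∃ (Least W)
  leastPeriod em {W} {n} = <-rec (λ n → 1 ≤ n → Per W n → ∃ (Least W)) step n
    where
    step : ∀ n → (∀ {m} → m < n → 1 ≤ m → Per W m → ∃ (Least W)) → 1 ≤ n → Per W n → ∃ (Least W)
    step n rec 1≤n pn = go (em {∃ λ e → e < n × 1 ≤ e × Per W e})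
      where
      go : Dec (∃ λ e → e < n × 1 ≤ e × Per W e) → ∃ (Least W)
      go (yes (e , e<n , 1≤e , pe)) = rec e<n 1≤e pe
      go (no ¬e) = n , 1≤n , pn , λ e 1≤e pe → ℕ.≮⇒≥ λ e<n → ¬e (e , e<n , 1≤e , pe)

Linked-applyUpTo⁻ : ∀ {A : Set} {R : A → A → Set} (W : ℕ → A) n → Linked R (applyUpTo W (suc n)) →
  ∀ i → i < n → R (W i) (W (suc i))
Linked-applyUpTo⁻ W (suc n) (r ∷ rs) zero    i<n       = r
Linked-applyUpTo⁻ W (suc n) (r ∷ rs) (suc i) (s≤s i<n) = Linked-applyUpTo⁻ (W ∘ suc) n rs i i<n

-- Prime cycles

module Cycles (em : ExcludedMiddle 0ℓ) (Y : Digraph) where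
  open Digraph Y using (E; o; t; edges; E↔Fin; #E)

  Walk : (ℕ → E) → Set
  Walk W = ∀ i → t (W i) ≡ o (W (suc i))

  private
    ∷ʳ-applyUpTo : ∀ {W : ℕ → E} n → Per W (suc n) →
      W 0 ∷ applyUpTo (W ∘ suc) n ++ W 0 ∷ [] ≡ applyUpTo W (suc (suc n))
    ∷ʳ-applyUpTo {W} n per = ≡.trans (cong (applyUpTo W (suc n) ∷ʳ_) (≡.sym (per 0))) (List.applyUpTo-∷ʳ W (suc n))

  IsCycle⇒Walk : ∀ {W} n → Per W n → IsCycle Y (applyUpTo W n) → Walk W
  IsCycle⇒Walk {W} (suc n) per cycle i = ≡.subst₂ (λ e f → t e ≡ o f) (Per-% per i) suc-%
    (Linked-applyUpTo⁻ W (suc n) (≡.subst (Linked (λ e f → t e ≡ o f)) (∷ʳ-applyUpTo n per) cycle)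
      (i % suc n) (ℕ.m%n<n i (suc n)))
    where
    suc-% : W (suc (i % suc n)) ≡ W (suc i)
    suc-% = ≡.trans (≡.sym (Per-multiple (i / suc n) per (suc (i % suc n))))
      (cong (W ∘ suc) (≡.sym (ℕ.m≡m%n+[m/n]*n i (suc n))))

  Walk⇒IsCycle : ∀ {W} n → 1 ≤ n → Per W n → Walk W → IsCycle Y (applyUpTo W n)
  Walk⇒IsCycle {W} (suc n) _ per walk = ≡.subst (Linked (λ e f → t e ≡ o f)) (≡.sym (∷ʳ-applyUpTo n per))
    (Linked.applyUpTo⁺₂ W (suc (suc n)) walk)

  word : ∀ c → 1 ≤ length c → ∃ λ (W : ℕ → E) → Per W (length c) × applyUpTo W (length c) ≡ c
  word (e ∷ es) _ = cyc e es , Per-cyc e es , applyUpTo-cyc e es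

  IsCycle⇒1≤ : ∀ c → IsCycle Y c → 1 ≤ length c
  IsCycle⇒1≤ (e ∷ es) _ = s≤s z≤n

  -- The length of the prime cycle of which a cycle is a multiple. The value at the empty list is
  -- arbitrary, cycles being non-empty.
  root : List E → ℕ
  root []       = 0
  root (e ∷ es) = proj₁ (leastPeriod em (s≤s z≤n) (Per-cyc e es))

  root-applyUpTo : ∀ {W d} n → 1 ≤ n → Per W n → Least W d → root (applyUpTo W n) ≡ d
  root-applyUpTo {W} {d} (suc n) 1≤n per least =
    Least-unique (proj₂ (leastPeriod em (s≤s z≤n) (Per-cyc _ _))) (Least-≗ W≗ least)
    where
    es = applyUpTo (W ∘ suc) n
    len : suc (length es) ≡ suc n
    len = List.length-applyUpTo W (suc n)
    W≗ : W ≗ cyc (W 0) es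
    W≗ = Per-agree (s≤s z≤n) per (≡.subst (Per (cyc (W 0) es)) len (Per-cyc (W 0) es))
      (applyUpTo-injective (suc n) (≡.sym (≡.trans (cong (applyUpTo (cyc (W 0) es)) (≡.sym len)) (applyUpTo-cyc (W 0) es))))

  -- The least period divides n; if it were a proper divisor, one least period of W would be a cycle
  -- with the given one as a multiple.
  Prime⇒Least : ∀ {W} n → 1 ≤ n → Per W n → IsPrime Y (applyUpTo W n) → Least W n
  Prime⇒Least {W} n 1≤n per (cycle , ¬multiple) = go (leastPeriod em 1≤n per)
    where
    go : ∃ (Least W) → Least W n
    go (d , least@(1≤d , pd , _)) = split (Least-∣ least per)
      where
      split : d ∣ n → Least W n
      split (divides 0             n≡) = contradiction (≡.subst (1 ≤_) n≡ 1≤n) λ ()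
      split (divides 1             n≡) = ≡.subst (Least W) (≡.sym (≡.trans n≡ (ℕ.*-identityˡ d))) least
      split (divides (suc (suc k)) n≡) = ⊥-elim (¬multiple
        (suc (suc k) , applyUpTo W d , s≤s (s≤s z≤n) ,
         Walk⇒IsCycle d 1≤d pd (IsCycle⇒Walk n per cycle) ,
         ≡.trans (cong (applyUpTo W) n≡) (≡.sym (concat-replicate pd (suc (suc k))))))

  Least⇒Prime : ∀ {W} n → Walk W → Least W n → IsPrime Y (applyUpTo W n)
  Least⇒Prime {W} n walk (1≤n , per , n≤) = Walk⇒IsCycle n 1≤n per walk , ¬multiple
    where
    ¬multiple : ¬ IsMultiple Y (applyUpTo W n)
    ¬multiple (k , c′ , 2≤k , cycle′ , eq) = go (word c′ (IsCycle⇒1≤ c′ cycle′))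
      where
      d = length c′
      1≤d = IsCycle⇒1≤ c′ cycle′
      go : (∃ λ W → Per W d × applyUpTo W d ≡ c′) → ⊥
      go (V , pV , V≡c′) = ℕ.<⇒≱ d<n (n≤ d 1≤d (Per-≗ (≡.sym ∘ W≗V) pV))
        where
        W≡V : applyUpTo W n ≡ applyUpTo V (k ℕ.* d)
        W≡V = ≡.trans eq (≡.trans (cong (λ c → concat (replicate k c)) (≡.sym V≡c′)) (concat-replicate pV k))
        n≡kd : n ≡ k ℕ.* d
        n≡kd = ≡.trans (≡.sym (List.length-applyUpTo W n)) (≡.trans (cong length W≡V) (List.length-applyUpTo V (k ℕ.* d)))
        W≗V : W ≗ V
        W≗V = Per-agree 1≤n per (≡.subst (Per V) (≡.sym n≡kd) (Per-multiple k pV))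
          (applyUpTo-injective n (≡.trans W≡V (cong (applyUpTo V) (≡.sym n≡kd))))
        d<n : d < n
        d<n = ≡.subst (d <_) (≡.sym n≡kd) (ℕ.<-≤-trans (ℕ.m<m+n d 1≤d)
          (≡.subst (ℕ._≤ k ℕ.* d) (cong (d ℕ.+_) (ℕ.+-identityʳ d)) (ℕ.*-monoˡ-≤ d 2≤k)))

  edges-unique : Unique edges
  edges-unique = Unique.map⁺ (Injection.injective (↔⇒↣ (↔-sym E↔Fin))) (Unique.allFin⁺ #E)

  ∈-edges : ∀ e → e ∈ edges
  ∈-edges e = ≡.subst (_∈ edges) (Inverse.strictlyInverseʳ E↔Fin e) (Mem.∈-map⁺ _ (Mem.∈-allFin (Inverse.to E↔Fin e)))

  edgeSequences-unique : ∀ n → Unique (edgeSequences Y n)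
  edgeSequences-unique zero    = [] ∷ []
  edgeSequences-unique (suc n) = Unique.cartesianProductWith⁺ _∷_ List.∷-injective edges-unique (edgeSequences-unique n)

  ∈-edgeSequences⁺ : ∀ c → c ∈ edgeSequences Y (length c)
  ∈-edgeSequences⁺ []      = here ≡.refl
  ∈-edgeSequences⁺ (e ∷ c) = Mem.∈-cartesianProductWith⁺ _∷_ (∈-edges e) (∈-edgeSequences⁺ c)

  ∈-edgeSequences⁻ : ∀ n {c} → c ∈ edgeSequences Y n → length c ≡ n
  ∈-edgeSequences⁻ zero    (here ≡.refl) = ≡.refl
  ∈-edgeSequences⁻ (suc n) c∈ = go (Mem.∈-cartesianProductWith⁻ _∷_ edges (edgeSequences Y n) c∈)
    where
    go : ∀ {c} → (∃₂ λ e es → e ∈ edges × es ∈ edgeSequences Y n × c ≡ e ∷ es) → length c ≡ suc n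
    go (e , es , _ , es∈ , ≡.refl) = cong suc (∈-edgeSequences⁻ n es∈)

  cycles primes : ℕ → List (List E)
  cycles n = filter (isCycle? Y) (edgeSequences Y n)
  primes n = filter (isPrime? Y) (edgeSequences Y n)

  cycles-unique : ∀ n → Unique (cycles n)
  cycles-unique n = Unique.filter⁺ (isCycle? Y) (edgeSequences-unique n)

  primes-unique : ∀ n → Unique (primes n)
  primes-unique n = Unique.filter⁺ (isPrime? Y) (edgeSequences-unique n)

  ∈-cycles : ∀ {c n} → length c ≡ n → IsCycle Y c → c ∈ cycles n
  ∈-cycles {c} ≡.refl cycle = Mem.∈-filter⁺ (isCycle? Y) (∈-edgeSequences⁺ c) cycle

  ∈-cycles⁻ : ∀ n {c} → c ∈ cycles n → length c ≡ n × IsCycle Y c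
  ∈-cycles⁻ n c∈ = ∈-edgeSequences⁻ n (proj₁ (Mem.∈-filter⁻ (isCycle? Y) {xs = edgeSequences Y n} c∈)) ,
    proj₂ (Mem.∈-filter⁻ (isCycle? Y) {xs = edgeSequences Y n} c∈)

  ∈-primes : ∀ {c n} → length c ≡ n → IsPrime Y c → c ∈ primes n
  ∈-primes {c} ≡.refl prime = Mem.∈-filter⁺ (isPrime? Y) (∈-edgeSequences⁺ c) prime

  ∈-primes⁻ : ∀ n {c} → c ∈ primes n → length c ≡ n × IsPrime Y c
  ∈-primes⁻ n c∈ = ∈-edgeSequences⁻ n (proj₁ (Mem.∈-filter⁻ (isPrime? Y) {xs = edgeSequences Y n} c∈)) ,
    proj₂ (Mem.∈-filter⁻ (isPrime? Y) {xs = edgeSequences Y n} c∈)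

  record Periodic (n : ℕ) (c : List E) : Set where
    constructor periodic
    field
      {W}      : ℕ → E
      1≤n      : 1 ≤ n
      per      : Per W n
      walk     : Walk W
      c≡       : c ≡ applyUpTo W n
      {d}      : ℕ
      least    : Least W d

  ∈-cycles⇒Periodic : ∀ n {c} → c ∈ cycles n → Periodic n c
  ∈-cycles⇒Periodic n {c} c∈ = go (∈-cycles⁻ n c∈)
    where
    go : length c ≡ n × IsCycle Y c → Periodic n c
    go (≡.refl , cycle) = go′ (word c (IsCycle⇒1≤ c cycle))
      where
      go′ : (∃ λ W → Per W (length c) × applyUpTo W (length c) ≡ c) → Periodic (length c) c
      go′ (W , per , W≡c) = periodic (IsCycle⇒1≤ c cycle) per
        (IsCycle⇒Walk (length c) per (≡.subst (IsCycle Y) (≡.sym W≡c) cycle)) (≡.sym W≡c)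
        (proj₂ (leastPeriod em (IsCycle⇒1≤ c cycle) per))

  Prime⇒Periodic : ∀ n {c} → c ∈ primes n → ∃ λ W → Walk W × Least W n × c ≡ applyUpTo W n
  Prime⇒Periodic n {c} c∈ = go (∈-primes⁻ n c∈)
    where
    go : length c ≡ n × IsPrime Y c → ∃ λ W → Walk W × Least W n × c ≡ applyUpTo W n
    go (≡.refl , prime@(cycle , _)) = go′ (word c 1≤)
      where
      1≤ = IsCycle⇒1≤ c cycle
      go′ : (∃ λ W → Per W (length c) × applyUpTo W (length c) ≡ c) → ∃ λ W → Walk W × Least W (length c) × c ≡ applyUpTo W (length c)
      go′ (W , per , W≡c) = W , IsCycle⇒Walk (length c) per (≡.subst (IsCycle Y) (≡.sym W≡c) cycle) ,
        Prime⇒Least (length c) 1≤ per (≡.subst (IsPrime Y) (≡.sym W≡c) prime) , ≡.sym W≡c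

  root-∣ : ∀ n {c} → c ∈ cycles n → root c ∣ n
  root-∣ n c∈ = go (∈-cycles⇒Periodic n c∈)
    where
    go : ∀ {c} → Periodic n c → root c ∣ n
    go (periodic 1≤n per walk ≡.refl least) =
      ≡.subst (_∣ n) (≡.sym (root-applyUpTo n 1≤n per least)) (Least-∣ least per)

  rooted : ℕ → ℕ → List (List E)
  rooted ℓ n = filter (λ c → root c ℕ.≟ ℓ) (cycles n)

  rooted-∤ : ∀ ℓ n → ¬ (ℓ ∣ n) → length (rooted ℓ n) ≡ 0
  rooted-∤ ℓ n ℓ∤n = go (rooted ℓ n) λ c∈ → Mem.∈-filter⁻ (λ c → root c ℕ.≟ ℓ) {xs = cycles n} c∈
    where
    go : ∀ xs → (∀ {c} → c ∈ xs → c ∈ cycles n × root c ≡ ℓ) → length xs ≡ 0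
    go []       xs∈ = ≡.refl
    go (c ∷ xs) xs∈ = contradiction (≡.subst (_∣ n) (proj₂ (xs∈ (here ≡.refl))) (root-∣ n (proj₁ (xs∈ (here ≡.refl))))) ℓ∤n

  -- k-fold repetition and truncation to the first ℓ edges are inverse to each other.
  rooted-∣ : ∀ ℓ k → 1 ≤ k → length (rooted ℓ (k ℕ.* ℓ)) ≡ length (primes ℓ)
  rooted-∣ ℓ k 1≤k = length-bijection (take ℓ) (λ c → concat (replicate k c))
    (Unique.filter⁺ (λ c → root c ℕ.≟ ℓ) (cycles-unique (k ℕ.* ℓ))) (primes-unique ℓ)
    (λ c∈ → proj₁ (from c∈)) (λ c∈ → proj₂ (from c∈)) (λ c∈ → proj₁ (to c∈)) (λ c∈ → proj₂ (to c∈))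
    where
    kℓ≡ : k ℕ.* ℓ ≡ ℓ ℕ.+ (k ℕ.∸ 1) ℕ.* ℓ
    kℓ≡ = cong (ℕ._* ℓ) (≡.sym (ℕ.m+[n∸m]≡n 1≤k))
    take-kℓ : ∀ (W : ℕ → E) → take ℓ (applyUpTo W (k ℕ.* ℓ)) ≡ applyUpTo W ℓ
    take-kℓ W = ≡.trans (cong (λ n → take ℓ (applyUpTo W n)) kℓ≡) (take-applyUpTo W ℓ _)
    from : ∀ {c} → c ∈ rooted ℓ (k ℕ.* ℓ) → take ℓ c ∈ primes ℓ × concat (replicate k (take ℓ c)) ≡ c
    from {c} c∈ = go (Mem.∈-filter⁻ (λ c → root c ℕ.≟ ℓ) {xs = cycles (k ℕ.* ℓ)} c∈)
      where
      go : c ∈ cycles (k ℕ.* ℓ) × root c ≡ ℓ → take ℓ c ∈ primes ℓ × concat (replicate k (take ℓ c)) ≡ c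
      go (c∈ , root≡) = go′ (∈-cycles⇒Periodic (k ℕ.* ℓ) c∈) root≡
        where
        go′ : ∀ {c} → Periodic (k ℕ.* ℓ) c → root c ≡ ℓ → take ℓ c ∈ primes ℓ × concat (replicate k (take ℓ c)) ≡ c
        go′ (periodic {W} 1≤n per walk ≡.refl least) root≡ =
          go″ (≡.subst (Least W) (≡.trans (≡.sym (root-applyUpTo (k ℕ.* ℓ) 1≤n per least)) root≡) least)
          where
          go″ : Least W ℓ → take ℓ (applyUpTo W (k ℕ.* ℓ)) ∈ primes ℓ ×
                concat (replicate k (take ℓ (applyUpTo W (k ℕ.* ℓ)))) ≡ applyUpTo W (k ℕ.* ℓ)
          go″ least′ = ≡.subst (_∈ primes ℓ) (≡.sym (take-kℓ W))
                         (∈-primes (List.length-applyUpTo W ℓ) (Least⇒Prime ℓ walk least′)) ,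
                       ≡.trans (cong (λ c → concat (replicate k c)) (take-kℓ W))
                         (concat-replicate (proj₁ (proj₂ least′)) k)
    to : ∀ {c} → c ∈ primes ℓ → concat (replicate k c) ∈ rooted ℓ (k ℕ.* ℓ) × take ℓ (concat (replicate k c)) ≡ c
    to c∈ = go (Prime⇒Periodic ℓ c∈)
      where
      go : ∀ {c} → (∃ λ W → Walk W × Least W ℓ × c ≡ applyUpTo W ℓ) →
           concat (replicate k c) ∈ rooted ℓ (k ℕ.* ℓ) × take ℓ (concat (replicate k c)) ≡ c
      go (W , walk , least@(1≤ℓ , per , _) , ≡.refl) =
        ≡.subst (_∈ rooted ℓ (k ℕ.* ℓ)) (≡.sym kc≡) (Mem.∈-filter⁺ (λ c → root c ℕ.≟ ℓ)
          (∈-cycles (List.length-applyUpTo W (k ℕ.* ℓ)) (Walk⇒IsCycle (k ℕ.* ℓ) 1≤kℓ per′ walk))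
          (root-applyUpTo (k ℕ.* ℓ) 1≤kℓ per′ least)) ,
        ≡.trans (cong (take ℓ) kc≡) (take-kℓ W)
        where
        kc≡ = concat-replicate per k
        per′ = Per-multiple k per
        1≤kℓ = ℕ.*-mono-≤ 1≤k 1≤ℓ

  rotate : ℕ → List E → List E
  rotate k c = drop k c ++ take k c

  private
    rotation : ∀ {W ℓ} k → k ≤ ℓ → Walk W → Least W ℓ →
      Walk (λ i → W (k ℕ.+ i)) × Least (λ i → W (k ℕ.+ i)) ℓ
    rotation {W} k k≤ℓ walk (1≤ℓ , per , ℓ≤) =
      (λ i → ≡.trans (walk (k ℕ.+ i)) (cong (o ∘ W) (≡.sym (ℕ.+-suc k i)))) ,
      1≤ℓ , Per-shift k per , λ e 1≤e pe → ℓ≤ e 1≤e (Per-unshift k per k≤ℓ pe)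

    -- If the rotations by i < j agreed, j - i would be a period below the least one.
    rotate-injective-≤ : ∀ {W ℓ} → Least W ℓ → ∀ {i j} → i ≤ j → j < ℓ →
      rotate i (applyUpTo W ℓ) ≡ rotate j (applyUpTo W ℓ) → i ≡ j
    rotate-injective-≤ {W} {ℓ} (1≤ℓ , per , ℓ≤) {i} {j} i≤j j<ℓ eq = go (j ℕ.∸ i) (ℕ.m+[n∸m]≡n i≤j)
      where
      Wi≗Wj : (λ a → W (i ℕ.+ a)) ≗ (λ a → W (j ℕ.+ a))
      Wi≗Wj = Per-agree 1≤ℓ (Per-shift i per) (Per-shift j per) (applyUpTo-injective ℓ
        (≡.trans (≡.sym (rotate-applyUpTo per i (ℕ.≤-trans i≤j (ℕ.<⇒≤ j<ℓ))))
          (≡.trans eq (rotate-applyUpTo per j (ℕ.<⇒≤ j<ℓ)))))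
      go : ∀ k → i ℕ.+ k ≡ j → i ≡ j
      go zero    i+k≡j = ≡.trans (≡.sym (ℕ.+-identityʳ i)) i+k≡j
      go (suc k) i+k≡j = contradiction (ℓ≤ (suc k) (s≤s z≤n) (Per-unshift i per (ℕ.≤-trans i≤j (ℕ.<⇒≤ j<ℓ))
        λ a → ≡.trans (cong W (≡.trans (cong (i ℕ.+_) (ℕ.+-comm a (suc k))) (≡.trans (≡.sym (ℕ.+-assoc i (suc k) a)) (cong (ℕ._+ a) i+k≡j))))
                (≡.sym (Wi≗Wj a))))
        (ℕ.<⇒≱ (ℕ.≤-<-trans (≡.subst (suc k ≤_) i+k≡j (ℕ.m≤n+m (suc k) i)) j<ℓ))

  rotate-injective : ∀ {ℓ c} → c ∈ primes ℓ → ∀ {i j} → i < ℓ → j < ℓ → rotate i c ≡ rotate j c → i ≡ j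
  rotate-injective {ℓ} c∈ {i} {j} i<ℓ j<ℓ eq = go (Prime⇒Periodic ℓ c∈) eq
    where
    go : ∀ {c} → (∃ λ W → Walk W × Least W ℓ × c ≡ applyUpTo W ℓ) → rotate i c ≡ rotate j c → i ≡ j
    go (W , _ , least , ≡.refl) eq = [ (λ i≤j → rotate-injective-≤ least i≤j j<ℓ eq) ,
      (λ j≤i → ≡.sym (rotate-injective-≤ least j≤i i<ℓ (≡.sym eq))) ]′ (ℕ.≤-total i j)

  rotate-∈-primes : ∀ {ℓ c} k → k ≤ ℓ → c ∈ primes ℓ → rotate k c ∈ primes ℓ
  rotate-∈-primes {ℓ} k k≤ℓ c∈ = go (Prime⇒Periodic ℓ c∈)
    where
    go : ∀ {c} → (∃ λ W → Walk W × Least W ℓ × c ≡ applyUpTo W ℓ) → rotate k c ∈ primes ℓ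
    go (W , walk , least@(1≤ℓ , per , _) , ≡.refl) = go′ (rotation k k≤ℓ walk least)
      where
      go′ : Walk (λ i → W (k ℕ.+ i)) × Least (λ i → W (k ℕ.+ i)) ℓ → rotate k (applyUpTo W ℓ) ∈ primes ℓ
      go′ (walk′ , least′) = ≡.subst (_∈ primes ℓ) (≡.sym (rotate-applyUpTo per k k≤ℓ))
        (∈-primes (List.length-applyUpTo _ ℓ) (Least⇒Prime ℓ walk′ least′))

  private
    Rotates : ℕ → List E → List E → Set
    Rotates ℓ c c′ = ∃ λ k → k < ℓ × c′ ≡ rotate k c

    CP⇒Rotates : ∀ {ℓ c c′} → length c ≡ ℓ → CyclicPermutation Y c c′ → Rotates ℓ c c′
    CP⇒Rotates ≡.refl (k , eq) = toℕ k , Fin.toℕ<n k , eq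

    Rotates⇒CP : ∀ {ℓ c c′} → length c ≡ ℓ → Rotates ℓ c c′ → CyclicPermutation Y c c′
    Rotates⇒CP {c = c} ≡.refl (k , k<ℓ , eq) = Fin.fromℕ< k<ℓ ,
      ≡.trans eq (cong (λ k → rotate k c) (≡.sym (Fin.toℕ-fromℕ< k<ℓ)))

    -- Rotations add modulo ℓ. The last component is for `CP-sym`, where the rotations by ℓ - k and
    -- k must compose to the identity.
    rotate-rotate : ∀ {ℓ c} j k → 1 ≤ ℓ → j ≤ ℓ → k ≤ ℓ → length c ≡ ℓ →
      ∃ λ i → i < ℓ × rotate j (rotate k c) ≡ rotate i c × (j ℕ.+ k ≡ ℓ → i ≡ 0)
    rotate-rotate {ℓ@(suc ℓ′)} {c} j k 1≤ℓ j≤ℓ k≤ℓ len = go (word c (≡.subst (1 ≤_) (≡.sym len) 1≤ℓ))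
      where
      go : (∃ λ W → Per W (length c) × applyUpTo W (length c) ≡ c) →
           ∃ λ i → i < ℓ × rotate j (rotate k c) ≡ rotate i c × (j ℕ.+ k ≡ ℓ → i ≡ 0)
      go (W , per , W≡) = (j ℕ.+ k) % ℓ , ℕ.m%n<n (j ℕ.+ k) ℓ , (begin
        rotate j (rotate k c)                                  ≡⟨ cong (rotate j ∘ rotate k) c≡ ⟩
        rotate j (rotate k (applyUpTo W ℓ))                    ≡⟨ cong (rotate j) (rotate-applyUpTo per′ k k≤ℓ) ⟩
        rotate j (applyUpTo (λ i → W (k ℕ.+ i)) ℓ)             ≡⟨ rotate-applyUpTo (Per-shift k per′) j j≤ℓ ⟩
        applyUpTo (λ i → W (k ℕ.+ (j ℕ.+ i))) ℓ                ≡⟨ applyUpTo-cong ℓ (λ i _ → step i) ⟩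
        applyUpTo (λ i → W ((j ℕ.+ k) % ℓ ℕ.+ i)) ℓ            ≡⟨ rotate-applyUpTo per′ _ (ℕ.m%n≤n (j ℕ.+ k) ℓ) ⟨
        rotate ((j ℕ.+ k) % ℓ) (applyUpTo W ℓ)                 ≡⟨ cong (rotate ((j ℕ.+ k) % ℓ)) c≡ ⟨
        rotate ((j ℕ.+ k) % ℓ) c                               ∎) ,
        λ j+k≡ℓ → ≡.trans (cong (_% ℓ) j+k≡ℓ) (ℕ.n%n≡0 ℓ)
        where
        open ≡-Reasoning
        c≡ : c ≡ applyUpTo W ℓ
        c≡ = ≡.trans (≡.sym W≡) (cong (applyUpTo W) len)
        per′ : Per W ℓ
        per′ = ≡.subst (Per W) len per
        step : ∀ i → W (k ℕ.+ (j ℕ.+ i)) ≡ W ((j ℕ.+ k) % ℓ ℕ.+ i)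
        step i = begin
          W (k ℕ.+ (j ℕ.+ i))                   ≡⟨ cong W (≡.trans (≡.sym (ℕ.+-assoc k j i)) (≡.trans (cong (ℕ._+ i) (ℕ.+-comm k j)) (ℕ.+-comm _ i))) ⟩
          W (i ℕ.+ (j ℕ.+ k))                   ≡⟨ cong (λ a → W (i ℕ.+ a)) (ℕ.m≡m%n+[m/n]*n (j ℕ.+ k) ℓ) ⟩
          W (i ℕ.+ ((j ℕ.+ k) % ℓ ℕ.+ (j ℕ.+ k) / ℓ ℕ.* ℓ)) ≡⟨ cong W (≡.sym (ℕ.+-assoc i _ _)) ⟩
          W (i ℕ.+ (j ℕ.+ k) % ℓ ℕ.+ (j ℕ.+ k) / ℓ ℕ.* ℓ)   ≡⟨ Per-multiple ((j ℕ.+ k) / ℓ) per′ _ ⟩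
          W (i ℕ.+ (j ℕ.+ k) % ℓ)               ≡⟨ cong W (ℕ.+-comm i _) ⟩
          W ((j ℕ.+ k) % ℓ ℕ.+ i)               ∎

    rotate-0 : ∀ c → rotate 0 c ≡ c
    rotate-0 c = List.++-identityʳ c

  module _ {ℓ : ℕ} (1≤ℓ : 1 ≤ ℓ) where

    CP-refl : ∀ {c} → length c ≡ ℓ → CyclicPermutation Y c c
    CP-refl {c} len = Rotates⇒CP len (0 , 1≤ℓ , ≡.sym (rotate-0 c))

    CP-sym : ∀ {c c′} → length c ≡ ℓ → length c′ ≡ ℓ → CyclicPermutation Y c c′ → CyclicPermutation Y c′ c
    CP-sym {c} {c′} len len′ cp = go (CP⇒Rotates len cp)
      where
      go : Rotates ℓ c c′ → CyclicPermutation Y c′ c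
      go (k , k<ℓ , ≡.refl) = go′ (ℓ ℕ.∸ k) (ℕ.m∸n≤m ℓ k) (ℕ.m∸n+n≡m (ℕ.<⇒≤ k<ℓ))
        where
        go′ : ∀ j → j ≤ ℓ → j ℕ.+ k ≡ ℓ → CyclicPermutation Y (rotate k c) c
        go′ j j≤ℓ j+k≡ℓ = back (rotate-rotate j k 1≤ℓ j≤ℓ (ℕ.<⇒≤ k<ℓ) len) (rotate-rotate j 0 1≤ℓ j≤ℓ z≤n len′)
          where
          back : (∃ λ i → i < ℓ × rotate j (rotate k c) ≡ rotate i c × (j ℕ.+ k ≡ ℓ → i ≡ 0)) →
                 (∃ λ i → i < ℓ × rotate j (rotate 0 (rotate k c)) ≡ rotate i (rotate k c) × (j ℕ.+ 0 ≡ ℓ → i ≡ 0)) →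
                 CyclicPermutation Y (rotate k c) c
          back (i , _ , eq , i≡0) (i′ , i′<ℓ , eq′ , _) = Rotates⇒CP len′ (i′ , i′<ℓ , ≡.sym (begin
            rotate i′ (rotate k c)            ≡⟨ eq′ ⟨
            rotate j (rotate 0 (rotate k c))  ≡⟨ cong (rotate j) (rotate-0 _) ⟩
            rotate j (rotate k c)             ≡⟨ eq ⟩
            rotate i c                        ≡⟨ cong (λ i → rotate i c) (i≡0 j+k≡ℓ) ⟩
            rotate 0 c                        ≡⟨ rotate-0 c ⟩
            c                                 ∎))
            where open ≡-Reasoning

    CP-trans : ∀ {c c′ c″} → length c ≡ ℓ → length c′ ≡ ℓ →
      CyclicPermutation Y c c′ → CyclicPermutation Y c′ c″ → CyclicPermutation Y c c″
    CP-trans {c} {c′} {c″} len len′ cp cp′ = go (CP⇒Rotates len cp) (CP⇒Rotates len′ cp′)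
      where
      go : Rotates ℓ c c′ → Rotates ℓ c′ c″ → CyclicPermutation Y c c″
      go (k , k<ℓ , ≡.refl) (j , j<ℓ , ≡.refl) = go′ (rotate-rotate j k 1≤ℓ (ℕ.<⇒≤ j<ℓ) (ℕ.<⇒≤ k<ℓ) len)
        where
        go′ : (∃ λ i → i < ℓ × rotate j (rotate k c) ≡ rotate i c × (j ℕ.+ k ≡ ℓ → i ≡ 0)) →
              CyclicPermutation Y c (rotate j (rotate k c))
        go′ (i , i<ℓ , eq , _) = Rotates⇒CP len (i , i<ℓ , eq)

    -- The ℓ rotations of a prime cycle are prime and pairwise distinct, and they exhaust its class.
    class-size : ∀ {c} → c ∈ primes ℓ → length (filter (cyclicPermutation? Y c) (primes ℓ)) ≡ ℓ
    class-size {c} c∈ = ≡.trans (≡.sym (Perm.↭-length (Unique⇒↭ !rotations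
        (Unique.filter⁺ (cyclicPermutation? Y c) (primes-unique ℓ)) from to)))
      (≡.trans (List.length-map (λ k → rotate (toℕ k) c) (allFin ℓ)) (List.length-tabulate id))
      where
      len = proj₁ (∈-primes⁻ ℓ c∈)
      !rotations : Unique (map (λ k → rotate (toℕ k) c) (allFin ℓ))
      !rotations = Unique.map⁺ (λ eq → Fin.toℕ-injective (rotate-injective c∈ (Fin.toℕ<n _) (Fin.toℕ<n _) eq)) (Unique.allFin⁺ ℓ)
      from : ∀ {x} → x ∈ map (λ k → rotate (toℕ k) c) (allFin ℓ) → x ∈ filter (cyclicPermutation? Y c) (primes ℓ)
      from x∈ = go (Mem.∈-map⁻ _ x∈)
        where
        go : ∀ {x} → (∃ λ k → k ∈ allFin ℓ × x ≡ rotate (toℕ k) c) → x ∈ filter (cyclicPermutation? Y c) (primes ℓ)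
        go (k , _ , ≡.refl) = Mem.∈-filter⁺ (cyclicPermutation? Y c)
          (rotate-∈-primes (toℕ k) (ℕ.<⇒≤ (Fin.toℕ<n k)) c∈) (Rotates⇒CP len (toℕ k , Fin.toℕ<n k , ≡.refl))
      to : ∀ {x} → x ∈ filter (cyclicPermutation? Y c) (primes ℓ) → x ∈ map (λ k → rotate (toℕ k) c) (allFin ℓ)
      to x∈ = go (CP⇒Rotates len (proj₂ (Mem.∈-filter⁻ (cyclicPermutation? Y c) {xs = primes ℓ} x∈)))
        where
        go : ∀ {x} → Rotates ℓ c x → x ∈ map (λ k → rotate (toℕ k) c) (allFin ℓ)
        go (k , k<ℓ , ≡.refl) = ≡.subst (λ k → rotate k c ∈ map (λ k → rotate (toℕ k) c) (allFin ℓ)) (Fin.toℕ-fromℕ< k<ℓ)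
          (Mem.∈-map⁺ _ (Mem.∈-allFin (Fin.fromℕ< k<ℓ)))

-- Counting closed walks

length-lsum : ∀ {A : Set} (xs : List A) → + length xs ≡ LZ.lsum (λ _ → 1ℤ) xs
length-lsum []       = ≡.refl
length-lsum (x ∷ xs) = cong (λ s → 1ℤ ℤ.+ s) (length-lsum xs)

lsum-const : ∀ {A : Set} c (xs : List A) → LZ.lsum (λ _ → c) xs ≡ + length xs ℤ.* c
lsum-const c []       = ≡.sym (ℤ.*-zeroˡ c)
lsum-const c (x ∷ xs) = ≡.trans (cong (λ s → c ℤ.+ s) (lsum-const c xs)) (≡.sym (ℤ.suc-* (+ length xs) c))

length-filter : ∀ {A : Set} {P : A → Set} (P? : Decidable P) xs → + length (filter P? xs) ≡ LZ.lsum (λ x → 𝟙 (P? x)) xs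
length-filter P? xs = ≡.trans (length-lsum (filter P? xs)) (≡.trans (LZ.lsum-filter P? (λ _ → 1ℤ) xs)
  (LZ.lsum-cong xs λ _ → ℤ.*-identityʳ _))

lsum-Σ< : ∀ {A : Set} n (f : ℕ → A → ℤ) xs → LZ.lsum (λ x → Σ< n λ i → f i x) xs ≡ Σ< n λ i → LZ.lsum (f i) xs
lsum-Σ< zero    f xs = LZ.lsum-0 xs λ _ → ≡.refl
lsum-Σ< (suc n) f xs = ≡.trans (LZ.lsum-+ (f 0) _ xs) (cong (ℤ._+_ (LZ.lsum (f 0) xs)) (lsum-Σ< n (f ∘ suc) xs))

length-partition : ∀ {A : Set} (r : A → ℕ) N xs → (∀ {x} → x ∈ xs → 1 ≤ r x × r x ≤ N) →
  + length xs ≡ Σ< N λ i → + length (filter (λ x → r x ℕ.≟ suc i) xs)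
length-partition r N xs r-bounds = begin
  + length xs                                                ≡⟨ length-lsum xs ⟩
  LZ.lsum (λ _ → 1ℤ) xs                                      ≡⟨ LZ.lsum-cong xs (λ x∈ → ≡.sym (one _ (r-bounds x∈))) ⟩
  LZ.lsum (λ x → Σ< N λ i → 𝟙 (r x ℕ.≟ suc i)) xs            ≡⟨ lsum-Σ< N _ xs ⟩
  Σ< N (λ i → LZ.lsum (λ x → 𝟙 (r x ℕ.≟ suc i)) xs)          ≡⟨ Σ<-cong N (λ i _ → length-filter (λ x → r x ℕ.≟ suc i) xs) ⟨
  Σ< N (λ i → + length (filter (λ x → r x ℕ.≟ suc i) xs))    ∎
  where
  open ≡-Reasoning
  one : ∀ k → 1 ≤ k × k ≤ N → Σ< N (λ i → 𝟙 (k ℕ.≟ suc i)) ≡ 1ℤ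
  one (suc k) (_ , k<N) = ≡.trans (Σ<-single N _ k k<N λ i _ i≢k → 𝟙-no (suc k ℕ.≟ suc i) (i≢k ∘ ≡.sym ∘ ℕ.suc-injective))
    (𝟙-yes (suc k ℕ.≟ suc k) ≡.refl)

-- If every class of an equivalence relation on the members of xs has k members, then
-- xs has k times as many members as representatives.
module _ {A : Set} {R : A → A → Set} (R? : ∀ x y → Dec (R x y)) where

  deduplicate-count : ∀ xs →
    (∀ {x} → x ∈ xs → R x x) → (∀ {x y} → x ∈ xs → y ∈ xs → R x y → R y x) →
    (∀ {x y z} → x ∈ xs → y ∈ xs → z ∈ xs → R x y → R y z → R x z) →
    ∀ {y} → y ∈ xs → LZ.lsum (λ c → 𝟙 (R? c y)) (deduplicate R? xs) ≡ 1ℤ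
  deduplicate-count (x ∷ xs) rfl sm tr {y} y∈ = begin
    𝟙 (R? x y) ℤ.+ LZ.lsum (λ c → 𝟙 (R? c y)) (filter (¬? ∘ R? x) D)
      ≡⟨ cong (ℤ._+_ (𝟙 (R? x y))) (LZ.lsum-filter (¬? ∘ R? x) (λ c → 𝟙 (R? c y)) D) ⟩
    𝟙 (R? x y) ℤ.+ LZ.lsum (λ c → 𝟙 (¬? (R? x c)) ℤ.* 𝟙 (R? c y)) D
      ≡⟨ split (R? x y) y∈ ⟩
    1ℤ ∎
    where
    open ≡-Reasoning
    D = deduplicate R? xs
    D⊆ : ∀ {c} → c ∈ D → c ∈ xs
    D⊆ = Mem.∈-deduplicate⁻ R? xs
    product-0 : ∀ {c} → c ∈ D → R x y → 𝟙 (¬? (R? x c)) ℤ.* 𝟙 (R? c y) ≡ 0ℤ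
    product-0 {c} c∈ xy with R? c y
    ... | no  _  = ℤ.*-zeroʳ (𝟙 (¬? (R? x c)))
    ... | yes cy = cong (ℤ._* 1ℤ) (𝟙-no (¬? (R? x c)) λ ¬xc →
      ¬xc (tr (here ≡.refl) y∈ (there (D⊆ c∈)) xy (sm (there (D⊆ c∈)) y∈ cy)))
    product-1 : ∀ {c} → c ∈ D → ¬ R x y → 𝟙 (¬? (R? x c)) ℤ.* 𝟙 (R? c y) ≡ 𝟙 (R? c y)
    product-1 {c} c∈ ¬xy with R? c y
    ... | no  _  = ℤ.*-zeroʳ (𝟙 (¬? (R? x c)))
    ... | yes cy = cong (ℤ._* 1ℤ) (𝟙-yes (¬? (R? x c)) λ xc →
      ¬xy (tr (here ≡.refl) (there (D⊆ c∈)) y∈ xc cy))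
    split : (xy? : Dec (R x y)) → y ∈ x ∷ xs →
      𝟙 xy? ℤ.+ LZ.lsum (λ c → 𝟙 (¬? (R? x c)) ℤ.* 𝟙 (R? c y)) D ≡ 1ℤ
    split (yes xy) _             = cong (ℤ._+_ 1ℤ) (LZ.lsum-0 D λ c∈ → product-0 c∈ xy)
    split (no ¬xy) (here ≡.refl) = contradiction (rfl (here ≡.refl)) ¬xy
    split (no ¬xy) (there y∈xs)  = ≡.trans (ℤ.+-identityˡ _) (≡.trans (LZ.lsum-cong D λ c∈ → product-1 c∈ ¬xy)
      (deduplicate-count xs (rfl ∘ there) (λ a b → sm (there a) (there b)) (λ a b c → tr (there a) (there b) (there c)) y∈xs))

  length-deduplicate-* : ∀ xs k →
    (∀ {x} → x ∈ xs → R x x) → (∀ {x y} → x ∈ xs → y ∈ xs → R x y → R y x) →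
    (∀ {x y z} → x ∈ xs → y ∈ xs → z ∈ xs → R x y → R y z → R x z) →
    (∀ {c} → c ∈ xs → length (filter (R? c) xs) ≡ k) →
    + length xs ≡ + length (deduplicate R? xs) ℤ.* + k
  length-deduplicate-* xs k rfl sm tr size = begin
    + length xs                                              ≡⟨ length-lsum xs ⟩
    LZ.lsum (λ _ → 1ℤ) xs                                    ≡⟨ LZ.lsum-cong xs (λ y∈ → deduplicate-count xs rfl sm tr y∈) ⟨
    LZ.lsum (λ y → LZ.lsum (λ c → 𝟙 (R? c y)) D) xs          ≡⟨ LZ.lsum-comm (λ y c → 𝟙 (R? c y)) xs D ⟩
    LZ.lsum (λ c → LZ.lsum (λ y → 𝟙 (R? c y)) xs) D
      ≡⟨ LZ.lsum-cong D (λ {c} c∈ → ≡.trans (≡.sym (length-filter (R? c) xs)) (cong +_ (size (Mem.∈-deduplicate⁻ R? xs c∈)))) ⟩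
    LZ.lsum (λ _ → + k) D                                    ≡⟨ lsum-const (+ k) D ⟩
    + length D ℤ.* + k                                       ∎
    where
    open ≡-Reasoning
    D = deduplicate R? xs

-- The logarithmic derivative of the zeta function

module SZ = Series ℤ.+-*-commutativeRing
module SZR = CommutativeRing SZ.series

⊛≡*ˢ : ∀ f g n → (f ⊛ g) n ≡ (f SZ.*ˢ g) n
⊛≡*ˢ f g zero    = ℤ.+-identityʳ _
⊛≡*ˢ f g (suc n) = cong (ℤ._+_ (f 0 ℤ.* g (suc n))) (⊛≡*ˢ (f ∘ suc) g n)

oneˢ≡1ˢ : ∀ n → oneˢ n ≡ SZ.1ˢ n
oneˢ≡1ˢ zero    = ≡.refl
oneˢ≡1ˢ (suc n) = ≡.refl

θ-ℤ : ∀ f n → SZ.θ f n ≡ + n ℤ.* f n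
θ-ℤ f n = go n (f n)
  where
  open import Algebra.Properties.Semiring.Mult (CommutativeRing.semiring ℤ.+-*-commutativeRing) using () renaming (_×_ to _×ℕ_)
  go : ∀ n x → n ×ℕ x ≡ + n ℤ.* x
  go zero    x = ≡.sym (ℤ.*-zeroˡ x)
  go (suc n) x = ≡.trans (cong (λ s → x ℤ.+ s) (go n x)) (≡.sym (ℤ.suc-* (+ n) x))

private
  shiftBy : ℕ → PowerSeries → PowerSeries
  shiftBy zero    f = f
  shiftBy (suc k) f = SZ.shift (shiftBy k f)

  shiftBy-< : ∀ {k n} f → n < k → shiftBy k f n ≡ 0ℤ
  shiftBy-< {suc k} {zero}  f n<k       = ≡.refl
  shiftBy-< {suc k} {suc n} f (s≤s n<k) = shiftBy-< f n<k

  shiftBy-+ : ∀ k m f → shiftBy k f (k ℕ.+ m) ≡ f m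
  shiftBy-+ zero    m f = ≡.refl
  shiftBy-+ (suc k) m f = shiftBy-+ k m f

  shiftBy-* : ∀ k f g → shiftBy k f SZ.*ˢ g SZ.≈ˢ shiftBy k (f SZ.*ˢ g)
  shiftBy-* zero    f g = SZ.coeffs λ _ → ≡.refl
  shiftBy-* (suc k) f g = SZ.coeffs λ n → ≡.trans (SZ.at (SZ.shift-* (shiftBy k f) g) n)
    (SZ.at (SZ.shift-cong (shiftBy-* k f g)) n)

  -- For ℓ ≥ 1 the equation X = A + u^ℓ X expresses each coefficient of X by A and earlier ones, so
  -- it has only one solution.
  shiftBy-induction : ∀ ℓ → 1 ≤ ℓ → ∀ (A X Y : PowerSeries) → (∀ n → X n ≡ A n ℤ.+ shiftBy ℓ X n) →
    (∀ n → Y n ≡ A n ℤ.+ shiftBy ℓ Y n) → ∀ n → X n ≡ Y n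
  shiftBy-induction (suc ℓ) _ A X Y X≡ Y≡ n = below (suc n) n ℕ.≤-refl
    where
    cut : ∀ k n → (∀ m → m ≤ n → X m ≡ Y m) → shiftBy k X n ≡ shiftBy k Y n
    cut zero    n       X≡Y = X≡Y n ℕ.≤-refl
    cut (suc k) zero    X≡Y = ≡.refl
    cut (suc k) (suc n) X≡Y = cut k n λ m m≤n → X≡Y m (ℕ.m≤n⇒m≤1+n m≤n)
    below : ∀ N n → n < N → X n ≡ Y n
    below (suc N) zero    n<N       = ≡.trans (X≡ 0) (≡.sym (Y≡ 0))
    below (suc N) (suc n) (s≤s n<N) = ≡.trans (X≡ (suc n)) (≡.trans
      (cong (ℤ._+_ (A (suc n))) (cut ℓ n λ m m≤n → below N m (ℕ.≤-<-trans m≤n n<N))) (≡.sym (Y≡ (suc n))))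

  <-or-+ : ∀ n ℓ → n < ℓ ⊎ ∃ λ m → n ≡ ℓ ℕ.+ m
  <-or-+ n ℓ = [ (λ n<ℓ → inj₁ n<ℓ) , (λ ℓ≤n → inj₂ (n ℕ.∸ ℓ , ≡.sym (ℕ.m+[n∸m]≡n ℓ≤n))) ]′ (ℕ.<-≤-connex n ℓ)

module Zeta (em : ExcludedMiddle 0ℓ) (Y : Digraph) where
  open Cycles em Y
  open Digraph Y using (E)

  private
    e : ℕ → PowerSeries
    e = eulerFactor Y

  -- θ e / e for the Euler factor e = (1 - u^ℓ)⁻¹, that is ℓ Σ_{k≥1} u^{kℓ}. The coefficient at 0 is
  -- split off because e itself has constant term 1.
  log : ℕ → PowerSeries
  log ℓ zero    = 0ℤ
  log ℓ (suc n) = e ℓ (suc n) ℤ.* + ℓ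

  private
    e-+ : ∀ ℓ m → e ℓ (ℓ ℕ.+ m) ≡ e ℓ m
    e-+ ℓ m = 𝟙-⇔ (ℓ ∣? ℓ ℕ.+ m) (ℓ ∣? m) (λ ℓ∣ → ℕ∣.∣m+n∣m⇒∣n ℓ∣ ℕ∣.∣-refl) (ℕ∣.∣m∣n⇒∣m+n ℕ∣.∣-refl)

    e-< : ∀ ℓ {n} → suc n < ℓ → e ℓ (suc n) ≡ 0ℤ
    e-< ℓ {n} n<ℓ = 𝟙-no (ℓ ∣? suc n) λ ℓ∣ → ℕ.<⇒≱ n<ℓ (ℕ∣.∣⇒≤ ℓ∣)

    e-0 : ∀ ℓ → e ℓ 0 ≡ 1ℤ
    e-0 ℓ = 𝟙-yes (ℓ ∣? 0) (ℓ ℕ∣.∣0)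

    e≡1+shift : ∀ ℓ → 1 ≤ ℓ → ∀ n → e ℓ n ≡ SZ.1ˢ n ℤ.+ shiftBy ℓ (e ℓ) n
    e≡1+shift ℓ 1≤ℓ n = [ small n , (λ (m , n≡) → ≡.subst (λ n → e ℓ n ≡ SZ.1ˢ n ℤ.+ shiftBy ℓ (e ℓ) n) (≡.sym n≡) (large ℓ 1≤ℓ m)) ]′ (<-or-+ n ℓ)
      where
      small : ∀ n → n < ℓ → e ℓ n ≡ SZ.1ˢ n ℤ.+ shiftBy ℓ (e ℓ) n
      small zero    n<ℓ = ≡.trans (e-0 ℓ) (≡.sym (cong (ℤ._+_ 1ℤ) (shiftBy-< (e ℓ) n<ℓ)))
      small (suc n) n<ℓ = ≡.trans (e-< ℓ n<ℓ) (≡.sym (cong (ℤ._+_ 0ℤ) (shiftBy-< (e ℓ) n<ℓ)))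
      large : ∀ ℓ → 1 ≤ ℓ → ∀ m → e ℓ (ℓ ℕ.+ m) ≡ SZ.1ˢ (ℓ ℕ.+ m) ℤ.+ shiftBy ℓ (e ℓ) (ℓ ℕ.+ m)
      large (suc ℓ) _ m = ≡.trans (e-+ (suc ℓ) m) (≡.trans (≡.sym (shiftBy-+ (suc ℓ) m (e (suc ℓ)))) (≡.sym (ℤ.+-identityˡ _)))

    θe≡log+shift : ∀ ℓ → 1 ≤ ℓ → ∀ n → SZ.θ (e ℓ) n ≡ log ℓ n ℤ.+ shiftBy ℓ (SZ.θ (e ℓ)) n
    θe≡log+shift ℓ 1≤ℓ n = [ small n , (λ (m , n≡) → ≡.subst (λ n → SZ.θ (e ℓ) n ≡ log ℓ n ℤ.+ shiftBy ℓ (SZ.θ (e ℓ)) n) (≡.sym n≡) (large ℓ 1≤ℓ m)) ]′ (<-or-+ n ℓ)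
      where
      small : ∀ n → n < ℓ → SZ.θ (e ℓ) n ≡ log ℓ n ℤ.+ shiftBy ℓ (SZ.θ (e ℓ)) n
      small zero    n<ℓ = ≡.sym (cong (ℤ._+_ 0ℤ) (shiftBy-< (SZ.θ (e ℓ)) n<ℓ))
      small (suc n) n<ℓ = ≡.trans (θ-ℤ (e ℓ) (suc n)) (≡.trans (cong (ℤ._*_ (+ suc n)) (e-< ℓ n<ℓ)) (≡.trans (ℤ.*-zeroʳ (+ suc n))
        (≡.sym (cong₂ ℤ._+_ (cong (ℤ._* + ℓ) (e-< ℓ n<ℓ)) (shiftBy-< (SZ.θ (e ℓ)) n<ℓ)))))
      large : ∀ ℓ → 1 ≤ ℓ → ∀ m → SZ.θ (e ℓ) (ℓ ℕ.+ m) ≡ log ℓ (ℓ ℕ.+ m) ℤ.+ shiftBy ℓ (SZ.θ (e ℓ)) (ℓ ℕ.+ m)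
      large ℓ@(suc ℓ′) _ m = begin
        SZ.θ (e ℓ) (ℓ ℕ.+ m)                             ≡⟨ θ-ℤ (e ℓ) (ℓ ℕ.+ m) ⟩
        + (ℓ ℕ.+ m) ℤ.* e ℓ (ℓ ℕ.+ m)                    ≡⟨ cong₂ ℤ._*_ (ℤ.pos-+ ℓ m) (e-+ ℓ m) ⟩
        (+ ℓ ℤ.+ + m) ℤ.* e ℓ m                          ≡⟨ lemma (+ ℓ) (+ m) (e ℓ m) ⟩
        e ℓ m ℤ.* + ℓ ℤ.+ + m ℤ.* e ℓ m                  ≡⟨ cong₂ ℤ._+_ (cong (ℤ._* + ℓ) (e-+ ℓ m)) (≡.trans (shiftBy-+ ℓ m (SZ.θ (e ℓ))) (θ-ℤ (e ℓ) m)) ⟨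
        log ℓ (ℓ ℕ.+ m) ℤ.+ shiftBy ℓ (SZ.θ (e ℓ)) (ℓ ℕ.+ m) ∎
        where
        open ≡-Reasoning
        lemma : ∀ x y z → (x ℤ.+ y) ℤ.* z ≡ z ℤ.* x ℤ.+ y ℤ.* z
        lemma = solve-∀

  -- Both sides solve X = `log ℓ` + u^ℓ X: the left one by its coefficients, the right one because e
  -- = 1 + u^ℓ e.
  θ-euler : ∀ ℓ → 1 ≤ ℓ → SZ.θ (e ℓ) SZ.≈ˢ e ℓ SZ.*ˢ log ℓ
  θ-euler ℓ 1≤ℓ = SZ.coeffs (shiftBy-induction ℓ 1≤ℓ (log ℓ) _ _ (θe≡log+shift ℓ 1≤ℓ)
    (SZ.at (SZR.trans (SZR.*-congʳ (SZ.coeffs {e ℓ} {SZ.1ˢ SZ.+ˢ shiftBy ℓ (e ℓ)} (e≡1+shift ℓ 1≤ℓ)))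
      (SZR.trans (SZR.distribʳ (log ℓ) SZ.1ˢ (shiftBy ℓ (e ℓ)))
        (SZR.+-cong (SZR.*-identityˡ (log ℓ)) (shiftBy-* ℓ (e ℓ) (log ℓ)))))))

  product : List (List E) → PowerSeries
  product = foldr (λ c f → e (length c) ⊛ f) oneˢ

  logs : List (List E) → PowerSeries
  logs cs n = LZ.lsum (λ c → log (length c) n) cs

  product-∷ : ∀ c cs → product (c ∷ cs) SZ.≈ˢ e (length c) SZ.*ˢ product cs
  product-∷ c cs = SZ.coeffs (⊛≡*ˢ (e (length c)) (product cs))

  θ-product : ∀ cs → (∀ {c} → c ∈ cs → 1 ≤ length c) → SZ.θ (product cs) SZ.≈ˢ product cs SZ.*ˢ logs cs
  θ-product []       1≤ = SZR.trans (SZ.θ-cong (SZ.coeffs {oneˢ} oneˢ≡1ˢ)) (SZR.trans (SZ.θ-const 1ℤ) (SZR.sym (SZR.zeroʳ oneˢ)))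
  θ-product (c ∷ cs) 1≤ = SZR.trans (SZ.θ-cong (product-∷ c cs)) (SZR.trans (SZ.θ-* (e (length c)) (product cs))
    (SZR.trans (SZR.+-cong (SZR.*-congʳ (θ-euler (length c) (1≤ (here ≡.refl)))) (SZR.*-congˡ {e (length c)} (θ-product cs (1≤ ∘ there))))
    (SZR.trans (eab (e (length c)) (log (length c)) (product cs) (logs cs))
      (SZR.*-congʳ {log (length c) SZ.+ˢ logs cs} (SZR.sym (product-∷ c cs))))))
    where
    eab : ∀ e l P L → e SZ.*ˢ l SZ.*ˢ P SZ.+ˢ e SZ.*ˢ (P SZ.*ˢ L) SZ.≈ˢ e SZ.*ˢ P SZ.*ˢ (l SZ.+ˢ L)
    eab = SemiringIdentities.elP+e[PL]≈eP[l+L] SZ.series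

  private
    -- The n-th coefficient of `zeta` is taken from a finite product that depends on n, so series
    -- are compared up to order n only; longer classes do not change these coefficients.
    Agree : ℕ → PowerSeries → PowerSeries → Set
    Agree n f g = ∀ i → i ≤ n → f i ≡ g i

    Agree-* : ∀ {n f f′ g g′} → Agree n f f′ → Agree n g g′ → (f SZ.*ˢ g) n ≡ (f′ SZ.*ˢ g′) n
    Agree-* {zero}  f≡ g≡ = cong₂ ℤ._*_ (f≡ 0 z≤n) (g≡ 0 z≤n)
    Agree-* {suc n} f≡ g≡ = cong₂ ℤ._+_ (cong₂ ℤ._*_ (f≡ 0 z≤n) (g≡ (suc n) ℕ.≤-refl))
      (Agree-* {n} (λ i i≤n → f≡ (suc i) (s≤s i≤n)) (λ i i≤n → g≡ i (ℕ.m≤n⇒m≤1+n i≤n)))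

    Agree-⊛ : ∀ {n f f′ g g′} → Agree n f f′ → Agree n g g′ → Agree n (f ⊛ g) (f′ ⊛ g′)
    Agree-⊛ {n} {f} {f′} {g} {g′} f≡ g≡ i i≤n = ≡.trans (⊛≡*ˢ f g i) (≡.trans
      (Agree-* (λ j j≤i → f≡ j (ℕ.≤-trans j≤i i≤n)) (λ j j≤i → g≡ j (ℕ.≤-trans j≤i i≤n))) (≡.sym (⊛≡*ˢ f′ g′ i)))

    euler-Agree : ∀ {n ℓ} → n < ℓ → Agree n (e ℓ) oneˢ
    euler-Agree {n} {ℓ} n<ℓ zero    i≤n = e-0 ℓ
    euler-Agree {n} {ℓ} n<ℓ (suc i) i≤n = e-< ℓ (ℕ.≤-<-trans i≤n n<ℓ)

    oneˢ-⊛ : ∀ f i → (oneˢ ⊛ f) i ≡ f i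
    oneˢ-⊛ f i = ≡.trans (⊛≡*ˢ oneˢ f i) (≡.trans (SZ.at (SZR.*-congʳ {f} (SZ.coeffs {oneˢ} oneˢ≡1ˢ)) i) (SZ.at (SZR.*-identityˡ f) i))

    product-Agree-long : ∀ {n} cs → (∀ {c} → c ∈ cs → n < length c) → Agree n (product cs) oneˢ
    product-Agree-long []       n< i i≤n = ≡.refl
    product-Agree-long (c ∷ cs) n< i i≤n = ≡.trans
      (Agree-⊛ (euler-Agree (n< (here ≡.refl))) (product-Agree-long cs (n< ∘ there)) i i≤n) (oneˢ-⊛ oneˢ i)

    product-Agree-++ : ∀ {n} cs ds → (∀ {c} → c ∈ ds → n < length c) → Agree n (product (cs ++ ds)) (product cs)
    product-Agree-++ []       ds n< = product-Agree-long ds n<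
    product-Agree-++ (c ∷ cs) ds n< = Agree-⊛ {f = e (length c)} (λ _ _ → ≡.refl) (product-Agree-++ cs ds n<)

  classes : ℕ → List (List E)
  classes N = concatMap (primeClasses Y) (map suc (upTo N))

  classes-suc : ∀ N → classes (suc N) ≡ classes N ++ primeClasses Y (suc N)
  classes-suc N = begin
    concatMap (primeClasses Y) (map suc (upTo (suc N)))
      ≡⟨ cong (λ xs → concatMap (primeClasses Y) (map suc xs)) (List.upTo-∷ʳ N) ⟨
    concatMap (primeClasses Y) (map suc (upTo N ++ N ∷ []))
      ≡⟨ cong (concatMap (primeClasses Y)) (List.map-++ suc (upTo N) (N ∷ [])) ⟩
    concatMap (primeClasses Y) (map suc (upTo N) ++ suc N ∷ [])
      ≡⟨ List.concatMap-++ (primeClasses Y) (map suc (upTo N)) (suc N ∷ []) ⟩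
    classes N ++ (primeClasses Y (suc N) ++ [])
      ≡⟨ cong (classes N ++_) (List.++-identityʳ _) ⟩
    classes N ++ primeClasses Y (suc N) ∎
    where open ≡-Reasoning

  ∈-primeClasses : ∀ {ℓ c} → c ∈ primeClasses Y ℓ → c ∈ primes ℓ
  ∈-primeClasses {ℓ} c∈ = Mem.∈-deduplicate⁻ (cyclicPermutation? Y) (primes ℓ) c∈

  length-∈-primeClasses : ∀ {ℓ c} → c ∈ primeClasses Y ℓ → length c ≡ ℓ
  length-∈-primeClasses {ℓ} c∈ = proj₁ (∈-primes⁻ ℓ (∈-primeClasses {ℓ} c∈))

  ∈-classes : ∀ N {c} → c ∈ classes N → 1 ≤ length c
  ∈-classes (suc N) {c} c∈ = [ ∈-classes N , (λ c∈ → ≡.subst (1 ≤_) (≡.sym (length-∈-primeClasses {suc N} c∈)) (s≤s z≤n)) ]′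
    (Mem.∈-++⁻ (classes N) (≡.subst (c ∈_) (classes-suc N) c∈))

  zeta-stable : ∀ n k → product (classes (n ℕ.+ k)) n ≡ zeta Y n
  zeta-stable n zero    = cong (λ N → product (classes N) n) (ℕ.+-identityʳ n)
  zeta-stable n (suc k) = ≡.trans (cong (λ N → product (classes N) n) (ℕ.+-suc n k))
    (≡.trans (cong (λ cs → product cs n) (classes-suc (n ℕ.+ k)))
    (≡.trans (product-Agree-++ (classes (n ℕ.+ k)) (primeClasses Y (suc (n ℕ.+ k)))
      (λ c∈ → ≡.subst (n <_) (≡.sym (length-∈-primeClasses {suc (n ℕ.+ k)} c∈)) (s≤s (ℕ.m≤m+n n k))) n ℕ.≤-refl)
    (zeta-stable n k)))

  zeta-Agree : ∀ N → Agree N (product (classes N)) (zeta Y)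
  zeta-Agree N i i≤N = ≡.trans (cong (λ N → product (classes N) i) (≡.sym (ℕ.m+[n∸m]≡n i≤N))) (zeta-stable i (N ℕ.∸ i))

  -- Cycles are counted here as edge sequences with a first edge and not up to rotation, so the
  -- coefficients will be traces of powers of the adjacency matrix.
  cycleSeries : PowerSeries
  cycleSeries zero    = 0ℤ
  cycleSeries (suc n) = + length (cycles (suc n))

  length-primes : ∀ ℓ → 1 ≤ ℓ → + length (primes ℓ) ≡ + length (primeClasses Y ℓ) ℤ.* + ℓ
  length-primes ℓ 1≤ℓ = length-deduplicate-* (cyclicPermutation? Y) (primes ℓ) ℓ
    (λ c∈ → CP-refl 1≤ℓ (len c∈)) (λ c∈ d∈ → CP-sym 1≤ℓ (len c∈) (len d∈))
    (λ c∈ d∈ _ → CP-trans 1≤ℓ (len c∈) (len d∈)) (class-size 1≤ℓ)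
    where
    len : ∀ {c} → c ∈ primes ℓ → length c ≡ ℓ
    len c∈ = proj₁ (∈-primes⁻ ℓ c∈)

  logs-classes : ∀ N n → logs (classes N) n ≡ Σ< N λ i → + length (primeClasses Y (suc i)) ℤ.* log (suc i) n
  logs-classes zero    n = ≡.refl
  logs-classes (suc N) n = begin
    logs (classes (suc N)) n                          ≡⟨ cong (λ cs → logs cs n) (classes-suc N) ⟩
    logs (classes N ++ primeClasses Y (suc N)) n      ≡⟨ LZ.lsum-++ (λ c → log (length c) n) (classes N) (primeClasses Y (suc N)) ⟩
    logs (classes N) n ℤ.+ logs (primeClasses Y (suc N)) n
      ≡⟨ cong₂ ℤ._+_ (logs-classes N n) (≡.trans (LZ.lsum-cong (primeClasses Y (suc N)) λ c∈ → cong (λ ℓ → log ℓ n) (length-∈-primeClasses {suc N} c∈))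
           (lsum-const (log (suc N) n) (primeClasses Y (suc N)))) ⟩
    Σ< N F ℤ.+ F N                                    ≡⟨ Σ<-last N F ⟨
    Σ< (suc N) F                                      ∎
    where
    open ≡-Reasoning
    F : ℕ → ℤ
    F i = + length (primeClasses Y (suc i)) ℤ.* log (suc i) n

  -- Cycles of length n are sorted by the length ℓ of their root. A divisor ℓ of n accounts for as
  -- many of them as there are prime cycles of length ℓ, which is ℓ times the number of classes; any
  -- other ℓ accounts for none.
  logs-Agree : ∀ N → Agree N (logs (classes N)) cycleSeries
  logs-Agree N zero    n≤N = LZ.lsum-0 (classes N) λ _ → ≡.refl
  logs-Agree N (suc n) n≤N = ≡.trans (logs-classes N (suc n)) (≡.trans (Σ<-cong N λ i _ → ≡.sym (term i))
    (≡.sym (length-partition root N (cycles (suc n)) bounds)))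
    where
    open ≡-Reasoning
    bounds : ∀ {c} → c ∈ cycles (suc n) → 1 ≤ root c × root c ≤ N
    bounds {c} c∈ = go (root c) (root-∣ (suc n) c∈)
      where
      go : ∀ r → r ∣ suc n → 1 ≤ r × r ≤ N
      go zero    0∣ = contradiction (ℕ∣.0∣⇒≡0 0∣) λ ()
      go (suc r) r∣ = s≤s z≤n , ℕ.≤-trans (ℕ∣.∣⇒≤ r∣) n≤N
    term : ∀ i → + length (rooted (suc i) (suc n)) ≡ + length (primeClasses Y (suc i)) ℤ.* log (suc i) (suc n)
    term i = go (suc i ∣? suc n)
      where
      go : (d? : Dec (suc i ∣ suc n)) → + length (rooted (suc i) (suc n)) ≡ + length (primeClasses Y (suc i)) ℤ.* (𝟙 d? ℤ.* + suc i)
      go (no i∤n) = ≡.trans (cong +_ (rooted-∤ (suc i) (suc n) i∤n)) (≡.sym (ℤ.*-zeroʳ (+ length (primeClasses Y (suc i)))))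
      go (yes (divides k n≡)) = begin
        + length (rooted (suc i) (suc n))                           ≡⟨ cong (λ m → + length (rooted (suc i) m)) n≡ ⟩
        + length (rooted (suc i) (k ℕ.* suc i))                     ≡⟨ cong +_ (rooted-∣ (suc i) k (1≤k k n≡)) ⟩
        + length (primes (suc i))                                   ≡⟨ length-primes (suc i) (s≤s z≤n) ⟩
        + length (primeClasses Y (suc i)) ℤ.* + suc i               ≡⟨ cong (ℤ._*_ (+ length (primeClasses Y (suc i)))) (ℤ.*-identityˡ (+ suc i)) ⟨
        + length (primeClasses Y (suc i)) ℤ.* (1ℤ ℤ.* + suc i)      ∎
        where
        1≤k : ∀ k → suc n ≡ k ℕ.* suc i → 1 ≤ k
        1≤k (suc k) _ = s≤s z≤n

  θ-zeta : SZ.θ (zeta Y) SZ.≈ˢ zeta Y SZ.*ˢ cycleSeries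
  θ-zeta = SZ.coeffs λ n → begin
    SZ.θ (zeta Y) n                               ≡⟨ θ-ℤ (zeta Y) n ⟩
    + n ℤ.* zeta Y n                              ≡⟨ θ-ℤ (product (classes n)) n ⟨
    SZ.θ (product (classes n)) n                  ≡⟨ SZ.at (θ-product (classes n) (∈-classes n)) n ⟩
    (product (classes n) SZ.*ˢ logs (classes n)) n ≡⟨ Agree-* {n} (zeta-Agree n) (logs-Agree n) ⟩
    (zeta Y SZ.*ˢ cycleSeries) n                  ∎
    where open ≡-Reasoning

  zeta-0 : zeta Y 0 ≡ 1ℤ
  zeta-0 = ≡.refl

-- Closed walks and traces

module Paths (Y : Digraph) where
  open Digraph Y using (V; E; o; t; edges; _≟ⱽ_)

  Path : V → List E → V → Set
  Path v []       w = v ≡ w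
  Path v (e ∷ es) w = o e ≡ v × Path (t e) es w

  Path? : ∀ v es w → Dec (Path v es w)
  Path? v []       w = v ≟ⱽ w
  Path? v (e ∷ es) w = (o e ≟ⱽ v) ×-dec Path? (t e) es w

  Linked⇒Path : ∀ e es f → Linked (λ e f → t e ≡ o f) (e ∷ es ++ f ∷ []) → Path (t e) es (o f)
  Linked⇒Path e []        f (te≡of ∷ _)  = te≡of
  Linked⇒Path e (e′ ∷ es) f (te≡oe′ ∷ l) = ≡.sym te≡oe′ , Linked⇒Path e′ es f l

  Path⇒Linked : ∀ e es f → Path (t e) es (o f) → Linked (λ e f → t e ≡ o f) (e ∷ es ++ f ∷ [])
  Path⇒Linked e []        f te≡of        = te≡of ∷ [-]
  Path⇒Linked e (e′ ∷ es) f (oe′≡te , l) = ≡.sym oe′≡te ∷ Path⇒Linked e′ es f l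

-- The weights are general because three kinds occur: values of a character for the zeta function,
-- and elements of the group algebra and the constant 1 for the Bowen-Franks modules.
module Trace (em : ExcludedMiddle 0ℓ) (Y : Digraph) (R : CommutativeRing 0ℓ 0ℓ)
  (wt : Digraph.E Y → CommutativeRing.Carrier R) where
  open CommutativeRing R hiding (zero)
  open Digraph Y using (V; E; o; t; edges; _≟ⱽ_; vertex; edgesFromTo; #V; V↔Fin)
  open Paths Y
  open Cycles em Y using (cycles)
  open ListSums R
  open Sums R
  open Series R using (_^ᴬ_; traceSeries)
  open CommutativeSemigroupProperties *-commutativeSemigroup using (x∙yz≈y∙xz)
  open SetoidReasoning setoid

  weight : List E → Carrier
  weight []       = 1#
  weight (e ∷ es) = wt e * weight es

  A : Matrix Carrier #V
  A i j = lsum wt (edgesFromTo (vertex j) (vertex i))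

  paths : ℕ → V → V → Carrier
  paths zero    v w = 𝟙ᴿ (v ≟ⱽ w)
  paths (suc m) v w = lsum (λ e → 𝟙ᴿ (o e ≟ⱽ v) * (wt e * paths m (t e) w)) edges

  𝟙ᴿ-× : ∀ {P Q : Set} (P? : Dec P) (Q? : Dec Q) → 𝟙ᴿ (P? ×-dec Q?) ≈ 𝟙ᴿ P? * 𝟙ᴿ Q?
  𝟙ᴿ-× (yes _) (yes _) = sym (*-identityˡ 1#)
  𝟙ᴿ-× (yes _) (no _)  = sym (*-identityˡ 0#)
  𝟙ᴿ-× (no _)  Q?      = sym (zeroˡ _)

  sum-vertex : ∀ v (F : V → Carrier) → sum (λ i → 𝟙ᴿ (v ≟ⱽ vertex i) * F (vertex i)) ≈ F v
  sum-vertex v F = begin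
    sum (λ i → 𝟙ᴿ (v ≟ⱽ vertex i) * F (vertex i))
      ≈⟨ sum-single iᵥ (λ k k≢iᵥ → trans (*-congʳ (reflexive (𝟙ᴿ-no (v ≟ⱽ vertex k)
           λ v≡ → k≢iᵥ (≡.trans (≡.sym (Inverse.strictlyInverseˡ V↔Fin k)) (cong (Inverse.to V↔Fin) (≡.sym v≡))))))
           (zeroˡ _)) ⟩
    𝟙ᴿ (v ≟ⱽ vertex iᵥ) * F (vertex iᵥ)
      ≈⟨ *-congʳ (reflexive (𝟙ᴿ-yes (v ≟ⱽ vertex iᵥ) (≡.sym vertex-iᵥ))) ⟩
    1# * F (vertex iᵥ)   ≈⟨ *-identityˡ _ ⟩
    F (vertex iᵥ)        ≈⟨ reflexive (cong F vertex-iᵥ) ⟩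
    F v                  ∎
    where
    iᵥ = Inverse.to V↔Fin v
    vertex-iᵥ : vertex iᵥ ≡ v
    vertex-iᵥ = Inverse.strictlyInverseʳ V↔Fin v

  lsum-edgesFromTo : ∀ (f : E → Carrier) v w → lsum f (edgesFromTo v w) ≈
    lsum (λ e → 𝟙ᴿ (o e ≟ⱽ v) * (𝟙ᴿ (t e ≟ⱽ w) * f e)) edges
  lsum-edgesFromTo f v w = trans (lsum-filter (λ e → (o e ≟ⱽ v) ×-dec (t e ≟ⱽ w)) f edges)
    (lsum-cong edges λ {e} _ → trans (*-congʳ (𝟙ᴿ-× (o e ≟ⱽ v) (t e ≟ⱽ w))) (*-assoc _ _ _))

  sum-lsum : ∀ {n} {B : Set} (f : Fin n → B → Carrier) xs →
             sum (λ i → lsum (f i) xs) ≈ lsum (λ x → sum λ i → f i x) xs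
  sum-lsum f []       = sum-0 λ _ → refl
  sum-lsum f (x ∷ xs) = trans (sum-+ _ _) (+-congˡ (sum-lsum f xs))

  power≈paths : ∀ m i j → (A ^ᴬ suc m) i j ≈ paths (suc m) (vertex j) (vertex i)
  power≈paths zero    i j = trans (lsum-edgesFromTo wt (vertex j) (vertex i))
    (lsum-cong edges λ _ → *-congˡ (*-comm _ _))
  power≈paths (suc m) i j = begin
    sum (λ k → (A ^ᴬ suc m) i k * A k j)
      ≈⟨ sum-cong (λ k → *-cong (power≈paths m i k) (lsum-edgesFromTo wt (vertex j) (vertex k))) ⟩
    sum (λ k → P (vertex k) * lsum (λ e → 𝟙ᴿ (o e ≟ⱽ vertex j) * (𝟙ᴿ (t e ≟ⱽ vertex k) * wt e)) edges)
      ≈⟨ sum-cong (λ k → lsum-*ˡ (P (vertex k)) _ edges) ⟨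
    sum (λ k → lsum (λ e → P (vertex k) * (𝟙ᴿ (o e ≟ⱽ vertex j) * (𝟙ᴿ (t e ≟ⱽ vertex k) * wt e))) edges)
      ≈⟨ sum-lsum _ edges ⟩
    lsum (λ e → sum λ k → P (vertex k) * (𝟙ᴿ (o e ≟ⱽ vertex j) * (𝟙ᴿ (t e ≟ⱽ vertex k) * wt e))) edges
      ≈⟨ lsum-cong edges (λ {e} _ → step e) ⟩
    lsum (λ e → 𝟙ᴿ (o e ≟ⱽ vertex j) * (wt e * P (t e))) edges ∎
    where
    P : V → Carrier
    P v = paths (suc m) v (vertex i)
    step : ∀ e → sum (λ k → P (vertex k) * (𝟙ᴿ (o e ≟ⱽ vertex j) * (𝟙ᴿ (t e ≟ⱽ vertex k) * wt e))) ≈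
                 𝟙ᴿ (o e ≟ⱽ vertex j) * (wt e * P (t e))
    step e = begin
      sum (λ k → P (vertex k) * (a * (𝟙ᴿ (t e ≟ⱽ vertex k) * wt e)))
        ≈⟨ sum-cong (λ k → SemiringIdentities.p[a[bw]]≈b[a[wp]] R (P (vertex k)) a (𝟙ᴿ (t e ≟ⱽ vertex k)) (wt e)) ⟩
      sum (λ k → 𝟙ᴿ (t e ≟ⱽ vertex k) * (a * (wt e * P (vertex k))))
        ≈⟨ sum-vertex (t e) (λ v → a * (wt e * P v)) ⟩
      a * (wt e * P (t e)) ∎
      where a = 𝟙ᴿ (o e ≟ⱽ vertex j)

  A-apply : ∀ i (F : V → Carrier) →
    sum (λ j → A i j * F (vertex j)) ≈ lsum (λ e → 𝟙ᴿ (t e ≟ⱽ vertex i) * (wt e * F (o e))) edges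
  A-apply i F = begin
    sum (λ j → A i j * F (vertex j))
      ≈⟨ sum-cong (λ j → trans (*-congʳ (lsum-edgesFromTo wt (vertex j) (vertex i))) (sym (lsum-*ʳ _ _ edges))) ⟩
    sum (λ j → lsum (λ e → 𝟙ᴿ (o e ≟ⱽ vertex j) * (𝟙ᴿ (t e ≟ⱽ vertex i) * wt e) * F (vertex j)) edges)
      ≈⟨ sum-lsum _ edges ⟩
    lsum (λ e → sum λ j → 𝟙ᴿ (o e ≟ⱽ vertex j) * (𝟙ᴿ (t e ≟ⱽ vertex i) * wt e) * F (vertex j)) edges
      ≈⟨ lsum-cong edges (λ {e} _ → trans
           (sum-cong λ j → trans (*-assoc _ _ _) (*-congˡ (*-assoc _ _ _)))
           (sum-vertex (o e) (λ v → 𝟙ᴿ (t e ≟ⱽ vertex i) * (wt e * F v)))) ⟩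
    lsum (λ e → 𝟙ᴿ (t e ≟ⱽ vertex i) * (wt e * F (o e))) edges ∎

  lsum-cartesianProductWith : ∀ {B C D : Set} (f : D → Carrier) (g : B → C → D) xs ys →
    lsum f (cartesianProductWith g xs ys) ≈ lsum (λ x → lsum (λ y → f (g x y)) ys) xs
  lsum-cartesianProductWith f g []       ys = refl
  lsum-cartesianProductWith f g (x ∷ xs) ys = trans (lsum-++ f (map (g x) ys) _)
    (+-cong (lsum-map f (g x) ys) (lsum-cartesianProductWith f g xs ys))

  lsum-paths : ∀ m v w → lsum (λ es → 𝟙ᴿ (Path? v es w) * weight es) (edgeSequences Y m) ≈ paths m v w
  lsum-paths zero    v w = trans (+-identityʳ _) (*-identityʳ _)
  lsum-paths (suc m) v w = trans (lsum-cartesianProductWith _ _∷_ edges (edgeSequences Y m))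
    (lsum-cong edges λ {e} _ → begin
      lsum (λ es → 𝟙ᴿ ((o e ≟ⱽ v) ×-dec Path? (t e) es w) * (wt e * weight es)) (edgeSequences Y m)
        ≈⟨ lsum-cong (edgeSequences Y m) (λ {es} _ → trans (*-congʳ (𝟙ᴿ-× (o e ≟ⱽ v) (Path? (t e) es w)))
             (trans (*-assoc _ _ _) (*-congˡ (x∙yz≈y∙xz _ _ _)))) ⟩
      lsum (λ es → 𝟙ᴿ (o e ≟ⱽ v) * (wt e * (𝟙ᴿ (Path? (t e) es w) * weight es))) (edgeSequences Y m)
        ≈⟨ trans (lsum-*ˡ _ _ (edgeSequences Y m)) (*-congˡ (lsum-*ˡ _ _ (edgeSequences Y m))) ⟩
      𝟙ᴿ (o e ≟ⱽ v) * (wt e * lsum (λ es → 𝟙ᴿ (Path? (t e) es w) * weight es) (edgeSequences Y m))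
        ≈⟨ *-congˡ (*-congˡ (lsum-paths m (t e) w)) ⟩
      𝟙ᴿ (o e ≟ⱽ v) * (wt e * paths m (t e) w) ∎)

  -- A cycle is an edge e followed by a path from the end of e back to its origin. That origin is a
  -- base point, and summing over it gives the trace.
  lsum-cycles : ∀ m → lsum weight (cycles (suc m)) ≈ traceSeries A (suc m)
  lsum-cycles m = begin
    lsum weight (cycles (suc m))
      ≈⟨ lsum-filter (isCycle? Y) weight (edgeSequences Y (suc m)) ⟩
    lsum (λ c → 𝟙ᴿ (isCycle? Y c) * weight c) (edgeSequences Y (suc m))
      ≈⟨ lsum-cartesianProductWith _ _∷_ edges (edgeSequences Y m) ⟩
    lsum (λ e → lsum (λ es → 𝟙ᴿ (isCycle? Y (e ∷ es)) * (wt e * weight es)) (edgeSequences Y m)) edges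
      ≈⟨ lsum-cong edges (λ {e} _ → trans (lsum-cong (edgeSequences Y m) λ {es} _ → trans
           (*-congʳ (reflexive (𝟙ᴿ-⇔ (isCycle? Y (e ∷ es)) (Path? (t e) es (o e)) (Linked⇒Path e es e) (Path⇒Linked e es e))))
           (x∙yz≈y∙xz _ _ _))
           (trans (lsum-*ˡ _ _ (edgeSequences Y m)) (*-congˡ (lsum-paths m (t e) (o e))))) ⟩
    lsum (λ e → wt e * paths m (t e) (o e)) edges
      ≈⟨ lsum-cong edges (λ {e} _ → sum-vertex (o e) (λ v → wt e * paths m (t e) v)) ⟨
    lsum (λ e → sum λ i → 𝟙ᴿ (o e ≟ⱽ vertex i) * (wt e * paths m (t e) (vertex i))) edges
      ≈⟨ sum-lsum _ edges ⟨
    sum (λ i → paths (suc m) (vertex i) (vertex i))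
      ≈⟨ sum-cong (λ i → power≈paths m i i) ⟨
    sum (λ i → (A ^ᴬ suc m) i i) ∎

-- Closed walks of derived digraphs

length-cartesianProduct : ∀ {A B : Set} (xs : List A) (ys : List B) →
  length (cartesianProduct xs ys) ≡ length xs ℕ.* length ys
length-cartesianProduct []       ys = ≡.refl
length-cartesianProduct (x ∷ xs) ys = ≡.trans (List.length-++ (map (x ,_) ys))
  (cong₂ ℕ._+_ (List.length-map (x ,_) ys) (length-cartesianProduct xs ys))

Morphism-IsCycle : ∀ {Y X : Digraph} (f : Morphism Y X) c → IsCycle Y c → IsCycle X (map (Morphism.onE f) c)
Morphism-IsCycle f []       ()
Morphism-IsCycle {Y} {X} f (e ∷ es) cycle = ≡.subst (Linked (λ e f → Digraph.t X e ≡ Digraph.o X f))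
  (List.map-++ onE (e ∷ es) (e ∷ []))
  (Linked.map⁺ (Linked.map (λ te≡oe → ≡.trans (t-comm _) (≡.trans (cong onV te≡oe) (≡.sym (o-comm _)))) cycle))
  where open Morphism f

length-cycles-Iso : ∀ (em : ExcludedMiddle 0ℓ) {Y X : Digraph} → Iso Y X → ∀ m →
  length (Cycles.cycles em Y m) ≡ length (Cycles.cycles em X m)
length-cycles-Iso em {Y} {X} iso m = length-bijection (map (Morphism.onE to)) (map (Morphism.onE from))
  (Y.cycles-unique m) (X.cycles-unique m) to∈ (λ {c} _ → back (proj₂ from∘to≗id) c) from∈ (λ {c} _ → back (proj₂ to∘from≗id) c)
  where
  open Iso iso
  module Y = Cycles em Y
  module X = Cycles em X
  back : ∀ {A B : Set} {f : A → B} {g : B → A} → (∀ x → g (f x) ≡ x) → ∀ xs → map g (map f xs) ≡ xs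
  back gf≡id xs = map-∈-id xs λ {x} _ → gf≡id x
  to∈ : ∀ {c} → c ∈ Y.cycles m → map (Morphism.onE to) c ∈ X.cycles m
  to∈ {c} c∈ = go (Y.∈-cycles⁻ m c∈)
    where
    go : length c ≡ m × IsCycle Y c → map (Morphism.onE to) c ∈ X.cycles m
    go (len , cycle) = X.∈-cycles (≡.trans (List.length-map _ c) len) (Morphism-IsCycle to c cycle)
  from∈ : ∀ {c} → c ∈ X.cycles m → map (Morphism.onE from) c ∈ Y.cycles m
  from∈ {c} c∈ = go (X.∈-cycles⁻ m c∈)
    where
    go : length c ≡ m × IsCycle X c → map (Morphism.onE from) c ∈ Y.cycles m
    go (len , cycle) = Y.∈-cycles (≡.trans (List.length-map _ c) len) (Morphism-IsCycle from c cycle)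

module DerivedCycles (em : ExcludedMiddle 0ℓ) (p : ℕ) .{{_ : NonZero p}} (X : Digraph)
  (α : Digraph.E X → ℤₚ p) (n : ℕ) where
  open Digraph X using (V; E; o; t)

  private
    D = derived p X α n
    q = p ℕ.^ n
    instance
      q≢0 : NonZero q
      q≢0 = ℕ.m^n≢0 p n
    module B = Cycles em X
    module C = Cycles em D
    module PB = Paths X
    module PD = Paths D

  infixl 6 _⊕_
  _⊕_ : Fin q → Fin q → Fin q
  _⊕_ = AbelianGroup._∙_ (ℤ/p^ p n)

  ⊕-mod : ∀ σ τ → toℕ (σ ⊕ τ) ≡ toℕ σ ℕ.+ toℕ τ [mod q ]
  ⊕-mod σ τ = ≡.subst (_≡ toℕ σ ℕ.+ toℕ τ [mod q ])
    (≡.sym (Fin.toℕ-fromℕ< (ℕ.m%n<n (toℕ σ ℕ.+ toℕ τ) q))) (%-mod (toℕ σ ℕ.+ toℕ τ) q)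

  toℕ-mod-injective : ∀ {σ τ : Fin q} → toℕ σ ≡ toℕ τ [mod q ] → σ ≡ τ
  toℕ-mod-injective σ≡τ = Fin.toℕ-injective (mod-unique (Fin.toℕ<n _) (Fin.toℕ<n _) σ≡τ)

  ρ : E → Fin q
  ρ e = ℤₚ.residue (α e) n

  voltage : List E → ℕ
  voltage = foldr (λ e s → toℕ (ρ e) ℕ.+ s) 0

  private
    lift : List E → Fin q → List (E × Fin q)
    lift []       σ = []
    lift (e ∷ es) σ = (e , σ) ∷ lift es (σ ⊕ ρ e)

    end : Fin q → List E → Fin q
    end σ []       = σ
    end σ (e ∷ es) = end (σ ⊕ ρ e) es

    end-mod : ∀ σ es → toℕ (end σ es) ≡ toℕ σ ℕ.+ voltage es [mod q ]
    end-mod σ []       = ≡.subst (toℕ σ ≡_[mod q ]) (≡.sym (ℕ.+-identityʳ _)) (mod-refl _)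
    end-mod σ (e ∷ es) = mod-trans (end-mod (σ ⊕ ρ e) es)
      (≡.subst (toℕ (σ ⊕ ρ e) ℕ.+ voltage es ≡_[mod q ]) (ℕ.+-assoc (toℕ σ) _ _) (mod-+ʳ (voltage es) (⊕-mod σ (ρ e))))

    lift-Path : ∀ v es w σ → PB.Path v es w → PD.Path (v , σ) (lift es σ) (w , end σ es)
    lift-Path v []       w σ v≡w          = cong (_, σ) v≡w
    lift-Path v (e ∷ es) w σ (oe≡v , path) = cong (_, σ) oe≡v , lift-Path (t e) es w (σ ⊕ ρ e) path

    unlift : ∀ v σ es w τ → PD.Path (v , σ) es (w , τ) →
      PB.Path v (map proj₁ es) w × es ≡ lift (map proj₁ es) σ × τ ≡ end σ (map proj₁ es)
    unlift v σ []             w τ eq           = cong proj₁ eq , ≡.refl , ≡.sym (cong proj₂ eq)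
    unlift v σ ((e , ς) ∷ es) w τ (eq , path) = go (cong proj₁ eq) (cong proj₂ eq) path
      where
      go : o e ≡ v → ς ≡ σ → PD.Path (t e , ς ⊕ ρ e) es (w , τ) →
        PB.Path v (map proj₁ ((e , ς) ∷ es)) w × (e , ς) ∷ es ≡ lift (map proj₁ ((e , ς) ∷ es)) σ ×
        τ ≡ end σ (map proj₁ ((e , ς) ∷ es))
      go oe≡v ≡.refl path = go′ (unlift (t e) (σ ⊕ ρ e) es w τ path)
        where
        go′ : PB.Path (t e) (map proj₁ es) w × es ≡ lift (map proj₁ es) (σ ⊕ ρ e) × τ ≡ end (σ ⊕ ρ e) (map proj₁ es) →
          PB.Path v (map proj₁ ((e , σ) ∷ es)) w × (e , σ) ∷ es ≡ lift (map proj₁ ((e , σ) ∷ es)) σ ×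
          τ ≡ end σ (map proj₁ ((e , σ) ∷ es))
        go′ (path′ , es≡ , τ≡) = (oe≡v , path′) , cong ((e , σ) ∷_) es≡ , τ≡

    start : List (E × Fin q) → Fin q
    start []            = 0 mod q
    start ((e , σ) ∷ _) = σ

    closed⇒voltage : ∀ σ c → end σ c ≡ σ → voltage c ≡ 0 [mod q ]
    closed⇒voltage σ c end≡ = mod-+ˡ-cancel (toℕ σ) (≡.subst (toℕ σ ℕ.+ voltage c ≡_[mod q ])
      (≡.trans (cong toℕ end≡) (≡.sym (ℕ.+-identityʳ _))) (mod-sym (end-mod σ c)))

    voltage⇒closed : ∀ σ c → voltage c ≡ 0 [mod q ] → end σ c ≡ σ
    voltage⇒closed σ c v≡0 = toℕ-mod-injective (mod-trans (end-mod σ c)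
      (≡.subst (toℕ σ ℕ.+ voltage c ≡_[mod q ]) (ℕ.+-identityʳ _) (mod-+ˡ (toℕ σ) v≡0)))

    length-lift : ∀ es σ → length (lift es σ) ≡ length es
    length-lift []       σ = ≡.refl
    length-lift (e ∷ es) σ = cong suc (length-lift es _)

    map-lift : ∀ es σ → map proj₁ (lift es σ) ≡ es
    map-lift []       σ = ≡.refl
    map-lift (e ∷ es) σ = cong (e ∷_) (map-lift es _)

  neutral : ℕ → List (List E)
  neutral m = filter (λ c → voltage c ≡ 0 [mod q ]?) (B.cycles m)

  -- A cycle of the derived digraph is a cycle of X together with the sheet on which it starts.
  -- Running through c moves the sheet by the voltage of c, so the lift closes up exactly when that
  -- voltage is 0 modulo q, and then from each of the q sheets.
  length-cycles-derived : ∀ m → length (C.cycles (suc m)) ≡ length (neutral (suc m)) ℕ.* q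
  length-cycles-derived m = ≡.trans
    (length-bijection {A = List (E × Fin q)} {B = List E × Fin q} (λ w → map proj₁ w , start w) (λ (c , σ) → lift c σ)
      (C.cycles-unique (suc m))
      (Unique.cartesianProduct⁺ (Unique.filter⁺ (λ c → voltage c ≡ 0 [mod q ]?) (B.cycles-unique (suc m))) (Unique.allFin⁺ q))
      (λ w∈ → proj₁ (to w∈)) (λ w∈ → proj₂ (to w∈)) (λ {(c , σ)} x∈ → proj₁ (from c σ x∈)) (λ {(c , σ)} x∈ → proj₂ (from c σ x∈)))
    (≡.trans (length-cartesianProduct (neutral (suc m)) (allFin q))
      (cong (length (neutral (suc m)) ℕ.*_) (List.length-tabulate {n = q} id)))
    where
    pairs = cartesianProduct (neutral (suc m)) (allFin q)
    to : ∀ {w} → w ∈ C.cycles (suc m) → (map proj₁ w , start w) ∈ pairs × lift (map proj₁ w) (start w) ≡ w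
    to {w} w∈ = go w (C.∈-cycles⁻ (suc m) w∈)
      where
      go : ∀ w → length w ≡ suc m × IsCycle D w → (map proj₁ w , start w) ∈ pairs × lift (map proj₁ w) (start w) ≡ w
      go ((e , σ) ∷ es) (len , cycle) = go′ (unlift (t e) (σ ⊕ ρ e) es (o e) σ (PD.Linked⇒Path (e , σ) es (e , σ) cycle))
        where
        c = map proj₁ ((e , σ) ∷ es)
        go′ : PB.Path (t e) (map proj₁ es) (o e) × es ≡ lift (map proj₁ es) (σ ⊕ ρ e) × σ ≡ end (σ ⊕ ρ e) (map proj₁ es) →
          (c , σ) ∈ pairs × lift c σ ≡ (e , σ) ∷ es
        go′ (path , es≡ , σ≡) = Mem.∈-cartesianProduct⁺ (Mem.∈-filter⁺ (λ c → voltage c ≡ 0 [mod q ]?)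
            (B.∈-cycles (≡.trans (List.length-map proj₁ ((e , σ) ∷ es)) len) (PB.Path⇒Linked e (map proj₁ es) e path))
            (closed⇒voltage σ c (≡.sym σ≡))) (Mem.∈-allFin σ) ,
          cong ((e , σ) ∷_) (≡.sym es≡)
    from : ∀ c σ → (c , σ) ∈ pairs → lift c σ ∈ C.cycles (suc m) × (map proj₁ (lift c σ) , start (lift c σ)) ≡ (c , σ)
    from c σ x∈ = go c (Mem.∈-filter⁻ (λ c → voltage c ≡ 0 [mod q ]?) {xs = B.cycles (suc m)}
        (proj₁ (Mem.∈-cartesianProduct⁻ (neutral (suc m)) (allFin q) x∈)))
      where
      go : ∀ c → c ∈ B.cycles (suc m) × voltage c ≡ 0 [mod q ] →
        lift c σ ∈ C.cycles (suc m) × (map proj₁ (lift c σ) , start (lift c σ)) ≡ (c , σ)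
      go c (c∈ , v≡0) = go′ c (B.∈-cycles⁻ (suc m) c∈) v≡0
        where
        go′ : ∀ c → length c ≡ suc m × IsCycle X c → voltage c ≡ 0 [mod q ] →
          lift c σ ∈ C.cycles (suc m) × (map proj₁ (lift c σ) , start (lift c σ)) ≡ (c , σ)
        go′ (e ∷ es) (len , cycle) v≡0 =
          C.∈-cycles (≡.trans (length-lift (e ∷ es) σ) len)
            (PD.Path⇒Linked (e , σ) (lift es (σ ⊕ ρ e)) (e , σ)
              (≡.subst (λ τ → PD.Path (t e , σ ⊕ ρ e) (lift es (σ ⊕ ρ e)) (o e , τ)) (voltage⇒closed σ (e ∷ es) v≡0)
                (lift-Path (t e) es (o e) (σ ⊕ ρ e) (PB.Linked⇒Path e es e cycle)))) ,
          cong (_, σ) (map-lift (e ∷ es) σ)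

-- Inverses of power series

module SeriesInverse (R : CommutativeRing 0ℓ 0ℓ) where
  open CommutativeRing R hiding (zero)
  open Series R
  open SetoidReasoning setoid
  open AbelianGroupProperties +-abelianGroup using () renaming (ε⁻¹≈ε to -0≈0)
  private module S = CommutativeRing series

  *ˢ-agree : ∀ n {f g h : Ser} → (∀ i → i ≤ n → g i ≈ h i) → (f *ˢ g) n ≈ (f *ˢ h) n
  *ˢ-agree zero    g≈h = *-congˡ (g≈h 0 z≤n)
  *ˢ-agree (suc n) g≈h = +-cong (*-congˡ (g≈h (suc n) ℕ.≤-refl))
    (*ˢ-agree n λ i i≤n → g≈h i (ℕ.m≤n⇒m≤1+n i≤n))

  private
    -- The k-th iterate of g ↦ 1 - u (tl f) g, whose fixed point is the inverse of f when f₀ = 1.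
    -- Each step makes one more coefficient final.
    approx : Ser → ℕ → Ser
    approx f zero    = 0ˢ
    approx f (suc k) = 1ˢ +ˢ -ˢ shift (tl f *ˢ approx f k)

    approx-stable : ∀ f k i → i < k → approx f k i ≈ approx f (suc k) i
    approx-stable f (suc k) zero    i<k       = refl
    approx-stable f (suc k) (suc i) (s≤s i<k) = +-congˡ (-‿cong (*ˢ-agree i λ j j≤i →
      approx-stable f k j (ℕ.≤-<-trans j≤i i<k)))

  inverse : Ser → Ser
  inverse f n = approx f (suc n) n

  private
    approx≈inverse : ∀ f k i → i < k → approx f k i ≈ inverse f i
    approx≈inverse f (suc k) i (s≤s i≤k) = [ (λ i<k → trans (sym (approx-stable f k i i<k)) (approx≈inverse f k i i<k)) ,
      (λ i≡k → reflexive (cong (λ k → approx f (suc k) i) (≡.sym i≡k))) ]′ (ℕ.m≤n⇒m<n∨m≡n i≤k)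

  *ˢ-inverse : ∀ f → f 0 ≈ 1# → f *ˢ inverse f ≈ˢ 1ˢ
  *ˢ-inverse f f₀≈1 = S.trans (S.*-congʳ {inverse f} f≈) (S.trans (S.distribʳ (inverse f) 1ˢ (shift (tl f)))
    (S.trans (S.+-cong (S.trans (S.*-identityˡ (inverse f)) g≈) (shift-* (tl f) (inverse f)))
    (S.trans (S.+-assoc 1ˢ _ _) (S.trans (S.+-congˡ {1ˢ} (S.-‿inverseˡ _)) (S.+-identityʳ 1ˢ)))))
    where
    f≈ : f ≈ˢ 1ˢ +ˢ shift (tl f)
    f≈ = coeffs λ { zero → trans f₀≈1 (sym (+-identityʳ 1#)) ; (suc n) → sym (+-identityˡ _) }
    g≈ : inverse f ≈ˢ 1ˢ +ˢ -ˢ shift (tl f *ˢ inverse f)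
    g≈ = coeffs λ { zero → refl ; (suc n) → +-congˡ (-‿cong (*ˢ-agree n λ i i≤n → approx≈inverse f (suc n) i (s≤s i≤n))) }

-- Artin L-functions

-- A domain of characteristic zero in which ℤ/q has q characters χ 0 , … , χ (q − 1);
-- χ j b is the value of the j-th character at the class of b.
record CharacterRing (q : ℕ) : Set₁ where
  field
    O : CommutativeRing 0ℓ 0ℓ
  open CommutativeRing O hiding (zero)
  field
    domain        : ∀ x y → x * y ≈ 0# → x ≈ 0# ⊎ y ≈ 0#
    torsionFree   : Series.TorsionFree O
    ιᴼ             : ℤ → Carrier
    ιᴼ-0           : ιᴼ 0ℤ ≈ 0#
    ιᴼ-1           : ιᴼ 1ℤ ≈ 1#
    ιᴼ-+           : ∀ c d → ιᴼ (c ℤ.+ d) ≈ ιᴼ c + ιᴼ d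
    ιᴼ-*           : ∀ c d → ιᴼ (c ℤ.* d) ≈ ιᴼ c * ιᴼ d
    ιᴼ-neg         : ∀ c → ιᴼ (ℤ.- c) ≈ - ιᴼ c
    ιᴼ-injective   : ∀ c → ιᴼ c ≈ 0# → c ≡ 0ℤ
    χ             : ℕ → ℕ → Carrier
    χ-0           : ∀ j → χ j 0 ≈ 1#
    χ-+           : ∀ j a b → χ j (a ℕ.+ b) ≈ χ j a * χ j b
    orthogonality : ∀ b → ListSums.lsum O (λ j → χ j b) (upTo q) ≈ ιᴼ (+ q ℤ.* 𝟙 (b ≡ 0 [mod q ]?))

-- Y is tied to X through `count` alone: its cycles are the cycles of X of voltage 0 modulo q, each
-- counted q times.
module Artin (em : ExcludedMiddle 0ℓ) (q : ℕ) (𝓞 : CharacterRing q)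
  (X : Digraph) (v : Digraph.E X → ℕ)
  (Y : Digraph)
  (count : ∀ m → length (Cycles.cycles em Y (suc m)) ≡
    length (filter (λ c → foldr (λ e s → v e ℕ.+ s) 0 c ≡ 0 [mod q ]?) (Cycles.cycles em X (suc m))) ℕ.* q)
  where

  open Digraph X using (E; #V)
  open CharacterRing 𝓞
  open CommutativeRing O hiding (zero)
  open Series O hiding (TorsionFree)
  private
    module S = CommutativeRing series
    module LO = ListSums O
    module LS = ListSums series
    module CX = Cycles em X
    module CY = Cycles em Y
    module Z = Zeta em Y
    module Tr (j : ℕ) = Trace em X O (λ e → χ j (v e))

  voltage : List E → ℕ
  voltage = foldr (λ e s → v e ℕ.+ s) 0

  A : ℕ → Matrix Carrier #V
  A j = Tr.A j

  D T : ℕ → Ser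
  D j = charPoly (A j)
  T j = traceSeries (A j)

  ∏ : List ℕ → Ser
  ∏ []       = 1ˢ
  ∏ (j ∷ js) = D j *ˢ ∏ js

  θ-∏ : ∀ js → θ (∏ js) ≈ˢ -ˢ (LS.lsum T js *ˢ ∏ js)
  θ-∏ []       = S.trans (θ-const 1#) (S.sym (S.trans (S.-‿cong (S.zeroˡ (∏ []))) -0≈0))
    where open AbelianGroupProperties S.+-abelianGroup using () renaming (ε⁻¹≈ε to -0≈0)
  θ-∏ (j ∷ js) = begin
    θ (D j *ˢ P)                                       ≈⟨ θ-* (D j) P ⟩
    θ (D j) *ˢ P +ˢ D j *ˢ θ P
      ≈⟨ S.+-cong (S.*-congʳ {P} (θ-charPoly (A j))) (S.*-congˡ {D j} (θ-∏ js)) ⟩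
    (-ˢ (T j *ˢ D j)) *ˢ P +ˢ D j *ˢ (-ˢ (Σ *ˢ P))
      ≈⟨ S.+-cong (S.sym (-‿distribˡ-* (T j *ˢ D j) P)) (S.sym (-‿distribʳ-* (D j) (Σ *ˢ P))) ⟩
    -ˢ (T j *ˢ D j *ˢ P) +ˢ -ˢ (D j *ˢ (Σ *ˢ P))       ≈⟨ -‿+-comm _ _ ⟩
    -ˢ (T j *ˢ D j *ˢ P +ˢ D j *ˢ (Σ *ˢ P))            ≈⟨ S.-‿cong (SemiringIdentities.TDP+D[SP]≈[T+S][DP] series (T j) (D j) P Σ) ⟩
    -ˢ ((T j +ˢ Σ) *ˢ (D j *ˢ P))                      ∎
    where
    open SetoidReasoning S.setoid
    open RingProperties S.ring using (-‿distribˡ-*; -‿distribʳ-*)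
    open AbelianGroupProperties S.+-abelianGroup using () renaming (⁻¹-∙-comm to -‿+-comm)
    P = ∏ js
    Σ = LS.lsum T js

  ιˢ : PowerSeries → Ser
  ιˢ f n = ιᴼ (f n)

  ιˢ-cong : ∀ {f g} → (∀ n → f n ≡ g n) → ιˢ f ≈ˢ ιˢ g
  ιˢ-cong f≡g = coeffs λ n → reflexive (cong ιᴼ (f≡g n))

  ιˢ-* : ∀ f g → ιˢ (f SZ.*ˢ g) ≈ˢ ιˢ f *ˢ ιˢ g
  ιˢ-* f g = coeffs (go f g)
    where
    go : ∀ f g n → ιᴼ ((f SZ.*ˢ g) n) ≈ (ιˢ f *ˢ ιˢ g) n
    go f g zero    = ιᴼ-* _ _
    go f g (suc n) = trans (ιᴼ-+ _ _) (+-cong (ιᴼ-* _ _) (go (f ∘ suc) g n))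

  ιˢ-θ : ∀ f → ιˢ (SZ.θ f) ≈ˢ θ (ιˢ f)
  ιˢ-θ f = coeffs λ n → go n (f n)
    where
    open SemiringMult (CommutativeRing.semiring ℤ.+-*-commutativeRing) using () renaming (_×_ to _×ℤ_)
    open SemiringMult semiring using () renaming (_×_ to _×ℕ_)
    go : ∀ n x → ιᴼ (n ×ℤ x) ≈ n ×ℕ ιᴼ x
    go zero    x = ιᴼ-0
    go (suc n) x = trans (ιᴼ-+ _ _) (+-congˡ (go n x))

  ιˢ-1 : ιˢ SZ.1ˢ ≈ˢ 1ˢ
  ιˢ-1 = coeffs λ { zero → ιᴼ-1 ; (suc n) → ιᴼ-0 }

  ιˢ-w : ιˢ SZ.w ≈ˢ w
  ιˢ-w = coeffs λ { zero → trans (ιᴼ-+ 0ℤ -1ℤ) (+-cong ιᴼ-0 (trans (ιᴼ-neg 1ℤ) (-‿cong ιᴼ-1)))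
                  ; (suc zero) → trans (ιᴼ-+ 1ℤ 0ℤ) (+-cong ιᴼ-1 (trans (ιᴼ-neg 0ℤ) (-‿cong ιᴼ-0)))
                  ; (suc (suc n)) → trans (ιᴼ-+ 0ℤ 0ℤ) (+-cong ιᴼ-0 (trans (ιᴼ-neg 0ℤ) (-‿cong ιᴼ-0))) }

  ιˢ-w^ : ∀ d → ιˢ (SZ.w^ d) ≈ˢ w^ d
  ιˢ-w^ zero    = ιˢ-1
  ιˢ-w^ (suc d) = S.trans (ιˢ-* SZ.w (SZ.w^ d)) (S.*-cong ιˢ-w (ιˢ-w^ d))

  ιˢ-Deg≤ : ∀ {f N} → SZ.Deg≤ f N → Deg≤ (ιˢ f) N
  ιˢ-Deg≤ df n N<n = trans (reflexive (cong ιᴼ (df n N<n))) ιᴼ-0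

  ιˢ-Ev : ∀ {f c} → SZ.Ev f c → Ev (ιˢ f) (ιᴼ c)
  ιˢ-Ev {f} {c} (h , (N , dh) , f≈) = ιˢ h , (N , ιˢ-Deg≤ {h} dh) , (begin
    ιˢ f                                  ≈⟨ ιˢ-cong (SZ.at f≈) ⟩
    ιˢ (SZ.const c SZ.+ˢ SZ.w SZ.*ˢ h)    ≈⟨ coeffs (λ n → ιᴼ-+ (SZ.const c n) ((SZ.w SZ.*ˢ h) n)) ⟩
    ιˢ (SZ.const c) +ˢ ιˢ (SZ.w SZ.*ˢ h)
      ≈⟨ S.+-cong (coeffs λ { zero → refl ; (suc n) → ιᴼ-0 }) (S.trans (ιˢ-* SZ.w h) (S.*-congʳ {ιˢ h} ιˢ-w)) ⟩
    const (ιᴼ c) +ˢ w *ˢ ιˢ h              ∎)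
    where open SetoidReasoning S.setoid

  ιᴼ-lsum : ∀ {B : Set} (f : B → ℤ) xs → ιᴼ (LZ.lsum f xs) ≈ LO.lsum (ιᴼ ∘ f) xs
  ιᴼ-lsum f []       = ιᴼ-0
  ιᴼ-lsum f (x ∷ xs) = trans (ιᴼ-+ _ _) (+-congˡ (ιᴼ-lsum f xs))

  lsumˢ-at : ∀ {B : Set} (f : B → Ser) xs n → LS.lsum f xs n ≈ LO.lsum (λ x → f x n) xs
  lsumˢ-at f []       n = refl
  lsumˢ-at f (x ∷ xs) n = +-congˡ (lsumˢ-at f xs n)

  weight≈χ : ∀ j c → Tr.weight j c ≈ χ j (voltage c)
  weight≈χ j []       = sym (χ-0 j)
  weight≈χ j (e ∷ es) = trans (*-congˡ (weight≈χ j es)) (sym (χ-+ j (v e) (voltage es)))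

  -- The m-th trace of `A j` is the sum of χ_j over the voltages of the cycles of length m. After
  -- exchanging the sums, orthogonality leaves q for each neutral cycle and 0 for the others, which
  -- is what `count` supplies.
  ΣT≈cycleSeries : LS.lsum T (upTo q) ≈ˢ ιˢ Z.cycleSeries
  ΣT≈cycleSeries = coeffs λ n → trans (lsumˢ-at T (upTo q) n) (coefficient n)
    where
    open SetoidReasoning setoid
    coefficient : ∀ n → LO.lsum (λ j → T j n) (upTo q) ≈ ιᴼ (Z.cycleSeries n)
    coefficient zero    = trans (LO.lsum-0 (upTo q) λ _ → refl) (sym ιᴼ-0)
    coefficient (suc m) = begin
      LO.lsum (λ j → T j (suc m)) (upTo q)
        ≈⟨ LO.lsum-cong (upTo q) (λ {j} _ → trans (sym (Tr.lsum-cycles j m)) (LO.lsum-cong (CX.cycles (suc m)) λ {c} _ → weight≈χ j c)) ⟩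
      LO.lsum (λ j → LO.lsum (λ c → χ j (voltage c)) (CX.cycles (suc m))) (upTo q)
        ≈⟨ LO.lsum-comm (λ j c → χ j (voltage c)) (upTo q) (CX.cycles (suc m)) ⟩
      LO.lsum (λ c → LO.lsum (λ j → χ j (voltage c)) (upTo q)) (CX.cycles (suc m))
        ≈⟨ LO.lsum-cong (CX.cycles (suc m)) (λ {c} _ → orthogonality (voltage c)) ⟩
      LO.lsum (λ c → ιᴼ (+ q ℤ.* 𝟙 (voltage c ≡ 0 [mod q ]?))) (CX.cycles (suc m))
        ≈⟨ ιᴼ-lsum _ (CX.cycles (suc m)) ⟨
      ιᴼ (LZ.lsum (λ c → + q ℤ.* 𝟙 (voltage c ≡ 0 [mod q ]?)) (CX.cycles (suc m)))
        ≡⟨ cong ιᴼ (≡.trans (LZ.lsum-*ˡ (+ q) _ (CX.cycles (suc m)))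
             (cong (ℤ._*_ (+ q)) (≡.sym (length-filter (λ c → voltage c ≡ 0 [mod q ]?) (CX.cycles (suc m)))))) ⟩
      ιᴼ (+ q ℤ.* + length (filter (λ c → voltage c ≡ 0 [mod q ]?) (CX.cycles (suc m))))
        ≡⟨ cong ιᴼ (≡.trans (≡.sym (ℤ.pos-* q _)) (cong +_ (≡.trans (ℕ.*-comm q _) (≡.sym (count m))))) ⟩
      ιᴼ (+ length (CY.cycles (suc m))) ∎

  ∏-0 : ∀ js → ∏ js 0 ≈ 1#
  ∏-0 []       = refl
  ∏-0 (j ∷ js) = trans (*-cong (charPoly-0 (A j)) (∏-0 js)) (*-identityˡ 1#)

  -- Both sides have constant term 1, and the left-hand side has vanishing derivative.
  zeta-∏ : ιˢ (zeta Y) *ˢ ∏ (upTo q) ≈ˢ 1ˢ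
  zeta-∏ = S.trans (θ≈0⇒const torsionFree (ζ *ˢ P) θ≈0) (const-cong (trans (*-cong ιᴼ-1 (∏-0 (upTo q))) (*-identityˡ 1#)))
    where
    open SetoidReasoning S.setoid
    open RingProperties S.ring using (-‿distribʳ-*)
    ζ = ιˢ (zeta Y)
    P = ∏ (upTo q)
    C = ιˢ Z.cycleSeries
    θ≈0 : θ (ζ *ˢ P) ≈ˢ 0ˢ
    θ≈0 = begin
      θ (ζ *ˢ P)                               ≈⟨ θ-* ζ P ⟩
      θ ζ *ˢ P +ˢ ζ *ˢ θ P
        ≈⟨ S.+-cong (S.*-congʳ {P} (S.trans (S.sym (ιˢ-θ (zeta Y))) (S.trans (ιˢ-cong (SZ.at Z.θ-zeta)) (ιˢ-* (zeta Y) Z.cycleSeries))))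
             (S.*-congˡ {ζ} (S.trans (θ-∏ (upTo q)) (S.-‿cong (S.*-congʳ {P} ΣT≈cycleSeries)))) ⟩
      ζ *ˢ C *ˢ P +ˢ ζ *ˢ (-ˢ (C *ˢ P))         ≈⟨ S.+-cong (S.*-assoc ζ C P) (S.sym (-‿distribʳ-* ζ (C *ˢ P))) ⟩
      ζ *ˢ (C *ˢ P) +ˢ -ˢ (ζ *ˢ (C *ˢ P))       ≈⟨ S.-‿inverseʳ (ζ *ˢ (C *ˢ P)) ⟩
      0ˢ                                        ∎

  -- The reciprocal is formed over ℤ as a power series. The bound on its degree is found over the
  -- character ring, by `den≈∏`, and comes back to ℤ by injectivity of `ιᴼ`.
  den : PowerSeries
  den = SeriesInverse.inverse ℤ.+-*-commutativeRing (zeta Y)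

  zeta-den : zeta Y SZ.*ˢ den SZ.≈ˢ SZ.1ˢ
  zeta-den = SeriesInverse.*ˢ-inverse ℤ.+-*-commutativeRing (zeta Y) Z.zeta-0

  den≈∏ : ιˢ den ≈ˢ ∏ (upTo q)
  den≈∏ = begin
    δˢ                       ≈⟨ S.*-identityʳ δˢ ⟨
    δˢ *ˢ 1ˢ                 ≈⟨ S.*-congˡ {δˢ} zeta-∏ ⟨
    δˢ *ˢ (ζ *ˢ P)           ≈⟨ S.*-assoc δˢ ζ P ⟨
    δˢ *ˢ ζ *ˢ P             ≈⟨ S.*-congʳ {P} (S.trans (S.*-comm δˢ ζ) (S.trans (S.sym (ιˢ-* (zeta Y) den)) (S.trans (ιˢ-cong (SZ.at zeta-den)) ιˢ-1))) ⟩
    1ˢ *ˢ P                  ≈⟨ S.*-identityˡ P ⟩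
    P                        ∎
    where
    open SetoidReasoning S.setoid
    δˢ = ιˢ den
    ζ = ιˢ (zeta Y)
    P = ∏ (upTo q)

  ∏-Deg≤ : ∀ js → Deg≤ (∏ js) (length js ℕ.* #V)
  ∏-Deg≤ []       = Deg≤-const
  ∏-Deg≤ (j ∷ js) = Deg≤-* {D j} {∏ js} (charPoly-Deg≤ (A j)) (∏-Deg≤ js)

  den-IsPoly : SZ.IsPoly den
  den-IsPoly = length (upTo q) ℕ.* #V , λ n N<n → ιᴼ-injective (den n) (trans (at den≈∏ n) (∏-Deg≤ (upTo q) n N<n))

  L : ℕ → Carrier
  L j = det rawRing λ i k → Id rawRing i k + - A j i k

  module _ {Bad : ℕ → Set} (bad? : Decidable Bad) (L≉0 : ∀ {j} → j ∈ upTo q → ¬ Bad j → ¬ L j ≈ 0#) where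

    private
      bad good : List ℕ → List ℕ
      bad  = filter bad?
      good = filter (¬? ∘ bad?)

      ∏-split : ∀ js → ∏ js ≈ˢ ∏ (bad js) *ˢ ∏ (good js)
      ∏-split []       = S.sym (S.*-identityˡ 1ˢ)
      ∏-split (j ∷ js) with bad? j
      ... | yes _ = S.trans (S.*-congˡ {D j} (∏-split js)) (S.sym (S.*-assoc (D j) _ _))
      ... | no  _ = S.trans (S.*-congˡ {D j} (∏-split js)) (SemiringIdentities.a[bc]≈b[ac] series (D j) _ _)

      1≉0 : ¬ 1# ≈ 0#
      1≉0 1≈0 = contradiction (ιᴼ-injective 1ℤ (trans ιᴼ-1 1≈0)) λ ()

      ∏-Ev : ∀ js → (∀ {j} → j ∈ js → ¬ L j ≈ 0#) → ∃ λ c → Ev (∏ js) c × ¬ c ≈ 0#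
      ∏-Ev []       L≉0 = 1# , Ev-const 1# , 1≉0
      ∏-Ev (j ∷ js) L≉0 = go (∏-Ev js (L≉0 ∘ there))
        where
        go : (∃ λ c → Ev (∏ js) c × ¬ c ≈ 0#) → ∃ λ c → Ev (D j *ˢ ∏ js) c × ¬ c ≈ 0#
        go (c , ev , c≉0) = L j * c , Ev-* {D j} {∏ js} {L j} {c} (charPoly-1 (A j)) ev ,
          λ Lc≈0 → [ L≉0 (here ≡.refl) , c≉0 ]′ (domain (L j) c Lc≈0)

    -- Over the character ring `den` splits into the product F over bad j, of degree at most #V per
    -- factor, and the product G over good j, which does not vanish at u = 1. The extra factor g
    -- allows for fractions representing the zeta function that are not in lowest terms.
    den-order : ∀ d g k c → SZ.IsPoly k → SZ.Ev g c → c ≢ 0ℤ → g SZ.*ˢ den SZ.≈ˢ SZ.w^ d SZ.*ˢ k →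
                d ≤ length (bad (upTo q)) ℕ.* #V
    den-order d g k c (N , dk) evg c≢0 gD≈ = go (∏-Ev (good (upTo q)) λ j∈ →
        let j∈upTo , ¬bad = Mem.∈-filter⁻ (¬? ∘ bad?) {xs = upTo q} j∈ in L≉0 j∈upTo ¬bad)
      where
      F = ∏ (bad (upTo q))
      G = ∏ (good (upTo q))
      go : (∃ λ c → Ev G c × ¬ c ≈ 0#) → d ≤ length (bad (upTo q)) ℕ.* #V
      go (e , evG , e≉0) = order≤degree domain d _ F (ιˢ g *ˢ G) (ιᴼ c * e) (ιˢ k)
        (∏-Deg≤ (bad (upTo q))) (λ F₀≈0 → 1≉0 (trans (sym (∏-0 (bad (upTo q)))) F₀≈0))
        (Ev-* {ιˢ g} {G} {ιᴼ c} {e} (ιˢ-Ev {g} {c} evg) evG)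
        (λ ce≈0 → [ (λ c≈0 → c≢0 (ιᴼ-injective c c≈0)) , e≉0 ]′ (domain (ιᴼ c) e ce≈0))
        (N , ιˢ-Deg≤ {k} dk)
        (begin
          F *ˢ (ιˢ g *ˢ G)           ≈⟨ SemiringIdentities.a[bc]≈b[ac] series F (ιˢ g) G ⟩
          ιˢ g *ˢ (F *ˢ G)           ≈⟨ S.*-congˡ {ιˢ g} (S.trans den≈∏ (∏-split (upTo q))) ⟨
          ιˢ g *ˢ ιˢ den             ≈⟨ ιˢ-* g den ⟨
          ιˢ (g SZ.*ˢ den)           ≈⟨ ιˢ-cong (SZ.at gD≈) ⟩
          ιˢ (SZ.w^ d SZ.*ˢ k)       ≈⟨ ιˢ-* (SZ.w^ d) k ⟩
          ιˢ (SZ.w^ d) *ˢ ιˢ k       ≈⟨ S.*-congʳ {ιˢ k} (ιˢ-w^ d) ⟩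
          w^ d *ˢ ιˢ k               ∎)
        where open SetoidReasoning S.setoid

-- Orders at u = 1

w^-+ : ∀ a b → SZ.w^ (a ℕ.+ b) SZ.≈ˢ SZ.w^ a SZ.*ˢ SZ.w^ b
w^-+ zero    b = SZR.sym (SZR.*-identityˡ (SZ.w^ b))
w^-+ (suc a) b = SZR.trans (SZR.*-congˡ {SZ.w} (w^-+ a b)) (SZR.sym (SZR.*-assoc SZ.w (SZ.w^ a) (SZ.w^ b)))

w^-cancel : ∀ a {f g} → SZ.w^ a SZ.*ˢ f SZ.≈ˢ SZ.w^ a SZ.*ˢ g → f SZ.≈ˢ g
w^-cancel zero    {f} {g} eq = SZR.trans (SZR.sym (SZR.*-identityˡ f)) (SZR.trans eq (SZR.*-identityˡ g))
w^-cancel (suc a) {f} {g} eq = w^-cancel a {f} {g} (SZ.w-cancel {SZ.w^ a SZ.*ˢ f} {SZ.w^ a SZ.*ˢ g}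
  (SZR.trans (SZR.sym (SZR.*-assoc SZ.w (SZ.w^ a) f)) (SZR.trans eq (SZR.*-assoc SZ.w (SZ.w^ a) g))))

IsPoly⇒IsPolynomial : ∀ {f} → SZ.IsPoly f → IsPolynomial f
IsPoly⇒IsPolynomial (N , df) = suc N , df

IsPolynomial⇒IsPoly : ∀ {f} → IsPolynomial f → SZ.IsPoly f
IsPolynomial⇒IsPoly (N , df) = N , λ n N<n → df n (ℕ.<⇒≤ N<n)

u-1≈w : u-1 SZ.≈ˢ SZ.w
u-1≈w = SZ.coeffs λ { 0 → ≡.refl ; 1 → ≡.refl ; (suc (suc n)) → ≡.refl }

[u-1]^≈w^ : ∀ d → [u-1]^ d SZ.≈ˢ SZ.w^ d
[u-1]^≈w^ zero    = SZ.coeffs oneˢ≡1ˢ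
[u-1]^≈w^ (suc d) = SZR.trans (SZ.coeffs (⊛≡*ˢ u-1 ([u-1]^ d))) (SZR.*-cong u-1≈w ([u-1]^≈w^ d))

infix 4 w^_∣_
w^_∣_ : ℕ → PowerSeries → Set
w^ d ∣ f = ∃ λ h → SZ.IsPoly h × SZ.w^ d SZ.*ˢ h SZ.≈ˢ f

∣ᴾ⇒∣ : ∀ d {f} → [u-1]^ d ∣ᴾ f → w^ d ∣ f
∣ᴾ⇒∣ d {f} (h , ph , eq) = h , IsPolynomial⇒IsPoly {h} ph ,
  SZR.trans (SZR.*-congʳ {h} (SZR.sym ([u-1]^≈w^ d)))
    (SZR.trans (SZR.sym (SZ.coeffs (⊛≡*ˢ ([u-1]^ d) h))) (SZ.coeffs {[u-1]^ d ⊛ h} {f} eq))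

∣⇒∣ᴾ : ∀ d {f} → w^ d ∣ f → [u-1]^ d ∣ᴾ f
∣⇒∣ᴾ d {f} (h , ph , eq) = h , IsPoly⇒IsPolynomial {h} ph ,
  SZ.at (SZR.trans (SZ.coeffs (⊛≡*ˢ ([u-1]^ d) h)) (SZR.trans (SZR.*-congʳ {h} ([u-1]^≈w^ d)) eq))

∣-weaken : ∀ {i j f} → i ≤ j → w^ j ∣ f → w^ i ∣ f
∣-weaken {i} {j} {f} i≤j (h , ph , eq) = SZ.w^ (j ℕ.∸ i) SZ.*ˢ h ,
  SZ.IsPoly-* {SZ.w^ (j ℕ.∸ i)} {h} (SZ.IsPoly-w^ (j ℕ.∸ i)) ph , (begin
    SZ.w^ i SZ.*ˢ (SZ.w^ (j ℕ.∸ i) SZ.*ˢ h)   ≈⟨ SZR.*-assoc (SZ.w^ i) (SZ.w^ (j ℕ.∸ i)) h ⟨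
    SZ.w^ i SZ.*ˢ SZ.w^ (j ℕ.∸ i) SZ.*ˢ h     ≈⟨ SZR.*-congʳ {h} (w^-+ i (j ℕ.∸ i)) ⟨
    SZ.w^ (i ℕ.+ (j ℕ.∸ i)) SZ.*ˢ h           ≈⟨ SZR.*-congʳ {h} (SZR.reflexive (cong SZ.w^ (ℕ.m+[n∸m]≡n i≤j))) ⟩
    SZ.w^ j SZ.*ˢ h                           ≈⟨ eq ⟩
    f                                         ∎)
  where open SetoidReasoning SZR.setoid

module Order (em : ExcludedMiddle 0ℓ) (Y : Digraph) (den : PowerSeries)
  (zeta-den : zeta Y SZ.*ˢ den SZ.≈ˢ SZ.1ˢ) (den-IsPoly : SZ.IsPoly den) (B : ℕ)
  (den-order : ∀ d g k c → SZ.IsPoly k → SZ.Ev g c → c ≢ 0ℤ → g SZ.*ˢ den SZ.≈ˢ SZ.w^ d SZ.*ˢ k → d ≤ B)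
  where

  ∣den⇒≤B : ∀ d → w^ d ∣ den → d ≤ B
  ∣den⇒≤B d (h , ph , eq) = den-order d SZ.1ˢ h 1ℤ ph (SZ.Ev-const 1ℤ) (λ ()) (SZR.trans (SZR.*-identityˡ den) (SZR.sym eq))

  order-exists : ∀ N → ¬ (w^ N ∣ den) → ∃ λ d → w^ d ∣ den × ¬ (w^ suc d ∣ den)
  order-exists zero    ¬div = contradiction (den , den-IsPoly , SZR.*-identityˡ den) ¬div
  order-exists (suc N) ¬div = go (em {w^ N ∣ den})
    where
    go : Dec (w^ N ∣ den) → ∃ λ d → w^ d ∣ den × ¬ (w^ suc d ∣ den)
    go (yes div)  = N , div , ¬div
    go (no ¬div′) = order-exists N ¬div′

  ¬w∣1 : ¬ (w^ 1 ∣ oneˢ)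
  ¬w∣1 (h , ph , eq) = contradiction (SZ.Ev-unique {oneˢ} {1ℤ} {0ℤ}
    (SZ.Ev-cong {SZ.1ˢ} {oneˢ} {1ℤ} (SZR.sym (SZ.coeffs oneˢ≡1ˢ)) (SZ.Ev-const 1ℤ))
    (SZ.Ev-cong {SZ.w SZ.*ˢ h} {oneˢ} {0ℤ} (SZR.trans (SZR.*-congʳ {h} (SZR.sym (SZR.*-identityʳ SZ.w))) eq) (SZ.Ev-w* {h} ph)))
    λ ()

  a-exists : ∃ (a-Value Y)
  a-exists = go (order-exists (suc B) (ℕ.1+n≰n ∘ ∣den⇒≤B (suc B)))
    where
    oneˢ-poly : IsPolynomial oneˢ
    oneˢ-poly = 1 , λ { (suc n) _ → ≡.refl }
    go : (∃ λ d → w^ d ∣ den × ¬ (w^ suc d ∣ den)) → ∃ (a-Value Y)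
    go (d , div , ¬div) = + d , oneˢ , den , oneˢ-poly , IsPoly⇒IsPolynomial {den} den-IsPoly ,
      SZ.at (SZR.trans (SZ.coeffs (⊛≡*ˢ den (zeta Y))) (SZR.trans (SZR.*-comm den (zeta Y)) (SZR.trans zeta-den (SZR.sym (SZ.coeffs {oneˢ} oneˢ≡1ˢ))))) ,
      0 , d ,
      (∣⇒∣ᴾ 0 (oneˢ , IsPolynomial⇒IsPoly {oneˢ} oneˢ-poly , SZR.*-identityˡ oneˢ) , λ div → ¬w∣1 (∣ᴾ⇒∣ 1 div)) ,
      (∣⇒∣ᴾ d div , λ div → ¬div (∣ᴾ⇒∣ (suc d) div)) ,
      ≡.sym (ℤ.+-identityˡ (ℤ.- + d))

  -- Any fraction num / den′ for the zeta function satisfies num · den = den′. Writing num = (u -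
  -- 1)ⁱ g with g non-zero at 1 and cancelling, (u - 1)^{j-i} divides g · den, to which `den-order`
  -- applies.
  a-bounded : ∀ k → a-Value Y k → ∣ k ∣ ≤ B
  a-bounded k (num , den′ , pnum , pden′ , den′ζ≗num , i , j , (i∣num , ¬si∣num) , (j∣den′ , ¬sj∣den′) , -k≡) =
    -- A zero of num at u = 1 is one of den′ = num · den too, so i > j is impossible.
    [ (λ i≤j → above i≤j) , (λ j<i → contradiction (∣⇒∣ᴾ (suc j) (divides-den′ j<i)) ¬sj∣den′) ]′ (ℕ.≤-<-connex i j)
    where
    open SetoidReasoning SZR.setoid
    num-den : num SZ.*ˢ den SZ.≈ˢ den′
    num-den = begin
      num SZ.*ˢ den                        ≈⟨ SZR.*-congʳ {den} (SZ.coeffs {den′ ⊛ zeta Y} {num} den′ζ≗num) ⟨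
      (den′ ⊛ zeta Y) SZ.*ˢ den            ≈⟨ SZR.*-congʳ {den} (SZ.coeffs (⊛≡*ˢ den′ (zeta Y))) ⟩
      den′ SZ.*ˢ zeta Y SZ.*ˢ den          ≈⟨ SZR.*-assoc den′ (zeta Y) den ⟩
      den′ SZ.*ˢ (zeta Y SZ.*ˢ den)        ≈⟨ SZR.*-congˡ {den′} zeta-den ⟩
      den′ SZ.*ˢ SZ.1ˢ                     ≈⟨ SZR.*-identityʳ den′ ⟩
      den′                                 ∎
    divides-den′ : j < i → w^ suc j ∣ den′
    divides-den′ j<i = go (∣-weaken j<i (∣ᴾ⇒∣ i i∣num))
      where
      go : w^ suc j ∣ num → w^ suc j ∣ den′
      go (h , ph , eq) = h SZ.*ˢ den , SZ.IsPoly-* {h} {den} ph den-IsPoly ,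
        SZR.trans (SZR.sym (SZR.*-assoc (SZ.w^ (suc j)) h den)) (SZR.trans (SZR.*-congʳ {den} eq) num-den)
    above : i ≤ j → ∣ k ∣ ≤ B
    above i≤j = go (∣ᴾ⇒∣ i i∣num) (∣ᴾ⇒∣ j j∣den′)
      where
      d = j ℕ.∸ i
      j≡ : i ℕ.+ d ≡ j
      j≡ = ℕ.m+[n∸m]≡n i≤j
      k≡d : k ≡ + d
      k≡d = ≡.trans (≡.sym (ℤ.neg-involutive k)) (≡.trans (cong ℤ.-_ (≡.trans -k≡ (cong (λ j → + i ℤ.- + j) (≡.sym j≡))))
        (≡.trans (cong (λ j → ℤ.- (+ i ℤ.- j)) (ℤ.pos-+ i d)) (lemma (+ i) (+ d))))
        where
        lemma : ∀ x y → ℤ.- (x ℤ.- (x ℤ.+ y)) ≡ y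
        lemma = solve-∀
      go : w^ i ∣ num → w^ j ∣ den′ → ∣ k ∣ ≤ B
      go (g , pg@(N , dg) , num≈) (h , ph , den′≈) = go′ (SZ.Ev-exists N g dg)
        where
        gden≈ : g SZ.*ˢ den SZ.≈ˢ SZ.w^ d SZ.*ˢ h
        gden≈ = w^-cancel i {g SZ.*ˢ den} {SZ.w^ d SZ.*ˢ h} (begin
          SZ.w^ i SZ.*ˢ (g SZ.*ˢ den)        ≈⟨ SZR.*-assoc (SZ.w^ i) g den ⟨
          SZ.w^ i SZ.*ˢ g SZ.*ˢ den          ≈⟨ SZR.*-congʳ {den} num≈ ⟩
          num SZ.*ˢ den                      ≈⟨ num-den ⟩
          den′                               ≈⟨ den′≈ ⟨
          SZ.w^ j SZ.*ˢ h                    ≈⟨ SZR.*-congʳ {h} (SZR.reflexive (cong SZ.w^ (≡.sym j≡))) ⟩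
          SZ.w^ (i ℕ.+ d) SZ.*ˢ h            ≈⟨ SZR.*-congʳ {h} (w^-+ i d) ⟩
          SZ.w^ i SZ.*ˢ SZ.w^ d SZ.*ˢ h      ≈⟨ SZR.*-assoc (SZ.w^ i) (SZ.w^ d) h ⟩
          SZ.w^ i SZ.*ˢ (SZ.w^ d SZ.*ˢ h)    ∎)
        go′ : (∃₂ λ c h → SZ.Deg≤ h (ℕ.pred N) × g SZ.≈ˢ SZ.const c SZ.+ˢ SZ.w SZ.*ˢ h × (N ≡ 0 → h SZ.≈ˢ SZ.0ˢ)) → ∣ k ∣ ≤ B
        go′ (c , g′ , dg′ , g≈ , _) = ≡.subst (λ k → ∣ k ∣ ≤ B) (≡.sym k≡d)
          (den-order d g h c ph (g′ , (ℕ.pred N , dg′) , g≈) c≢0 gden≈)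
          where
          c≢0 : c ≢ 0ℤ
          c≢0 c≡0 = ¬si∣num (∣⇒∣ᴾ (suc i) (g′ , (ℕ.pred N , dg′) , (begin
            SZ.w SZ.*ˢ SZ.w^ i SZ.*ˢ g′                   ≈⟨ SZR.*-congʳ {g′} (SZR.*-comm SZ.w (SZ.w^ i)) ⟩
            SZ.w^ i SZ.*ˢ SZ.w SZ.*ˢ g′                   ≈⟨ SZR.*-assoc (SZ.w^ i) SZ.w g′ ⟩
            SZ.w^ i SZ.*ˢ (SZ.w SZ.*ˢ g′)                 ≈⟨ SZR.*-congˡ {SZ.w^ i} (SZR.trans g≈ (SZR.trans (SZR.+-congʳ {SZ.w SZ.*ˢ g′} const-c≈0) (SZR.+-identityˡ _))) ⟨
            SZ.w^ i SZ.*ˢ g                               ≈⟨ num≈ ⟩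
            num                                           ∎)))
            where
            const-c≈0 : SZ.const c SZ.≈ˢ SZ.0ˢ
            const-c≈0 = SZ.coeffs λ { zero → c≡0 ; (suc n) → ≡.refl }

-- Characters

Unique-⊆-length : ∀ {A : Set} {xs ys : List A} → Unique xs → (∀ {x} → x ∈ xs → x ∈ ys) → length xs ≤ length ys
Unique-⊆-length {xs = []}     !xs         xs⊆ys = z≤n
Unique-⊆-length {xs = x ∷ xs} (x∉ ∷ !xs) xs⊆ys with Mem.∈-∃++ (xs⊆ys (here ≡.refl))
... | as , bs , ≡.refl = ≡.subst (suc (length xs) ≤_) (≡.sym (≡.trans (List.length-++ as)
      (≡.trans (ℕ.+-suc (length as) (length bs)) (cong suc (≡.sym (List.length-++ as))))))
    (s≤s (Unique-⊆-length !xs λ z∈ → remove (All.lookup x∉ z∈) (Mem.∈-++⁻ as (xs⊆ys (there z∈)))))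
  where
  remove : ∀ {z} → x ≢ z → z ∈ as ⊎ z ∈ x ∷ bs → z ∈ as ++ bs
  remove x≢z (inj₁ z∈as)         = Mem.∈-++⁺ˡ z∈as
  remove x≢z (inj₂ (here z≡x))   = contradiction (≡.sym z≡x) x≢z
  remove x≢z (inj₂ (there z∈bs)) = Mem.∈-++⁺ʳ as z∈bs

lsum-upTo : ∀ (f : ℕ → ℤ) n → LZ.lsum f (upTo n) ≡ Σ< n f
lsum-upTo f n = go id n
  where
  go : ∀ (g : ℕ → ℕ) n → LZ.lsum f (applyUpTo g n) ≡ Σ< n (f ∘ g)
  go g zero    = ≡.refl
  go g (suc n) = cong (ℤ._+_ (f (g 0))) (go (g ∘ suc) n)

-- The factors p of d, fewer than k in number, are moved to a one at a time; Euclid's lemma then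
-- discards what remains of d.
p^∣-cancel : ∀ {p} → Prime p → ∀ N {a d} k → p ℕ.^ N ∣ a ℕ.* d → ¬ (p ℕ.^ k ∣ d) → p ℕ.^ N ∣ a ℕ.* p ℕ.^ k
p^∣-cancel {p} pp N {a} {d} zero    p^N∣ad ¬1∣d = contradiction (ℕ∣.1∣ d) ¬1∣d
p^∣-cancel {p} pp N {a} {d} (suc k) p^N∣ad ¬p∣d with p ∣? d
... | yes (ℕ∣.divides d′ ≡.refl) = ≡.subst (p ℕ.^ N ∣_) (ℕ.*-assoc a p (p ℕ.^ k))
      (p^∣-cancel pp N {a ℕ.* p} {d′} k (≡.subst (p ℕ.^ N ∣_) (≡.trans (cong (a ℕ.*_) (ℕ.*-comm d′ p)) (≡.sym (ℕ.*-assoc a p d′))) p^N∣ad)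
        λ p^k∣d′ → ¬p∣d (≡.subst (p ℕ.* p ℕ.^ k ∣_) (ℕ.*-comm p d′) (ℕ∣.*-monoʳ-∣ p p^k∣d′)))
... | no p∤d = ℕ∣.∣m⇒∣m*n (p ℕ.^ suc k) (strip N a p^N∣ad)
  where
  strip : ∀ N a → p ℕ.^ N ∣ a ℕ.* d → p ℕ.^ N ∣ a
  strip zero    a _ = ℕ∣.1∣ a
  strip (suc N) a p^∣ad = [ (λ p∣a → divide p∣a p^∣ad) , (λ p∣d → contradiction p∣d p∤d) ]′
    (euclidsLemma a d pp (ℕ∣.∣-trans (ℕ∣.m∣m*n (p ℕ.^ N)) p^∣ad))
    where
    instance _ = prime⇒nonZero pp
    divide : p ∣ a → p ℕ.* p ℕ.^ N ∣ a ℕ.* d → p ℕ.* p ℕ.^ N ∣ a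
    divide (ℕ∣.divides a′ ≡.refl) p^∣ = ≡.subst (p ℕ.* p ℕ.^ N ∣_) (ℕ.*-comm p a′) (ℕ∣.*-monoʳ-∣ p
      (strip N a′ (ℕ∣.*-cancelˡ-∣ p (≡.subst (p ℕ.* p ℕ.^ N ∣_)
        (≡.trans (cong (ℕ._* d) (ℕ.*-comm a′ p)) (ℕ.*-assoc p a′ d)) p^∣))))

-- ℤ[ℤ/m] as ℤ[x]/(xᵐ - 1): the linear forms on ℤ[x] that vanish on the multiples of xᵐ - 1 are the
-- m-periodic functions of the exponent.
module GroupAlgebra (m : ℕ) .{{_ : NonZero m}} where

  Periodic : (ℕ → ℤ) → Set
  Periodic φ = ∀ a → φ (a ℕ.+ m) ≡ φ a

  Periodic-shift : ∀ {φ} a → Periodic φ → Periodic (λ b → φ (a ℕ.+ b))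
  Periodic-shift {φ} a pφ b = ≡.trans (cong φ (≡.sym (ℕ.+-assoc a b m))) (pφ (a ℕ.+ b))

  Periodic-mod : ∀ {φ a b} → Periodic φ → a ≡ b [mod m ] → φ a ≡ φ b
  Periodic-mod {φ} {a} {b} pφ a≡b = ≡.trans (remainder a) (≡.trans (cong φ (mod-unique (ℕ.m%n<n a m) (ℕ.m%n<n b m)
    (mod-trans (%-mod a m) (mod-trans a≡b (mod-sym (%-mod b m)))))) (≡.sym (remainder b)))
    where
    multiple : ∀ k a → φ (a ℕ.+ k ℕ.* m) ≡ φ a
    multiple zero    a = cong φ (ℕ.+-identityʳ a)
    multiple (suc k) a = ≡.trans (cong φ (≡.sym (ℕ.+-assoc a m (k ℕ.* m)))) (≡.trans (multiple k (a ℕ.+ m)) (pφ a))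
    remainder : ∀ a → φ a ≡ φ (a % m)
    remainder a = ≡.trans (cong φ (ℕ.m≡m%n+[m/n]*n a m)) (multiple (a / m) (a % m))

  Periodic-δ : ∀ b → Periodic (δ m b)
  Periodic-δ b a = δ-cong {m} b (mod-period a)

  open FormQuotient Periodic (λ {φ} → Periodic-shift {φ}) public

  δ-basis : ∀ φ → Periodic φ → ∀ a → φ a ≡ Σ< m λ τ → φ τ ℤ.* δ m τ a
  δ-basis φ pφ a = ≡.sym (begin
    Σ< m (λ τ → φ τ ℤ.* δ m τ a)
      ≡⟨ Σ<-single m _ (a % m) (ℕ.m%n<n a m) (λ τ τ<m τ≢ → ≡.trans (cong (φ τ ℤ.*_) (δ-≢ {m} {τ} {a} λ a≡τ →
           τ≢ (mod-unique τ<m (ℕ.m%n<n a m) (mod-sym (mod-trans (%-mod a m) a≡τ))))) (ℤ.*-zeroʳ (φ τ))) ⟩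
    φ (a % m) ℤ.* δ m (a % m) a
      ≡⟨ cong₂ ℤ._*_ (Periodic-mod {φ} pφ (%-mod a m)) (𝟙-yes (a ≡ a % m [mod m ]?) (mod-sym (%-mod a m))) ⟩
    φ a ℤ.* 1ℤ                       ≡⟨ ℤ.*-identityʳ (φ a) ⟩
    φ a                              ∎)
    where open ≡-Reasoning

  -- The m coefficient forms span all periodic ones, which turns equality in the group algebra into
  -- m integer equations, as linear algebra over ℤ will need.
  δ-test : ∀ f → (∀ τ → τ < m → ⟪ f , δ m τ ⟫ ≡ 0ℤ) → f ≈ []
  δ-test f f≡0 = forms λ φ pφ → begin
    ⟪ f , φ ⟫                                          ≡⟨ ⟪⟫-cong f (δ-basis φ pφ) ⟩
    ⟪ f , (λ a → Σ< m λ τ → φ τ ℤ.* δ m τ a) ⟫         ≡⟨ ⟪⟫-Σ< f m (λ τ a → φ τ ℤ.* δ m τ a) ⟩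
    Σ< m (λ τ → ⟪ f , (λ a → φ τ ℤ.* δ m τ a) ⟫)       ≡⟨ Σ<-0 m (λ τ τ<m → ≡.trans (⟪⟫-* f (φ τ) (δ m τ)) (≡.trans (cong (φ τ ℤ.*_) (f≡0 τ τ<m)) (ℤ.*-zeroʳ (φ τ)))) ⟩
    0ℤ                                                 ∎
    where open ≡-Reasoning

module Characters (em : ExcludedMiddle 0ℓ) {p : ℕ} (pp : Prime p) (n : ℕ) where
  open Cyclotomic em pp n using (q; p≢0; q≢0; p>1; Vanishing; Vanishing-shift; Vanishing-period; Vanishing-δ; q≢0[mod-pq])
  module C = Cyclotomic em pp n
  module G = GroupAlgebra q
  module O = CommutativeRing C.ring
  module Rₙ = CommutativeRing G.ring

  Vanishing-multiple : ∀ {φ} → Vanishing φ → ∀ a k → φ (a ℕ.+ k ℕ.* (p ℕ.* q)) ≡ φ a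
  Vanishing-multiple {φ} Vφ a zero    = cong φ (ℕ.+-identityʳ a)
  Vanishing-multiple {φ} Vφ a (suc k) = ≡.trans (cong φ (≡.sym (ℕ.+-assoc a (p ℕ.* q) _)))
    (≡.trans (Vanishing-multiple {φ} Vφ (a ℕ.+ p ℕ.* q) k) (Vanishing-period {φ} Vφ a))

  -- χ j : ℤ[ℤ/pⁿ] → ℤ[ζ] takes x to ζ^{jp}, where ζ has order pⁿ⁺¹.
  χ : ℕ → ℕ → Formal
  χ j b = x^ (j ℕ.* (p ℕ.* b))

  -- The extension of χ j to the group algebra, written as a substitution in the exponents.
  dilate : ℕ → Formal → Formal
  dilate j = map λ (c , a) → c , j ℕ.* (p ℕ.* a)

  ⟪⟫-dilate : ∀ j f φ → ⟪ dilate j f , φ ⟫ ≡ ⟪ f , (λ a → φ (j ℕ.* (p ℕ.* a))) ⟫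
  ⟪⟫-dilate j []            φ = ≡.refl
  ⟪⟫-dilate j ((c , a) ∷ f) φ = cong (ℤ._+_ (c ℤ.* φ (j ℕ.* (p ℕ.* a)))) (⟪⟫-dilate j f φ)

  jp-+ : ∀ j a b → j ℕ.* (p ℕ.* (a ℕ.+ b)) ≡ j ℕ.* (p ℕ.* a) ℕ.+ j ℕ.* (p ℕ.* b)
  jp-+ j a b = ≡.trans (cong (j ℕ.*_) (ℕ.*-distribˡ-+ p a b)) (ℕ.*-distribˡ-+ j _ _)

  Vanishing⇒Periodic : ∀ j {φ} → Vanishing φ → G.Periodic (λ a → φ (j ℕ.* (p ℕ.* a)))
  Vanishing⇒Periodic j {φ} Vφ a = ≡.trans (cong φ (jp-+ j a q)) (Vanishing-multiple {φ} Vφ _ j)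

  dilate-cong : ∀ j {f g} → f G.≈ g → dilate j f C.≈ dilate j g
  dilate-cong j {f} {g} f≈g = C.forms λ φ Vφ → ≡.trans (⟪⟫-dilate j f φ)
    (≡.trans (G.on f≈g _ (Vanishing⇒Periodic j {φ} Vφ)) (≡.sym (⟪⟫-dilate j g φ)))

  dilate-* : ∀ j f g → dilate j (mulF f g) C.≈ mulF (dilate j f) (dilate j g)
  dilate-* j f g = C.forms λ φ Vφ → begin
    ⟪ dilate j (mulF f g) , φ ⟫                                            ≡⟨ ⟪⟫-dilate j (mulF f g) φ ⟩
    ⟪ mulF f g , (λ a → φ (j ℕ.* (p ℕ.* a))) ⟫                             ≡⟨ ⟪⟫-mul f g _ ⟩
    ⟪ f , (λ a → ⟪ g , (λ b → φ (j ℕ.* (p ℕ.* (a ℕ.+ b)))) ⟫) ⟫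
      ≡⟨ ⟪⟫-cong f (λ a → ≡.trans (⟪⟫-cong g λ b → cong φ (jp-+ j a b)) (≡.sym (⟪⟫-dilate j g _))) ⟩
    ⟪ f , (λ a → ⟪ dilate j g , (λ b → φ (j ℕ.* (p ℕ.* a) ℕ.+ b)) ⟫) ⟫     ≡⟨ ⟪⟫-dilate j f _ ⟨
    ⟪ dilate j f , (λ a → ⟪ dilate j g , (λ b → φ (a ℕ.+ b)) ⟫) ⟫          ≡⟨ ⟪⟫-mul (dilate j f) (dilate j g) φ ⟨
    ⟪ mulF (dilate j f) (dilate j g) , φ ⟫                                 ∎
    where open ≡-Reasoning

  dilate-neg : ∀ j f → dilate j (negF f) ≡ negF (dilate j f)
  dilate-neg j []            = ≡.refl
  dilate-neg j ((c , a) ∷ f) = cong ((ℤ.- c , _) ∷_) (dilate-neg j f)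

  dilate-det : ∀ j {r} {M N : Matrix Formal r} → (∀ i k → dilate j (M i k) C.≈ N i k) →
    dilate j (det Rₙ.rawRing M) C.≈ det O.rawRing N
  dilate-det j {M = M} {N} = DetRel.Related.det-~ Rₙ.rawRing O.rawRing (λ f g → dilate j f C.≈ g)
    (λ {a} {b} p q → O.trans (O.reflexive (List.map-++ _ a b)) (O.+-cong p q))
    (λ {a} {b} p q → O.trans (dilate-* j a b) (O.*-cong p q))
    (λ {a} p → O.trans (O.reflexive (dilate-neg j a)) (O.-‿cong p))
    O.refl (O.reflexive (cong (λ a → (1ℤ , a) ∷ []) (≡.trans (cong (j ℕ.*_) (ℕ.*-zeroʳ p)) (ℕ.*-zeroʳ j))))
    {M = M} {N = N}

  χ-0 : ∀ j → χ j 0 C.≈ O.1#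
  χ-0 j = O.reflexive (cong x^ (≡.trans (cong (j ℕ.*_) (ℕ.*-zeroʳ p)) (ℕ.*-zeroʳ j)))

  χ-+ : ∀ j a b → χ j (a ℕ.+ b) C.≈ mulF (χ j a) (χ j b)
  χ-+ j a b = O.reflexive (cong x^ (jp-+ j a b))

  ⟪⟫-lsum : ∀ {B : Set} (f : B → Formal) xs φ →
    ⟪ ListSums.lsum C.ring f xs , φ ⟫ ≡ LZ.lsum (λ x → ⟪ f x , φ ⟫) xs
  ⟪⟫-lsum f []       φ = ≡.refl
  ⟪⟫-lsum f (x ∷ xs) φ = ≡.trans (⟪⟫-++ (f x) _ φ) (cong (ℤ._+_ ⟪ f x , φ ⟫) (⟪⟫-lsum f xs φ))

  Σχ : ℕ → Formal
  Σχ b = ListSums.lsum C.ring (λ j → χ j b) (upTo q)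

  ⟪⟫-Σχ : ∀ b φ → ⟪ Σχ b , φ ⟫ ≡ Σ< q λ j → φ (j ℕ.* (p ℕ.* b))
  ⟪⟫-Σχ b φ = ≡.trans (⟪⟫-lsum (λ j → χ j b) (upTo q) φ) (≡.trans (lsum-upTo _ q)
    (Σ<-cong q λ j _ → ≡.trans (ℤ.+-identityʳ _) (ℤ.*-identityˡ _)))

  -- A form on ℤ[ζ] that takes the value 1 at x^c exactly for c ≡ 0 modulo pq, so it separates 1
  -- from the other powers of ζ.
  φ₀ : ℕ → ℤ
  φ₀ a = δ (p ℕ.* q) 0 a ℤ.- δ (p ℕ.* q) (q ℕ.+ 0) a

  φ₀-0 : φ₀ 0 ≡ 1ℤ
  φ₀-0 = cong₂ ℤ._-_ (δ-refl (p ℕ.* q) 0) (δ-≢ {p ℕ.* q} {q ℕ.+ 0} {0} (q≢0[mod-pq] 0))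

  pq∣pb⇒q∣b : ∀ b → p ℕ.* b ≡ 0 [mod p ℕ.* q ] → b ≡ 0 [mod q ]
  pq∣pb⇒q∣b b pb≡0 = modulo (ℤ∣.*-cancelˡ-∣ (+ p) (≡.subst₂ _∣ℤ_ (ℤ.pos-* p q)
    (≡.trans (cong (ℤ._- + 0) (ℤ.pos-* p b)) (lemma (+ p) (+ b))) (difference pb≡0)))
    where
    lemma : ∀ x y → x ℤ.* y ℤ.- 0ℤ ≡ x ℤ.* (y ℤ.- 0ℤ)
    lemma = solve-∀

  -- For b ≢ 0 the sum S of the χ j b satisfies (x^{pb} − 1) S = x^{pqb} − 1 = 0.
  orthogonality : ∀ b → Σχ b C.≈ ι (+ q ℤ.* 𝟙 (b ≡ 0 [mod q ]?))
  orthogonality b = decide (b ≡ 0 [mod q ]?)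
    where
    trivial : b ≡ 0 [mod q ] → Σχ b C.≈ ι (+ q ℤ.* 1ℤ)
    trivial b≡0 = C.forms λ φ Vφ → begin
      ⟪ Σχ b , φ ⟫                                   ≡⟨ ⟪⟫-Σχ b φ ⟩
      Σ< q (λ j → φ (j ℕ.* (p ℕ.* b)))
        ≡⟨ Σ<-cong q (λ j _ → ≡.trans (G.Periodic-mod {λ a → φ (j ℕ.* (p ℕ.* a))} (Vanishing⇒Periodic j {φ} Vφ) b≡0)
             (cong φ (≡.trans (cong (j ℕ.*_) (ℕ.*-zeroʳ p)) (ℕ.*-zeroʳ j)))) ⟩
      Σ< q (λ _ → φ 0)                               ≡⟨ Σ<-const q (φ 0) ⟩
      + q ℤ.* φ 0                                    ≡⟨ lemma (+ q) (φ 0) ⟩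
      (+ q ℤ.* 1ℤ) ℤ.* φ 0 ℤ.+ 0ℤ                    ∎
      where
      open ≡-Reasoning
      lemma : ∀ x y → x ℤ.* y ≡ (x ℤ.* 1ℤ) ℤ.* y ℤ.+ 0ℤ
      lemma = solve-∀
    nontrivial : ¬ b ≡ 0 [mod q ] → Σχ b C.≈ ι (+ q ℤ.* 0ℤ)
    nontrivial b≢0 = O.trans ([ (λ x^c≈1 → contradiction x^c≈1 x^c≉1) , id ]′ (C.domain (x^ c ++ negF (ι 1ℤ)) (Σχ b) product≈0))
      (O.sym (O.trans (O.reflexive (cong ι (ℤ.*-zeroʳ (+ q)))) C.ι-0))
      where
      open ≡-Reasoning
      c = p ℕ.* b
      product≈0 : mulF (x^ c ++ negF (ι 1ℤ)) (Σχ b) C.≈ []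
      product≈0 = C.forms λ φ Vφ → begin
        ⟪ mulF (x^ c ++ negF (ι 1ℤ)) (Σχ b) , φ ⟫
          ≡⟨ ⟪⟫-mul (x^ c ++ negF (ι 1ℤ)) (Σχ b) φ ⟩
        1ℤ ℤ.* ⟪ Σχ b , (λ a → φ (c ℕ.+ a)) ⟫ ℤ.+ (-1ℤ ℤ.* ⟪ Σχ b , φ ⟫ ℤ.+ 0ℤ)
          ≡⟨ lemma ⟪ Σχ b , (λ a → φ (c ℕ.+ a)) ⟫ ⟪ Σχ b , φ ⟫ ⟩
        ⟪ Σχ b , (λ a → φ (c ℕ.+ a)) ⟫ ℤ.- ⟪ Σχ b , φ ⟫
          ≡⟨ cong₂ ℤ._-_ (⟪⟫-Σχ b (λ a → φ (c ℕ.+ a))) (⟪⟫-Σχ b φ) ⟩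
        Σ< q (λ j → φ (suc j ℕ.* c)) ℤ.- Σ< q (λ j → φ (j ℕ.* c))
          ≡⟨ lemma′ (Σ< q (λ j → φ (suc j ℕ.* c))) (Σ< q (λ j → φ (j ℕ.* c))) (φ 0) ⟩
        (Σ< q (λ j → φ (suc j ℕ.* c)) ℤ.+ φ 0) ℤ.- (Σ< q (λ j → φ (j ℕ.* c)) ℤ.+ φ 0)
          ≡⟨ cong (ℤ._- (Σ< q (λ j → φ (j ℕ.* c)) ℤ.+ φ 0)) (≡.trans (Σ<-telescope q λ j → φ (j ℕ.* c)) (cong (ℤ._+_ (Σ< q (λ j → φ (j ℕ.* c)))) (φqc φ Vφ))) ⟩
        (Σ< q (λ j → φ (j ℕ.* c)) ℤ.+ φ 0) ℤ.- (Σ< q (λ j → φ (j ℕ.* c)) ℤ.+ φ 0)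
          ≡⟨ ℤ.+-inverseʳ (Σ< q (λ j → φ (j ℕ.* c)) ℤ.+ φ 0) ⟩
        0ℤ ∎
        where
        lemma : ∀ x y → 1ℤ ℤ.* x ℤ.+ (-1ℤ ℤ.* y ℤ.+ 0ℤ) ≡ x ℤ.- y
        lemma = solve-∀
        lemma′ : ∀ x y z → x ℤ.- y ≡ (x ℤ.+ z) ℤ.- (y ℤ.+ z)
        lemma′ = solve-∀
        φqc : ∀ φ → Vanishing φ → φ (q ℕ.* c) ≡ φ 0
        φqc φ Vφ = ≡.trans (cong φ (≡.trans (ℕ.*-comm q c) (≡.trans (cong (ℕ._* q) (ℕ.*-comm p b)) (ℕ.*-assoc b p q)))) (Vanishing-multiple {φ} Vφ 0 b)
      x^c≉1 : ¬ x^ c ++ negF (ι 1ℤ) C.≈ []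
      x^c≉1 x^c≈1 = ≢1 (q ℕ.+ 0) (≡.trans (≡.sym φ₀-c) φ₀c≡1)
        where
        φ₀c≡1 : φ₀ c ≡ 1ℤ
        φ₀c≡1 = ℤ.i-j≡0⇒i≡j _ _ (≡.trans (lemma (φ₀ c) 1ℤ) (≡.trans (cong (λ y → 1ℤ ℤ.* φ₀ c ℤ.+ (-1ℤ ℤ.* y ℤ.+ 0ℤ)) (≡.sym φ₀-0))
          (C.on x^c≈1 φ₀ (Vanishing-δ 0))))
          where
          lemma : ∀ x y → x ℤ.- y ≡ 1ℤ ℤ.* x ℤ.+ (-1ℤ ℤ.* y ℤ.+ 0ℤ)
          lemma = solve-∀
        φ₀-c : φ₀ c ≡ 0ℤ ℤ.- δ (p ℕ.* q) (q ℕ.+ 0) c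
        φ₀-c = cong (ℤ._- δ (p ℕ.* q) (q ℕ.+ 0) c) (δ-≢ {p ℕ.* q} {0} {c} (b≢0 ∘ pq∣pb⇒q∣b b))
        ≢1 : ∀ b → 0ℤ ℤ.- δ (p ℕ.* q) b c ≢ 1ℤ
        ≢1 b = go (c ≡ b [mod p ℕ.* q ]?)
          where
          go : ∀ {P : Set} (P? : Dec P) → 0ℤ ℤ.- 𝟙 P? ≢ 1ℤ
          go (yes _) ()
          go (no _)  ()
    decide : ∀ (b≡0? : Dec (b ≡ 0 [mod q ])) → Σχ b C.≈ ι (+ q ℤ.* 𝟙 b≡0?)
    decide (yes b≡0) = trivial b≡0
    decide (no b≢0)  = nontrivial b≢0

  ι-injective : ∀ c → ι c C.≈ [] → c ≡ 0ℤ
  ι-injective c ιc≈0 = begin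
    c                       ≡⟨ lemma c ⟩
    c ℤ.* 1ℤ ℤ.+ 0ℤ         ≡⟨ cong (λ x → c ℤ.* x ℤ.+ 0ℤ) φ₀-0 ⟨
    c ℤ.* φ₀ 0 ℤ.+ 0ℤ       ≡⟨ C.on ιc≈0 φ₀ (Vanishing-δ 0) ⟩
    0ℤ                      ∎
    where
    open ≡-Reasoning
    lemma : ∀ c → c ≡ c ℤ.* 1ℤ ℤ.+ 0ℤ
    lemma = solve-∀

  -- χ j factors through ℤ/pᵏ.
  Bad : ℕ → ℕ → Set
  Bad k j = p ℕ.^ n ∣ j ℕ.* p ℕ.^ k

  bad? : ∀ k j → Dec (Bad k j)
  bad? k j = p ℕ.^ n ∣? j ℕ.* p ℕ.^ k

  -- A bad j is determined by the quotient j pᵏ / q, which is below pᵏ because j < q. This covers k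
  -- > n, where every j is bad.
  length-bad : ∀ k → length (filter (bad? k) (upTo q)) ≤ p ℕ.^ k
  length-bad k = ≡.subst₂ _≤_ (List.length-map f bads) (List.length-upTo (p ℕ.^ k))
    (Unique-⊆-length (Unique-map {f = f} {g} (Unique.filter⁺ (bad? k) (Unique.upTo⁺ q)) gf≡id) f∈)
    where
    instance
      p^k≢0 : NonZero (p ℕ.^ k)
      p^k≢0 = ℕ.m^n≢0 p k
    bads = filter (bad? k) (upTo q)
    f g : ℕ → ℕ
    f j = (j ℕ.* p ℕ.^ k) / q
    g i = (i ℕ.* q) / p ℕ.^ k
    ∈bads⁻ : ∀ {j} → j ∈ bads → j ∈ upTo q × Bad k j
    ∈bads⁻ = Mem.∈-filter⁻ (bad? k) {xs = upTo q}
    gf≡id : ∀ {j} → j ∈ bads → g (f j) ≡ j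
    gf≡id {j} j∈ = ≡.trans (cong (_/ p ℕ.^ k) (ℕ.m/n*n≡m (proj₂ (∈bads⁻ j∈)))) (ℕ.m*n/n≡m j (p ℕ.^ k))
    f∈ : ∀ {i} → i ∈ map f bads → i ∈ upTo (p ℕ.^ k)
    f∈ i∈ = go (Mem.∈-map⁻ f i∈)
      where
      go : ∀ {i} → (∃ λ j → j ∈ bads × i ≡ f j) → i ∈ upTo (p ℕ.^ k)
      go (j , j∈ , ≡.refl) = Mem.∈-upTo⁺ (ℕ.*-cancelʳ-< q (f j) (p ℕ.^ k) (≡.subst₂ _<_
        (≡.sym (ℕ.m/n*n≡m (proj₂ (∈bads⁻ j∈)))) (ℕ.*-comm q (p ℕ.^ k))
        (ℕ.*-monoˡ-< (p ℕ.^ k) (Mem.∈-upTo⁻ (proj₁ (∈bads⁻ j∈))))))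

  -- On good characters, a term whose exponent is isolated modulo pᵏ cannot be cancelled.
  dilate-≉0 : ∀ k j c a g → c ≢ 0ℤ → ¬ Bad (suc k) j → All (λ (_ , b) → ¬ b ≡ a [mod p ℕ.^ k ]) g →
              ¬ dilate j ((c , a) ∷ g) C.≈ []
  dilate-≉0 k j c a g c≢0 ¬bad isolated f≈0 = c≢0 (begin
    c                                            ≡⟨ lemma c ⟩
    c ℤ.* 1ℤ ℤ.+ 0ℤ                              ≡⟨ cong₂ (λ x y → c ℤ.* x ℤ.+ y) φ-b₀ (rest g isolated) ⟨
    c ℤ.* φ b₀ ℤ.+ ⟪ dilate j g , φ ⟫            ≡⟨ C.on f≈0 φ (Vanishing-δ b₀) ⟩
    0ℤ                                           ∎)
    where
    open ≡-Reasoning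
    lemma : ∀ c → c ≡ c ℤ.* 1ℤ ℤ.+ 0ℤ
    lemma = solve-∀
    b₀ = j ℕ.* (p ℕ.* a)
    φ : ℕ → ℤ
    φ b = δ (p ℕ.* q) b₀ b ℤ.- δ (p ℕ.* q) (q ℕ.+ b₀) b
    φ-b₀ : φ b₀ ≡ 1ℤ
    φ-b₀ = cong₂ ℤ._-_ (δ-refl (p ℕ.* q) b₀) (δ-≢ {p ℕ.* q} {q ℕ.+ b₀} {b₀} (q≢0[mod-pq] b₀))
    -- The exponents have to differ modulo q and not only modulo pq, since φ is also non-zero at q +
    -- b₀. As they carry the factor jp, what comes out is the condition with k + 1.
    ≢b₀ : ∀ b → ¬ b ≡ a [mod p ℕ.^ k ] → ¬ j ℕ.* (p ℕ.* b) ≡ b₀ [mod q ]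
    ≢b₀ b b≢a jpb≡ = ¬bad (≡.subst (p ℕ.^ n ∣_) (ℕ.*-assoc j p (p ℕ.^ k))
      (p^∣-cancel pp n {j ℕ.* p} {∣ + b ℤ.- + a ∣} k q∣jpd λ p^k∣d → b≢a (modulo (ℤ∣.∣ᵤ⇒∣ p^k∣d))))
      where
      q∣jpd : q ∣ j ℕ.* p ℕ.* ∣ + b ℤ.- + a ∣
      q∣jpd = ≡.subst (q ∣_) (ℤ.abs-* (+ (j ℕ.* p)) (+ b ℤ.- + a)) (ℤ∣.∣⇒∣ᵤ (∣ℤ-resp (begin
        + (j ℕ.* (p ℕ.* b)) ℤ.- + (j ℕ.* (p ℕ.* a))      ≡⟨ cong₂ (λ x y → + x ℤ.- + y) (ℕ.*-assoc j p b) (ℕ.*-assoc j p a) ⟨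
        + (j ℕ.* p ℕ.* b) ℤ.- + (j ℕ.* p ℕ.* a)          ≡⟨ cong₂ ℤ._-_ (ℤ.pos-* (j ℕ.* p) b) (ℤ.pos-* (j ℕ.* p) a) ⟩
        + (j ℕ.* p) ℤ.* + b ℤ.- + (j ℕ.* p) ℤ.* + a      ≡⟨ lemma″ (+ (j ℕ.* p)) (+ b) (+ a) ⟩
        + (j ℕ.* p) ℤ.* (+ b ℤ.- + a)                    ∎) (difference jpb≡)))
        where
        lemma″ : ∀ x y z → x ℤ.* y ℤ.- x ℤ.* z ≡ x ℤ.* (y ℤ.- z)
        lemma″ = solve-∀
    rest : ∀ g → All (λ (_ , b) → ¬ b ≡ a [mod p ℕ.^ k ]) g → ⟪ dilate j g , φ ⟫ ≡ 0ℤ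
    rest []            []            = ≡.refl
    rest ((d , b) ∷ g) (b≢a ∷ ¬g≡a) = cong₂ ℤ._+_ (≡.trans (cong (d ℤ.*_)
      (cong₂ ℤ._-_ (δ-≢ {p ℕ.* q} {b₀} {j ℕ.* (p ℕ.* b)} (λ eq → ≢b₀ b b≢a (mod-≤ q∣pq eq)))
        (δ-≢ {p ℕ.* q} {q ℕ.+ b₀} {j ℕ.* (p ℕ.* b)} λ eq → ≢b₀ b b≢a (mod-trans (mod-≤ q∣pq eq)
          (≡.subst (_≡ b₀ [mod q ]) (ℕ.+-comm b₀ q) (mod-period b₀)))))) (ℤ.*-zeroʳ d)) (rest g ¬g≡a)
      where
      q∣pq : + q ∣ℤ + (p ℕ.* q)
      q∣pq = ∣ℤ-k p q

-- The Bowen–Franks function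

∣ℤ-p^ : ∀ p {k n} → k ≤ n → + (p ℕ.^ k) ∣ℤ + (p ℕ.^ n)
∣ℤ-p^ p {k} {n} k≤n = ∣ℤ-resp (cong +_ (≡.trans (≡.sym (ℕ.^-distribˡ-+-* p (n ℕ.∸ k) k))
  (cong (p ℕ.^_) (ℕ.m∸n+n≡m k≤n)))) (∣ℤ-k (p ℕ.^ (n ℕ.∸ k)) (p ℕ.^ k))

module _ (p : ℕ) .{{_ : NonZero p}} where
  open GroupRing (ℤₚ,+ p)
  private module P = RawMonoid (ℤₚ,+ p)

  residueℕ : ∀ n → ℤₚ p → ℕ
  residueℕ n a = toℕ (ℤₚ.residue a n)

  residue-suc : ∀ a n → residueℕ (suc n) a ≡ residueℕ n a [mod p ℕ.^ n ]
  residue-suc a n = mod-sym (≡.subst (_≡ residueℕ (suc n) a [mod p ℕ.^ n ])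
    (≡.trans (≡.sym (Fin.toℕ-fromℕ< (ℕ.m%n<n (residueℕ (suc n) a) (p ℕ.^ n)))) (cong toℕ (ℤₚ.coherent a n)))
    (%-mod (residueℕ (suc n) a) (p ℕ.^ n)))
    where instance _ = ℕ.m^n≢0 p n

  residue-≤ : ∀ a {k n} → k ≤ n → residueℕ n a ≡ residueℕ k a [mod p ℕ.^ k ]
  residue-≤ a {k} {n} k≤n = ≡.subst (λ n → residueℕ n a ≡ residueℕ k a [mod p ℕ.^ k ]) (ℕ.m+[n∸m]≡n k≤n) (go (n ℕ.∸ k))
    where
    go : ∀ j → residueℕ (k ℕ.+ j) a ≡ residueℕ k a [mod p ℕ.^ k ]
    go zero    = ≡.subst (λ n → residueℕ n a ≡ residueℕ k a [mod p ℕ.^ k ]) (≡.sym (ℕ.+-identityʳ k)) (mod-refl _)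
    go (suc j) = ≡.subst (λ n → residueℕ n a ≡ residueℕ k a [mod p ℕ.^ k ]) (≡.sym (ℕ.+-suc k j))
      (mod-trans (mod-≤ (∣ℤ-p^ p (ℕ.m≤m+n k j)) (residue-suc a (k ℕ.+ j))) (go j))

  -- The difference modulo pᵏ is demanded of the residues at every level n ≥ k, so that one k serves
  -- the whole tower.
  Apart : ℕ → ℤₚ p → ℤₚ p → Set
  Apart k a b = ∀ n → k ≤ n → ¬ residueℕ n b ≡ residueℕ n a [mod p ℕ.^ k ]

  module _ (em : ExcludedMiddle 0ℓ) where

    ≉⇒Apart : ∀ a b → ¬ b P.≈ a → ∃ λ k → Apart k a b
    ≉⇒Apart a b b≉a = go (em {∃ λ k → ℤₚ.residue b k ≢ ℤₚ.residue a k})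
      where
      instance
        p^≢0 : ∀ {k} → NonZero (p ℕ.^ k)
        p^≢0 {k} = ℕ.m^n≢0 p k
      go : Dec (∃ λ k → ℤₚ.residue b k ≢ ℤₚ.residue a k) → ∃ λ k → Apart k a b
      go (yes (k , b≢a)) = k , λ n k≤n b≡a → b≢a (Fin.toℕ-injective (mod-unique (Fin.toℕ<n _) (Fin.toℕ<n _)
        (mod-trans (mod-sym (residue-≤ b k≤n)) (mod-trans b≡a (residue-≤ a k≤n)))))
      go (no ¬∃) = contradiction (λ k → decide k (ℤₚ.residue b k Fin.≟ ℤₚ.residue a k)) b≉a
        where
        decide : ∀ k → Dec (ℤₚ.residue b k ≡ ℤₚ.residue a k) → ℤₚ.residue b k ≡ ℤₚ.residue a k
        decide k (yes b≡a) = b≡a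
        decide k (no b≢a)  = contradiction (k , b≢a) ¬∃

    Apart-mono : ∀ {k l a b} → k ≤ l → Apart k a b → Apart l a b
    Apart-mono k≤l apart n l≤n b≡a = apart n (ℕ.≤-trans k≤l l≤n) (mod-≤ (∣ℤ-p^ p k≤l) b≡a)

    All-Apart : ∀ (a : ℤₚ p) (g : FormalSum) → All (λ (_ , b) → ¬ b P.≈ a) g → ∃ λ k → All (λ (_ , b) → Apart k a b) g
    All-Apart a []            []           = 0 , []
    All-Apart a ((_ , b) ∷ g) (b≉a ∷ g≉a) = go (≉⇒Apart a b b≉a) (All-Apart a g g≉a)
      where
      go : (∃ λ k → Apart k a b) → (∃ λ k → All (λ (_ , b) → Apart k a b) g) →
           ∃ λ k → All (λ (_ , b) → Apart k a b) ((_ , b) ∷ g)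
      go (k , b-apart) (l , g-apart) = k ℕ.+ l , Apart-mono {a = a} {b} (ℕ.m≤m+n k l) b-apart ∷
        All.map (λ {(_ , b′)} → Apart-mono {a = a} {b′} (ℕ.m≤n+m l k)) g-apart

    collect : ∀ a f → ∃₂ λ c g → f ≋ (c , a) ∷ g × All (λ (_ , b) → ¬ b P.≈ a) g × length g ≤ length f
    collect a []            = 0ℤ , [] , ≋-sym ∷-zero , [] , z≤n
    collect a ((d , b) ∷ f) = go (collect a f) (em {b P.≈ a})
      where
      go : (∃₂ λ c g → f ≋ (c , a) ∷ g × All (λ (_ , b) → ¬ b P.≈ a) g × length g ≤ length f) → Dec (b P.≈ a) →
           ∃₂ λ c g → (d , b) ∷ f ≋ (c , a) ∷ g × All (λ (_ , b) → ¬ b P.≈ a) g × length g ≤ suc (length f)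
      go (c , g , f≋ , g≉a , len) (yes b≈a) = d ℤ.+ c , g , ≋-trans (∷-cong b≈a f≋) ∷-merge , g≉a , ℕ.m≤n⇒m≤1+n len
      go (c , g , f≋ , g≉a , len) (no b≉a)  = c , (d , b) ∷ g , ≋-trans (∷-cong (λ _ → ≡.refl) f≋) ∷-swap , b≉a ∷ g≉a , s≤s len

    -- All terms with the exponent of the first one are collected. If their coefficients cancel, the
    -- search continues in the other terms, a shorter sum that is still non-zero; the bound N makes
    -- this recursion structural.
    leadingTerm : ∀ N f → length f ≤ N → ¬ (f ≋ []) →
      ∃₂ λ c a → ∃ λ g → c ≢ 0ℤ × f ≋ (c , a) ∷ g × All (λ (_ , b) → ¬ b P.≈ a) g
    leadingTerm N       []            len f≉0 = contradiction ≋-refl f≉0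
    leadingTerm (suc N) ((d , b) ∷ f) (s≤s len) f≉0 = go (collect b f)
      where
      go : (∃₂ λ c g → f ≋ (c , b) ∷ g × All (λ (_ , b′) → ¬ b′ P.≈ b) g × length g ≤ length f) →
           ∃₂ λ c a → ∃ λ g → c ≢ 0ℤ × (d , b) ∷ f ≋ (c , a) ∷ g × All (λ (_ , b) → ¬ b P.≈ a) g
      go (c , g , f≋ , g≉b , len′) = decide (d ℤ.+ c ℤ.≟ 0ℤ)
        where
        f≋′ : (d , b) ∷ f ≋ (d ℤ.+ c , b) ∷ g
        f≋′ = ≋-trans (∷-cong (λ _ → ≡.refl) f≋) ∷-merge
        decide : Dec (d ℤ.+ c ≡ 0ℤ) → ∃₂ λ c a → ∃ λ g → c ≢ 0ℤ × (d , b) ∷ f ≋ (c , a) ∷ g × All (λ (_ , b) → ¬ b P.≈ a) g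
        decide (no ≢0)  = d ℤ.+ c , b , g , ≢0 , f≋′ , g≉b
        decide (yes ≡0) = rest (leadingTerm N g (ℕ.≤-trans len′ len) λ g≋0 → f≉0 (≋-trans f≋g g≋0))
          where
          f≋g : (d , b) ∷ f ≋ g
          f≋g = ≋-trans f≋′ (≋-trans (≋-reflexive (cong (λ c → (c , b) ∷ g) ≡0)) ∷-zero)
            where
            ≋-reflexive : ∀ {f g} → f ≡ g → f ≋ g
            ≋-reflexive ≡.refl = ≋-refl
          rest : (∃₂ λ c a → ∃ λ h → c ≢ 0ℤ × g ≋ (c , a) ∷ h × All (λ (_ , b) → ¬ b P.≈ a) h) →
                 ∃₂ λ c a → ∃ λ h → c ≢ 0ℤ × (d , b) ∷ f ≋ (c , a) ∷ h × All (λ (_ , b) → ¬ b P.≈ a) h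
          rest (c , a , h , c≢0 , g≋ , h≉a) = c , a , h , c≢0 , ≋-trans f≋g g≋ , h≉a

    -- Each of the finitely many other exponents differs from a at some finite level, and the levels
    -- have a common bound. Applied to L_p, this is the origin of the k in the final bounds.
    isolatedTerm : ∀ f → ¬ (f ≋ []) →
      ∃₂ λ c a → ∃₂ λ g k → c ≢ 0ℤ × f ≋ (c , a) ∷ g × All (λ (_ , b) → Apart k a b) g
    isolatedTerm f f≉0 = go (leadingTerm (length f) f ℕ.≤-refl f≉0)
      where
      go : (∃₂ λ c a → ∃ λ g → c ≢ 0ℤ × f ≋ (c , a) ∷ g × All (λ (_ , b) → ¬ b P.≈ a) g) →
           ∃₂ λ c a → ∃₂ λ g k → c ≢ 0ℤ × f ≋ (c , a) ∷ g × All (λ (_ , b) → Apart k a b) g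
      go (c , a , g , c≢0 , f≋ , g≉a) = let k , apart = All-Apart a g g≉a in c , a , g , k , c≢0 , f≋ , apart

  module Evaluation (n : ℕ) where
    private
      q = p ℕ.^ n
      instance
        q≢0 : NonZero q
        q≢0 = ℕ.m^n≢0 p n
      module G = GroupAlgebra q
      module Rₙ = CommutativeRing G.ring
      module FR = RawRing ℤ[T]

    evaluate : FormalSum → Formal
    evaluate = map λ (c , a) → c , residueℕ n a

    residue-∙ : ∀ a b → residueℕ n (a P.∙ b) ≡ residueℕ n a ℕ.+ residueℕ n b [mod q ]
    residue-∙ a b = ≡.subst (_≡ residueℕ n a ℕ.+ residueℕ n b [mod q ])
      (≡.sym (Fin.toℕ-fromℕ< (ℕ.m%n<n (residueℕ n a ℕ.+ residueℕ n b) q))) (%-mod (residueℕ n a ℕ.+ residueℕ n b) q)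

    evaluate-cong : ∀ {f g} → f ≋ g → evaluate f G.≈ evaluate g
    evaluate-cong ≋-refl        = Rₙ.refl
    evaluate-cong (≋-sym p)     = Rₙ.sym (evaluate-cong p)
    evaluate-cong (≋-trans p q) = Rₙ.trans (evaluate-cong p) (evaluate-cong q)
    evaluate-cong (∷-cong {c} {a} {a′} a≈a′ p) = G.forms λ φ pφ →
      cong₂ (λ x y → c ℤ.* φ (toℕ x) ℤ.+ y) (a≈a′ n) (G.on (evaluate-cong p) φ pφ)
    evaluate-cong (∷-swap {c , a} {d , b} {f}) = G.forms λ φ pφ → lemma (c ℤ.* φ (residueℕ n a)) (d ℤ.* φ (residueℕ n b)) ⟪ evaluate f , φ ⟫
      where
      lemma : ∀ x y z → x ℤ.+ (y ℤ.+ z) ≡ y ℤ.+ (x ℤ.+ z)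
      lemma = solve-∀
    evaluate-cong (∷-merge {c} {d} {a} {f}) = G.forms λ φ pφ → lemma c d (φ (residueℕ n a)) ⟪ evaluate f , φ ⟫
      where
      lemma : ∀ c d x z → c ℤ.* x ℤ.+ (d ℤ.* x ℤ.+ z) ≡ (c ℤ.+ d) ℤ.* x ℤ.+ z
      lemma = solve-∀
    evaluate-cong (∷-zero {a} {f}) = G.forms λ φ pφ → lemma (φ (residueℕ n a)) ⟪ evaluate f , φ ⟫
      where
      lemma : ∀ x z → 0ℤ ℤ.* x ℤ.+ z ≡ z
      lemma = solve-∀

    evaluate-* : ∀ f g → evaluate (f FR.* g) G.≈ mulF (evaluate f) (evaluate g)
    evaluate-* []            g = Rₙ.refl
    evaluate-* ((c , a) ∷ f) g = Rₙ.trans (Rₙ.reflexive (List.map-++ _ (map _ g) (f FR.* g)))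
      (Rₙ.+-cong (term g) (evaluate-* f g))
      where
      term : ∀ g → evaluate (map (λ (d , b) → c ℤ.* d , a P.∙ b) g) G.≈
                   map (λ (d , b) → c ℤ.* d , residueℕ n a ℕ.+ b) (evaluate g)
      term []            = Rₙ.refl
      term ((d , b) ∷ g) = G.forms λ φ pφ → cong₂ (λ x y → (c ℤ.* d) ℤ.* x ℤ.+ y)
        (G.Periodic-mod {φ} pφ (residue-∙ a b)) (G.on (term g) φ pφ)

    evaluate-neg : ∀ f → evaluate (FR.- f) ≡ negF (evaluate f)
    evaluate-neg []            = ≡.refl
    evaluate-neg ((c , a) ∷ f) = cong ((ℤ.- c , _) ∷_) (evaluate-neg f)

    evaluate-1 : evaluate FR.1# G.≈ Rₙ.1#
    evaluate-1 = G.forms λ φ pφ → cong (λ x → 1ℤ ℤ.* x ℤ.+ 0ℤ) (G.Periodic-mod {φ} pφ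
      (≡.subst (_≡ 0 [mod q ]) (≡.sym (Fin.toℕ-fromℕ< (ℕ.m%n<n 0 q))) (%-mod 0 q)))

    module _ (X : Digraph) (α : Digraph.E X → ℤₚ p) where
      open Digraph X using (E; #V; vertex; edgesFromTo)

      groupMatrix : Matrix Formal #V
      groupMatrix i j = ListSums.lsum G.ring (λ e → x^ (residueℕ n (α e))) (edgesFromTo (vertex j) (vertex i))

      bowenFranksₙ : Formal
      bowenFranksₙ = det Rₙ.rawRing λ i j → Id Rₙ.rawRing i j ++ negF (groupMatrix i j)

      evaluate-bowenFranks : evaluate (bowenFranks p X α) G.≈ bowenFranksₙ
      evaluate-bowenFranks = Rel.det-~ {M = λ i j → Id ℤ[T] i j FR.+ (FR.- voltageMatrix p X α i j)}
          {N = λ i j → Id Rₙ.rawRing i j ++ negF (groupMatrix i j)} λ i j →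
        +-~ {Id ℤ[T] i j} {FR.- voltageMatrix p X α i j} {Id Rₙ.rawRing i j} {negF (groupMatrix i j)}
          (Rel.Id-~ i j) (neg-~ {voltageMatrix p X α i j} {groupMatrix i j} (Rₙ.reflexive (matrix (edgesFromTo (vertex j) (vertex i)))))
        where
        _~_ : FormalSum → Formal → Set
        f ~ g = evaluate f G.≈ g
        +-~ : ∀ {a b x y} → a ~ x → b ~ y → (a FR.+ b) ~ (x ++ y)
        +-~ {a} {b} p q = Rₙ.trans (Rₙ.reflexive (List.map-++ _ a b)) (Rₙ.+-cong p q)
        neg-~ : ∀ {a x} → a ~ x → (FR.- a) ~ negF x
        neg-~ {a} p = Rₙ.trans (Rₙ.reflexive (evaluate-neg a)) (Rₙ.-‿cong p)
        module Rel = DetRel.Related ℤ[T] Rₙ.rawRing _~_ (λ {a} {b} {x} {y} → +-~ {a} {b} {x} {y})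
          (λ {a} {b} p q → Rₙ.trans (evaluate-* a b) (Rₙ.*-cong p q)) (λ {a} {x} → neg-~ {a} {x}) Rₙ.refl evaluate-1
        matrix : ∀ es → evaluate (map (λ e → 1ℤ , α e) es) ≡ ListSums.lsum G.ring (λ e → x^ (residueℕ n (α e))) es
        matrix []       = ≡.refl
        matrix (e ∷ es) = cong ((1ℤ , residueℕ n (α e)) ∷_) (matrix es)

-- Linear dependence over ℤ

module ZSum = Sums ℤ.+-*-commutativeRing

Dependent : ∀ {k s} → (Fin k → Vector ℤ s) → Set
Dependent {k} v = ∃ λ (c : Vector ℤ k) → (∃ λ i → c i ≢ 0ℤ) × ∀ j → ZSum.sum (λ i → c i ℤ.* v i j) ≡ 0ℤ

-- Gaussian elimination without division: with a non-zero pivot a = v i₀ 0, the vectors a · u l - (u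
-- l 0) · v i₀ vanish in the first coordinate, and induction applies to the others.
dependent : ∀ {k s} → s < k → (v : Fin k → Vector ℤ s) → Dependent v
dependent {suc k} {zero}  _         v = (λ _ → 1ℤ) , (zero , λ ()) , λ ()
dependent {suc k} {suc s} (s≤s s<k) v = decide (Fin.all? λ i → v i zero ℤ.≟ 0ℤ)
  where
  decide : Dec (∀ i → v i zero ≡ 0ℤ) → Dependent v
  decide (yes v₀≡0) = go (dependent (ℕ.m≤n⇒m≤1+n s<k) λ i j → v i (suc j))
    where
    go : Dependent (λ i j → v i (suc j)) → Dependent v
    go (c , c≢0 , rel) = c , c≢0 , λ
      { zero    → ZSum.sum-0 λ i → ≡.trans (cong (c i ℤ.*_) (v₀≡0 i)) (ℤ.*-zeroʳ (c i))
      ; (suc j) → rel j }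
  decide (no ¬v₀≡0) = pivot (Fin.¬∀⟶∃¬ (suc k) _ (λ i → v i zero ℤ.≟ 0ℤ) ¬v₀≡0)
    where
    pivot : (∃ λ i → v i zero ≢ 0ℤ) → Dependent v
    pivot (i₀ , a≢0) = go (dependent s<k w)
      where
      open ≡-Reasoning
      a = v i₀ zero
      u : Fin k → Vector ℤ (suc s)
      u l = v (punchIn i₀ l)
      w : Fin k → Vector ℤ s
      w l j = a ℤ.* u l (suc j) ℤ.- u l zero ℤ.* v i₀ (suc j)
      go : Dependent w → Dependent v
      go (d , (l₀ , d≢0) , rel) = c , (punchIn i₀ l₀ , λ c≡0 → [ a≢0 , d≢0 ]′ (ℤ.i*j≡0⇒i≡0∨j≡0 a (≡.trans (≡.sym (c-punchIn l₀)) c≡0))) , relation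
        where
        -- The coefficient of the pivot row when a relation Σ d l · w l = 0 is rewritten in terms of
        -- the vectors v.
        c₀ = ℤ.- ZSum.sum (λ l → d l ℤ.* u l zero)
        c : Vector ℤ (suc k)
        c = insertAt (λ l → a ℤ.* d l) i₀ c₀
        c-punchIn : ∀ l → c (punchIn i₀ l) ≡ a ℤ.* d l
        c-punchIn = Vec.insertAt-punchIn (λ l → a ℤ.* d l) i₀ c₀
        expand : ∀ j → ZSum.sum (λ i → c i ℤ.* v i j) ≡ c₀ ℤ.* v i₀ j ℤ.+ ZSum.sum (λ l → a ℤ.* d l ℤ.* u l j)
        expand j = ≡.trans (ZSum.sum-remove i₀ _) (cong₂ ℤ._+_ (cong (ℤ._* v i₀ j) (Vec.insertAt-lookup (λ l → a ℤ.* d l) i₀ c₀))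
          (ZSum.sum-cong λ l → cong (ℤ._* u l j) (c-punchIn l)))
        combine : ∀ x j → (∀ l → a ℤ.* d l ℤ.* u l j ≡ x l ℤ.+ d l ℤ.* u l zero ℤ.* v i₀ j) → ZSum.sum x ≡ 0ℤ →
          ZSum.sum (λ i → c i ℤ.* v i j) ≡ 0ℤ
        combine x j term x≡0 = begin
          ZSum.sum (λ i → c i ℤ.* v i j)                                       ≡⟨ expand j ⟩
          c₀ ℤ.* v i₀ j ℤ.+ ZSum.sum (λ l → a ℤ.* d l ℤ.* u l j)               ≡⟨ cong (ℤ._+_ (c₀ ℤ.* v i₀ j)) (ZSum.sum-cong term) ⟩
          c₀ ℤ.* v i₀ j ℤ.+ ZSum.sum (λ l → x l ℤ.+ d l ℤ.* u l zero ℤ.* v i₀ j)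
            ≡⟨ cong (ℤ._+_ (c₀ ℤ.* v i₀ j)) (≡.trans (ZSum.sum-+ x _) (cong₂ ℤ._+_ x≡0 (≡.sym (ZSum.*-sumʳ (v i₀ j) _)))) ⟩
          c₀ ℤ.* v i₀ j ℤ.+ (0ℤ ℤ.+ ZSum.sum (λ l → d l ℤ.* u l zero) ℤ.* v i₀ j)
            ≡⟨ lemma (ZSum.sum (λ l → d l ℤ.* u l zero)) (v i₀ j) ⟩
          0ℤ ∎
          where
          lemma : ∀ x y → (ℤ.- x) ℤ.* y ℤ.+ (0ℤ ℤ.+ x ℤ.* y) ≡ 0ℤ
          lemma = solve-∀
        relation : ∀ j → ZSum.sum (λ i → c i ℤ.* v i j) ≡ 0ℤ
        relation zero    = combine (λ _ → 0ℤ) zero (λ l → lemma a (d l) (u l zero)) (ZSum.sum-0 λ _ → ≡.refl)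
          where
          lemma : ∀ a d u → a ℤ.* d ℤ.* u ≡ 0ℤ ℤ.+ d ℤ.* u ℤ.* a
          lemma = solve-∀
        relation (suc j) = combine (λ l → d l ℤ.* w l j) (suc j) (λ l → lemma a (d l) (u l (suc j)) (u l zero) (v i₀ (suc j))) (rel j)
          where
          lemma : ∀ a d x y z → a ℤ.* d ℤ.* x ≡ d ℤ.* (a ℤ.* x ℤ.- y ℤ.* z) ℤ.+ d ℤ.* y ℤ.* z
          lemma = solve-∀

combination : ∀ {k} → Vector ℤ k → (Fin k → Formal) → Formal
combination {zero}  c x = []
combination {suc k} c x = mulF (ι (c zero)) (x zero) ++ combination (c ∘ suc) (x ∘ suc)

⟪⟫-ι* : ∀ c f φ → ⟪ mulF (ι c) f , φ ⟫ ≡ c ℤ.* ⟪ f , φ ⟫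
⟪⟫-ι* c f φ = ≡.trans (⟪⟫-mul (ι c) f φ) (ℤ.+-identityʳ _)

⟪⟫-combination : ∀ {k} (c : Vector ℤ k) x φ → ⟪ combination c x , φ ⟫ ≡ ZSum.sum λ i → c i ℤ.* ⟪ x i , φ ⟫
⟪⟫-combination {zero}  c x φ = ≡.sym (ZSum.sum-[] _)
⟪⟫-combination {suc k} c x φ = ≡.trans (⟪⟫-++ (mulF (ι (c zero)) (x zero)) _ φ)
  (≡.trans (cong₂ ℤ._+_ (⟪⟫-ι* (c zero) (x zero) φ) (⟪⟫-combination (c ∘ suc) (x ∘ suc) φ)) (≡.sym (ZSum.sum-∷ _)))

⟪⟫-sum : ∀ {k} f (φ : Fin k → ℕ → ℤ) → ⟪ f , (λ a → ZSum.sum λ i → φ i a) ⟫ ≡ ZSum.sum λ i → ⟪ f , φ i ⟫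
⟪⟫-sum {zero}  f φ = ≡.trans (⟪⟫-0 f λ a → ZSum.sum-[] _) (≡.sym (ZSum.sum-[] _))
⟪⟫-sum {suc k} f φ = ≡.trans (⟪⟫-cong f λ a → ZSum.sum-∷ _) (≡.trans (⟪⟫-+ f (φ zero) _)
  (≡.trans (cong (ℤ._+_ ⟪ f , φ zero ⟫) (⟪⟫-sum f (φ ∘ suc))) (≡.sym (ZSum.sum-∷ _))))

module _ (L : Formal) where

  L^ : ℕ → Formal
  L^ zero    = ι 1ℤ
  L^ (suc i) = mulF L (L^ i)

  -- The value at L of the polynomial with coefficients c. In Horner form a vanishing lowest
  -- coefficient exposes a factor L, which `L-divide` strips off.
  horner : ∀ {k} → Vector ℤ k → Formal
  horner {zero}  c = []
  horner {suc k} c = ι (c zero) ++ mulF L (horner (c ∘ suc))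

  ⟪⟫-horner : ∀ {k} (c : Vector ℤ k) φ → ⟪ horner c , φ ⟫ ≡ ZSum.sum λ i → c i ℤ.* ⟪ L^ (toℕ i) , φ ⟫
  ⟪⟫-horner {zero}  c φ = ≡.sym (ZSum.sum-[] _)
  ⟪⟫-horner {suc k} c φ = begin
    ⟪ ι (c zero) ++ mulF L (horner (c ∘ suc)) , φ ⟫
      ≡⟨ ⟪⟫-++ (ι (c zero)) (mulF L (horner (c ∘ suc))) φ ⟩
    ⟪ ι (c zero) , φ ⟫ ℤ.+ ⟪ mulF L (horner (c ∘ suc)) , φ ⟫
      ≡⟨ cong₂ ℤ._+_ (lemma (c zero) (φ 0)) (≡.trans (⟪⟫-mul L (horner (c ∘ suc)) φ)
           (≡.trans (⟪⟫-cong L λ a → ⟪⟫-horner (c ∘ suc) (λ b → φ (a ℕ.+ b))) (⟪⟫-sum L _))) ⟩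
    c zero ℤ.* ⟪ ι 1ℤ , φ ⟫ ℤ.+ ZSum.sum (λ i → ⟪ L , (λ a → c (suc i) ℤ.* ⟪ L^ (toℕ i) , (λ b → φ (a ℕ.+ b)) ⟫) ⟫)
      ≡⟨ cong (ℤ._+_ (c zero ℤ.* ⟪ ι 1ℤ , φ ⟫)) (ZSum.sum-cong λ i → ≡.trans (⟪⟫-* L (c (suc i)) _)
           (cong (c (suc i) ℤ.*_) (≡.sym (⟪⟫-mul L (L^ (toℕ i)) φ)))) ⟩
    c zero ℤ.* ⟪ ι 1ℤ , φ ⟫ ℤ.+ ZSum.sum (λ i → c (suc i) ℤ.* ⟪ L^ (suc (toℕ i)) , φ ⟫)
      ≡⟨ ZSum.sum-∷ _ ⟨
    ZSum.sum (λ i → c i ℤ.* ⟪ L^ (toℕ i) , φ ⟫) ∎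
    where
    open ≡-Reasoning
    lemma : ∀ c x → c ℤ.* x ℤ.+ 0ℤ ≡ c ℤ.* (1ℤ ℤ.* x ℤ.+ 0ℤ)
    lemma = solve-∀

-- The kernel of ℤ[ℤ/pⁿ] → ℤ[ℤ/pᴷ]

module Kernel (em : ExcludedMiddle 0ℓ) {p : ℕ} (pp : Prime p) (n K : ℕ) where
  open Characters em pp n
  open Cyclotomic em pp n using (q; p≢0; q≢0; Vanishing; Vanishing-shift; Vanishing-δ)
  private
    instance
      p^K≢0 : NonZero (p ℕ.^ K)
      p^K≢0 = ℕ.m^n≢0 p K
  module H = GroupAlgebra (p ℕ.^ K)

  -- The condition is put on the formal sum, so it makes sense for K > n as well; such a sum is then
  -- already zero in ℤ[ℤ/pⁿ].
  InKernel : Formal → Set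
  InKernel f = f H.≈ []

  InKernel-* : ∀ g {f} → InKernel f → InKernel (mulF g f)
  InKernel-* g {f} f≈0 = H.forms λ φ pφ → ≡.trans (⟪⟫-mul g f φ) (⟪⟫-0 g λ a → H.on f≈0 _ (H.Periodic-shift {φ} a pφ))

  -- f is determined by the dilations of f, by Fourier inversion.
  dilations≈0 : ∀ f → (∀ j → j < q → dilate j f C.≈ []) → f G.≈ []
  dilations≈0 f f≈0 = G.δ-test f λ τ τ<q → q⟪⟫≡0 (begin
    + q ℤ.* ⟪ f , δ q τ ⟫                                          ≡⟨ ⟪⟫-* f (+ q) (δ q τ) ⟨
    ⟪ f , (λ a → + q ℤ.* δ q τ a) ⟫                                ≡⟨ ⟪⟫-cong f (λ a → inversion τ τ<q a) ⟩
    ⟪ f , (λ a → Σ< q λ j → φ₀ (j ℕ.* (p ℕ.* (q ℕ.∸ τ ℕ.+ a)))) ⟫  ≡⟨ ⟪⟫-Σ< f q _ ⟩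
    Σ< q (λ j → ⟪ f , (λ a → φ₀ (j ℕ.* (p ℕ.* (q ℕ.∸ τ ℕ.+ a)))) ⟫)
      ≡⟨ Σ<-0 q (λ j j<q → ≡.trans (⟪⟫-cong f λ a → cong φ₀ (jp-+ j (q ℕ.∸ τ) a))
           (≡.trans (≡.sym (⟪⟫-dilate j f (shifted j τ))) (C.on (f≈0 j j<q) (shifted j τ) (Vanishing-shift {φ₀} (j ℕ.* (p ℕ.* (q ℕ.∸ τ))) (Vanishing-δ 0))))) ⟩
    0ℤ                                                             ∎)
    where
    open ≡-Reasoning
    shifted : ℕ → ℕ → ℕ → ℤ
    shifted j τ b = φ₀ (j ℕ.* (p ℕ.* (q ℕ.∸ τ)) ℕ.+ b)
    q⟪⟫≡0 : ∀ {x} → + q ℤ.* x ≡ 0ℤ → x ≡ 0ℤ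
    q⟪⟫≡0 {x} qx≡0 = [ (λ q≡0 → contradiction (ℤ.+-injective q≡0) (ℕ.≢-nonZero⁻¹ q)) , id ]′ (ℤ.i*j≡0⇒i≡0∨j≡0 (+ q) qx≡0)
    inversion : ∀ τ → τ < q → ∀ a → + q ℤ.* δ q τ a ≡ Σ< q λ j → φ₀ (j ℕ.* (p ℕ.* (q ℕ.∸ τ ℕ.+ a)))
    inversion τ τ<q a = begin
      + q ℤ.* δ q τ a                                      ≡⟨ cong (+ q ℤ.*_) (𝟙-⇔ (a ≡ τ [mod q ]?) (q ℕ.∸ τ ℕ.+ a ≡ 0 [mod q ]?) to from) ⟩
      + q ℤ.* 𝟙 (q ℕ.∸ τ ℕ.+ a ≡ 0 [mod q ]?)              ≡⟨ lemma (+ q ℤ.* 𝟙 (q ℕ.∸ τ ℕ.+ a ≡ 0 [mod q ]?)) ⟩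
      + q ℤ.* 𝟙 (q ℕ.∸ τ ℕ.+ a ≡ 0 [mod q ]?) ℤ.* 1ℤ ℤ.+ 0ℤ
        ≡⟨ cong (λ x → + q ℤ.* 𝟙 (q ℕ.∸ τ ℕ.+ a ≡ 0 [mod q ]?) ℤ.* x ℤ.+ 0ℤ) φ₀-0 ⟨
      ⟪ ι (+ q ℤ.* 𝟙 (q ℕ.∸ τ ℕ.+ a ≡ 0 [mod q ]?)) , φ₀ ⟫ ≡⟨ C.on (orthogonality (q ℕ.∸ τ ℕ.+ a)) φ₀ (Vanishing-δ 0) ⟨
      ⟪ Σχ (q ℕ.∸ τ ℕ.+ a) , φ₀ ⟫                          ≡⟨ ⟪⟫-Σχ (q ℕ.∸ τ ℕ.+ a) φ₀ ⟩
      Σ< q (λ j → φ₀ (j ℕ.* (p ℕ.* (q ℕ.∸ τ ℕ.+ a))))      ∎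
      where
      lemma : ∀ x → x ≡ x ℤ.* 1ℤ ℤ.+ 0ℤ
      lemma = solve-∀
      τ′≡0 : q ℕ.∸ τ ℕ.+ τ ≡ 0 [mod q ]
      τ′≡0 = ≡.subst (_≡ 0 [mod q ]) (≡.sym (ℕ.m∸n+n≡m (ℕ.<⇒≤ τ<q))) (mod-period 0)
      to : a ≡ τ [mod q ] → q ℕ.∸ τ ℕ.+ a ≡ 0 [mod q ]
      to a≡τ = mod-trans (mod-+ˡ (q ℕ.∸ τ) a≡τ) τ′≡0
      from : q ℕ.∸ τ ℕ.+ a ≡ 0 [mod q ] → a ≡ τ [mod q ]
      from eq = mod-+ˡ-cancel (q ℕ.∸ τ) (mod-trans eq (mod-sym τ′≡0))

  module _ (L : Formal) (L≉0 : ∀ j → j < q → ¬ Bad K j → ¬ dilate j L C.≈ []) where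

    -- A bad character factors through ℤ/pᴷ and kills f; at a good one L is non-zero in a domain. So
    -- all characters kill f, and Fourier inversion applies.
    L-regular : ∀ f → InKernel f → mulF L f G.≈ [] → f G.≈ []
    L-regular f f∈K Lf≈0 = dilations≈0 f λ j j<q → decide j j<q (bad? K j)
      where
      decide : ∀ j → j < q → Dec (Bad K j) → dilate j f C.≈ []
      decide j j<q (yes bad) = C.forms λ φ Vφ → ≡.trans (⟪⟫-dilate j f φ) (H.on f∈K _ (periodic φ Vφ bad))
        where
        periodic : ∀ φ → Vanishing φ → Bad K j → H.Periodic (λ a → φ (j ℕ.* (p ℕ.* a)))
        periodic φ Vφ (ℕ∣.divides k jp^K≡) a = ≡.trans (cong φ (≡.trans (jp-+ j a (p ℕ.^ K))
          (cong (j ℕ.* (p ℕ.* a) ℕ.+_) jpp^K≡))) (Vanishing-multiple {φ} Vφ _ k)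
          where
          open ≡-Reasoning
          jpp^K≡ : j ℕ.* (p ℕ.* p ℕ.^ K) ≡ k ℕ.* (p ℕ.* q)
          jpp^K≡ = begin
            j ℕ.* (p ℕ.* p ℕ.^ K)    ≡⟨ cong (j ℕ.*_) (ℕ.*-comm p (p ℕ.^ K)) ⟩
            j ℕ.* (p ℕ.^ K ℕ.* p)    ≡⟨ ℕ.*-assoc j (p ℕ.^ K) p ⟨
            j ℕ.* p ℕ.^ K ℕ.* p      ≡⟨ cong (ℕ._* p) jp^K≡ ⟩
            k ℕ.* q ℕ.* p            ≡⟨ ℕ.*-assoc k q p ⟩
            k ℕ.* (q ℕ.* p)          ≡⟨ cong (k ℕ.*_) (ℕ.*-comm q p) ⟩
            k ℕ.* (p ℕ.* q)          ∎
      decide j j<q (no ¬bad) = [ (λ L≈0 → contradiction L≈0 (L≉0 j j<q ¬bad)) , id ]′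
        (C.domain (dilate j L) (dilate j f) (O.trans (O.sym (dilate-* j L f)) (dilate-cong j Lf≈0)))

    -- Dividing a linear relation between the powers of L by L as often as possible
    L-divide : ∀ {k} (c : Vector ℤ k) → (∃ λ i → c i ≢ 0ℤ) → (∀ f → InKernel f → mulF (horner L c) f G.≈ []) →
      ∃₂ λ d W → d ≢ 0ℤ × (∀ f → InKernel f → mulF (ι d ++ mulF L W) f G.≈ [])
    L-divide {suc k} c (i , cᵢ≢0) rel = decide (c zero ℤ.≟ 0ℤ)
      where
      decide : Dec (c zero ≡ 0ℤ) → ∃₂ λ d W → d ≢ 0ℤ × (∀ f → InKernel f → mulF (ι d ++ mulF L W) f G.≈ [])
      decide (no c₀≢0)  = c zero , horner L (c ∘ suc) , c₀≢0 , rel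
      decide (yes c₀≡0) = L-divide (c ∘ suc) (later i cᵢ≢0) λ f f∈K →
        L-regular (mulF h f) (InKernel-* h f∈K) (begin
          mulF L (mulF h f)                        ≈⟨ Rₙ.*-assoc L h f ⟨
          mulF (mulF L h) f                        ≈⟨ Rₙ.*-congʳ {f} (Rₙ.trans (Rₙ.+-congʳ {mulF L h} (Rₙ.trans (Rₙ.reflexive (cong ι c₀≡0)) G.ι-0)) (Rₙ.+-identityˡ _)) ⟨
          mulF (ι (c zero) ++ mulF L h) f          ≈⟨ rel f f∈K ⟩
          []                                       ∎)
        where
        open SetoidReasoning Rₙ.setoid
        h = horner L (c ∘ suc)
        later : ∀ i → c i ≢ 0ℤ → ∃ λ i → c (suc i) ≢ 0ℤ
        later zero    cᵢ≢0 = contradiction c₀≡0 cᵢ≢0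
        later (suc i) cᵢ≢0 = i , cᵢ≢0

    -- The group algebra has rank q, so q + 1 powers of L satisfy an integral relation. Divided by L
    -- until its constant term d is non-zero, it says that -W inverts L on the kernel up to the
    -- factor d.
    L-invertible : ∃₂ λ d W → d ≢ 0ℤ × (∀ f → InKernel f → mulF (ι d ++ mulF L W) f G.≈ [])
    L-invertible = go (dependent ℕ.≤-refl λ i τ → ⟪ L^ L (toℕ {suc q} i) , δ q (toℕ {q} τ) ⟫)
      where
      go : Dependent (λ i τ → ⟪ L^ L (toℕ {suc q} i) , δ q (toℕ {q} τ) ⟫) →
           ∃₂ λ d W → d ≢ 0ℤ × (∀ f → InKernel f → mulF (ι d ++ mulF L W) f G.≈ [])
      go (c , c≢0 , rel) = L-divide c c≢0 λ f _ → Rₙ.trans (Rₙ.*-congʳ {f} horner≈0) (Rₙ.zeroˡ f)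
        where
        horner≈0 : horner L c G.≈ []
        horner≈0 = G.δ-test (horner L c) λ τ τ<q → ≡.trans (⟪⟫-horner L c (δ q τ))
          (≡.subst (λ τ → ZSum.sum (λ i → c i ℤ.* ⟪ L^ L (toℕ i) , δ q τ ⟫) ≡ 0ℤ) (Fin.toℕ-fromℕ< τ<q) (rel (Fin.fromℕ< τ<q)))

  module _ {r : ℕ} (M : Matrix Formal r)
    (L≉0 : ∀ j → j < q → ¬ Bad K j → ¬ dilate j (det Rₙ.rawRing M) C.≈ []) where

    open Sums G.ring
    open Determinant G.ring using (adjugate; *-adjugate; detR; detR≡det)
    open RingProperties Rₙ.ring using (-‿distribʳ-*; -‿distribˡ-*)

    private L = det Rₙ.rawRing M

    adjugate-solves : ∀ (y : Vector Formal r) → ∃ λ (z : Vector Formal r) →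
      ∀ i → sum (λ j → mulF (M i j) (z j)) G.≈ mulF L (y i)
    adjugate-solves y = (λ j → sum λ l → mulF (adjugate M j l) (y l)) , λ i → begin
      sum (λ j → mulF (M i j) (sum λ l → mulF (adjugate M j l) (y l)))
        ≈⟨ sum-cong (λ j → Rₙ.trans (*-sumˡ (M i j) _) (sum-cong λ l → Rₙ.sym (Rₙ.*-assoc (M i j) (adjugate M j l) (y l)))) ⟩
      sum (λ j → sum λ l → mulF (mulF (M i j) (adjugate M j l)) (y l))
        ≈⟨ sum-comm (λ j l → mulF (mulF (M i j) (adjugate M j l)) (y l)) ⟩
      sum (λ l → sum λ j → mulF (mulF (M i j) (adjugate M j l)) (y l))
        ≈⟨ sum-cong (λ l → Rₙ.trans (Rₙ.sym (*-sumʳ (y l) (λ j → mulF (M i j) (adjugate M j l)))) (Rₙ.*-congʳ {y l} (*-adjugate M i l))) ⟩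
      sum (λ l → mulF (mulF (detR M) (Id Rₙ.rawRing i l)) (y l))
        ≈⟨ sum-single i (λ l l≢i → Rₙ.trans (Rₙ.*-congʳ {y l} (Rₙ.trans (Rₙ.*-congˡ {detR M} (Id-≢ (l≢i ∘ ≡.sym))) (Rₙ.zeroʳ (detR M)))) (Rₙ.zeroˡ (y l))) ⟩
      mulF (mulF (detR M) (Id Rₙ.rawRing i i)) (y i)
        ≈⟨ Rₙ.*-congʳ {y i} (Rₙ.trans (Rₙ.*-congˡ {detR M} (Id-≡ i)) (Rₙ.trans (Rₙ.*-identityʳ (detR M)) (Rₙ.reflexive (detR≡det M)))) ⟩
      mulF L (y i) ∎
      where open SetoidReasoning Rₙ.setoid

    -- The solution is z = adj(M) (-W y), as M adj(M) = L and -L W y = d y on the kernel.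
    kernel-solves : ∃ λ d → d ≢ 0ℤ × (∀ (y : Vector Formal r) → (∀ i → InKernel (y i)) →
      ∃ λ (z : Vector Formal r) → ∀ i → sum (λ j → mulF (M i j) (z j)) G.≈ mulF (ι d) (y i))
    kernel-solves = go (L-invertible L L≉0)
      where
      go : (∃₂ λ d W → d ≢ 0ℤ × (∀ f → InKernel f → mulF (ι d ++ mulF L W) f G.≈ [])) →
        ∃ λ d → d ≢ 0ℤ × (∀ (y : Vector Formal r) → (∀ i → InKernel (y i)) →
          ∃ λ (z : Vector Formal r) → ∀ i → sum (λ j → mulF (M i j) (z j)) G.≈ mulF (ι d) (y i))
      go (d , W , d≢0 , rel) = d , d≢0 , λ y y∈K →
        let z , Mz≈ = adjugate-solves (λ i → negF (mulF W (y i))) in z , λ i → Rₙ.trans (Mz≈ i) (step (y i) (y∈K i))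
        where
        open SetoidReasoning Rₙ.setoid
        step : ∀ f → InKernel f → mulF L (negF (mulF W f)) G.≈ mulF (ι d) f
        step f f∈K = begin
          mulF L (negF (mulF W f))        ≈⟨ -‿distribʳ-* L (mulF W f) ⟨
          negF (mulF L (mulF W f))        ≈⟨ Rₙ.-‿cong (Rₙ.*-assoc L W f) ⟨
          negF (mulF (mulF L W) f)        ≈⟨ GroupProperties.inverseˡ-unique Rₙ.+-group _ _
                                               (Rₙ.trans (Rₙ.sym (Rₙ.distribʳ f (ι d) (mulF L W))) (rel f f∈K)) ⟨
          mulF (ι d) f                    ∎

-- The rank of Bowen–Franks modules

module CokernelRank (em : ExcludedMiddle 0ℓ) (p : ℕ) .{{_ : NonZero p}} (pp : Prime p)
  (X : Digraph) (α : Digraph.E X → ℤₚ p) (n : ℕ) (Y : Digraph) (iso : Iso Y (derived p X α n)) (K : ℕ) where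
  private
    module X = Digraph X
    module Y = Digraph Y
    q = p ℕ.^ n
    instance
      q≢0 : NonZero q
      q≢0 = ℕ.m^n≢0 p n
      p^K≢0 : NonZero (p ℕ.^ K)
      p^K≢0 = ℕ.m^n≢0 p K
    module G = GroupAlgebra q
    module Rₙ = CommutativeRing G.ring
    module LG = ListSums G.ring
    module GS = Sums G.ring
  open Characters em pp n using (dilate; Bad; module C)
  open Kernel em pp n K using (InKernel; kernel-solves; module H)
  open Evaluation p n using (groupMatrix; bowenFranksₙ)
  open DerivedCycles em p X α n using (_⊕_; ⊕-mod; toℕ-mod-injective; ρ)
  private
    module to = Morphism (Iso.to iso)
    module from = Morphism (Iso.from iso)
    module TX = Trace em X G.ring (λ e → x^ (toℕ (ρ e)))
    module TY = Trace em Y ℤ.+-*-commutativeRing (λ _ → 1ℤ)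

    index : X.V → Fin X.#V
    index = Inverse.to X.V↔Fin

    position : X.V → Fin q → Fin Y.#V
    position w τ = Inverse.to Y.V↔Fin (from.onV (w , τ))

    M : Matrix Formal X.#V
    M i j = Id Rₙ.rawRing i j ++ negF (groupMatrix X α i j)

    N : Matrix ℤ Y.#V
    N i j = Id ℤ.+-*-rawRing i j ℤ.- adjacency Y i j

    -- The entries of x at the vertices over w, as an element of ℤ[ℤ/pⁿ].
    fibre : Vector ℤ Y.#V → X.V → Formal
    fibre x w = map (λ σ → x (position w σ) , toℕ σ) (allFin q)

    ⟪⟫-fibre : ∀ x w φ → ⟪ fibre x w , φ ⟫ ≡ LZ.lsum (λ σ → x (position w σ) ℤ.* φ (toℕ σ)) (allFin q)
    ⟪⟫-fibre x w φ = go (allFin q)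
      where
      go : ∀ σs → ⟪ map (λ σ → x (position w σ) , toℕ σ) σs , φ ⟫ ≡ LZ.lsum (λ σ → x (position w σ) ℤ.* φ (toℕ σ)) σs
      go []       = ≡.refl
      go (σ ∷ σs) = cong (ℤ._+_ (x (position w σ) ℤ.* φ (toℕ σ))) (go σs)

    fibre-δ : ∀ x w τ → ⟪ fibre x w , δ q (toℕ τ) ⟫ ≡ x (position w τ)
    fibre-δ x w τ = begin
      ⟪ fibre x w , δ q (toℕ τ) ⟫                                          ≡⟨ ⟪⟫-fibre x w (δ q (toℕ τ)) ⟩
      LZ.lsum (λ σ → x (position w σ) ℤ.* δ q (toℕ τ) (toℕ σ)) (allFin q)
        ≡⟨ LZ.lsum-single τ (Unique.allFin⁺ q) (Mem.∈-allFin τ) (λ {σ} _ σ≢τ → ≡.trans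
             (cong (x (position w σ) ℤ.*_) (δ-≢ {q} {toℕ τ} {toℕ σ} (σ≢τ ∘ toℕ-mod-injective))) (ℤ.*-zeroʳ (x (position w σ)))) ⟩
      x (position w τ) ℤ.* δ q (toℕ τ) (toℕ τ)                             ≡⟨ cong (x (position w τ) ℤ.*_) (δ-refl q (toℕ τ)) ⟩
      x (position w τ) ℤ.* 1ℤ                                              ≡⟨ ℤ.*-identityʳ _ ⟩
      x (position w τ)                                                     ∎
      where open ≡-Reasoning

    -- Following the lifts of e from sheet σ to sheet σ + ρ e is multiplication by x^{ρ e}; only one
    -- σ reaches τ.
    shift-δ : ∀ e τ f → LZ.lsum (λ σ → 𝟙 (σ ⊕ ρ e Fin.≟ τ) ℤ.* ⟪ f , δ q (toℕ σ) ⟫) (allFin q) ≡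
              ⟪ mulF (x^ (toℕ (ρ e))) f , δ q (toℕ τ) ⟫
    shift-δ e τ f = ≡.sym (≡.trans (G.⟪⟫-x^* (toℕ (ρ e)) f (δ q (toℕ τ)))
      (≡.trans (⟪⟫-cong f pointwise) (go (allFin q))))
      where
      go : ∀ σs → ⟪ f , (λ a → LZ.lsum (λ σ → 𝟙 (σ ⊕ ρ e Fin.≟ τ) ℤ.* δ q (toℕ σ) a) σs) ⟫ ≡
                  LZ.lsum (λ σ → 𝟙 (σ ⊕ ρ e Fin.≟ τ) ℤ.* ⟪ f , δ q (toℕ σ) ⟫) σs
      go []       = ⟪⟫-0 f λ _ → ≡.refl
      go (σ ∷ σs) = ≡.trans (⟪⟫-+ f (λ a → 𝟙 (σ ⊕ ρ e Fin.≟ τ) ℤ.* δ q (toℕ σ) a) _)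
        (cong₂ ℤ._+_ (⟪⟫-* f (𝟙 (σ ⊕ ρ e Fin.≟ τ)) (δ q (toℕ σ))) (go σs))
      pointwise : ∀ a → δ q (toℕ τ) (toℕ (ρ e) ℕ.+ a) ≡ LZ.lsum (λ σ → 𝟙 (σ ⊕ ρ e Fin.≟ τ) ℤ.* δ q (toℕ σ) a) (allFin q)
      pointwise a = ≡.sym (begin
        LZ.lsum (λ σ → 𝟙 (σ ⊕ ρ e Fin.≟ τ) ℤ.* δ q (toℕ σ) a) (allFin q)
          ≡⟨ LZ.lsum-single σ₀ (Unique.allFin⁺ q) (Mem.∈-allFin σ₀) (λ {σ} _ σ≢σ₀ → ≡.trans
               (cong (𝟙 (σ ⊕ ρ e Fin.≟ τ) ℤ.*_) (δ-≢ {q} {toℕ σ} {a} λ a≡σ → σ≢σ₀ (toℕ-mod-injective (mod-sym (mod-trans σ₀≡a a≡σ)))))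
               (ℤ.*-zeroʳ (𝟙 (σ ⊕ ρ e Fin.≟ τ)))) ⟩
        𝟙 (σ₀ ⊕ ρ e Fin.≟ τ) ℤ.* δ q (toℕ σ₀) a
          ≡⟨ ≡.trans (cong (𝟙 (σ₀ ⊕ ρ e Fin.≟ τ) ℤ.*_) (𝟙-yes (a ≡ toℕ σ₀ [mod q ]?) (mod-sym σ₀≡a))) (ℤ.*-identityʳ _) ⟩
        𝟙 (σ₀ ⊕ ρ e Fin.≟ τ)
          ≡⟨ 𝟙-⇔ (σ₀ ⊕ ρ e Fin.≟ τ) (toℕ (ρ e) ℕ.+ a ≡ toℕ τ [mod q ]?)
               (λ eq → mod-trans (mod-sym ⊕≡) (≡.subst (λ σ → toℕ (σ₀ ⊕ ρ e) ≡ toℕ σ [mod q ]) eq (mod-refl _)))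
               (λ eq → toℕ-mod-injective (mod-trans ⊕≡ eq)) ⟩
        δ q (toℕ τ) (toℕ (ρ e) ℕ.+ a) ∎)
        where
        open ≡-Reasoning
        σ₀ : Fin q
        σ₀ = Fin.fromℕ< (ℕ.m%n<n a q)
        σ₀≡a : toℕ σ₀ ≡ a [mod q ]
        σ₀≡a = ≡.subst (_≡ a [mod q ]) (≡.sym (Fin.toℕ-fromℕ< (ℕ.m%n<n a q))) (%-mod a q)
        ⊕≡ : toℕ (σ₀ ⊕ ρ e) ≡ toℕ (ρ e) ℕ.+ a [mod q ]
        ⊕≡ = mod-trans (⊕-mod σ₀ (ρ e)) (≡.subst (λ b → toℕ σ₀ ℕ.+ toℕ (ρ e) ≡ b [mod q ]) (ℕ.+-comm a (toℕ (ρ e)))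
          (mod-+ʳ (toℕ (ρ e)) σ₀≡a))

    edges-derived : ∀ (F : Y.E → ℤ) → LZ.lsum F Y.edges ≡
      LZ.lsum (λ e → LZ.lsum (λ σ → F (from.onE (e , σ))) (allFin q)) X.edges
    edges-derived F = ≡.trans (≡.sym (LZ.lsum-↭ F (map-↭ {f = from.onE} {g = to.onE}
        (Unique.cartesianProduct⁺ CX.edges-unique (Unique.allFin⁺ q)) CY.edges-unique
        (λ _ → CY.∈-edges _) (λ {x} _ → proj₂ (Iso.to∘from≗id iso) x)
        (λ {y} _ → Mem.∈-cartesianProduct⁺ (CX.∈-edges (proj₁ (to.onE y))) (Mem.∈-allFin (proj₂ (to.onE y))))
        (λ {y} _ → proj₂ (Iso.from∘to≗id iso) y))))
      (≡.trans (LZ.lsum-map F from.onE (cartesianProduct X.edges (allFin q)))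
        (TY.lsum-cartesianProductWith (F ∘ from.onE) _,_ X.edges (allFin q)))
      where
      module CX = Cycles em X
      module CY = Cycles em Y

    module _ (z : Vector Formal X.#V) where

      -- The reverse of `fibre`: a vector over the group algebra becomes an integer function on the
      -- vertices of the derived digraph, and `lower` carries it to Y.
      value : X.V × Fin q → ℤ
      value (w , σ) = ⟪ z (index w) , δ q (toℕ σ) ⟫

      lower : Vector ℤ Y.#V
      lower j = value (to.onV (Y.vertex j))

      incoming : X.V → Fin q → ℤ
      incoming w τ = LZ.lsum (λ e → 𝟙 (X.t e X.≟ⱽ w) ℤ.* ⟪ mulF (x^ (toℕ (ρ e))) (z (index (X.o e))) , δ q (toℕ τ) ⟫) X.edges

      adjacency-lower : ∀ u → ZSum.sum (λ j → adjacency Y u j ℤ.* lower j) ≡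
        incoming (proj₁ (to.onV (Y.vertex u))) (proj₂ (to.onV (Y.vertex u)))
      adjacency-lower u = begin
        ZSum.sum (λ j → adjacency Y u j ℤ.* lower j)
          ≡⟨ ZSum.sum-cong (λ j → cong (ℤ._* lower j) (length-lsum (Y.edgesFromTo (Y.vertex j) (Y.vertex u)))) ⟩
        ZSum.sum (λ j → TY.A u j ℤ.* value (to.onV (Y.vertex j)))
          ≡⟨ TY.A-apply u (value ∘ to.onV) ⟩
        LZ.lsum (λ e → 𝟙 (Y.t e Y.≟ⱽ Y.vertex u) ℤ.* (1ℤ ℤ.* value (to.onV (Y.o e)))) Y.edges
          ≡⟨ edges-derived _ ⟩
        LZ.lsum (λ e → LZ.lsum (λ σ → 𝟙 (Y.t (from.onE (e , σ)) Y.≟ⱽ Y.vertex u) ℤ.* (1ℤ ℤ.* value (to.onV (Y.o (from.onE (e , σ)))))) (allFin q)) X.edges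
          ≡⟨ LZ.lsum-cong X.edges (λ {e} _ → ≡.trans (LZ.lsum-cong (allFin q) λ {σ} _ → term e σ)
               (≡.trans (LZ.lsum-*ˡ (𝟙 (X.t e X.≟ⱽ w)) _ (allFin q)) (cong (𝟙 (X.t e X.≟ⱽ w) ℤ.*_) (shift-δ e τ (z (index (X.o e))))))) ⟩
        incoming w τ ∎
        where
        open ≡-Reasoning
        w = proj₁ (to.onV (Y.vertex u))
        τ = proj₂ (to.onV (Y.vertex u))
        term : ∀ e σ → 𝟙 (Y.t (from.onE (e , σ)) Y.≟ⱽ Y.vertex u) ℤ.* (1ℤ ℤ.* value (to.onV (Y.o (from.onE (e , σ))))) ≡
                       𝟙 (X.t e X.≟ⱽ w) ℤ.* (𝟙 (σ ⊕ ρ e Fin.≟ τ) ℤ.* value (X.o e , σ))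
        term e σ = ≡.trans (cong₂ ℤ._*_
            (≡.trans (𝟙-⇔ (Y.t (from.onE (e , σ)) Y.≟ⱽ Y.vertex u) ((X.t e X.≟ⱽ w) ×-dec (σ ⊕ ρ e Fin.≟ τ)) split join)
              (TY.𝟙ᴿ-× (X.t e X.≟ⱽ w) (σ ⊕ ρ e Fin.≟ τ)))
            (≡.trans (ℤ.*-identityˡ _) (cong value (≡.trans (cong to.onV (from.o-comm (e , σ))) (proj₁ (Iso.to∘from≗id iso) (X.o e , σ))))))
          (ℤ.*-assoc (𝟙 (X.t e X.≟ⱽ w)) _ _)
          where
          split : Y.t (from.onE (e , σ)) ≡ Y.vertex u → X.t e ≡ w × σ ⊕ ρ e ≡ τ
          split t≡ = cong proj₁ t≡′ , cong proj₂ t≡′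
            where
            t≡′ : (X.t e , σ ⊕ ρ e) ≡ to.onV (Y.vertex u)
            t≡′ = ≡.trans (≡.sym (proj₁ (Iso.to∘from≗id iso) (X.t e , σ ⊕ ρ e)))
              (cong to.onV (≡.trans (≡.sym (from.t-comm (e , σ))) t≡))
          join : X.t e ≡ w × σ ⊕ ρ e ≡ τ → Y.t (from.onE (e , σ)) ≡ Y.vertex u
          join (t≡w , σ≡τ) = ≡.trans (from.t-comm (e , σ)) (≡.trans (cong from.onV (×-≡,≡→≡ (t≡w , σ≡τ)))
            (proj₁ (Iso.from∘to≗id iso) (Y.vertex u)))

      ⟪⟫-𝟙* : ∀ {P : Set} (P? : Dec P) f φ → ⟪ mulF (LG.𝟙ᴿ P?) f , φ ⟫ ≡ 𝟙 P? ℤ.* ⟪ f , φ ⟫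
      ⟪⟫-𝟙* (yes _) f φ = ⟪⟫-ι* 1ℤ f φ
      ⟪⟫-𝟙* (no _)  f φ = ≡.sym (ℤ.*-zeroˡ ⟪ f , φ ⟫)

      ⟪⟫-lsumᴳ : ∀ {B : Set} (f : B → Formal) xs φ → ⟪ LG.lsum f xs , φ ⟫ ≡ LZ.lsum (λ x → ⟪ f x , φ ⟫) xs
      ⟪⟫-lsumᴳ f []       φ = ≡.refl
      ⟪⟫-lsumᴳ f (x ∷ xs) φ = ≡.trans (⟪⟫-++ (f x) _ φ) (cong (ℤ._+_ ⟪ f x , φ ⟫) (⟪⟫-lsumᴳ f xs φ))

      M-apply : ∀ i → GS.sum (λ j → mulF (M i j) (z j)) G.≈
        z i ++ negF (LG.lsum (λ e → mulF (LG.𝟙ᴿ (X.t e X.≟ⱽ X.vertex i)) (mulF (x^ (toℕ (ρ e))) (z (index (X.o e))))) X.edges)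
      M-apply i = begin
        GS.sum (λ j → mulF (M i j) (z j))
          ≈⟨ GS.sum-cong (λ j → Rₙ.distribʳ (z j) (Id Rₙ.rawRing i j) (negF (A i j))) ⟩
        GS.sum (λ j → mulF (Id Rₙ.rawRing i j) (z j) ++ mulF (negF (A i j)) (z j))
          ≈⟨ GS.sum-+ _ _ ⟩
        GS.sum (λ j → mulF (Id Rₙ.rawRing i j) (z j)) ++ GS.sum (λ j → mulF (negF (A i j)) (z j))
          ≈⟨ Rₙ.+-cong identity negated ⟩
        z i ++ negF (LG.lsum _ X.edges) ∎
        where
        open import Relation.Binary.Reasoning.Setoid Rₙ.setoid
        open import Algebra.Properties.Ring Rₙ.ring using (-1*x≈-x; -‿distribˡ-*)
        A = groupMatrix X α
        identity : GS.sum (λ j → mulF (Id Rₙ.rawRing i j) (z j)) G.≈ z i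
        identity = Rₙ.trans (GS.sum-single i λ j j≢i → Rₙ.trans (Rₙ.*-congʳ {z j} (GS.Id-≢ (j≢i ∘ ≡.sym))) (Rₙ.zeroˡ (z j)))
          (Rₙ.trans (Rₙ.*-congʳ {z i} (GS.Id-≡ i)) (Rₙ.*-identityˡ (z i)))
        negated : GS.sum (λ j → mulF (negF (A i j)) (z j)) G.≈
          negF (LG.lsum (λ e → mulF (LG.𝟙ᴿ (X.t e X.≟ⱽ X.vertex i)) (mulF (x^ (toℕ (ρ e))) (z (index (X.o e))))) X.edges)
        negated = begin
          GS.sum (λ j → mulF (negF (A i j)) (z j))
            ≈⟨ GS.sum-cong (λ j → Rₙ.trans (Rₙ.sym (-‿distribˡ-* (A i j) (z j))) (Rₙ.sym (-1*x≈-x (mulF (A i j) (z j))))) ⟩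
          GS.sum (λ j → mulF (negF (ι 1ℤ)) (mulF (A i j) (z j)))
            ≈⟨ GS.*-sumˡ (negF (ι 1ℤ)) _ ⟨
          mulF (negF (ι 1ℤ)) (GS.sum (λ j → mulF (A i j) (z j)))
            ≈⟨ -1*x≈-x _ ⟩
          negF (GS.sum (λ j → mulF (A i j) (z j)))
            ≈⟨ Rₙ.-‿cong (GS.sum-cong λ j → Rₙ.*-congˡ {A i j} (Rₙ.reflexive (cong z (≡.sym (Inverse.strictlyInverseˡ X.V↔Fin j))))) ⟩
          negF (GS.sum (λ j → mulF (A i j) (z (index (X.vertex j)))))
            ≈⟨ Rₙ.-‿cong (TX.A-apply i (λ v → z (index v))) ⟩
          negF (LG.lsum (λ e → mulF (LG.𝟙ᴿ (X.t e X.≟ⱽ X.vertex i)) (mulF (x^ (toℕ (ρ e))) (z (index (X.o e))))) X.edges) ∎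

      ⟪⟫-M-apply : ∀ w τ → ⟪ GS.sum (λ j → mulF (M (index w) j) (z j)) , δ q (toℕ τ) ⟫ ≡ value (w , τ) ℤ.- incoming w τ
      ⟪⟫-M-apply w τ = begin
        ⟪ GS.sum (λ j → mulF (M (index w) j) (z j)) , φ ⟫   ≡⟨ G.on (M-apply (index w)) φ (G.Periodic-δ (toℕ τ)) ⟩
        ⟪ z (index w) ++ negF Σ , φ ⟫                       ≡⟨ ≡.trans (⟪⟫-++ (z (index w)) (negF Σ) φ) (cong (ℤ._+_ (value (w , τ))) (⟪⟫-neg Σ φ)) ⟩
        value (w , τ) ℤ.- ⟪ Σ , φ ⟫                         ≡⟨ cong (ℤ._-_ (value (w , τ))) (⟪⟫-lsumᴳ _ X.edges φ) ⟩
        value (w , τ) ℤ.- LZ.lsum (λ e → ⟪ mulF (LG.𝟙ᴿ (X.t e X.≟ⱽ X.vertex (index w))) (g e) , φ ⟫) X.edges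
          ≡⟨ cong (ℤ._-_ (value (w , τ))) (LZ.lsum-cong X.edges λ {e} _ → ≡.trans
               (⟪⟫-𝟙* (X.t e X.≟ⱽ X.vertex (index w)) (g e) φ)
               (cong (λ v → 𝟙 (X.t e X.≟ⱽ v) ℤ.* ⟪ g e , φ ⟫) (Inverse.strictlyInverseʳ X.V↔Fin w))) ⟩
        value (w , τ) ℤ.- incoming w τ ∎
        where
        open ≡-Reasoning
        φ = δ q (toℕ τ)
        g : X.E → Formal
        g e = mulF (x^ (toℕ (ρ e))) (z (index (X.o e)))
        Σ = LG.lsum (λ e → mulF (LG.𝟙ᴿ (X.t e X.≟ⱽ X.vertex (index w))) (g e)) X.edges

      -- Together with `⟪⟫-M-apply` this identifies N · `lower z` with the coordinates of M z: Id -
      -- A_Y is Id - A_α over ℤ[ℤ/pⁿ], written out over ℤ.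
      lower-solves : ∀ u → (N · lower) u ≡ value (to.onV (Y.vertex u)) ℤ.-
        incoming (proj₁ (to.onV (Y.vertex u))) (proj₂ (to.onV (Y.vertex u)))
      lower-solves u = begin
        (N · lower) u
          ≡⟨ ZSum.sum≡∑ (λ j → N u j ℤ.* lower j) ⟨
        ZSum.sum (λ j → N u j ℤ.* lower j)
          ≡⟨ ZSum.sum-cong (λ j → lemma (Id ℤ.+-*-rawRing u j) (adjacency Y u j) (lower j)) ⟩
        ZSum.sum (λ j → Id ℤ.+-*-rawRing u j ℤ.* lower j ℤ.+ -1ℤ ℤ.* (adjacency Y u j ℤ.* lower j))
          ≡⟨ ≡.trans (ZSum.sum-+ _ _) (cong₂ ℤ._+_ identity (≡.sym (ZSum.*-sumˡ -1ℤ _))) ⟩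
        lower u ℤ.+ -1ℤ ℤ.* ZSum.sum (λ j → adjacency Y u j ℤ.* lower j)
          ≡⟨ cong (ℤ._+_ (lower u)) (≡.trans (ℤ.-1*i≡-i _) (cong ℤ.-_ (adjacency-lower u))) ⟩
        lower u ℤ.- incoming (proj₁ (to.onV (Y.vertex u))) (proj₂ (to.onV (Y.vertex u))) ∎
        where
        open ≡-Reasoning
        lemma : ∀ x a y → (x ℤ.- a) ℤ.* y ≡ x ℤ.* y ℤ.+ -1ℤ ℤ.* (a ℤ.* y)
        lemma = solve-∀
        identity : ZSum.sum (λ j → Id ℤ.+-*-rawRing u j ℤ.* lower j) ≡ lower u
        identity = ≡.trans (ZSum.sum-single u λ j j≢u → ≡.trans (cong (ℤ._* lower j) (ZSum.Id-≢ (j≢u ∘ ≡.sym))) (ℤ.*-zeroˡ (lower j)))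
          (≡.trans (cong (ℤ._* lower u) (ZSum.Id-≡ u)) (ℤ.*-identityˡ (lower u)))

  module _ (L≉0 : ∀ j → j < q → ¬ Bad K j → ¬ dilate j (bowenFranksₙ X α) C.≈ []) where

    open LeftModule (BF Y) using (_≈ᴹ_; 0ᴹ; _*ₗ_; +ᴹ-commutativeMonoid)
    open CommutativeMonoidSum +ᴹ-commutativeMonoid using () renaming (sum to sumᴹ)

    sumᴹ-at : ∀ {k} (f : Fin k → Vector ℤ Y.#V) u → sumᴹ f u ≡ ZSum.sum λ i → f i u
    sumᴹ-at {zero}  f u = ≡.sym (ZSum.sum-[] _)
    sumᴹ-at {suc k} f u = ≡.trans (cong (ℤ._+_ (f zero u)) (sumᴹ-at (f ∘ suc) u)) (≡.sym (ZSum.sum-∷ _))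

    -- The images in ℤ[ℤ/pᴷ]^r have r pᴷ coordinates, so a non-trivial combination of the x lies in
    -- the kernel. By `kernel-solves` a non-zero multiple d of it lies in the image of N, that is,
    -- vanishes in the Bowen-Franks module.
    ¬independent : ∀ {k} → X.#V ℕ.* p ℕ.^ K < k → (x : Fin k → Vector ℤ Y.#V) → ¬ LinearlyIndependent (BF Y) x
    ¬independent {k} B<k x independent = contra (dependent B<k coordinates) (kernel-solves M L≉0)
      where
      coordinates : Fin k → Vector ℤ (X.#V ℕ.* p ℕ.^ K)
      coordinates i l = ⟪ fibre (x i) (X.vertex (proj₁ (Fin.remQuot {X.#V} (p ℕ.^ K) l))) , δ (p ℕ.^ K) (toℕ (proj₂ (Fin.remQuot {X.#V} (p ℕ.^ K) l))) ⟫
      contra : Dependent coordinates →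
        (∃ λ d → d ≢ 0ℤ × (∀ (y : Vector Formal X.#V) → (∀ i → InKernel (y i)) →
          ∃ λ (z : Vector Formal X.#V) → ∀ i → GS.sum (λ j → mulF (M i j) (z j)) G.≈ mulF (ι d) (y i))) → _
      contra (c , (i₀ , cᵢ≢0) , rel) (d , d≢0 , solve) = go (solve y y∈K)
        where
        open ≡-Reasoning
        y : Vector Formal X.#V
        y i = combination c λ l → fibre (x l) (X.vertex i)
        y∈K : ∀ i → InKernel (y i)
        y∈K i = H.δ-test (y i) λ τ τ<p^K → ≡.trans (⟪⟫-combination c _ (δ (p ℕ.^ K) τ)) (begin
          ZSum.sum (λ l → c l ℤ.* ⟪ fibre (x l) (X.vertex i) , δ (p ℕ.^ K) τ ⟫)
            ≡⟨ ZSum.sum-cong (λ l → cong (λ (i , τ) → c l ℤ.* ⟪ fibre (x l) (X.vertex i) , δ (p ℕ.^ K) τ ⟫)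
                 (cong₂ _,_ (cong proj₁ (Fin.remQuot-combine i (Fin.fromℕ< τ<p^K)))
                   (≡.trans (cong (toℕ ∘ proj₂) (Fin.remQuot-combine i (Fin.fromℕ< τ<p^K))) (Fin.toℕ-fromℕ< τ<p^K)))) ⟨
          ZSum.sum (λ l → c l ℤ.* coordinates l (Fin.combine i (Fin.fromℕ< τ<p^K)))
            ≡⟨ rel (Fin.combine i (Fin.fromℕ< τ<p^K)) ⟩
          0ℤ ∎)
        go : (∃ λ (z : Vector Formal X.#V) → ∀ i → GS.sum (λ j → mulF (M i j) (z j)) G.≈ mulF (ι d) (y i)) → _
        go (z , Mz≈) = [ d≢0 , cᵢ≢0 ]′ (ℤ.i*j≡0⇒i≡0∨j≡0 d (independent (λ i → d ℤ.* c i) (lower z , image) i₀))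
          where
          image : ∀ u → sumᴹ (λ i → (d ℤ.* c i) *ₗ x i) u ≡ 0ℤ ℤ.+ (N · lower z) u
          image u = begin
            sumᴹ (λ i → (d ℤ.* c i) *ₗ x i) u                          ≡⟨ sumᴹ-at (λ i → (d ℤ.* c i) *ₗ x i) u ⟩
            ZSum.sum (λ i → d ℤ.* c i ℤ.* x i u)                       ≡⟨ ZSum.sum-cong (λ i → ℤ.*-assoc d (c i) (x i u)) ⟩
            ZSum.sum (λ i → d ℤ.* (c i ℤ.* x i u))                     ≡⟨ ZSum.*-sumˡ d _ ⟨
            d ℤ.* ZSum.sum (λ i → c i ℤ.* x i u)
              ≡⟨ cong (d ℤ.*_) (ZSum.sum-cong λ i → cong (c i ℤ.*_) (≡.sym (≡.trans (fibre-δ (x i) (X.vertex (index w)) τ) (cong (x i) position≡u)))) ⟩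
            d ℤ.* ZSum.sum (λ i → c i ℤ.* ⟪ fibre (x i) (X.vertex (index w)) , δ q (toℕ τ) ⟫)
              ≡⟨ cong (d ℤ.*_) (⟪⟫-combination c _ (δ q (toℕ τ))) ⟨
            d ℤ.* ⟪ y (index w) , δ q (toℕ τ) ⟫                        ≡⟨ ⟪⟫-ι* d (y (index w)) (δ q (toℕ τ)) ⟨
            ⟪ mulF (ι d) (y (index w)) , δ q (toℕ τ) ⟫                 ≡⟨ G.on (Mz≈ (index w)) _ (G.Periodic-δ (toℕ τ)) ⟨
            ⟪ GS.sum (λ j → mulF (M (index w) j) (z j)) , δ q (toℕ τ) ⟫ ≡⟨ ⟪⟫-M-apply z w τ ⟩
            value z (w , τ) ℤ.- incoming z w τ                         ≡⟨ lower-solves z u ⟨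
            (N · lower z) u                                            ≡⟨ ℤ.+-identityˡ _ ⟨
            0ℤ ℤ.+ (N · lower z) u                                     ∎
            where
            w = proj₁ (to.onV (Y.vertex u))
            τ = proj₂ (to.onV (Y.vertex u))
            position≡u : position (X.vertex (index w)) τ ≡ u
            position≡u = ≡.trans (cong (λ w → position w τ) (Inverse.strictlyInverseʳ X.V↔Fin w))
              (≡.trans (cong (Inverse.to Y.V↔Fin) (proj₁ (Iso.from∘to≗id iso) (Y.vertex u))) (Inverse.strictlyInverseˡ Y.V↔Fin u))

-- Uniform bounds

module Rank (em : ExcludedMiddle 0ℓ) (N : LeftModule ℤ.+-*-ring 0ℓ 0ℓ) (B : ℕ)
  (¬independent : ∀ {k} → B < k → ∀ x → ¬ LinearlyIndependent N {k} x) where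

  rank-exists : ∀ m → (∀ x → ¬ LinearlyIndependent N {m} x) → ∃ (HasRank N)
  -- The empty family is independent, so the descent ends before this.
  rank-exists zero    ¬ind = contradiction (λ _ _ ()) (¬ind λ ())
  rank-exists (suc m) ¬ind = go (em {∃ (LinearlyIndependent N {m})})
    where
    go : Dec (∃ (LinearlyIndependent N {m})) → ∃ (HasRank N)
    go (yes ind)  = m , ind , ¬ind
    go (no ¬ind′) = rank-exists m λ x ind → ¬ind′ (x , ind)

  rank≤B : ∀ r → HasRank N r → r ≤ B
  rank≤B r ((x , ind) , _) = ℕ.≮⇒≥ λ B<r → ¬independent B<r x ind

module TowerLevel (em : ExcludedMiddle 0ℓ) (p : ℕ) .{{_ : NonZero p}} (pp : Prime p)
  (X : Digraph) (α : Digraph.E X → ℤₚ p) (n : ℕ) (Y : Digraph) (iso : Iso Y (derived p X α n))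
  {c : ℤ} {a : ℤₚ p} {g : GroupRing.FormalSum (ℤₚ,+ p)} {k : ℕ} (c≢0 : c ≢ 0ℤ)
  (L≋ : GroupRing._≋_ (ℤₚ,+ p) (bowenFranks p X α) ((c , a) ∷ g))
  (isolated : All (λ (_ , b) → Apart p k a b) g) where

  -- For a: at most pᵏ⁺¹ bad characters, each with a determinant of degree at most #V. For b: the
  -- rank of ℤ[ℤ/pᵏ⁺¹]^r with r = #V. The level n does not enter.
  B : ℕ
  B = Digraph.#V X ℕ.* p ℕ.^ suc k

  private
    q = p ℕ.^ n
    open Characters em pp n
    open Evaluation p n
    open DerivedCycles em p X α n using (ρ; voltage; length-cycles-derived)
    module LO = ListSums C.ring

    dilate-≉0′ : ∀ j → ¬ Bad (suc k) j → ¬ dilate j (bowenFranksₙ X α) C.≈ []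
    dilate-≉0′ j ¬bad L≈0 = dilate-≉0 k j c (residueℕ p n a) (evaluate g) c≢0 ¬bad (apart g isolated)
      (O.trans (O.sym (dilate-cong j (Rₙ.trans (Rₙ.sym (evaluate-bowenFranks X α)) (evaluate-cong L≋)))) L≈0)
      where
      -- For n < k every character would be bad, so a good one ensures that the level is high enough
      -- for the exponents to be apart.
      k≤n : k ≤ n
      k≤n = ℕ.≮⇒≥ λ n<k → ¬bad (ℕ∣.∣n⇒∣m*n j (ℕ∣.∣-trans (ℕ∣.m∣m*n (p ℕ.^ (suc k ℕ.∸ n)))
        (ℕ∣.∣-reflexive (≡.trans (≡.sym (ℕ.^-distribˡ-+-* p n (suc k ℕ.∸ n)))
          (cong (p ℕ.^_) (ℕ.m+[n∸m]≡n (ℕ.≤-trans (ℕ.<⇒≤ n<k) (ℕ.n≤1+n k))))))))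
      apart : ∀ g → All (λ (_ , b) → Apart p k a b) g →
        All (λ (_ , b) → ¬ b ≡ residueℕ p n a [mod p ℕ.^ k ]) (evaluate g)
      apart []            []                = []
      apart ((_ , b) ∷ g) (b-apart ∷ g-apart) = b-apart n k≤n ∷ apart g g-apart

    characterRing : CharacterRing q
    characterRing = record
      { O = C.ring ; domain = C.domain ; torsionFree = C.torsionFree
      ; ιᴼ = ι ; ιᴼ-0 = C.ι-0 ; ιᴼ-1 = O.refl ; ιᴼ-+ = C.ι-+ ; ιᴼ-* = C.ι-* ; ιᴼ-neg = C.ι-neg
      ; ιᴼ-injective = ι-injective
      ; χ = χ ; χ-0 = χ-0 ; χ-+ = χ-+ ; orthogonality = orthogonality
      }

    module A = Artin em q characterRing X (λ e → toℕ (ρ e)) Y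
      (λ m → ≡.trans (length-cycles-Iso em iso (suc m)) (length-cycles-derived m))

    dilate-L : ∀ j → dilate j (bowenFranksₙ X α) C.≈ A.L j
    dilate-L j = dilate-det j {M = λ i l → Id Rₙ.rawRing i l ++ negF (groupMatrix X α i l)} λ i l →
      O.trans (O.reflexive (List.map-++ _ (Id Rₙ.rawRing i l) (negF (groupMatrix X α i l))))
        (O.+-cong (identity i l) (O.trans (O.reflexive (dilate-neg j (groupMatrix X α i l)))
          (O.-‿cong {dilate j (groupMatrix X α i l)} (O.reflexive (matrix (edgesFromTo (vertex l) (vertex i)))))))
      where
      open Digraph X using (#V; vertex; edgesFromTo)
      identity : ∀ (i l : Fin #V) → dilate j (Id Rₙ.rawRing i l) C.≈ Id O.rawRing i l
      identity i l with i Fin.≟ l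
      ... | yes _ = χ-0 j
      ... | no  _ = O.refl
      matrix : ∀ es → dilate j (ListSums.lsum G.ring (λ e → x^ (residueℕ p n (α e))) es) ≡ LO.lsum (λ e → χ j (toℕ (ρ e))) es
      matrix []       = ≡.refl
      matrix (e ∷ es) = cong ((1ℤ , _) ∷_) (matrix es)

    bad≤B : length (filter (bad? (suc k)) (upTo q)) ℕ.* Digraph.#V X ≤ B
    bad≤B = ≡.subst (length (filter (bad? (suc k)) (upTo q)) ℕ.* Digraph.#V X ≤_)
      (ℕ.*-comm (p ℕ.^ suc k) (Digraph.#V X)) (ℕ.*-monoˡ-≤ (Digraph.#V X) (length-bad (suc k)))

    den-order : ∀ d f h e → SZ.IsPoly h → SZ.Ev f e → e ≢ 0ℤ → f SZ.*ˢ A.den SZ.≈ˢ SZ.w^ d SZ.*ˢ h → d ≤ B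
    den-order d f h e ph ev e≢0 eq = ℕ.≤-trans
      (A.den-order (bad? (suc k)) (λ {j} _ ¬bad L≈0 → dilate-≉0′ j ¬bad (O.trans (dilate-L j) L≈0)) d f h e ph ev e≢0 eq)
      bad≤B

    module Ord = Order em Y A.den A.zeta-den A.den-IsPoly B den-order

    ¬independent : ∀ {m} → B < m → ∀ x → ¬ LinearlyIndependent (BF Y) {m} x
    ¬independent = CokernelRank.¬independent em p pp X α n Y iso (suc k) λ j _ → dilate-≉0′ j

    module R = Rank em (BF Y) B ¬independent

  a-bound : ∃ (a-Value Y) × (∀ e → a-Value Y e → ∣ e ∣ ≤ B)
  a-bound = Ord.a-exists , Ord.a-bounded

  b-bound : ∃ (b-Value Y) × (∀ e → b-Value Y e → ∣ e ∣ ≤ B)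
  b-bound = exists (R.rank-exists (suc B) (¬independent ℕ.≤-refl)) , bounded
    where
    exists : ∃ (HasRank (BF Y)) → ∃ (b-Value Y)
    exists (r , rank) = + r , r , rank , ≡.refl
    bounded : ∀ e → b-Value Y e → ∣ e ∣ ≤ B
    bounded e (r , rank , ≡.refl) = R.rank≤B r rank

  δ-bound : ∃ (δ-Value Y) × (∀ e → δ-Value Y e → ∣ e ∣ ≤ B ℕ.+ B)
  δ-bound = exists a-bound b-bound , bounded
    where
    exists : ∃ (a-Value Y) × (∀ e → a-Value Y e → ∣ e ∣ ≤ B) → ∃ (b-Value Y) × (∀ e → b-Value Y e → ∣ e ∣ ≤ B) → ∃ (δ-Value Y)
    exists ((a , a-value) , _) ((b , b-value) , _) = a ℤ.- b , a , b , a-value , b-value , ≡.refl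
    bounded : ∀ e → δ-Value Y e → ∣ e ∣ ≤ B ℕ.+ B
    bounded e (a , b , a-value , b-value , ≡.refl) = ℕ.≤-trans (ℤ.∣i-j∣≤∣i∣+∣j∣ a b)
      (ℕ.+-mono-≤ (proj₂ a-bound a a-value) (proj₂ b-bound b b-value))

lemma7p7 : ExcludedMiddle 0ℓ →
    (p : ℕ) .{{_ : NonZero p}} → Prime p →
    (X : ℕ → Digraph) (π : ∀ n → Morphism (X (suc n)) (X n)) →
    IsℤₚTower p X π →
    (∀ n → StronglyConnected (X n)) →
    (α : Digraph.E (X 0) → ℤₚ p) → IsAssociatedVoltage p X π α →
    BowenFranks≉0 p (X 0) α →
    UniformlyBounded (λ n → a-Value (X n)) ×
    UniformlyBounded (λ n → b-Value (X n)) ×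
    UniformlyBounded (λ n → δ-Value (X n))
-- The isolated term is chosen before the level n, which makes the bounds uniform.
lemma7p7 em p pp X π _ _ α voltage L≉0 = go (isolatedTerm p em (bowenFranks p (X 0) α) L≉0)
  where
  Goal : Set
  Goal = UniformlyBounded (λ n → a-Value (X n)) × UniformlyBounded (λ n → b-Value (X n)) ×
         UniformlyBounded (λ n → δ-Value (X n))
  go : (∃₂ λ c a → ∃₂ λ g k → c ≢ 0ℤ × GroupRing._≋_ (ℤₚ,+ p) (bowenFranks p (X 0) α) ((c , a) ∷ g) ×
       All (λ (_ , b) → Apart p k a b) g) → Goal
  go (c , a , g , k , c≢0 , L≋ , isolated) =
    (B , λ n → L.a-bound n) , (B , λ n → L.b-bound n) , (B ℕ.+ B , λ n → L.δ-bound n)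
    where
    B : ℕ
    B = Digraph.#V (X 0) ℕ.* p ℕ.^ suc k
    module L (n : ℕ) = TowerLevel em p pp (X 0) α n (X n) (IsAssociatedVoltage.iso voltage n) {c} {a} {g} {k} c≢0 L≋ isolated
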